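{- Let $q$ be an odd prime power, $A=\mathbb{F}_q[T]$, $F=\mathbb{F}_q(T)$, and let $\psi: A\to F\{\tau\}$ be a Drinfeld module of rank $2$ over $F$ with $\operatorname{End}_{F^{\mathrm{alg}}}(\psi)=A$. Then there is a constant $C>0$, depending only on $q$ and on the coefficients of $\psi_T\in F\{\tau\}$, such that for every prime $\mathfrak{p}=pA$ of good reduction for $\psi$ (with $p$ the monic generator of $\mathfrak{p}$), $$|d_{2,\mathfrak{p}}|\ \geq\ C\,|p|^{\frac12}\,\frac{(\log|p|)^{\frac12}}{\log\log|p|},$$ where $d_{1,\mathfrak{p}},d_{2,\mathfrak{p}}\in A$ are the unique nonzero monic polynomials with $d_{1,\mathfrak{p}}\mid d_{2,\mathfrak{p}}$ and ${}^{\psi}\mathbb{F}_{\mathfrak{p}}\cong A/d_{1,\mathfrak{p}}A\times A/d_{2,\mathfrak{p}}A$ as $A$-modules.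
   Context: $F^{\mathrm{alg}}$ is a fixed algebraic closure of $F$. A prime of $A$ is a nonzero prime ideal $\mathfrak{p}$ of $A$, and $\mathbb{F}_{\mathfrak{p}}=A/\mathfrak{p}$. An $A$-field is a field $L$ with a ring homomorphism $\gamma:A\to L$ (the natural inclusion if $L\supseteq F$; the natural map $A\to A/\mathfrak{p}\hookrightarrow L$ if $L$ is a finite extension of $\mathbb{F}_{\mathfrak{p}}$). $L\{\tau\}$ is the ring of noncommutative polynomials in $\tau$ with $\tau c=c^q\tau$ for $c\in L$. A Drinfeld module of rank $r\ge 1$ over $L$ is an $\mathbb{F}_q$-algebra homomorphism $\psi:A\to L\{\tau\}$, $a\mapsto\psi_a$, with $\psi_T=\gamma(T)+\sum_{i=1}^r g_i\tau^i$, $g_i\in L$, $g_r\ne0$. For $L'\supseteq L$, $\operatorname{End}_{L'}(\psi)=\{u\in L'\{\tau\}: u\psi_a=\psi_a u\ \forall a\in A\}$; it contains $\psi(A)\cong A$, and $\operatorname{End}_{F^{\mathrm{alg}}}(\psi)=A$ means that it equals $\psi(A)$. For $\psi$ of rank $2$ over $F$ with $\psi_T=T+g_1\tau+g_2\tau^2$, a prime $\mathfrak{p}$ is of good reduction if $\operatorname{ord}_{\mathfrak{p}}(g_1)\ge0$ and $\operatorname{ord}_{\mathfrak{p}}(g_2)=0$; then the reduction $\psi\otimes\mathbb{F}_{\mathfrak{p}}:A\to\mathbb{F}_{\mathfrak{p}}\{\tau\}$ is the rank $2$ Drinfeld module obtained by reducing the coefficients of $\psi_T$ modulo $\mathfrak{p}$.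 Letting $\tau$ act on $\mathbb{F}_{\mathfrak{p}}$ as $\alpha\mapsto\alpha^q$, the field $\mathbb{F}_{\mathfrak{p}}$ becomes an $A$-module on which $a\in A$ acts as $(\psi\otimes\mathbb{F}_{\mathfrak{p}})_a$; this $A$-module is denoted ${}^{\psi}\mathbb{F}_{\mathfrak{p}}$. It is known that it is isomorphic to $A/d_1A\times A/d_2A$ for uniquely determined nonzero monic $d_1\mid d_2$. The absolute value is $|a|=q^{\deg a}$ for $a\in A$. -}

module Defs where

open import Algebra.Bundles using (CommutativeRing; RawRing)
import Algebra.Definitions.RawSemiring as RawSemiringDefinitions
open import Algebra.Module.Bundles.Raw using (RawLeftModule)
import Algebra.Module.Construct.DirectProduct as DirectProduct
open import Algebra.Module.Morphism.Structures using (module LeftModuleMorphisms)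
open import Algebra.Morphism.Structures using (module RingMorphisms)
open import Data.Fin.Base using (Fin)
open import Data.Integer.Base as ℤ using (ℤ; 0ℤ)
open import Data.List.Base using (List; []; _∷_; map)
open import Data.Nat.Base as ℕ using (ℕ; zero; suc)
import Data.Nat.Divisibility as ℕ
import Data.Nat.Primality as ℕ
import Data.Nat.Properties as ℕ
open import Data.Product.Base using (_×_; _,_; ∃; ∃-syntax)
open import Data.Rational.Base as ℚ using (ℚ; 0ℚ; 1ℚ)
import Data.Rational.Properties as ℚ
open import Data.Sum.Base using (_⊎_)
open import Function.Base using (id)
open import Function.Bundles using (Inverse; _⇔_)
open import Level using (Level; _⊔_) renaming (suc to lsuc)
open import Relation.Binary.PropositionalEquality as ≡ using (_≡_; cong)
open import Relation.Nullary.Negation.Core using (¬_)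

private
  variable
    c ℓ f ℓf : Level

------------------------------------------------------------------------
-- Real numbers

-- Cauchy sequences of rationals, compared by _≃ᴿ_.

record ℝ : Set where
  field
    seq    : ℕ → ℚ
    cauchy : ∀ ε → 0ℚ ℚ.< ε →
             ∃[ N ] ∀ m n → N ℕ.≤ m → N ℕ.≤ n → ℚ.∣ seq m ℚ.- seq n ∣ ℚ.≤ ε

open ℝ public

infix 4 _≤ᴿ_ _<ᴿ_ _≃ᴿ_ _⟶_
infixl 7 _*ᴿ_

_≤ᴿ_ : ℝ → ℝ → Set
x ≤ᴿ y = ∀ ε → 0ℚ ℚ.< ε → ∃[ N ] ∀ n → N ℕ.≤ n → seq x n ℚ.≤ seq y n ℚ.+ ε

_<ᴿ_ : ℝ → ℝ → Set
x <ᴿ y = ∃[ ε ] 0ℚ ℚ.< ε × ∃[ N ] ∀ n → N ℕ.≤ n → seq x n ℚ.+ ε ℚ.≤ seq y n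

_⟶_ : (ℕ → ℚ) → ℝ → Set
s ⟶ x = ∀ ε → 0ℚ ℚ.< ε → ∃[ N ] ∀ n → N ℕ.≤ n → ℚ.∣ s n ℚ.- seq x n ∣ ℚ.≤ ε

_≃ᴿ_ : ℝ → ℝ → Set
x ≃ᴿ y = seq x ⟶ y

fromℚ : ℚ → ℝ
fromℚ r = record
  { seq    = λ _ → r
  ; cauchy = λ ε 0<ε → 0 , λ _ _ _ _ →
      ≡.subst (ℚ._≤ ε) (≡.sym (cong ℚ.∣_∣ (ℚ.+-inverseʳ r))) (ℚ.<⇒≤ 0<ε)
  }

fromℕ : ℕ → ℝ
fromℕ n = fromℚ (ℤ.+ n ℚ./ 1)

private
  bounded : ∀ x → ∃[ M ] 0ℚ ℚ.< M × ∃[ N ] ∀ n → N ℕ.≤ n → ℚ.∣ seq x n ∣ ℚ.≤ M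
  bounded x with cauchy x 1ℚ (ℚ.positive⁻¹ 1ℚ)
  ... | N , close = M , 0<M , N , bound
    where
    open ℚ.≤-Reasoning
    s = seq x

    M : ℚ
    M = 1ℚ ℚ.+ ℚ.∣ s N ∣

    0<M : 0ℚ ℚ.< M
    0<M = ℚ.+-mono-<-≤ (ℚ.positive⁻¹ 1ℚ) (ℚ.0≤∣p∣ (s N))

    split : ∀ a b → a ≡ (a ℚ.- b) ℚ.+ b
    split a b = ≡.sym (begin-equality
      (a ℚ.- b) ℚ.+ b        ≡⟨ ℚ.+-assoc a (ℚ.- b) b ⟩
      a ℚ.+ (ℚ.- b ℚ.+ b)    ≡⟨ cong (a ℚ.+_) (ℚ.+-inverseˡ b) ⟩
      a ℚ.+ 0ℚ               ≡⟨ ℚ.+-identityʳ a ⟩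
      a                      ∎)

    bound : ∀ n → N ℕ.≤ n → ℚ.∣ s n ∣ ℚ.≤ M
    bound n N≤n = begin
      ℚ.∣ s n ∣                              ≡⟨ cong ℚ.∣_∣ (split (s n) (s N)) ⟩
      ℚ.∣ (s n ℚ.- s N) ℚ.+ s N ∣            ≤⟨ ℚ.∣p+q∣≤∣p∣+∣q∣ (s n ℚ.- s N) (s N) ⟩
      ℚ.∣ s n ℚ.- s N ∣ ℚ.+ ℚ.∣ s N ∣        ≤⟨ ℚ.+-monoˡ-≤ ℚ.∣ s N ∣ (close n N N≤n ℕ.≤-refl) ⟩
      M                                      ∎

_*ᴿ_ : ℝ → ℝ → ℝ
seq    (x *ᴿ y) n = seq x n ℚ.* seq y n
cauchy (x *ᴿ y) ε 0<ε with bounded x | bounded y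
... | X , 0<X , N₁ , x≤X | Y , 0<Y , N₂ , y≤Y =
  let N₃ , x-close = cauchy x δ 0<δ
      N₄ , y-close = cauchy y δ 0<δ
  in (N₁ ℕ.⊔ N₂) ℕ.⊔ (N₃ ℕ.⊔ N₄) , λ m n N≤m N≤n →
     close m n
       (x≤X m (below₁ N₃ N₄ N≤m))
       (y≤Y n (below₂ N₃ N₄ N≤n))
       (x-close m n (below₃ N₃ N₄ N≤m) (below₃ N₃ N₄ N≤n))
       (y-close m n (below₄ N₃ N₄ N≤m) (below₄ N₃ N₄ N≤n))
  where
  open ℚ.≤-Reasoning
  s = seq x
  t = seq y

  B : ℚ
  B = X ℚ.+ Y

  instance
    B-positive : ℚ.Positive B
    B-positive = ℚ.positive (ℚ.+-mono-< 0<X 0<Y)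

    B-nonZero : ℚ.NonZero B
    B-nonZero = ℚ.pos⇒nonZero B

    1/B-positive : ℚ.Positive (ℚ.1/ B)
    1/B-positive = ℚ.1/pos⇒pos B

    X-nonNegative : ℚ.NonNegative X
    X-nonNegative = ℚ.nonNegative (ℚ.<⇒≤ 0<X)

  δ : ℚ
  δ = ε ℚ.* ℚ.1/ B

  0<δ : 0ℚ ℚ.< δ
  0<δ = ≡.subst (ℚ._< δ) (ℚ.*-zeroˡ (ℚ.1/ B)) (ℚ.*-monoˡ-<-pos (ℚ.1/ B) 0<ε)

  instance
    δ-nonNegative : ℚ.NonNegative δ
    δ-nonNegative = ℚ.nonNegative (ℚ.<⇒≤ 0<δ)

  below₁ : ∀ a b {n} → (N₁ ℕ.⊔ N₂) ℕ.⊔ (a ℕ.⊔ b) ℕ.≤ n → N₁ ℕ.≤ n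
  below₁ a b p = ℕ.≤-trans (ℕ.m≤m⊔n N₁ N₂) (ℕ.≤-trans (ℕ.m≤m⊔n (N₁ ℕ.⊔ N₂) (a ℕ.⊔ b)) p)

  below₂ : ∀ a b {n} → (N₁ ℕ.⊔ N₂) ℕ.⊔ (a ℕ.⊔ b) ℕ.≤ n → N₂ ℕ.≤ n
  below₂ a b p = ℕ.≤-trans (ℕ.m≤n⊔m N₁ N₂) (ℕ.≤-trans (ℕ.m≤m⊔n (N₁ ℕ.⊔ N₂) (a ℕ.⊔ b)) p)

  below₃ : ∀ a b {n} → (N₁ ℕ.⊔ N₂) ℕ.⊔ (a ℕ.⊔ b) ℕ.≤ n → a ℕ.≤ n
  below₃ a b p = ℕ.≤-trans (ℕ.m≤m⊔n a b) (ℕ.≤-trans (ℕ.m≤n⊔m (N₁ ℕ.⊔ N₂) (a ℕ.⊔ b)) p)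

  below₄ : ∀ a b {n} → (N₁ ℕ.⊔ N₂) ℕ.⊔ (a ℕ.⊔ b) ℕ.≤ n → b ℕ.≤ n
  below₄ a b p = ℕ.≤-trans (ℕ.m≤n⊔m a b) (ℕ.≤-trans (ℕ.m≤n⊔m (N₁ ℕ.⊔ N₂) (a ℕ.⊔ b)) p)

  split : ∀ a b a′ b′ → (a ℚ.* b) ℚ.- (a′ ℚ.* b′) ≡ a ℚ.* (b ℚ.- b′) ℚ.+ (a ℚ.- a′) ℚ.* b′
  split a b a′ b′ = ≡.sym (begin-equality
    a ℚ.* (b ℚ.- b′) ℚ.+ (a ℚ.- a′) ℚ.* b′
      ≡⟨ ≡.cong₂ ℚ._+_ (*-distribˡ-- a b b′) (*-distribʳ-- b′ a a′) ⟩
    (a ℚ.* b ℚ.- a ℚ.* b′) ℚ.+ (a ℚ.* b′ ℚ.- a′ ℚ.* b′)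
      ≡⟨ telescope (a ℚ.* b) (a ℚ.* b′) (a′ ℚ.* b′) ⟩
    (a ℚ.* b) ℚ.- (a′ ℚ.* b′) ∎)
    where
    *-distribˡ-- : ∀ u v w → u ℚ.* (v ℚ.- w) ≡ u ℚ.* v ℚ.- u ℚ.* w
    *-distribˡ-- u v w = ≡.trans (ℚ.*-distribˡ-+ u v (ℚ.- w))
      (cong (u ℚ.* v ℚ.+_) (≡.sym (ℚ.neg-distribʳ-* u w)))

    *-distribʳ-- : ∀ u v w → (v ℚ.- w) ℚ.* u ≡ v ℚ.* u ℚ.- w ℚ.* u
    *-distribʳ-- u v w = ≡.trans (ℚ.*-distribʳ-+ u v (ℚ.- w))
      (cong (v ℚ.* u ℚ.+_) (≡.sym (ℚ.neg-distribˡ-* w u)))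

    telescope : ∀ u v w → (u ℚ.- v) ℚ.+ (v ℚ.- w) ≡ u ℚ.- w
    telescope u v w = begin-equality
      (u ℚ.- v) ℚ.+ (v ℚ.- w)         ≡⟨ ℚ.+-assoc u (ℚ.- v) (v ℚ.- w) ⟩
      u ℚ.+ (ℚ.- v ℚ.+ (v ℚ.- w))     ≡⟨ cong (u ℚ.+_) (≡.sym (ℚ.+-assoc (ℚ.- v) v (ℚ.- w))) ⟩
      u ℚ.+ ((ℚ.- v ℚ.+ v) ℚ.- w)     ≡⟨ cong (λ z → u ℚ.+ (z ℚ.- w)) (ℚ.+-inverseˡ v) ⟩
      u ℚ.+ (0ℚ ℚ.- w)                ≡⟨ cong (u ℚ.+_) (ℚ.+-identityˡ (ℚ.- w)) ⟩
      u ℚ.- w                         ∎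

  *-mono : ∀ {u v U V} .{{_ : ℚ.NonNegative U}} → ℚ.∣ u ∣ ℚ.≤ U → ℚ.∣ v ∣ ℚ.≤ V →
           ℚ.∣ u ℚ.* v ∣ ℚ.≤ U ℚ.* V
  *-mono {u} {v} {U} {V} u≤U v≤V = begin
    ℚ.∣ u ℚ.* v ∣            ≡⟨ ℚ.∣p*q∣≡∣p∣*∣q∣ u v ⟩
    ℚ.∣ u ∣ ℚ.* ℚ.∣ v ∣      ≤⟨ ℚ.*-monoʳ-≤-nonNeg ℚ.∣ v ∣ {{ℚ.∣-∣-nonNeg v}} u≤U ⟩
    U ℚ.* ℚ.∣ v ∣            ≤⟨ ℚ.*-monoˡ-≤-nonNeg U v≤V ⟩
    U ℚ.* V                  ∎

  total : X ℚ.* δ ℚ.+ δ ℚ.* Y ≡ ε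
  total = begin-equality
    X ℚ.* δ ℚ.+ δ ℚ.* Y        ≡⟨ cong (X ℚ.* δ ℚ.+_) (ℚ.*-comm δ Y) ⟩
    X ℚ.* δ ℚ.+ Y ℚ.* δ        ≡⟨ ℚ.*-distribʳ-+ δ X Y ⟨
    B ℚ.* (ε ℚ.* ℚ.1/ B)       ≡⟨ ℚ.*-comm B δ ⟩
    (ε ℚ.* ℚ.1/ B) ℚ.* B       ≡⟨ ℚ.*-assoc ε (ℚ.1/ B) B ⟩
    ε ℚ.* (ℚ.1/ B ℚ.* B)       ≡⟨ cong (ε ℚ.*_) (ℚ.*-inverseˡ B) ⟩
    ε ℚ.* 1ℚ                   ≡⟨ ℚ.*-identityʳ ε ⟩
    ε                          ∎

  close : ∀ m n → ℚ.∣ s m ∣ ℚ.≤ X → ℚ.∣ t n ∣ ℚ.≤ Y →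
          ℚ.∣ s m ℚ.- s n ∣ ℚ.≤ δ → ℚ.∣ t m ℚ.- t n ∣ ℚ.≤ δ →
          ℚ.∣ (s m ℚ.* t m) ℚ.- (s n ℚ.* t n) ∣ ℚ.≤ ε
  close m n x≤ y≤ dx dy = begin
    ℚ.∣ (s m ℚ.* t m) ℚ.- (s n ℚ.* t n) ∣
      ≡⟨ cong ℚ.∣_∣ (split (s m) (t m) (s n) (t n)) ⟩
    ℚ.∣ s m ℚ.* (t m ℚ.- t n) ℚ.+ (s m ℚ.- s n) ℚ.* t n ∣
      ≤⟨ ℚ.∣p+q∣≤∣p∣+∣q∣ (s m ℚ.* (t m ℚ.- t n)) ((s m ℚ.- s n) ℚ.* t n) ⟩
    ℚ.∣ s m ℚ.* (t m ℚ.- t n) ∣ ℚ.+ ℚ.∣ (s m ℚ.- s n) ℚ.* t n ∣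
      ≤⟨ ℚ.+-mono-≤ (*-mono x≤ dy) (*-mono dx y≤) ⟩
    X ℚ.* δ ℚ.+ δ ℚ.* Y
      ≡⟨ total ⟩
    ε ∎

expTerm : ℚ → ℕ → ℚ
expTerm r zero    = 1ℚ
expTerm r (suc k) = expTerm r k ℚ.* (r ℚ.* (ℤ.+ 1 ℚ./ suc k))

expSum : ℚ → ℕ → ℚ
expSum r zero    = 0ℚ
expSum r (suc n) = expSum r n ℚ.+ expTerm r n

-- y is the natural logarithm of x when exp y = x.  The exponential series
-- converges uniformly on bounded sets, so exp y is the limit of its n-th
-- partial sum taken at the n-th approximation of y.
_IsLogOf_ : ℝ → ℝ → Set
y IsLogOf x = (λ n → expSum (seq y n) n) ⟶ x

_IsSquareRootOf_ : ℝ → ℝ → Set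
y IsSquareRootOf x = fromℕ 0 ≤ᴿ y × y *ᴿ y ≃ᴿ x

-- Only meaningful for a nonzero divisor z.
_IsQuotientOf_By_ : ℝ → ℝ → ℝ → Set
w IsQuotientOf y By z = w *ᴿ z ≃ᴿ y

------------------------------------------------------------------------
-- Fields

-- Discrete fields: being zero is decidable.
record Field c ℓ : Set (lsuc (c ⊔ ℓ)) where
  field
    commutativeRing : CommutativeRing c ℓ

  open CommutativeRing commutativeRing public

  field
    1≉0     : ¬ 1# ≈ 0#
    inverse : ∀ x → x ≈ 0# ⊎ (∃[ y ] x * y ≈ 1#)

record FiniteField c ℓ (q : ℕ) : Set (lsuc (c ⊔ ℓ)) where
  field
    asField     : Field c ℓ
    cardinality : Inverse (Field.setoid asField) (≡.setoid (Fin q))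

  open Field asField public

IsOddPrimePower : ℕ → Set
IsOddPrimePower q =
  ¬ (2 ℕ.∣ q) × ∃[ r ] ∃[ e ] ℕ.Prime r × 1 ℕ.≤ e × q ≡ r ℕ.^ e

------------------------------------------------------------------------
-- Polynomials

-- a₀ ∷ a₁ ∷ … ∷ aₙ ∷ [] represents Σ aᵢ τⁱ, where τ c = σ(c) τ; trailing zeros
-- are identified away by comparing coefficients.
module SkewPolynomials (R : RawRing c ℓ) (σ : RawRing.Carrier R → RawRing.Carrier R) where
  private module R = RawRing R

  Poly : Set c
  Poly = List R.Carrier

  coeff : Poly → ℕ → R.Carrier
  coeff []      _       = R.0#
  coeff (a ∷ _) zero    = a
  coeff (_ ∷ u) (suc n) = coeff u n

  add : Poly → Poly → Poly
  add []      v       = v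
  add (a ∷ u) []      = a ∷ u
  add (a ∷ u) (b ∷ v) = (a R.+ b) ∷ add u v

  τ· : Poly → Poly
  τ· v = R.0# ∷ map σ v

  mul : Poly → Poly → Poly
  mul []      v = []
  mul (a ∷ u) v = add (map (a R.*_) v) (mul u (τ· v))

  ring : RawRing c ℓ
  ring = record
    { Carrier = Poly
    ; _≈_     = λ u v → ∀ n → coeff u n R.≈ coeff v n
    ; _+_     = add
    ; _*_     = mul
    ; -_      = map R.-_
    ; 0#      = []
    ; 1#      = R.1# ∷ []
    }

  -- The action of Σ aᵢ τⁱ on R in which τ acts as σ.
  act : Poly → R.Carrier → R.Carrier
  act []      x = R.0#
  act (a ∷ u) x = (a R.* x) R.+ act u (σ x)

module Polynomials (R : RawRing c ℓ) where
  private module R = RawRing R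
  open SkewPolynomials R id public using (Poly; coeff) renaming (ring to R[T])

  constant : R.Carrier → Poly
  constant a = a ∷ []

  T : Poly
  T = R.0# ∷ R.1# ∷ []

  eval : Poly → R.Carrier → R.Carrier
  eval []      x = R.0#
  eval (a ∷ u) x = a R.+ (x R.* eval u x)

  record Monic (u : Poly) : Set ℓ where
    field
      degree       : ℕ
      leading      : coeff u degree R.≈ R.1#
      above-degree : ∀ n → degree ℕ.< n → coeff u n R.≈ R.0#

record AlgebraicClosure (F : Field f ℓf) c ℓ : Set (f ⊔ ℓf ⊔ lsuc (c ⊔ ℓ)) where
  private
    module F = Field F
    module F[X] = Polynomials F.rawRing
  field
    asField : Field c ℓ
  open Field asField public
  private module K[X] = Polynomials rawRing
  field
    embedding           : F.Carrier → Carrier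
    isRingHomomorphism  : RingMorphisms.IsRingHomomorphism F.rawRing rawRing embedding
    algebraic           : ∀ x → ∃[ u ] F[X].Monic u × K[X].eval (map embedding u) x ≈ 0#
    algebraicallyClosed : ∀ u (monic : K[X].Monic u) → 1 ℕ.≤ K[X].Monic.degree monic →
                          ∃[ x ] K[X].eval u x ≈ 0#

record FractionField (R : RawRing c ℓ) f ℓf : Set (c ⊔ ℓ ⊔ lsuc (f ⊔ ℓf)) where
  private module R = RawRing R
  field
    asField : Field f ℓf
  open Field asField public
  field
    embedding          : R.Carrier → Carrier
    isRingMonomorphism : RingMorphisms.IsRingMonomorphism R rawRing embedding
    fraction           : ∀ x → ∃[ a ] ∃[ b ] (¬ b R.≈ R.0#) × x * embedding b ≈ embedding a

------------------------------------------------------------------------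
-- Drinfeld modules

module FunctionField {q : ℕ} (k : FiniteField c ℓ q) where
  private module k = FiniteField k

  open Polynomials k.rawRing public using (constant; T; Monic) renaming (R[T] to A)
  private module A = RawRing A
  open RawSemiringDefinitions A.rawSemiring public using (_∣_; _∤_; _^_; Prime)

  ∣_∣ : ∀ {a} → Monic a → ℕ
  ∣ monic ∣ = q ℕ.^ Monic.degree monic

  infix 4 _≡_mod_
  _≡_mod_ : A.Carrier → A.Carrier → A.Carrier → Set (c ⊔ ℓ)
  a ≡ b mod d = d ∣ (a A.+ (A.- b))

  A/ : A.Carrier → RawRing c (c ⊔ ℓ)
  A/ d = record
    { Carrier = A.Carrier
    ; _≈_     = _≡_mod d
    ; _+_     = A._+_
    ; _*_     = A._*_
    ; -_      = A.-_
    ; 0#      = A.0#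
    ; 1#      = A.1#
    }

  A/-module : A.Carrier → RawLeftModule A.Carrier c (c ⊔ ℓ)
  A/-module d = record
    { Carrierᴹ = A.Carrier
    ; _≈ᴹ_     = _≡_mod d
    ; _+ᴹ_     = A._+_
    ; _*ₗ_     = A._*_
    ; 0ᴹ       = A.0#
    ; -ᴹ_      = A.-_
    }

  infix 4 _≅_
  _≅_ : ∀ {m ℓm n ℓn} → RawLeftModule A.Carrier m ℓm → RawLeftModule A.Carrier n ℓn →
        Set (c ⊔ m ⊔ ℓm ⊔ n ⊔ ℓn)
  M ≅ N = ∃ (LeftModuleMorphisms.IsLeftModuleIsomorphism M N)

  infixr 5 _⊕_
  _⊕_ : ∀ {m ℓm n ℓn} → RawLeftModule A.Carrier m ℓm → RawLeftModule A.Carrier n ℓn →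
        RawLeftModule A.Carrier (m ⊔ n) (ℓm ⊔ ℓn)
  _⊕_ = DirectProduct.rawLeftModule

  -- L{τ}, where τ c = c^q τ.
  module Twisted (L : RawRing f ℓf) where
    private module L where
      open RawRing L public
      open RawSemiringDefinitions rawSemiring public using (_^_)
    open SkewPolynomials L (L._^ q) public using (coeff; act) renaming (ring to L⟨τ⟩)

  record DrinfeldModule (L : RawRing f ℓf) (γ : A.Carrier → RawRing.Carrier L)
                        (r : ℕ) .{{_ : ℕ.NonZero r}} : Set (c ⊔ ℓ ⊔ f ⊔ ℓf) where
    private module L = RawRing L
    open Twisted L
    private module L⟨τ⟩ = RawRing L⟨τ⟩

    field
      ψ                  : A.Carrier → L⟨τ⟩.Carrier
      isRingHomomorphism : RingMorphisms.IsRingHomomorphism A L⟨τ⟩ ψ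
      isAlgebra          : ∀ a → ψ (constant a) L⟨τ⟩.≈ (γ (constant a) ∷ [])

    g : ℕ → L.Carrier
    g = coeff (ψ T)

    field
      constant-term : g 0 L.≈ γ T
      leading       : ¬ g r L.≈ L.0#
      above-rank    : ∀ n → r ℕ.< n → g n L.≈ L.0#

    -- L with a ∈ A acting as ψ a.
    module-on-L : RawLeftModule A.Carrier f ℓf
    module-on-L = record
      { Carrierᴹ = L.Carrier
      ; _≈ᴹ_     = L._≈_
      ; _+ᴹ_     = L._+_
      ; _*ₗ_     = λ a x → act (ψ a) x
      ; 0ᴹ       = L.0#
      ; -ᴹ_      = L.-_
      }

  module Rational (F : FractionField A f ℓf) where
    private module F = FractionField F

    module _ {s ℓs} (K : AlgebraicClosure F.asField s ℓs)
             (ψ : DrinfeldModule F.rawRing F.embedding 2) where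
      private module K = AlgebraicClosure K
      open Twisted K.rawRing
      open RawRing L⟨τ⟩ using (_≈_; _*_) renaming (Carrier to K⟨τ⟩)
      private module ψ = DrinfeldModule ψ

      ψᴷ : A.Carrier → K⟨τ⟩
      ψᴷ a = map K.embedding (ψ.ψ a)

      IsEndomorphism : K⟨τ⟩ → Set (c ⊔ ℓs)
      IsEndomorphism u = ∀ a → u * ψᴷ a ≈ ψᴷ a * u

      TrivialEndomorphismRing : Set (c ⊔ s ⊔ ℓs)
      TrivialEndomorphismRing = ∀ u → IsEndomorphism u ⇔ (∃[ a ] u ≈ ψᴷ a)

    -- ord_p(x) = i - j when x = pⁱ a / pʲ b with p dividing neither a nor b.
    HasOrd : A.Carrier → F.Carrier → ℤ → Set (c ⊔ ℓ ⊔ ℓf)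
    HasOrd p x n =
      ∃[ i ] ∃[ j ] ∃[ a ] ∃[ b ]
        p ∤ a × p ∤ b × n ≡ i ℤ.⊖ j ×
        x F.* F.embedding ((p ^ j) A.* b) F.≈ F.embedding ((p ^ i) A.* a)

    -- ord_p(0) = ∞.
    NonNegativeOrd : A.Carrier → F.Carrier → Set (c ⊔ ℓ ⊔ ℓf)
    NonNegativeOrd p x = x F.≈ F.0# ⊎ (∃[ n ] 0ℤ ℤ.≤ n × HasOrd p x n)

    ReducesTo : A.Carrier → F.Carrier → A.Carrier → Set (c ⊔ ℓ ⊔ ℓf)
    ReducesTo p x y =
      ∃[ a ] ∃[ b ] p ∤ b × x F.* F.embedding b F.≈ F.embedding a × (y A.* b) ≡ a mod p

    module _ (p : A.Carrier) (ψ : DrinfeldModule F.rawRing F.embedding 2) where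
      private module ψ = DrinfeldModule ψ

      GoodReduction : Set (c ⊔ ℓ ⊔ ℓf)
      GoodReduction = NonNegativeOrd p (ψ.g 1) × HasOrd p (ψ.g 2) 0ℤ

      IsReduction : DrinfeldModule (A/ p) id 2 → Set (c ⊔ ℓ ⊔ ℓf)
      IsReduction ψ̄ = ∀ i → ReducesTo p (ψ.g i) (DrinfeldModule.g ψ̄ i)

{-# OPTIONS --safe #-}

-- Let n = deg p, δ = deg d₁ and m = n - 2δ.  Since τⁿ fixes 𝔽_p, it fixes the
-- d₁-torsion (A/d₁)² ⊆ 𝔽_p of the reduction, so ψ̄_{d₁} divides τⁿ - 1.  The quotient u
-- is an endomorphism of ψ̄ of τ-degree m with constant term u₀ d₁ ≡ -1.  From trace and
-- norm, u² - a u + b = 0 with a, b ∈ A, and v = 2u - ψ̄_a satisfies v² = ψ̄_D with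
-- deg D ≤ m + 1.  Comparing coefficients in v ψ̄_T = ψ̄_T v gives v_i = √D s_{i+1} / Δ_{i+1}
-- with s and Δ the reductions of elements of A that depend only on D and on ψ, and
-- deg s_{i+1} is O(i qⁱ m).  If n exceeds these degrees for i ≤ m + 2, then
-- s_{m+2} = s_{m+3} = 0 holds in A itself, and the same recursion with a square root of D
-- in F^alg terminates in an endomorphism of ψ with constant term √D.  As ψ has no complex
-- multiplication, D is a square in A; then u₀ is a polynomial of degree at most m + 1
-- divided by 2, contradicting u₀ d₁ ≡ -1.  Hence n = O(m² q^m), while
-- 2 deg d₂ ≥ 2 (n - δ) = n + m, so |d₂| ≥ |p|^{1/2} q^{m/2}, and q^{m/2} is estimated from
-- below by n^{1/2} / m, that is by (log |p|)^{1/2} / log log |p|.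
module Submission where

open import Defs
open import Algebra.Bundles using (CommutativeRing; RawRing; Ring)
open import Algebra.Definitions.RawMagma using (_,_; module _∣ʳ_)
import Algebra.Definitions.RawSemiring as RawSemiringDefinitions
open import Algebra.Module.Morphism.Structures using (module LeftModuleMorphisms)
import Algebra.Morphism.Construct.Composition as Composition
import Algebra.Morphism.RingMonomorphism as RingMonomorphism
open import Algebra.Morphism.Structures using (module RingMorphisms)
import Algebra.Properties.CommutativeMonoid.Sum as Sum
import Algebra.Properties.CommutativeSemiring.Exp as Exp
import Algebra.Properties.Ring as RingProperties
import Algebra.Properties.Semiring.Mult.TCOptimised as Mult
import Algebra.Solver.Ring as RingSolver
import Algebra.Solver.Ring.AlmostCommutativeRing as ACR
open import Data.Empty using (⊥)
open import Data.Fin.Base as Fin using (Fin; zero; suc; combine; finToFun; funToFin)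
import Data.Fin.Permutation as Perm
import Data.Fin.Properties as Fin
open import Data.Integer.Base as ℤ using (ℤ)
import Data.Integer.Properties as ℤ
open import Data.List.Base using (List; []; _∷_; length; map; tabulate)
open import Data.Maybe.Base using (Maybe; just; nothing)
open import Data.Nat.Base as ℕ using (ℕ; zero; suc; z≤n; s≤s)
import Data.Nat.Divisibility as ℕ
import Data.Nat.Properties as ℕ
import Data.Nat.Solver as ℕ
open import Data.Product.Base using (_×_; _,_; proj₁; proj₂; ∃-syntax; Σ-syntax)
open import Data.Rational.Base as ℚ using (ℚ)
import Data.Rational.Properties as ℚ
open import Data.Rational.Unnormalised.Base as ℚᵘ using (mkℚᵘ; *≡*; *≤*)
import Data.Rational.Unnormalised.Properties as ℚᵘ
open import Data.Sign.Base as Sign using (Sign)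
open import Data.Sum.Base using (_⊎_; inj₁; inj₂; [_,_]′)
open import Data.Unit.Base using (tt)
open import Data.Vec.Base as Vec using (Vec; []; _∷_)
open import Data.Vec.Functional using (removeAt)
open import Data.Vec.Relation.Unary.All as All using (All; []; _∷_)
import Data.Vec.Relation.Unary.All.Properties as All
open import Function.Base using (id; _∘_)
open import Function.Bundles using (Equivalence; Inverse)
open import Level using (Level; _⊔_) renaming (suc to lsuc)
open import Relation.Binary.PropositionalEquality as ≡ using (_≡_; cong; cong₂)
import Relation.Binary.Reasoning.Setoid as SetoidReasoning
open import Relation.Nullary using (¬_; Dec; yes; no; contradiction)
open import Relation.Nullary.Decidable using (decidable-stable; map′)

-- The endomorphism exists only modulo p and need not lift; what lifts is the recursion. Its
-- right-hand side contains y^q for y = √D, and this is where q = 2h + 1 matters: y^q = y Dʰ, so one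
-- factor y splits off at every step and the cofactor `s` is a polynomial expression in D, T and the
-- data of ψ. The same `s` thus serves the reduction and F^alg, although nothing relates the two
-- square roots of D.
--
-- The relation is kept free of division, as y s_i = Δ_i c_i with c the shifted coefficient
-- sequence, because Δ_i may vanish modulo p, through T^(q^j) - T or through the common denominator
-- of g₁ and g₂. It is read in opposite directions. Modulo p, c_i = 0 and y ≠ 0 give s_i ≡ 0, which
-- a degree below n turns into s_i = 0; over F^alg, where Δ_i ≠ 0, this gives c_i = 0 in turn. Two
-- consecutive zeros are asked for because the recursion has order two.
--
-- In the last estimate every real number enters through one rational approximation, with common
-- tolerance 1/128, so that all comparisons are between rational numbers.

private
  variable
    c ℓ c′ ℓ′ : Level

-- Ring solver with integer coefficients

module ℤ-Solver (R : CommutativeRing c ℓ) where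
  open CommutativeRing R using (Carrier; _≈_; _+_; _*_; -_; _-_; 0#; 1#; refl; sym; trans; reflexive; setoid; ring; semiring; +-cong; +-congˡ; +-congʳ; +-assoc; +-comm; +-identityˡ; +-identityʳ; -‿inverseʳ; -‿cong)
  open Mult semiring using (1+×; ×-homo-+; ×1-homo-*) renaming (_×_ to _·_)
  open RingProperties ring using (-0#≈0#; -‿distribˡ-*; -‿distribʳ-*; -‿involutive; -‿+-comm)
  open SetoidReasoning setoid

  private
    -- With the optimised multiple, `con ℤ.1ℤ` denotes `1#` itself and not `1# + 0#`, so solved
    -- equations match terms written with `1#`.
    ⟦_⟧ : ℤ → Carrier
    ⟦ ℤ.+ n ⟧ = n · 1#
    ⟦ ℤ.-[1+ n ] ⟧ = - (suc n · 1#)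

    cancel : ∀ x y z → x + y - (x + z) ≈ y - z
    cancel x y z = begin
      x + y - (x + z)       ≈⟨ +-cong (+-comm x y) (sym (-‿+-comm x z)) ⟩
      y + x + (- x - z)     ≈⟨ +-assoc y x _ ⟩
      y + (x + (- x - z))   ≈⟨ +-congˡ (sym (+-assoc x (- x) (- z))) ⟩
      y + (x - x - z)       ≈⟨ +-congˡ (+-congʳ (-‿inverseʳ x)) ⟩
      y + (0# - z)          ≈⟨ +-congˡ (+-identityˡ (- z)) ⟩
      y - z                 ∎

    ⊖-homo : ∀ m n → ⟦ m ℤ.⊖ n ⟧ ≈ m · 1# - n · 1#
    ⊖-homo zero    zero    = sym (-‿inverseʳ 0#)
    ⊖-homo zero    (suc n) = sym (+-identityˡ _)
    ⊖-homo (suc m) zero    = sym (trans (+-congˡ -0#≈0#) (+-identityʳ _))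
    ⊖-homo (suc m) (suc n) rewrite ℤ.[1+m]⊖[1+n]≡m⊖n m n = begin
      ⟦ m ℤ.⊖ n ⟧                        ≈⟨ ⊖-homo m n ⟩
      m · 1# - n · 1#                    ≈⟨ cancel 1# (m · 1#) (n · 1#) ⟨
      1# + m · 1# - (1# + n · 1#)        ≈⟨ +-cong (sym (1+× m 1#)) (-‿cong (sym (1+× n 1#))) ⟩
      suc m · 1# - suc n · 1#            ∎

    +-homo : ∀ i j → ⟦ i ℤ.+ j ⟧ ≈ ⟦ i ⟧ + ⟦ j ⟧
    +-homo (ℤ.+ m)      (ℤ.+ n)      = ×-homo-+ 1# m n
    +-homo (ℤ.+ m)      ℤ.-[1+ n ]   = ⊖-homo m (suc n)
    +-homo ℤ.-[1+ m ]   (ℤ.+ n)      = trans (⊖-homo n (suc m)) (+-comm _ _)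
    +-homo ℤ.-[1+ m ]   ℤ.-[1+ n ]   = trans
      (-‿cong (trans (reflexive (≡.cong (λ k → suc k · 1#) (≡.sym (ℕ.+-suc m n)))) (×-homo-+ 1# (suc m) (suc n))))
      (sym (-‿+-comm _ _))

    ◃⁺-homo : ∀ n → ⟦ Sign.+ ℤ.◃ n ⟧ ≈ n · 1#
    ◃⁺-homo zero    = refl
    ◃⁺-homo (suc n) = refl

    ◃⁻-homo : ∀ n → ⟦ Sign.- ℤ.◃ n ⟧ ≈ - (n · 1#)
    ◃⁻-homo zero    = sym -0#≈0#
    ◃⁻-homo (suc n) = refl

    *-homo : ∀ i j → ⟦ i ℤ.* j ⟧ ≈ ⟦ i ⟧ * ⟦ j ⟧
    *-homo (ℤ.+ m)    (ℤ.+ n)    = trans (◃⁺-homo (m ℕ.* n)) (×1-homo-* m n)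
    *-homo (ℤ.+ m)    ℤ.-[1+ n ] = trans (◃⁻-homo (m ℕ.* suc n))
      (trans (-‿cong (×1-homo-* m (suc n))) (-‿distribʳ-* _ _))
    *-homo ℤ.-[1+ m ] (ℤ.+ n)    = trans (◃⁻-homo (suc m ℕ.* n))
      (trans (-‿cong (×1-homo-* (suc m) n)) (-‿distribˡ-* _ _))
    *-homo ℤ.-[1+ m ] ℤ.-[1+ n ] = trans (◃⁺-homo (suc m ℕ.* suc n)) (begin
      (suc m ℕ.* suc n) · 1#                    ≈⟨ ×1-homo-* (suc m) (suc n) ⟩
      suc m · 1# * (suc n · 1#)                 ≈⟨ -‿involutive _ ⟨
      - - (suc m · 1# * (suc n · 1#))           ≈⟨ -‿cong (-‿distribʳ-* _ _) ⟩
      - (suc m · 1# * - (suc n · 1#))           ≈⟨ -‿distribˡ-* _ _ ⟩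
      - (suc m · 1#) * - (suc n · 1#)           ∎)

    neg-homo : ∀ i → ⟦ ℤ.- i ⟧ ≈ - ⟦ i ⟧
    neg-homo (ℤ.+ zero)  = sym -0#≈0#
    neg-homo (ℤ.+ suc n) = refl
    neg-homo ℤ.-[1+ n ]  = sym (-‿involutive _)

    morphism : ℤ.+-*-rawRing ACR.-Raw-AlmostCommutative⟶ ACR.fromCommutativeRing R
    morphism = record
      { ⟦_⟧ = ⟦_⟧ ; +-homo = +-homo ; *-homo = *-homo ; -‿homo = neg-homo
      ; 0-homo = refl ; 1-homo = refl }

    coeff≟ : ∀ i j → Maybe (⟦ i ⟧ ≈ ⟦ j ⟧)
    coeff≟ i j with i ℤ.≟ j
    ... | yes i≡j = just (reflexive (≡.cong ⟦_⟧ i≡j))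
    ... | no _    = nothing

  open RingSolver ℤ.+-*-rawRing (ACR.fromCommutativeRing R) morphism coeff≟ public
    using (solve; _:=_; _:+_; _:*_; _:-_; :-_; con)

module RingHom {R₁ : RawRing c ℓ} {R₂ : RawRing c′ ℓ′} {f : RawRing.Carrier R₁ → RawRing.Carrier R₂}
               (hom : RingMorphisms.IsRingHomomorphism R₁ R₂ f) where
  open RingMorphisms.IsRingHomomorphism hom public
    using (⟦⟧-cong; +-homo; *-homo; 0#-homo; 1#-homo; -‿homo)

-- Skew polynomials form a ring

module Skew {c ℓ : Level} (R : CommutativeRing c ℓ) (σ : CommutativeRing.Carrier R → CommutativeRing.Carrier R)
            (σ-hom : RingMorphisms.IsRingHomomorphism (CommutativeRing.rawRing R) (CommutativeRing.rawRing R) σ) where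
  open CommutativeRing R using (Carrier; _≈_; _+_; _*_; -_; _-_; 0#; 1#; refl; sym; trans; setoid; rawRing; ring; isRing; isEquivalence; +-cong; +-congˡ; +-congʳ; *-cong; *-congˡ; +-assoc; *-assoc; +-comm; +-identityˡ; +-identityʳ; *-identityˡ; *-identityʳ; zeroˡ; zeroʳ; distribˡ; distribʳ; -‿inverseʳ; -‿cong)
  open RingProperties ring using (-0#≈0#)
  open SkewPolynomials rawRing σ public renaming (ring to rawSkew)
  private
    module σ = RingHom σ-hom
    module Solver = ℤ-Solver R

  infix 4 _≋_
  -- The equality of `rawSkew` as a record: from the bare function type the two polynomials could
  -- not be inferred.
  record _≋_ (u v : Poly) : Set ℓ where
    constructor mk
    field at : ∀ n → coeff u n ≈ coeff v n
  open _≋_ public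

  ≋-refl : ∀ {u} → u ≋ u
  ≋-refl = mk λ n → refl

  ≋-sym : ∀ {u v} → u ≋ v → v ≋ u
  ≋-sym p = mk λ n → sym (at p n)

  ≋-trans : ∀ {u v w} → u ≋ v → v ≋ w → u ≋ w
  ≋-trans p q = mk λ n → trans (at p n) (at q n)

  ∷-cong : ∀ {a b u v} → a ≈ b → u ≋ v → a ∷ u ≋ b ∷ v
  ∷-cong a≈b u≋v = mk λ { zero → a≈b ; (suc n) → at u≋v n }

  tail≋ : ∀ {a b u v} → a ∷ u ≋ b ∷ v → u ≋ v
  tail≋ p = mk λ n → at p (suc n)

  coeff-add : ∀ u v n → coeff (add u v) n ≈ coeff u n + coeff v n
  coeff-add []      v       n       = sym (+-identityˡ _)
  coeff-add (a ∷ u) []      n       = sym (+-identityʳ _)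
  coeff-add (a ∷ u) (b ∷ v) zero    = refl
  coeff-add (a ∷ u) (b ∷ v) (suc n) = coeff-add u v n

  coeff-map : ∀ (f : Carrier → Carrier) → f 0# ≈ 0# → ∀ u n → coeff (map f u) n ≈ f (coeff u n)
  coeff-map f f0 []      n       = sym f0
  coeff-map f f0 (a ∷ u) zero    = refl
  coeff-map f f0 (a ∷ u) (suc n) = coeff-map f f0 u n

  coeff-scale : ∀ a u n → coeff (map (a *_) u) n ≈ a * coeff u n
  coeff-scale a = coeff-map (a *_) (zeroʳ a)

  coeff-neg : ∀ u n → coeff (map -_ u) n ≈ - coeff u n
  coeff-neg = coeff-map -_ -0#≈0#

  coeff-σ : ∀ u n → coeff (map σ u) n ≈ σ (coeff u n)
  coeff-σ = coeff-map σ σ.0#-homo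

  add-cong : ∀ {u u′ v v′} → u ≋ u′ → v ≋ v′ → add u v ≋ add u′ v′
  add-cong {u} {u′} {v} {v′} p q = mk λ n →
    trans (coeff-add u v n) (trans (+-cong (at p n) (at q n)) (sym (coeff-add u′ v′ n)))

  scale-cong : ∀ {a b u v} → a ≈ b → u ≋ v → map (a *_) u ≋ map (b *_) v
  scale-cong {a} {b} {u} {v} p q = mk λ n →
    trans (coeff-scale a u n) (trans (*-cong p (at q n)) (sym (coeff-scale b v n)))

  mapσ-cong : ∀ {u v} → u ≋ v → map σ u ≋ map σ v
  mapσ-cong {u} {v} q = mk λ n →
    trans (coeff-σ u n) (trans (σ.⟦⟧-cong (at q n)) (sym (coeff-σ v n)))

  neg-cong : ∀ {u v} → u ≋ v → map -_ u ≋ map -_ v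
  neg-cong {u} {v} q = mk λ n →
    trans (coeff-neg u n) (trans (-‿cong (at q n)) (sym (coeff-neg v n)))

  add-assoc : ∀ u v w → add (add u v) w ≋ add u (add v w)
  add-assoc u v w = mk λ n → begin
    coeff (add (add u v) w) n            ≈⟨ coeff-add (add u v) w n ⟩
    coeff (add u v) n + coeff w n        ≈⟨ +-congʳ (coeff-add u v n) ⟩
    coeff u n + coeff v n + coeff w n    ≈⟨ +-assoc _ _ _ ⟩
    coeff u n + (coeff v n + coeff w n)  ≈⟨ +-congˡ (coeff-add v w n) ⟨
    coeff u n + coeff (add v w) n        ≈⟨ coeff-add u (add v w) n ⟨
    coeff (add u (add v w)) n            ∎
    where open SetoidReasoning setoid

  add-comm : ∀ u v → add u v ≋ add v u
  add-comm u v = mk λ n → trans (coeff-add u v n) (trans (+-comm _ _) (sym (coeff-add v u n)))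

  add-zeroʳ : ∀ u → add u [] ≋ u
  add-zeroʳ u = mk λ n → trans (coeff-add u [] n) (+-identityʳ _)

  add-negʳ : ∀ u → add u (map -_ u) ≋ []
  add-negʳ u = mk λ n → trans (coeff-add u _ n) (trans (+-congˡ (coeff-neg u n)) (-‿inverseʳ _))

  private
    add-medial : ∀ s t u v → add (add s t) (add u v) ≋ add (add s u) (add t v)
    add-medial s t u v = mk λ n → begin
      coeff (add (add s t) (add u v)) n
        ≈⟨ trans (coeff-add (add s t) (add u v) n) (+-cong (coeff-add s t n) (coeff-add u v n)) ⟩
      coeff s n + coeff t n + (coeff u n + coeff v n)
        ≈⟨ solve 4 (λ s t u v → s :+ t :+ (u :+ v) := s :+ u :+ (t :+ v)) refl (coeff s n) (coeff t n) (coeff u n) (coeff v n) ⟩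
      coeff s n + coeff u n + (coeff t n + coeff v n)
        ≈⟨ trans (coeff-add (add s u) (add t v) n) (+-cong (coeff-add s u n) (coeff-add t v n)) ⟨
      coeff (add (add s u) (add t v)) n ∎
      where open SetoidReasoning setoid
            open Solver

  scale-add : ∀ a u v → map (a *_) (add u v) ≋ add (map (a *_) u) (map (a *_) v)
  scale-add a u v = mk λ n → begin
    coeff (map (a *_) (add u v)) n            ≈⟨ coeff-scale a (add u v) n ⟩
    a * coeff (add u v) n                     ≈⟨ *-congˡ (coeff-add u v n) ⟩
    a * (coeff u n + coeff v n)               ≈⟨ distribˡ _ _ _ ⟩
    a * coeff u n + a * coeff v n             ≈⟨ +-cong (coeff-scale a u n) (coeff-scale a v n) ⟨
    coeff (map (a *_) u) n + coeff (map (a *_) v) n ≈⟨ coeff-add (map (a *_) u) _ n ⟨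
    coeff (add (map (a *_) u) (map (a *_) v)) n ∎
    where open SetoidReasoning setoid

  add-scale : ∀ a b v → map ((a + b) *_) v ≋ add (map (a *_) v) (map (b *_) v)
  add-scale a b v = mk λ n → begin
    coeff (map ((a + b) *_) v) n                     ≈⟨ coeff-scale (a + b) v n ⟩
    (a + b) * coeff v n                              ≈⟨ distribʳ _ _ _ ⟩
    a * coeff v n + b * coeff v n                    ≈⟨ +-cong (coeff-scale a v n) (coeff-scale b v n) ⟨
    coeff (map (a *_) v) n + coeff (map (b *_) v) n  ≈⟨ coeff-add (map (a *_) v) _ n ⟨
    coeff (add (map (a *_) v) (map (b *_) v)) n      ∎
    where open SetoidReasoning setoid

  scale-scale : ∀ a b v → map (a *_) (map (b *_) v) ≋ map ((a * b) *_) v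
  scale-scale a b v = mk λ n → begin
    coeff (map (a *_) (map (b *_) v)) n  ≈⟨ trans (coeff-scale a (map (b *_) v) n) (*-congˡ (coeff-scale b v n)) ⟩
    a * (b * coeff v n)                  ≈⟨ *-assoc _ _ _ ⟨
    a * b * coeff v n                    ≈⟨ coeff-scale (a * b) v n ⟨
    coeff (map ((a * b) *_) v) n         ∎
    where open SetoidReasoning setoid

  scale-zero : ∀ v → map (0# *_) v ≋ []
  scale-zero v = mk λ n → trans (coeff-scale 0# v n) (zeroˡ _)

  scale-one : ∀ v → map (1# *_) v ≋ v
  scale-one v = mk λ n → trans (coeff-scale 1# v n) (*-identityˡ _)

  mapσ-add : ∀ u v → map σ (add u v) ≋ add (map σ u) (map σ v)
  mapσ-add u v = mk λ n → begin
    coeff (map σ (add u v)) n                 ≈⟨ trans (coeff-σ (add u v) n) (σ.⟦⟧-cong (coeff-add u v n)) ⟩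
    σ (coeff u n + coeff v n)                 ≈⟨ σ.+-homo _ _ ⟩
    σ (coeff u n) + σ (coeff v n)             ≈⟨ +-cong (coeff-σ u n) (coeff-σ v n) ⟨
    coeff (map σ u) n + coeff (map σ v) n     ≈⟨ coeff-add (map σ u) _ n ⟨
    coeff (add (map σ u) (map σ v)) n         ∎
    where open SetoidReasoning setoid

  mapσ-scale : ∀ a v → map σ (map (a *_) v) ≋ map (σ a *_) (map σ v)
  mapσ-scale a v = mk λ n → begin
    coeff (map σ (map (a *_) v)) n      ≈⟨ trans (coeff-σ (map (a *_) v) n) (σ.⟦⟧-cong (coeff-scale a v n)) ⟩
    σ (a * coeff v n)                   ≈⟨ σ.*-homo _ _ ⟩
    σ a * σ (coeff v n)                 ≈⟨ trans (coeff-scale (σ a) (map σ v) n) (*-congˡ (coeff-σ v n)) ⟨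
    coeff (map (σ a *_) (map σ v)) n    ∎
    where open SetoidReasoning setoid

  τ·-cong : ∀ {u v} → u ≋ v → τ· u ≋ τ· v
  τ·-cong p = ∷-cong refl (mapσ-cong p)

  τ·-add : ∀ u v → τ· (add u v) ≋ add (τ· u) (τ· v)
  τ·-add u v = ∷-cong (sym (+-identityˡ 0#)) (mapσ-add u v)

  τ·-scale : ∀ a v → τ· (map (a *_) v) ≋ map (σ a *_) (τ· v)
  τ·-scale a v = ∷-cong (sym (zeroʳ _)) (mapσ-scale a v)

  mul-congʳ : ∀ u {v v′} → v ≋ v′ → mul u v ≋ mul u v′
  mul-congʳ []      p = ≋-refl
  mul-congʳ (a ∷ u) p = add-cong (scale-cong refl p) (mul-congʳ u (τ·-cong p))

  mul-zeroʳ : ∀ u → mul u [] ≋ []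
  mul-zeroʳ []      = ≋-refl
  mul-zeroʳ (a ∷ u) = ≋-trans (mul-congʳ u {τ· []} {[]} (mk λ { zero → refl ; (suc n) → refl })) (mul-zeroʳ u)

  mul-zeroˡ : ∀ u v → u ≋ [] → mul u v ≋ []
  mul-zeroˡ []      v p = ≋-refl
  mul-zeroˡ (a ∷ u) v p = ≋-trans
    (add-cong (≋-trans (scale-cong (at p 0) ≋-refl) (scale-zero v)) (mul-zeroˡ u (τ· v) (mk λ n → at p (suc n))))
    ≋-refl

  mul-congˡ : ∀ {u u′} v → u ≋ u′ → mul u v ≋ mul u′ v
  mul-congˡ {[]}    {u′}      v p = ≋-sym (mul-zeroˡ u′ v (≋-sym p))
  mul-congˡ {a ∷ u} {[]}      v p = mul-zeroˡ (a ∷ u) v p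
  mul-congˡ {a ∷ u} {b ∷ u′}  v p =
    add-cong (scale-cong (at p 0) ≋-refl) (mul-congˡ (τ· v) (tail≋ p))

  mul-cong : ∀ {u u′ v v′} → u ≋ u′ → v ≋ v′ → mul u v ≋ mul u′ v′
  mul-cong {u} {u′} {v} {v′} p q = ≋-trans (mul-congˡ v p) (mul-congʳ u′ q)

  mul-distribʳ : ∀ w u v → mul (add u v) w ≋ add (mul u w) (mul v w)
  mul-distribʳ w []      v       = ≋-refl
  mul-distribʳ w (a ∷ u) []      = ≋-sym (add-zeroʳ _)
  mul-distribʳ w (a ∷ u) (b ∷ v) = ≋-trans
    (add-cong (add-scale a b w) (mul-distribʳ (τ· w) u v))
    (add-medial (map (a *_) w) (map (b *_) w) (mul u (τ· w)) (mul v (τ· w)))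

  mul-distribˡ : ∀ u v w → mul u (add v w) ≋ add (mul u v) (mul u w)
  mul-distribˡ []      v w = ≋-refl
  mul-distribˡ (a ∷ u) v w = ≋-trans
    (add-cong (scale-add a v w) (≋-trans (mul-congʳ u (τ·-add v w)) (mul-distribˡ u (τ· v) (τ· w))))
    (add-medial (map (a *_) v) (map (a *_) w) (mul u (τ· v)) (mul u (τ· w)))

  mul-scale : ∀ a u v → mul (map (a *_) u) v ≋ map (a *_) (mul u v)
  mul-scale a []      v = ≋-refl
  mul-scale a (b ∷ u) v = ≋-trans
    (add-cong (≋-sym (scale-scale a b v)) (mul-scale a u (τ· v)))
    (≋-sym (scale-add a (map (b *_) v) (mul u (τ· v))))

  mul-mapσ : ∀ v w → mul (map σ v) (τ· w) ≋ τ· (mul v w)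
  mul-mapσ []      w = mk λ { zero → refl ; (suc n) → refl }
  mul-mapσ (a ∷ v) w = ≋-trans
    (add-cong (≋-sym (τ·-scale a w)) (mul-mapσ v (τ· w)))
    (≋-sym (τ·-add (map (a *_) w) (mul v (τ· w))))

  -- Associativity with left factor τ. Since `mul` recurses on its left factor, `mul-assoc` reduces
  -- to this case; it rests on σ being multiplicative.
  mul-τ· : ∀ v w → mul (τ· v) w ≋ τ· (mul v w)
  mul-τ· v w = ≋-trans (add-cong (scale-zero w) (mul-mapσ v w)) ≋-refl

  mul-assoc : ∀ u v w → mul (mul u v) w ≋ mul u (mul v w)
  mul-assoc []      v w = ≋-refl
  mul-assoc (a ∷ u) v w = ≋-trans (mul-distribʳ w (map (a *_) v) (mul u (τ· v)))
    (add-cong (mul-scale a v w) (≋-trans (mul-assoc u (τ· v) w) (mul-congʳ u (mul-τ· v w))))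

  mul-oneˡ : ∀ v → mul (1# ∷ []) v ≋ v
  mul-oneˡ v = ≋-trans (add-zeroʳ _) (scale-one v)

  mul-shiftʳ : ∀ u v → mul u (0# ∷ v) ≋ 0# ∷ mul u v
  mul-shiftʳ []      v = mk λ { zero → refl ; (suc n) → refl }
  mul-shiftʳ (a ∷ u) v = ≋-trans
    (add-cong (∷-cong (zeroʳ a) ≋-refl)
      (≋-trans (mul-congʳ u (∷-cong refl (∷-cong σ.0#-homo ≋-refl))) (mul-shiftʳ u (τ· v))))
    (∷-cong (+-identityˡ 0#) ≋-refl)

  mul-oneʳ : ∀ u → mul u (1# ∷ []) ≋ u
  mul-oneʳ []      = ≋-refl
  mul-oneʳ (a ∷ u) = ≋-trans
    (add-cong (∷-cong (*-identityʳ a) ≋-refl)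
      (≋-trans (mul-congʳ u (∷-cong refl (∷-cong σ.1#-homo ≋-refl)))
        (≋-trans (mul-shiftʳ u (1# ∷ [])) (∷-cong refl (mul-oneʳ u)))))
    (∷-cong (+-identityʳ a) ≋-refl)

  skewRing : Ring c ℓ
  skewRing = record
    { Carrier = Poly ; _≈_ = _≋_ ; _+_ = add ; _*_ = mul ; -_ = λ u → map -_ u ; 0# = [] ; 1# = 1# ∷ []
    ; isRing = record
      { +-isAbelianGroup = record
        { isGroup = record
          { isMonoid = record
            { isSemigroup = record
              { isMagma = record
                { isEquivalence = record { refl = ≋-refl ; sym = ≋-sym ; trans = ≋-trans }
                ; ∙-cong = add-cong }
              ; assoc = add-assoc }
            ; identity = (λ u → ≋-refl) , add-zeroʳ }
          ; inverse = (λ u → ≋-trans (add-comm (map -_ u) u) (add-negʳ u)) , add-negʳ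
          ; ⁻¹-cong = neg-cong }
        ; comm = add-comm }
      ; *-cong = mul-cong
      ; *-assoc = mul-assoc
      ; *-identity = mul-oneˡ , mul-oneʳ
      ; distrib = mul-distribˡ , mul-distribʳ } }

  -- Ring laws proved for `_≋_` are pulled back along this map to the bare coefficientwise equality,
  -- which is the equality that the statement of the theorem uses.
  unwrap : RingMorphisms.IsRingMonomorphism rawSkew (Ring.rawRing skewRing) id
  unwrap = record
    { isRingHomomorphism = record
      { isSemiringHomomorphism = record
        { isNearSemiringHomomorphism = record
          { +-isMonoidHomomorphism = record
            { isMagmaHomomorphism = record
              { isRelHomomorphism = record { cong = mk }
              ; homo = λ _ _ → ≋-refl }
            ; ε-homo = ≋-refl }
          ; *-homo = λ _ _ → ≋-refl }
        ; 1#-homo = ≋-refl }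
      ; -‿homo = λ _ → ≋-refl }
    ; injective = at }

-- The commutative case

module Poly (R : CommutativeRing c ℓ) where
  open CommutativeRing R using (_*_; 0#; refl; trans; rawRing; isCommutativeRing; isRing; *-comm; +-identityʳ)

  id-isRingHomomorphism : RingMorphisms.IsRingHomomorphism rawRing rawRing id
  id-isRingHomomorphism = record
    { isSemiringHomomorphism = record
      { isNearSemiringHomomorphism = record
        { +-isMonoidHomomorphism = record
          { isMagmaHomomorphism = record
            { isRelHomomorphism = record { cong = id }
            ; homo = λ _ _ → refl }
          ; ε-homo = refl }
        ; *-homo = λ _ _ → refl }
      ; 1#-homo = refl }
    ; -‿homo = λ _ → refl }

  open Skew R id id-isRingHomomorphism public using (rawSkew; Poly; coeff; add; τ·; mul; act; _≋_; mk; at; ≋-refl; ≋-sym; ≋-trans; ∷-cong; tail≋; coeff-add; coeff-map; coeff-scale; coeff-neg; coeff-σ; add-cong; scale-cong; mapσ-cong; neg-cong; add-assoc; add-comm; add-zeroʳ; add-negʳ; scale-add; add-scale; scale-scale; scale-zero; scale-one; mapσ-add; mapσ-scale; τ·-cong; τ·-add; τ·-scale; mul-congʳ; mul-zeroʳ; mul-zeroˡ; mul-congˡ; mul-cong; mul-distribʳ; mul-distribˡ; mul-scale; mul-mapσ; mul-τ·; mul-assoc; mul-oneˡ; mul-shiftʳ; mul-oneʳ; skewRing; unwrap)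
  open Polynomials rawRing public using (eval; constant; T; Monic)

  τ·≋shift : ∀ v → τ· v ≋ 0# ∷ v
  τ·≋shift v = ∷-cong refl (mk λ n → coeff-map id refl v n)

  mul-∷ : ∀ a u v → mul (a ∷ u) v ≋ add (map (a *_) v) (0# ∷ mul u v)
  mul-∷ a u v = add-cong ≋-refl (≋-trans (mul-congʳ u (τ·≋shift v)) (mul-shiftʳ u v))

  mul-constantʳ : ∀ v a → mul v (a ∷ []) ≋ map (a *_) v
  mul-constantʳ []      a = ≋-refl
  mul-constantʳ (b ∷ v) a = ≋-trans (mul-∷ b v (a ∷ []))
    (∷-cong (trans (+-identityʳ _) (*-comm b a)) (mul-constantʳ v a))

  mul-comm : ∀ u v → mul u v ≋ mul v u
  mul-comm []      v = ≋-sym (mul-zeroʳ v)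
  mul-comm (a ∷ u) v = ≋-trans (mul-∷ a u v) (≋-trans
    (add-cong (≋-sym (mul-constantʳ v a)) (≋-trans (∷-cong refl (mul-comm u v)) (≋-sym (mul-shiftʳ v u))))
    (≋-trans (≋-sym (mul-distribˡ v (a ∷ []) (0# ∷ u)))
      (mul-congʳ v (∷-cong (+-identityʳ a) ≋-refl))))

  polyRing≋ : CommutativeRing c ℓ
  polyRing≋ = record { isCommutativeRing = record { isRing = Ring.isRing skewRing ; *-comm = mul-comm } }

  polyRing : CommutativeRing c ℓ
  polyRing = record
    { isCommutativeRing = RingMonomorphism.isCommutativeRing unwrap (CommutativeRing.isCommutativeRing polyRing≋) }

iter : ∀ {a} {A : Set a} → (A → A) → ℕ → A → A
iter f zero    x = x
iter f (suc n) x = iter f n (f x)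

iter-suc : ∀ {a} {A : Set a} (f : A → A) n x → iter f n (f x) ≡ f (iter f n x)
iter-suc f zero    x = ≡.refl
iter-suc f (suc n) x = iter-suc f n (f x)

-- Degrees of skew polynomials

module SkewDegree {c ℓ : Level} (R : CommutativeRing c ℓ) (σ : CommutativeRing.Carrier R → CommutativeRing.Carrier R)
            (σ-hom : RingMorphisms.IsRingHomomorphism (CommutativeRing.rawRing R) (CommutativeRing.rawRing R) σ) where
  open CommutativeRing R using (Carrier; _≈_; _+_; _*_; -_; _-_; 0#; 1#; refl; sym; trans; reflexive; setoid; rawRing; ring; +-cong; +-congˡ; +-congʳ; *-cong; *-congˡ; *-congʳ; +-assoc; *-assoc; +-comm; *-comm; +-identityˡ; +-identityʳ; *-identityˡ; *-identityʳ; zeroˡ; zeroʳ; distribˡ; distribʳ; -‿inverseˡ; -‿inverseʳ; -‿cong)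
  open RingProperties ring using (-0#≈0#)
  open Skew R σ σ-hom using (Poly; coeff; add; τ·; mul; act; _≋_; mk; at; ≋-refl; ≋-sym; ≋-trans; ∷-cong; tail≋; coeff-add; coeff-scale; coeff-neg; coeff-σ; add-cong; scale-zero; mul-zeroˡ; mul-oneˡ; mul-shiftʳ; mul-oneʳ; skewRing)
  private
    module σ = RingHom σ-hom
    module S = Ring skewRing using (setoid; +-congˡ; +-congʳ; +-assoc; +-comm; +-identityʳ; distribʳ; -‿inverseˡ)

  infix 4 _<°_ _≤°_
  record _<°_ (u : Poly) (N : ℕ) : Set ℓ where
    constructor below
    field vanish : ∀ n → N ℕ.≤ n → coeff u n ≈ 0#
  open _<°_ public

  _≤°_ : Poly → ℕ → Set ℓ
  u ≤° d = u <° suc d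

  <°-length : ∀ u → u <° length u
  <°-length []      = below λ _ _ → refl
  <°-length (a ∷ u) = below λ { (suc n) (s≤s p) → vanish (<°-length u) n p }

  <°-resp : ∀ {u v N} → u ≋ v → u <° N → v <° N
  <°-resp u≋v p = below λ n N≤n → trans (sym (at u≋v n)) (vanish p n N≤n)

  <°-mono : ∀ {u N M} → N ℕ.≤ M → u <° N → u <° M
  <°-mono N≤M p = below λ n M≤n → vanish p n (ℕ.≤-trans N≤M M≤n)

  <°-add : ∀ {u v N} → u <° N → v <° N → add u v <° N
  <°-add {u} {v} p q = below λ n N≤n → trans (coeff-add u v n) (trans (+-cong (vanish p n N≤n) (vanish q n N≤n)) (+-identityˡ 0#))

  <°-neg : ∀ {u N} → u <° N → map -_ u <° N
  <°-neg {u} p = below λ n N≤n → trans (coeff-neg u n) (trans (-‿cong (vanish p n N≤n)) -0#≈0#)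

  <°-scale : ∀ a {u N} → u <° N → map (a *_) u <° N
  <°-scale a {u} p = below λ n N≤n → trans (coeff-scale a u n) (trans (*-congˡ (vanish p n N≤n)) (zeroʳ a))

  <°-mapσ : ∀ {u N} → u <° N → map σ u <° N
  <°-mapσ {u} p = below λ n N≤n → trans (coeff-σ u n) (trans (σ.⟦⟧-cong (vanish p n N≤n)) σ.0#-homo)

  <°-∷ : ∀ {a u N} → u <° N → a ∷ u <° suc N
  <°-∷ p = below λ { (suc n) (s≤s N≤n) → vanish p n N≤n }

  <°-tail : ∀ {a u N} → a ∷ u <° suc N → u <° N
  <°-tail p = below λ n N≤n → vanish p (suc n) (s≤s N≤n)

  <°0⇒≋[] : ∀ {u} → u <° 0 → u ≋ []
  <°0⇒≋[] p = mk λ n → vanish p n z≤n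

  []-<° : ∀ {N} → [] <° N
  []-<° = below λ _ _ → refl

  τ·-≤° : ∀ {v e} → v ≤° e → τ· v ≤° suc e
  τ·-≤° p = <°-∷ (<°-mapσ p)

  mul-≤° : ∀ {u v d e} → u ≤° d → v ≤° e → mul u v ≤° d ℕ.+ e
  mul-≤° {[]}    {v} {d}     {e} p q = []-<°
  mul-≤° {a ∷ u} {v} {zero}  {e} p q = <°-add (<°-scale a q)
    (<°-resp (≋-sym (mul-zeroˡ u (τ· v) (<°0⇒≋[] (<°-tail {a} p)))) []-<°)
  mul-≤° {a ∷ u} {v} {suc d} {e} p q = <°-add (<°-scale a (<°-mono (s≤s (ℕ.m≤n+m e (suc d))) q))
    (≡.subst (λ k → mul u (τ· v) ≤° k) (ℕ.+-suc d e) (mul-≤° (<°-tail {a} p) (τ·-≤° q)))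

  -- The leading coefficient of `v` is twisted `d` times because τᵈ has to pass over it.
  coeff-mul-lead : ∀ {u v d e} → u ≤° d → v ≤° e →
                   coeff (mul u v) (d ℕ.+ e) ≈ coeff u d * iter σ d (coeff v e)
  coeff-mul-lead {[]}    {v} {d}     {e} p q = sym (zeroˡ _)
  coeff-mul-lead {a ∷ u} {v} {zero}  {e} p q = begin
    coeff (add (map (a *_) v) (mul u (τ· v))) e          ≈⟨ coeff-add (map (a *_) v) _ e ⟩
    coeff (map (a *_) v) e + coeff (mul u (τ· v)) e      ≈⟨ +-cong (coeff-scale a v e) (at (mul-zeroˡ u (τ· v) (<°0⇒≋[] (<°-tail {a} p))) e) ⟩
    a * coeff v e + 0#                                   ≈⟨ +-identityʳ _ ⟩
    a * coeff v e                                        ∎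
    where open SetoidReasoning setoid
  coeff-mul-lead {a ∷ u} {v} {suc d} {e} p q = begin
    coeff (add (map (a *_) v) (mul u (τ· v))) (suc d ℕ.+ e)                  ≈⟨ coeff-add (map (a *_) v) _ (suc d ℕ.+ e) ⟩
    coeff (map (a *_) v) (suc d ℕ.+ e) + coeff (mul u (τ· v)) (suc d ℕ.+ e)  ≈⟨ +-congʳ (vanish (<°-scale a q) (suc d ℕ.+ e) (s≤s (ℕ.m≤n+m e d))) ⟩
    0# + coeff (mul u (τ· v)) (suc d ℕ.+ e)                                  ≈⟨ +-identityˡ _ ⟩
    coeff (mul u (τ· v)) (suc d ℕ.+ e)                                       ≡⟨ ≡.cong (coeff (mul u (τ· v))) (ℕ.+-suc d e) ⟨
    coeff (mul u (τ· v)) (d ℕ.+ suc e)                                       ≈⟨ coeff-mul-lead (<°-tail {a} p) (τ·-≤° q) ⟩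
    coeff u d * iter σ d (coeff (map σ v) e)                                 ≈⟨ *-congˡ (iter-cong d (coeff-σ v e)) ⟩
    coeff u d * iter σ d (σ (coeff v e))                                     ∎
    where
    open SetoidReasoning setoid
    iter-cong : ∀ n {x y} → x ≈ y → iter σ n x ≈ iter σ n y
    iter-cong zero    p = p
    iter-cong (suc n) p = iter-cong n (σ.⟦⟧-cong p)

  coeff₀-mul : ∀ u v → coeff (mul u v) 0 ≈ coeff u 0 * coeff v 0
  coeff₀-mul []      v = sym (zeroˡ _)
  coeff₀-mul (a ∷ u) v = begin
    coeff (add (map (a *_) v) (mul u (τ· v))) 0        ≈⟨ coeff-add (map (a *_) v) _ 0 ⟩
    coeff (map (a *_) v) 0 + coeff (mul u (τ· v)) 0    ≈⟨ +-cong (coeff-scale a v 0) (trans (coeff₀-mul u (τ· v)) (zeroʳ _)) ⟩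
    a * coeff v 0 + 0#                                 ≈⟨ +-identityʳ _ ⟩
    a * coeff v 0                                      ∎
    where open SetoidReasoning setoid

  coeff-mul-const : ∀ u a n → coeff (mul u (a ∷ [])) n ≈ coeff u n * iter σ n a
  coeff-mul-const []      a n       = sym (zeroˡ _)
  coeff-mul-const (b ∷ u) a zero    = coeff₀-mul (b ∷ u) (a ∷ [])
  coeff-mul-const (b ∷ u) a (suc n) =
    trans (coeff-add (map (b *_) (a ∷ [])) (mul u (τ· (a ∷ []))) (suc n)) (trans (+-identityˡ _)
      (trans (at (mul-shiftʳ u (σ a ∷ [])) (suc n)) (coeff-mul-const u (σ a) n)))

  τ^ : ℕ → Poly
  τ^ zero    = 1# ∷ []
  τ^ (suc n) = 0# ∷ τ^ n

  τ^-≤° : ∀ n → τ^ n ≤° n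
  τ^-≤° zero    = <°-length (1# ∷ [])
  τ^-≤° (suc n) = <°-∷ (τ^-≤° n)

  coeff-τ^ : ∀ n → coeff (τ^ n) n ≈ 1#
  coeff-τ^ zero    = refl
  coeff-τ^ (suc n) = coeff-τ^ n

  mul-τ^ : ∀ n v → mul (τ^ n) v ≋ iter τ· n v
  mul-τ^ zero    v = mul-oneˡ v
  mul-τ^ (suc n) v = ≋-trans (add-cong (scale-zero v) ≋-refl) (mul-τ^ n (τ· v))

  mul-τ^ʳ : ∀ n u → mul u (τ^ n) ≋ iter (0# ∷_) n u
  mul-τ^ʳ zero    u = mul-oneʳ u
  mul-τ^ʳ (suc n) u = ≋-trans (mul-shiftʳ u (τ^ n))
    (≋-trans (∷-cong refl (mul-τ^ʳ n u)) (mk λ k → reflexive (≡.cong (λ w → coeff w k) (≡.sym (iter-suc (0# ∷_) n u)))))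

  divide : ∀ {v d w} → v ≤° d → coeff v d * w ≈ 1# → ∀ N f → f <° N →
           ∃[ u ] ∃[ ρ ] f ≋ add (mul u v) ρ × u <° N ℕ.∸ d × ρ <° d
  divide {v} {d} {w} v≤d vw zero f f<N = [] , f , ≋-refl , []-<° , <°-mono {f} z≤n f<N
  divide {v} {d} {w} v≤d vw (suc N) f f<N with suc N ℕ.≤? d
  ... | yes N≤d = [] , f , ≋-refl , []-<° , <°-mono {f} N≤d f<N
  ... | no  N≰d with divide {v} {d} {w} v≤d vw N f′ f′<N
    where
    d≤N = ℕ.s≤s⁻¹ (ℕ.≰⇒> N≰d)
    j = N ℕ.∸ d
    -- Since `iter σ j w` inverts `iter σ j (coeff v d)`, the product (t τʲ) v has the leading
    -- coefficient of `f`, and subtracting it lowers the degree.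
    t = coeff f N * iter σ j w
    g = map (t *_) (τ^ j)
    f′ = add f (map -_ (mul g v))
    g≤j : g ≤° j
    g≤j = <°-scale t (τ^-≤° j)
    j+d≡N : j ℕ.+ d ≡ N
    j+d≡N = ℕ.m∸n+n≡m d≤N

    iter-inverse : ∀ n {x y} → x * y ≈ 1# → iter σ n x * iter σ n y ≈ 1#
    iter-inverse zero    p = p
    iter-inverse (suc n) p = iter-inverse n (trans (sym (σ.*-homo _ _)) (trans (σ.⟦⟧-cong p) σ.1#-homo))

    open SetoidReasoning setoid
    lead : coeff (mul g v) N ≈ coeff f N
    lead = begin
      coeff (mul g v) N                        ≡⟨ ≡.cong (coeff (mul g v)) j+d≡N ⟨
      coeff (mul g v) (j ℕ.+ d)                ≈⟨ coeff-mul-lead g≤j v≤d ⟩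
      coeff g j * iter σ j (coeff v d)         ≈⟨ *-congʳ (trans (coeff-scale t (τ^ j) j) (trans (*-congˡ (coeff-τ^ j)) (*-identityʳ t))) ⟩
      coeff f N * iter σ j w * iter σ j (coeff v d) ≈⟨ *-assoc _ _ _ ⟩
      coeff f N * (iter σ j w * iter σ j (coeff v d)) ≈⟨ *-congˡ (trans (*-comm _ _) (iter-inverse j vw)) ⟩
      coeff f N * 1#                           ≈⟨ *-identityʳ _ ⟩
      coeff f N                                ∎

    gv≤N : mul g v ≤° N
    gv≤N = ≡.subst (λ k → mul g v ≤° k) j+d≡N (mul-≤° g≤j v≤d)

    f′≤N : f′ ≤° N
    f′≤N = <°-add f<N (<°-neg gv≤N)

    f′<N : f′ <° N
    f′<N = below vanish′
      where
      vanish′ : ∀ n → N ℕ.≤ n → coeff f′ n ≈ 0#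
      vanish′ n N≤n with ℕ.m≤n⇒m<n∨m≡n N≤n
      ... | inj₁ N<n    = vanish f′≤N n N<n
      ... | inj₂ ≡.refl = trans (coeff-add f _ N) (trans (+-congˡ (trans (coeff-neg (mul g v) N) (-‿cong lead))) (-‿inverseʳ _))
  ... | u , ρ , f′≋ , u< , ρ<d = add g u , ρ , f≋ , add<  , ρ<d
    where
    d≤N = ℕ.s≤s⁻¹ (ℕ.≰⇒> N≰d)
    j = N ℕ.∸ d
    t = coeff f N * iter σ j w
    g = map (t *_) (τ^ j)
    open SetoidReasoning S.setoid
    f≋ : f ≋ add (mul (add g u) v) ρ
    f≋ = begin
      f                                                    ≈⟨ S.+-identityʳ f ⟨
      add f []                                             ≈⟨ S.+-congˡ {f} (S.-‿inverseˡ (mul g v)) ⟨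
      add f (add (map -_ (mul g v)) (mul g v))             ≈⟨ S.+-assoc f _ _ ⟨
      add (add f (map -_ (mul g v))) (mul g v)             ≈⟨ S.+-congʳ f′≋ ⟩
      add (add (mul u v) ρ) (mul g v)                      ≈⟨ S.+-comm _ (mul g v) ⟩
      add (mul g v) (add (mul u v) ρ)                      ≈⟨ S.+-assoc (mul g v) _ _ ⟨
      add (add (mul g v) (mul u v)) ρ                      ≈⟨ S.+-congʳ (S.distribʳ v g u) ⟨
      add (mul (add g u) v) ρ                              ∎
    add< : add g u <° suc N ℕ.∸ d
    add< = ≡.subst (λ k → add g u <° k) (≡.sym (ℕ.+-∸-assoc 1 d≤N))
      (<°-add (<°-scale t (τ^-≤° j)) (<°-mono {u} (ℕ.n≤1+n j) u<))

  act-cong : ∀ {u v x y} → u ≋ v → x ≈ y → act u x ≈ act v y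
  act-cong {[]}    {[]}    p q = refl
  act-cong {[]}    {b ∷ v} {x} {y} p q = sym (trans (+-cong (*-congʳ (sym (at p 0))) (sym (act-cong {[]} {v} {σ x} {σ y} (mk λ n → at p (suc n)) (σ.⟦⟧-cong q))))
                                  (trans (+-congʳ (zeroˡ _)) (+-identityˡ 0#)))
  act-cong {a ∷ u} {[]}    {x} {y} p q = trans (+-cong (*-congʳ (at p 0)) (act-cong {u} {[]} {σ x} {σ y} (mk λ n → at p (suc n)) (σ.⟦⟧-cong q)))
                                  (trans (+-congʳ (zeroˡ _)) (+-identityˡ 0#))
  act-cong {a ∷ u} {b ∷ v} p q = +-cong (*-cong (at p 0) q) (act-cong {u} {v} (tail≋ p) (σ.⟦⟧-cong q))

  private
    +-medial : ∀ s t u v → s + t + (u + v) ≈ s + u + (t + v)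
    +-medial = solve 4 (λ s t u v → s :+ t :+ (u :+ v) := s :+ u :+ (t :+ v)) refl
      where open ℤ-Solver R

  act-add : ∀ u v x → act (add u v) x ≈ act u x + act v x
  act-add []      v       x = sym (+-identityˡ _)
  act-add (a ∷ u) []      x = sym (+-identityʳ _)
  act-add (a ∷ u) (b ∷ v) x = trans (+-cong (distribʳ _ _ _) (act-add u v (σ x))) (+-medial _ _ _ _)

  act-scale : ∀ a v x → act (map (a *_) v) x ≈ a * act v x
  act-scale a []      x = sym (zeroʳ a)
  act-scale a (b ∷ v) x = trans (+-cong (*-assoc a b x) (act-scale a v (σ x))) (sym (distribˡ _ _ _))

  act-mapσ : ∀ v x → act (map σ v) (σ x) ≈ σ (act v x)
  act-mapσ []      x = sym σ.0#-homo
  act-mapσ (b ∷ v) x = trans (+-cong (sym (σ.*-homo _ _)) (act-mapσ v (σ x))) (sym (σ.+-homo _ _))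

  act-mul : ∀ u v x → act (mul u v) x ≈ act u (act v x)
  act-mul []      v x = refl
  act-mul (a ∷ u) v x = begin
    act (add (map (a *_) v) (mul u (τ· v))) x           ≈⟨ act-add (map (a *_) v) _ x ⟩
    act (map (a *_) v) x + act (mul u (τ· v)) x         ≈⟨ +-cong (act-scale a v x) (act-mul u (τ· v) x) ⟩
    a * act v x + act u (act (τ· v) x)                  ≈⟨ +-congˡ (act-cong (≋-refl {u}) (trans (+-cong (zeroˡ x) (act-mapσ v x)) (+-identityˡ _))) ⟩
    a * act v x + act u (σ (act v x))                   ∎
    where open SetoidReasoning setoid

  act-+ : ∀ u x y → act u (x + y) ≈ act u x + act u y
  act-+ []      x y = sym (+-identityˡ 0#)
  act-+ (a ∷ u) x y = trans (+-cong (distribˡ _ _ _) (trans (act-cong (≋-refl {u}) (σ.+-homo x y)) (act-+ u (σ x) (σ y)))) (+-medial _ _ _ _)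

  act-0 : ∀ u → act u 0# ≈ 0#
  act-0 []      = refl
  act-0 (a ∷ u) = trans (+-cong (zeroʳ a) (trans (act-cong (≋-refl {u}) σ.0#-homo) (act-0 u))) (+-identityˡ 0#)

  act-τ^ : ∀ n x → act (τ^ n) x ≈ iter σ n x
  act-τ^ zero    x = trans (+-identityʳ _) (*-identityˡ x)
  act-τ^ (suc n) x = trans (+-congʳ (zeroˡ x)) (trans (+-identityˡ _) (act-τ^ n (σ x)))

-- Integral domains with decidable equality

record Domain c ℓ : Set (lsuc (c ⊔ ℓ)) where
  field
    commutativeRing : CommutativeRing c ℓ
  open CommutativeRing commutativeRing public using (Carrier; _≈_; _+_; _*_; -_; _-_; 0#; 1#; refl; sym; trans; reflexive; setoid; rawRing; ring; semiring; commutativeSemiring; *-commutativeMonoid; +-commutativeMonoid; isCommutativeRing; isRing; isEquivalence; +-cong; +-congˡ; +-congʳ; *-cong; *-congˡ; *-congʳ; +-assoc; *-assoc; +-comm; *-comm; +-identityˡ; +-identityʳ; *-identityˡ; *-identityʳ; zeroˡ; zeroʳ; distribˡ; distribʳ; -‿inverseˡ; -‿inverseʳ; -‿cong)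
  field
    1≉0          : ¬ 1# ≈ 0#
    zero?        : ∀ x → Dec (x ≈ 0#)
    zero-product : ∀ x y → x * y ≈ 0# → x ≈ 0# ⊎ y ≈ 0#

  open RingProperties ring public
    using (-0#≈0#; -‿distribˡ-*; -‿distribʳ-*; -‿involutive; -‿+-comm; x+x≈x⇒x≈0)
  open Exp commutativeSemiring public
    using (_^_; ^-congˡ; ^-cong; ^-congʳ; ^-homo-*; ^-assocʳ; ^-distrib-*)
  module Solver = ℤ-Solver commutativeRing

  nonzero-product : ∀ {x y} → ¬ x ≈ 0# → ¬ y ≈ 0# → ¬ x * y ≈ 0#
  nonzero-product {x} {y} x≉0 y≉0 xy≈0 with zero-product x y xy≈0
  ... | inj₁ x≈0 = x≉0 x≈0
  ... | inj₂ y≈0 = y≉0 y≈0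

  difference-zero : ∀ {x y} → x - y ≈ 0# → x ≈ y
  difference-zero {x} {y} p = begin
    x                ≈⟨ solve 2 (λ x y → x := x :- y :+ y) refl x y ⟩
    x - y + y        ≈⟨ +-congʳ p ⟩
    0# + y           ≈⟨ +-identityˡ y ⟩
    y                ∎
    where open SetoidReasoning setoid
          open Solver

  zero-difference : ∀ {x y} → x ≈ y → x - y ≈ 0#
  zero-difference {x} {y} p = trans (+-congʳ p) (-‿inverseʳ y)

  *-cancelˡ : ∀ {x y z} → ¬ x ≈ 0# → x * y ≈ x * z → y ≈ z
  *-cancelˡ {x} {y} {z} x≉0 p with zero-product x (y - z) (begin
      x * (y - z)      ≈⟨ solve 3 (λ x y z → x :* (y :- z) := x :* y :- x :* z) refl x y z ⟩
      x * y - x * z    ≈⟨ zero-difference p ⟩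
      0#               ∎)
    where open SetoidReasoning setoid
          open Solver
  ... | inj₁ x≈0 = contradiction x≈0 x≉0
  ... | inj₂ q   = difference-zero q

  ^-nonzero : ∀ {x} n → ¬ x ≈ 0# → ¬ x ^ n ≈ 0#
  ^-nonzero zero    x≉0 = 1≉0
  ^-nonzero (suc n) x≉0 = nonzero-product x≉0 (^-nonzero n x≉0)

field⇒domain : Field c ℓ → Domain c ℓ
field⇒domain F = record
  { commutativeRing = commutativeRing
  ; 1≉0 = 1≉0
  ; zero? = zero?
  ; zero-product = λ x y xy≈0 → case-inverse x y xy≈0 (inverse x) }
  where
  open Field F
  zero? : ∀ x → Dec (x ≈ 0#)
  zero? x with inverse x
  ... | inj₁ x≈0      = yes x≈0
  ... | inj₂ (y , xy) = no λ x≈0 → 1≉0 (trans (sym xy) (trans (*-congʳ x≈0) (zeroˡ y)))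
  case-inverse : ∀ x y → x * y ≈ 0# → x ≈ 0# ⊎ (∃[ z ] x * z ≈ 1#) → x ≈ 0# ⊎ y ≈ 0#
  case-inverse x y xy≈0 (inj₁ x≈0)      = inj₁ x≈0
  case-inverse x y xy≈0 (inj₂ (z , xz)) = inj₂ (begin
    y              ≈⟨ *-identityˡ y ⟨
    1# * y         ≈⟨ *-congʳ xz ⟨
    x * z * y      ≈⟨ *-congʳ (*-comm x z) ⟩
    z * x * y      ≈⟨ *-assoc z x y ⟩
    z * (x * y)    ≈⟨ *-congˡ xy≈0 ⟩
    z * 0#         ≈⟨ zeroʳ z ⟩
    0#             ∎)
    where open SetoidReasoning setoid

module SkewDomain {c ℓ : Level} (D : Domain c ℓ) (σ : Domain.Carrier D → Domain.Carrier D)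
            (σ-hom : RingMorphisms.IsRingHomomorphism (Domain.rawRing D) (Domain.rawRing D) σ)
            (σ-injective₀ : ∀ x → Domain._≈_ D (σ x) (Domain.0# D) → Domain._≈_ D x (Domain.0# D)) where
  open Domain D using (commutativeRing; zero?; Carrier; _≈_; _+_; 0#; sym; trans; rawRing; nonzero-product)
  open Skew commutativeRing σ σ-hom using (coeff; mul; _≋_; mk; at; ≋-refl)
  open SkewDegree commutativeRing σ σ-hom using (below; _≤°_; <°-∷; coeff-mul-lead)

  degree? : ∀ u → u ≋ [] ⊎ (∃[ d ] u ≤° d × ¬ coeff u d ≈ 0#)
  degree? []      = inj₁ ≋-refl
  degree? (a ∷ u) with degree? u
  ... | inj₂ (d , u≤d , ud≉0) = inj₂ (suc d , <°-∷ u≤d , ud≉0)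
  ... | inj₁ u≋0 with zero? a
  ...   | yes a≈0 = inj₁ (mk λ { zero → a≈0 ; (suc n) → at u≋0 n })
  ...   | no  a≉0 = inj₂ (0 , below (λ { (suc n) _ → at u≋0 n }) , a≉0)

  zero-poly? : ∀ u → Dec (u ≋ [])
  zero-poly? u with degree? u
  ... | inj₁ u≋0            = yes u≋0
  ... | inj₂ (d , _ , ud≉0) = no λ u≋0 → ud≉0 (at u≋0 d)

  iter-nonzero : ∀ n {x} → ¬ x ≈ 0# → ¬ iter σ n x ≈ 0#
  iter-nonzero zero    p = p
  iter-nonzero (suc n) p = iter-nonzero n (p ∘ σ-injective₀ _)

  lead-nonzero : ∀ {u v d e} → u ≤° d → v ≤° e → ¬ coeff u d ≈ 0# → ¬ coeff v e ≈ 0# →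
                 ¬ coeff (mul u v) (d ℕ.+ e) ≈ 0#
  lead-nonzero {u} {v} {d} {e} p q ud ve r =
    nonzero-product ud (iter-nonzero d ve) (trans (sym (coeff-mul-lead {u} {v} p q)) r)

  mul-zero-product : ∀ u v → mul u v ≋ [] → u ≋ [] ⊎ v ≋ []
  mul-zero-product u v uv≋0 with degree? u | degree? v
  ... | inj₁ u≋0 | _ = inj₁ u≋0
  ... | _ | inj₁ v≋0 = inj₂ v≋0
  ... | inj₂ (d , p , ud) | inj₂ (e , q , ve) =
    contradiction (at uv≋0 (d ℕ.+ e)) (lead-nonzero {u} {v} p q ud ve)

module PolyDomain (D : Domain c ℓ) where
  open Domain D using (commutativeRing; 1≉0; zero?; zero-product; _≈_; 0#)
  open Poly commutativeRing using (id-isRingHomomorphism; Poly; coeff; mul; mk; at; polyRing≋; polyRing)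
  open SkewDomain D id id-isRingHomomorphism (λ _ p → p) using (zero-poly?; mul-zero-product)

  polyDomain≋ : Domain c ℓ
  polyDomain≋ = record
    { commutativeRing = polyRing≋
    ; 1≉0 = λ p → 1≉0 (at p 0)
    ; zero? = zero-poly?
    ; zero-product = mul-zero-product }

  polyDomain : Domain c ℓ
  polyDomain = record
    { commutativeRing = polyRing
    ; 1≉0 = λ p → 1≉0 (p 0)
    ; zero? = zero?′
    ; zero-product = zero-product′ }
    where
    zero?′ : ∀ u → Dec (∀ n → coeff u n ≈ 0#)
    zero?′ u with zero-poly? u
    ... | yes p = yes (at p)
    ... | no ¬p = no λ p → ¬p (mk p)
    zero-product′ : ∀ u v → (∀ n → coeff (mul u v) n ≈ 0#) → (∀ n → coeff u n ≈ 0#) ⊎ (∀ n → coeff v n ≈ 0#)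
    zero-product′ u v p with mul-zero-product u v (mk p)
    ... | inj₁ q = inj₁ (at q)
    ... | inj₂ q = inj₂ (at q)

-- Finite domains

module FiniteDomain {c ℓ : Level} (D : Domain c ℓ) {N : ℕ} (card : Inverse (Domain.setoid D) (≡.setoid (Fin N))) where
  open Domain D using (1≉0; zero?; Carrier; _≈_; _+_; _*_; -_; _-_; 0#; 1#; refl; sym; trans; setoid; semiring; *-commutativeMonoid; +-commutativeMonoid; +-cong; +-congˡ; +-congʳ; *-cong; *-congˡ; *-congʳ; *-assoc; *-comm; +-identityʳ; *-identityˡ; *-identityʳ; zeroˡ; zeroʳ; distribˡ; _^_; ^-homo-*; module Solver; nonzero-product; zero-difference; *-cancelˡ; ^-nonzero)
  open Inverse card
  module ∏ = Sum *-commutativeMonoid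
  module ∑ = Sum +-commutativeMonoid
  open SetoidReasoning setoid

  -- Two of the N + 1 powers x⁰, ..., xᴺ coincide; cancelling the lower one leaves x · xᵉ = 1.
  finite-inverse : ∀ x → ¬ x ≈ 0# → ∃[ y ] x * y ≈ 1#
  finite-inverse x x≉0 with Fin.pigeonhole (ℕ.n<1+n N) (λ i → to (x ^ Fin.toℕ i))
  ... | i , j , i<j , eq = x ^ e , sym (*-cancelˡ (^-nonzero (Fin.toℕ i) x≉0) (begin
      x ^ Fin.toℕ i * 1#          ≈⟨ *-identityʳ _ ⟩
      x ^ Fin.toℕ i               ≈⟨ strictlyInverseʳ _ ⟨
      from (to (x ^ Fin.toℕ i))   ≈⟨ from-cong eq ⟩
      from (to (x ^ Fin.toℕ j))   ≈⟨ strictlyInverseʳ _ ⟩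
      x ^ Fin.toℕ j               ≡⟨ ≡.cong (x ^_) j≡ ⟨
      x ^ (Fin.toℕ i ℕ.+ suc e)   ≈⟨ ^-homo-* x (Fin.toℕ i) (suc e) ⟩
      x ^ Fin.toℕ i * (x * x ^ e) ∎))
    where
    e = Fin.toℕ j ℕ.∸ suc (Fin.toℕ i)
    j≡ : Fin.toℕ i ℕ.+ suc e ≡ Fin.toℕ j
    j≡ = ≡.trans (ℕ.+-suc (Fin.toℕ i) e) (ℕ.m+[n∸m]≡n i<j)

  permutation : (f g : Carrier → Carrier) → (∀ {x y} → x ≈ y → f x ≈ f y) → (∀ {x y} → x ≈ y → g x ≈ g y) →
                (∀ x → f (g x) ≈ x) → (∀ x → g (f x) ≈ x) → Perm.Permutation N N
  permutation f g f-cong g-cong fg gf = Perm.permutation (λ i → to (f (from i))) (λ i → to (g (from i)))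
    (λ i → ≡.trans (to-cong (trans (f-cong (strictlyInverseʳ _)) (fg _))) (strictlyInverseˡ i))
    (λ i → ≡.trans (to-cong (trans (g-cong (strictlyInverseʳ _)) (gf _))) (strictlyInverseˡ i))

  private
    module _ (x : Carrier) where
      select : Carrier → Carrier → Carrier → Carrier
      select u a b with zero? u
      ... | yes _ = a
      ... | no  _ = b

      select-zero : ∀ {u a b} → u ≈ 0# → select u a b ≈ a
      select-zero {u} u≈0 with zero? u
      ... | yes _  = refl
      ... | no u≉0 = contradiction u≈0 u≉0

      select-nonzero : ∀ {u a b} → ¬ u ≈ 0# → select u a b ≈ b
      select-nonzero {u} u≉0 with zero? u
      ... | yes u≈0 = contradiction u≈0 u≉0
      ... | no _    = refl

  -- Multiplication by x permutes the nonzero elements, so the product of N - 1 copies of x is 1.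
  -- The products run over all N elements: at zero `f` and `g` are set to 1, and the factor x left
  -- out there is carried by `h`.
  fermat-unit : ∀ x y → ¬ x ≈ 0# → x * y ≈ 1# → x ^ N ≈ x
  fermat-unit x y x≉0 xy≈1 = begin
    x ^ N                       ≈⟨ ∏.sum-replicate N ⟨
    ∏.sum {N} (λ _ → x)         ≈⟨ ∏.sum-cong-≋ gh ⟨
    ∏.sum (λ i → g i * h i)     ≈⟨ ∏.∑-distrib-+ g h ⟩
    ∏.sum g * ∏.sum h           ≈⟨ *-cong ∏g (∏h N h (to 0#) h-zero h-else) ⟩
    1# * x                      ≈⟨ *-identityˡ x ⟩
    x                           ∎
    where
    f g h : Fin N → Carrier
    f i = select x (from i) 1# (from i)
    g i = select x (from i) 1# x
    h i = select x (from i) x 1#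

    yx : ∀ z → y * (x * z) ≈ z
    yx z = trans (sym (*-assoc y x z)) (trans (*-congʳ (trans (*-comm y x) xy≈1)) (*-identityˡ z))
    xy : ∀ z → x * (y * z) ≈ z
    xy z = trans (sym (*-assoc x y z)) (trans (*-congʳ xy≈1) (*-identityˡ z))

    π = permutation (x *_) (y *_) *-congˡ *-congˡ xy yx

    gh : ∀ i → g i * h i ≈ x
    gh i with zero? (from i)
    ... | yes _ = *-identityˡ x
    ... | no  _ = *-identityʳ x

    gf : ∀ i → g i * f i ≈ f (π Perm.⟨$⟩ʳ i)
    gf i with zero? (from i)
    ... | yes p = trans (*-identityˡ 1#) (sym (select-zero x (trans (strictlyInverseʳ _) (trans (*-congˡ p) (zeroʳ x)))))
    ... | no ¬p = sym (trans (select-nonzero x λ p → nonzero-product x≉0 ¬p (trans (sym (strictlyInverseʳ _)) p)) (strictlyInverseʳ _))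

    f≉0 : ∀ i → ¬ f i ≈ 0#
    f≉0 i with zero? (from i)
    ... | yes _ = 1≉0
    ... | no ¬p = ¬p

    ∏≉0 : ∀ M (t : Fin M → Carrier) → (∀ i → ¬ t i ≈ 0#) → ¬ ∏.sum t ≈ 0#
    ∏≉0 zero    t p = 1≉0
    ∏≉0 (suc M) t p = nonzero-product (p zero) (∏≉0 M (t ∘ suc) (p ∘ suc))

    ∏g : ∏.sum g ≈ 1#
    ∏g = *-cancelˡ (∏≉0 N f f≉0) (begin
      ∏.sum f * ∏.sum g              ≈⟨ *-comm _ _ ⟩
      ∏.sum g * ∏.sum f              ≈⟨ ∏.∑-distrib-+ g f ⟨
      ∏.sum (λ i → g i * f i)        ≈⟨ ∏.sum-cong-≋ gf ⟩
      ∏.sum (f ∘ (π Perm.⟨$⟩ʳ_))     ≈⟨ ∏.sum-permute f π ⟨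
      ∏.sum f                        ≈⟨ *-identityʳ _ ⟨
      ∏.sum f * 1#                   ∎)

    h-zero : h (to 0#) ≈ x
    h-zero = select-zero x (strictlyInverseʳ 0#)

    h-else : ∀ i → ¬ i ≡ to 0# → h i ≈ 1#
    h-else i i≢ = select-nonzero x λ p → i≢ (≡.trans (≡.sym (strictlyInverseˡ i)) (to-cong p))

    ∏h : ∀ M (t : Fin M → Carrier) i → t i ≈ x → (∀ j → ¬ j ≡ i → t j ≈ 1#) → ∏.sum t ≈ x
    ∏h (suc M) t i ti tj = begin
      ∏.sum t                       ≈⟨ ∏.sum-remove t ⟩
      t i * ∏.sum (removeAt t i)    ≈⟨ *-cong ti (∏.sum-cong-≋ λ j → tj (Fin.punchIn i j) (Fin.punchInᵢ≢i i j)) ⟩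
      x * ∏.sum {M} (λ _ → 1#)      ≈⟨ *-congˡ (∏.sum-replicate-zero M) ⟩
      x * 1#                        ≈⟨ *-identityʳ x ⟩
      x                             ∎

  fermat : ∀ x → x ^ N ≈ x
  fermat x = split (zero? x)
    where
    zero-case : ∀ M → Fin M → x ≈ 0# → x ^ M ≈ x
    zero-case (suc M) _ x≈0 = trans (*-congʳ x≈0) (trans (zeroˡ _) (sym x≈0))
    split : Dec (x ≈ 0#) → x ^ N ≈ x
    split (yes x≈0) = zero-case N (to 0#) x≈0
    split (no  x≉0) = let y , xy≈1 = finite-inverse x x≉0 in fermat-unit x y x≉0 xy≈1

  open import Algebra.Properties.Semiring.Mult semiring using () renaming (_×_ to _·_; ×1-homo-* to ·1-homo-*; ×-homo-+ to ·-homo-+)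

  -- Translation by 1 permutes the elements, so their sum S satisfies S = S + N · 1.
  characteristic : N · 1# ≈ 0#
  characteristic = begin
    N · 1#                       ≈⟨ ∑.sum-replicate N ⟨
    ∑.sum {N} (λ _ → 1#)         ≈⟨ solve 2 (λ s t → s := t :+ s :- t) refl _ (∑.sum from) ⟩
    ∑.sum from + ∑.sum {N} (λ _ → 1#) - ∑.sum from ≈⟨ zero-difference total ⟩
    0#                           ∎
    where
    open Solver
    π = permutation (_+ 1#) (_- 1#) +-congʳ +-congʳ
      (λ x → solve 1 (λ x → x :- con ℤ.1ℤ :+ con ℤ.1ℤ := x) refl x)
      (λ x → solve 1 (λ x → x :+ con ℤ.1ℤ :- con ℤ.1ℤ := x) refl x)
    total : ∑.sum from + ∑.sum {N} (λ _ → 1#) ≈ ∑.sum from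
    total = begin
      ∑.sum from + ∑.sum {N} (λ _ → 1#)         ≈⟨ ∑.∑-distrib-+ from (λ _ → 1#) ⟨
      ∑.sum (λ i → from i + 1#)                 ≈⟨ ∑.sum-cong-≋ (λ i → sym (strictlyInverseʳ (from i + 1#))) ⟩
      ∑.sum (λ i → from (π Perm.⟨$⟩ʳ i))        ≈⟨ ∑.sum-permute from π ⟨
      ∑.sum from                                ∎

  -- If 2 vanished, N · 1 = 1 + h · 2 would be 1, against `characteristic`.
  odd⇒2≉0 : ∀ h → N ≡ suc (h ℕ.+ h) → ¬ 1# + 1# ≈ 0#
  odd⇒2≉0 h ≡.refl 2≈0 = 1≉0 (begin
    1#                           ≈⟨ +-identityʳ 1# ⟨
    1# + 0#                      ≈⟨ +-congˡ even ⟨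
    1# + (h ℕ.+ h) · 1#          ≈⟨ characteristic ⟩
    0#                           ∎)
    where
    even : (h ℕ.+ h) · 1# ≈ 0#
    even = begin
      (h ℕ.+ h) · 1#                 ≈⟨ ·-homo-+ 1# h h ⟩
      h · 1# + h · 1#                ≈⟨ +-cong (*-identityʳ _) (*-identityʳ _) ⟨
      h · 1# * 1# + h · 1# * 1#      ≈⟨ distribˡ _ _ _ ⟨
      h · 1# * (1# + 1#)             ≈⟨ *-congˡ 2≈0 ⟩
      h · 1# * 0#                    ≈⟨ zeroʳ _ ⟩
      0#                             ∎

-- Evaluation of polynomials

module Eval {c ℓ : Level} (R : CommutativeRing c ℓ) where
  open CommutativeRing R using (_≈_; _+_; _*_; -_; _-_; 0#; 1#; refl; sym; trans; setoid; ring; semiring; +-cong; +-congˡ; *-congˡ; +-identityˡ; +-identityʳ; zeroˡ; zeroʳ)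
  open Poly R using (id-isRingHomomorphism; Poly; coeff; add; mul; _≋_; mk; at; ≋-sym; tail≋; eval; mul-∷)
  open SkewDegree R id id-isRingHomomorphism using (_<°_; <°-tail; <°0⇒≋[]; τ^)
  open RingProperties ring using (-0#≈0#; -‿distribʳ-*; -‿+-comm)
  open SetoidReasoning setoid
  private module S = ℤ-Solver R

  eval-[] : ∀ u x → u ≋ [] → eval u x ≈ 0#
  eval-[] []      x p = refl
  eval-[] (a ∷ u) x p = trans (+-cong (at p 0) (trans (*-congˡ (eval-[] u x (mk λ n → at p (suc n)))) (zeroʳ x))) (+-identityˡ 0#)

  eval-cong : ∀ {u v} x → u ≋ v → eval u x ≈ eval v x
  eval-cong {[]}    {v}     x p = sym (eval-[] v x (≋-sym p))
  eval-cong {a ∷ u} {[]}    x p = eval-[] (a ∷ u) x p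
  eval-cong {a ∷ u} {b ∷ v} x p = +-cong (at p 0) (*-congˡ (eval-cong {u} {v} x (tail≋ p)))

  eval-add : ∀ u v x → eval (add u v) x ≈ eval u x + eval v x
  eval-add []      v       x = sym (+-identityˡ _)
  eval-add (a ∷ u) []      x = sym (+-identityʳ _)
  eval-add (a ∷ u) (b ∷ v) x = trans (+-congˡ (*-congˡ (eval-add u v x)))
    (S.solve 5 (λ a b x u v → a S.:+ b S.:+ x S.:* (u S.:+ v) S.:= a S.:+ x S.:* u S.:+ (b S.:+ x S.:* v)) refl a b x (eval u x) (eval v x))

  eval-scale : ∀ a v x → eval (map (a *_) v) x ≈ a * eval v x
  eval-scale a []      x = sym (zeroʳ a)
  eval-scale a (b ∷ v) x = trans (+-congˡ (*-congˡ (eval-scale a v x)))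
    (S.solve 4 (λ a b x v → a S.:* b S.:+ x S.:* (a S.:* v) S.:= a S.:* (b S.:+ x S.:* v)) refl a b x (eval v x))

  eval-neg : ∀ v x → eval (map -_ v) x ≈ - eval v x
  eval-neg []      x = sym -0#≈0#
  eval-neg (b ∷ v) x = trans (+-congˡ (*-congˡ (eval-neg v x)))
    (S.solve 3 (λ b x v → S.:- b S.:+ x S.:* (S.:- v) S.:= S.:- (b S.:+ x S.:* v)) refl b x (eval v x))

  eval-mul : ∀ u v x → eval (mul u v) x ≈ eval u x * eval v x
  eval-mul []      v x = sym (zeroˡ _)
  eval-mul (a ∷ u) v x = begin
    eval (mul (a ∷ u) v) x                          ≈⟨ eval-cong x (mul-∷ a u v) ⟩
    eval (add (map (a *_) v) (0# ∷ mul u v)) x      ≈⟨ eval-add (map (a *_) v) _ x ⟩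
    eval (map (a *_) v) x + (0# + x * eval (mul u v) x)
      ≈⟨ +-cong (eval-scale a v x) (trans (+-identityˡ _) (*-congˡ (eval-mul u v x))) ⟩
    a * eval v x + x * (eval u x * eval v x)
      ≈⟨ S.solve 4 (λ a x u v → a S.:* v S.:+ x S.:* (u S.:* v) S.:= (a S.:+ x S.:* u) S.:* v) refl a x (eval u x) (eval v x) ⟩
    (a + x * eval u x) * eval v x                   ∎

  eval-<°1 : ∀ u x → u <° 1 → eval u x ≈ coeff u 0
  eval-<°1 []      x p = refl
  eval-<°1 (a ∷ u) x p = trans (+-congˡ (trans (*-congˡ (eval-[] u x (<°0⇒≋[] (<°-tail {a} p)))) (zeroʳ x))) (+-identityʳ a)

  open import Algebra.Properties.Semiring.Exp semiring using (_^_)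

  eval-τ^ : ∀ n x → eval (τ^ n) x ≈ x ^ n
  eval-τ^ zero    x = trans (+-congˡ (zeroʳ x)) (+-identityʳ 1#)
  eval-τ^ (suc n) x = trans (+-identityˡ _) (*-congˡ (eval-τ^ n x))

module Roots {c ℓ : Level} (D : Domain c ℓ) where
  open Domain D using (commutativeRing; zero-product; Carrier; _≈_; _+_; _*_; -_; _-_; 0#; 1#; refl; sym; trans; setoid; *-commutativeMonoid; +-cong; +-congˡ; +-congʳ; *-congˡ; +-comm; *-comm; +-identityˡ; +-identityʳ; *-identityˡ; *-identityʳ; zeroʳ; -‿inverseʳ; module Solver; difference-zero)
  open Poly commutativeRing using (id-isRingHomomorphism; Poly; coeff; add; mul; at; coeff-add; eval)
  open SkewDegree commutativeRing id id-isRingHomomorphism using (vanish; _≤°_; <°-length; coeff-mul-lead; divide)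
  open Eval commutativeRing using (eval-cong; eval-add; eval-mul; eval-<°1)
  open SetoidReasoning setoid
  open Sum *-commutativeMonoid using () renaming (sum to ∏)

  -- The root `r zero` is split off by division. The other roots differ from it, so in a domain they
  -- remain roots of the quotient.
  product-of-roots : ∀ N f (r : Fin N → Carrier) → f ≤° N → coeff f N ≈ 1# → (∀ i → eval f (r i) ≈ 0#) →
                     (∀ i j → r i ≈ r j → i ≡ j) → ∀ x → eval f x ≈ ∏ (λ i → x - r i)
  product-of-roots zero    f r f≤ lead f-root r-injective x = trans (eval-<°1 f x f≤) lead
  product-of-roots (suc N) f r f≤ lead f-root r-injective x
    with divide {v = - r zero ∷ 1# ∷ []} {1} {1#} (<°-length _) (*-identityˡ 1#) (suc (suc N)) f f≤
  ... | u , ρ , f≋ , u≤ , ρ<1 = begin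
    eval f x                              ≈⟨ f-at x ⟩
    eval u x * (x - r zero) + coeff ρ 0   ≈⟨ trans (+-congˡ ρ₀) (+-identityʳ _) ⟩
    eval u x * (x - r zero)               ≈⟨ *-comm _ _ ⟩
    (x - r zero) * eval u x               ≈⟨ *-congˡ (product-of-roots N u (r ∘ suc) u≤ u-lead u-root
                                               (λ i j p → Fin.suc-injective (r-injective (suc i) (suc j) p)) x) ⟩
    (x - r zero) * ∏ (λ i → x - r (suc i)) ∎
    where
    v = - r zero ∷ 1# ∷ []
    f-at : ∀ x → eval f x ≈ eval u x * (x - r zero) + coeff ρ 0
    f-at x = begin
      eval f x                                ≈⟨ eval-cong x f≋ ⟩
      eval (add (mul u v) ρ) x                ≈⟨ eval-add (mul u v) ρ x ⟩
      eval (mul u v) x + eval ρ x             ≈⟨ +-cong (eval-mul u v x) (eval-<°1 ρ x ρ<1) ⟩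
      eval u x * eval v x + coeff ρ 0         ≈⟨ +-congʳ (*-congˡ (solve 2 (λ r x → :- r :+ x :* (con ℤ.1ℤ :+ x :* con ℤ.0ℤ) := x :- r) refl (r zero) x)) ⟩
      eval u x * (x - r zero) + coeff ρ 0     ∎
      where open Solver
    ρ₀ : coeff ρ 0 ≈ 0#
    ρ₀ = begin
      coeff ρ 0                                              ≈⟨ +-identityˡ _ ⟨
      0# + coeff ρ 0                                         ≈⟨ +-congʳ (trans (*-congˡ (-‿inverseʳ _)) (zeroʳ _)) ⟨
      eval u (r zero) * (r zero - r zero) + coeff ρ 0        ≈⟨ f-at (r zero) ⟨
      eval f (r zero)                                        ≈⟨ f-root zero ⟩
      0#                                                     ∎
    u-lead : coeff u N ≈ 1#
    u-lead = begin
      coeff u N                                   ≈⟨ *-identityʳ _ ⟨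
      coeff u N * 1#                              ≡⟨ ≡.cong (coeff u N *_) (iter-id N 1#) ⟨
      coeff u N * iter id N (coeff v 1)           ≈⟨ coeff-mul-lead {u} {v} {N} {1} u≤ (<°-length v) ⟨
      coeff (mul u v) (N ℕ.+ 1)                   ≡⟨ ≡.cong (coeff (mul u v)) (ℕ.+-comm N 1) ⟩
      coeff (mul u v) (suc N)                     ≈⟨ +-identityʳ _ ⟨
      coeff (mul u v) (suc N) + 0#                ≈⟨ +-congˡ (vanish ρ<1 (suc N) (s≤s z≤n)) ⟨
      coeff (mul u v) (suc N) + coeff ρ (suc N)   ≈⟨ coeff-add (mul u v) ρ (suc N) ⟨
      coeff (add (mul u v) ρ) (suc N)             ≈⟨ at f≋ (suc N) ⟨
      coeff f (suc N)                             ≈⟨ lead ⟩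
      1#                                          ∎
      where
      iter-id : ∀ n x → iter {A = Carrier} id n x ≡ x
      iter-id zero    x = ≡.refl
      iter-id (suc n) x = iter-id n x
    u-root : ∀ i → eval u (r (suc i)) ≈ 0#
    u-root i = [ id , (λ p → contradiction (r-injective (suc i) zero (difference-zero p)) λ ()) ]′
      (zero-product (eval u (r (suc i))) (r (suc i) - r zero)
        (trans (sym (trans (f-at _) (trans (+-congˡ ρ₀) (+-identityʳ _)))) (f-root (suc i))))

field-hom-injective : (F : Field c ℓ) (D : Domain c′ ℓ′) (f : Field.Carrier F → Domain.Carrier D) →
                      RingMorphisms.IsRingHomomorphism (Field.rawRing F) (Domain.rawRing D) f →
                      ∀ {a b} → Domain._≈_ D (f a) (f b) → Field._≈_ F a b
field-hom-injective F D f f-hom {a} {b} p =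
  [ Domain.difference-zero (field⇒domain F) , (λ { (z , abz) → contradiction (one≈0 z abz) 1≉0 }) ]′ (F.inverse (a F.- b))
  where
  module F = Field F
  module f = RingHom f-hom
  open Domain D using (1≉0; _≈_; _+_; _*_; -_; _-_; 0#; 1#; trans; setoid; +-cong; *-congʳ; zeroˡ; -‿inverseʳ; difference-zero)
  open SetoidReasoning setoid
  one≈0 : ∀ z → (a F.- b) F.* z F.≈ F.1# → 1# ≈ 0#
  one≈0 z abz = begin
    1#                        ≈⟨ f.1#-homo ⟨
    f F.1#                    ≈⟨ f.⟦⟧-cong abz ⟨
    f ((a F.- b) F.* z)       ≈⟨ trans (f.*-homo _ _) (*-congʳ (f.+-homo _ _)) ⟩
    (f a + f (F.- b)) * f z   ≈⟨ *-congʳ (+-cong p (f.-‿homo b)) ⟩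
    (f b - f b) * f z         ≈⟨ trans (*-congʳ (-‿inverseʳ _)) (zeroˡ _) ⟩
    0#                        ∎

-- The Frobenius endomorphism of a domain containing k.  Additivity comes from
-- xᵠ - yᵠ⁻¹ x = ∏ (x - c y) over c ∈ k, whose right-hand side does not change
-- when x is replaced by x + y.

module Frobenius {c ℓ c′ ℓ′ : Level} {q : ℕ} (k : FiniteField c ℓ q) (D : Domain c′ ℓ′) (ι : FiniteField.Carrier k → Domain.Carrier D)
                 (ι-hom : RingMorphisms.IsRingHomomorphism (FiniteField.rawRing k) (Domain.rawRing D) ι) where
  private
    module k where
      open Domain (field⇒domain (FiniteField.asField k)) public using (1≉0; _≈_; _+_; -_; _-_; 0#; 1#; refl; sym; trans; +-congʳ; _^_; module Solver)
      open FiniteField k public using (inverse; cardinality)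
      open FiniteDomain (field⇒domain (FiniteField.asField k)) cardinality public using (permutation; fermat)
      open Inverse cardinality public using (to; from; to-cong; from-cong; strictlyInverseˡ; strictlyInverseʳ)
    module ι = RingHom ι-hom
  open Domain D using (commutativeRing; 1≉0; zero?; zero-product; Carrier; _≈_; _+_; _*_; -_; _-_; 0#; 1#; refl; sym; trans; setoid; rawRing; *-commutativeMonoid; +-cong; +-congˡ; +-congʳ; *-cong; *-congˡ; *-congʳ; *-comm; +-identityˡ; +-identityʳ; *-identityˡ; *-identityʳ; zeroˡ; -‿inverseˡ; -‿cong; _^_; ^-congˡ; ^-congʳ; ^-assocʳ; ^-distrib-*; module Solver; difference-zero; zero-difference; *-cancelˡ; ^-nonzero)
  open Poly commutativeRing using (id-isRingHomomorphism; Poly; coeff; add; coeff-add; eval)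
  open SkewDegree commutativeRing id id-isRingHomomorphism using (vanish; _≤°_; <°-mono; <°-add; <°-neg; <°-scale; τ^; τ^-≤°; coeff-τ^)
  open Eval commutativeRing using (eval-add; eval-scale; eval-neg; eval-τ^)
  open Roots D using (product-of-roots)
  open SetoidReasoning setoid
  private module ∏ = Sum *-commutativeMonoid

  ι-injective : ∀ {a b} → ι a ≈ ι b → a k.≈ b
  ι-injective = field-hom-injective (FiniteField.asField k) D ι ι-hom

  ι-^ : ∀ a n → ι (a k.^ n) ≈ ι a ^ n
  ι-^ a zero    = ι.1#-homo
  ι-^ a (suc n) = trans (ι.*-homo _ _) (*-congˡ (ι-^ a n))

  ι-fixed : ∀ a → ι a ^ q ≈ ι a
  ι-fixed a = trans (sym (ι-^ a q)) (ι.⟦⟧-cong (k.fermat a))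

  private
    large : ∀ {Q} → Q ≡ q → 2 ℕ.≤ Q
    large {0} ≡.refl with () ← k.to k.0#
    large {1} ≡.refl = contradiction
      (k.trans (k.sym (k.strictlyInverseʳ k.1#)) (k.trans (k.from-cong (Fin-1 _ _)) (k.strictlyInverseʳ k.0#))) k.1≉0
      where
      Fin-1 : (i j : Fin 1) → i ≡ j
      Fin-1 zero zero = ≡.refl
    large {suc (suc Q)} _ = s≤s (s≤s z≤n)

  2≤q : 2 ℕ.≤ q
  2≤q = large ≡.refl

  private
    e = ℕ.pred q
    1+e≡q : suc e ≡ q
    1+e≡q = ℕ.suc-pred q {{ℕ.>-nonZero (ℕ.≤-trans (s≤s z≤n) 2≤q)}}

  ^q≈ : ∀ x → x ^ q ≈ x * x ^ e
  ^q≈ x = ^-congʳ x (≡.sym 1+e≡q)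

  linear : Carrier → Carrier → Fin q → Carrier
  linear x y i = x - ι (k.from i) * y

  linear-product : ∀ x y → ¬ y ≈ 0# → x ^ q - y ^ e * x ≈ ∏.sum (linear x y)
  linear-product x y y≉0 = trans (sym (eval-f x))
    (product-of-roots q f (λ i → ι (k.from i) * y) f≤ lead root
      (λ i j p → ≡.trans (≡.sym (k.strictlyInverseˡ i)) (≡.trans (k.to-cong (ι-injective
        (*-cancelˡ y≉0 (trans (*-comm _ _) (trans p (*-comm _ _)))))) (k.strictlyInverseˡ j))) x)
    where
    g = map (y ^ e *_) (τ^ 1)
    f = add (τ^ q) (map -_ g)
    g≤ : map -_ g ≤° 1
    g≤ = <°-neg (<°-scale (y ^ e) (τ^-≤° 1))
    f≤ : f ≤° q
    f≤ = <°-add (τ^-≤° q) (<°-mono (s≤s (ℕ.≤-trans (s≤s z≤n) 2≤q)) g≤)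
    lead : coeff f q ≈ 1#
    lead = trans (coeff-add (τ^ q) (map -_ g) q) (trans (+-cong (coeff-τ^ q) (vanish g≤ q 2≤q)) (+-identityʳ 1#))
    eval-f : ∀ x → eval f x ≈ x ^ q - y ^ e * x
    eval-f x = begin
      eval f x                                  ≈⟨ eval-add (τ^ q) (map -_ g) x ⟩
      eval (τ^ q) x + eval (map -_ g) x         ≈⟨ +-cong (eval-τ^ q x) (trans (eval-neg g x) (-‿cong (trans (eval-scale (y ^ e) (τ^ 1) x) (*-congˡ (eval-τ^ 1 x))))) ⟩
      x ^ q - y ^ e * (x * 1#)                  ≈⟨ +-congˡ (-‿cong (*-congˡ (*-identityʳ x))) ⟩
      x ^ q - y ^ e * x                         ∎
    root : ∀ i → eval f (ι (k.from i) * y) ≈ 0#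
    root i = trans (eval-f _) (zero-difference (begin
      (z * y) ^ q         ≈⟨ ^-distrib-* z y q ⟩
      z ^ q * y ^ q       ≈⟨ *-cong (ι-fixed _) (^q≈ y) ⟩
      z * (y * y ^ e)     ≈⟨ solve 3 (λ z y w → z :* (y :* w) := w :* (z :* y)) refl z y (y ^ e) ⟩
      y ^ e * (z * y)     ∎))
      where
      open Solver
      z = ι (k.from i)

  ∏-zero : ∀ N (t : Fin N → Carrier) → ∏.sum t ≈ 0# → ∃[ i ] t i ≈ 0#
  ∏-zero zero    t p = contradiction p 1≉0
  ∏-zero (suc N) t p with zero-product (t zero) _ p
  ... | inj₁ q = zero , q
  ... | inj₂ q with ∏-zero N (t ∘ suc) q
  ...   | i , r = suc i , r

  -- By `linear-product` some factor x - a y vanishes. The case y = 1 identifies the fixed field of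
  -- Frobenius with k.
  proportional : ∀ x y → ¬ y ≈ 0# → x ^ q ≈ y ^ e * x → ∃[ a ] x ≈ ι a * y
  proportional x y y≉0 p =
    let i , r = ∏-zero q (linear x y) (trans (sym (linear-product x y y≉0)) (zero-difference p))
    in k.from i , difference-zero r

  private
    1^ : ∀ n → 1# ^ n ≈ 1#
    1^ zero    = refl
    1^ (suc n) = trans (*-identityˡ _) (1^ n)

  fixed : ∀ x → x ^ q ≈ x → ∃[ a ] x ≈ ι a
  fixed x p =
    let a , r = proportional x 1# 1≉0 (trans p (sym (trans (*-congʳ (1^ e)) (*-identityˡ x))))
    in a , trans r (*-identityʳ _)

  ^q-+ : ∀ x y → (x + y) ^ q ≈ x ^ q + y ^ q
  ^q-+ x y = split (zero? y)
   where
   open Solver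
   zero-case : y ≈ 0# → (x + y) ^ q ≈ x ^ q + y ^ q
   zero-case y≈0 = begin
    (x + y) ^ q       ≈⟨ ^-congˡ q (trans (+-congˡ y≈0) (+-identityʳ x)) ⟩
    x ^ q             ≈⟨ +-identityʳ _ ⟨
    x ^ q + 0#        ≈⟨ +-congˡ (trans (^q≈ y) (trans (*-congʳ y≈0) (zeroˡ _))) ⟨
    x ^ q + y ^ q     ∎
   nonzero-case : ¬ y ≈ 0# → (x + y) ^ q ≈ x ^ q + y ^ q
   nonzero-case y≉0 = begin
    (x + y) ^ q
      ≈⟨ solve 4 (λ s x y w → s := s :- w :* (x :+ y) :+ (w :* x :+ y :* w)) refl _ x y (y ^ e) ⟩
    (x + y) ^ q - y ^ e * (x + y) + (y ^ e * x + y * y ^ e)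
      ≈⟨ +-cong shift (+-congˡ (sym (^q≈ y))) ⟩
    x ^ q - y ^ e * x + (y ^ e * x + y ^ q)
      ≈⟨ solve 3 (λ s t u → s :- t :+ (t :+ u) := s :+ u) refl _ _ _ ⟩
    x ^ q + y ^ q ∎
    where
    π = k.permutation (k._- k.1#) (k._+ k.1#) k.+-congʳ k.+-congʳ
      (λ x → k.Solver.solve 1 (λ x → x k.Solver.:+ k.Solver.con ℤ.1ℤ k.Solver.:- k.Solver.con ℤ.1ℤ k.Solver.:= x) k.refl x)
      (λ x → k.Solver.solve 1 (λ x → x k.Solver.:- k.Solver.con ℤ.1ℤ k.Solver.:+ k.Solver.con ℤ.1ℤ k.Solver.:= x) k.refl x)
    factor : ∀ i → linear (x + y) y i ≈ linear x y (π Perm.⟨$⟩ʳ i)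
    factor i = begin
      x + y - ι (k.from i) * y                       ≈⟨ solve 3 (λ x y a → x :+ y :- a :* y := x :- (a :- con ℤ.1ℤ) :* y) refl x y _ ⟩
      x - (ι (k.from i) - 1#) * y                    ≈⟨ +-congˡ (-‿cong (*-congʳ (+-congˡ (trans (ι.-‿homo _) (-‿cong ι.1#-homo))))) ⟨
      x - (ι (k.from i) + ι (k.- k.1#)) * y          ≈⟨ +-congˡ (-‿cong (*-congʳ (ι.+-homo _ _))) ⟨
      x - ι (k.from i k.- k.1#) * y                  ≈⟨ +-congˡ (-‿cong (*-congʳ (ι.⟦⟧-cong (k.strictlyInverseʳ _)))) ⟨
      x - ι (k.from (π Perm.⟨$⟩ʳ i)) * y             ∎
    shift : (x + y) ^ q - y ^ e * (x + y) ≈ x ^ q - y ^ e * x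
    shift = begin
      (x + y) ^ q - y ^ e * (x + y)                              ≈⟨ linear-product (x + y) y y≉0 ⟩
      ∏.sum (linear (x + y) y)                                   ≈⟨ ∏.sum-cong-≋ {q} {linear (x + y) y} {linear x y ∘ (π Perm.⟨$⟩ʳ_)} factor ⟩
      ∏.sum (linear x y ∘ (π Perm.⟨$⟩ʳ_))                        ≈⟨ ∏.sum-permute (linear x y) π ⟨
      ∏.sum (linear x y)                                         ≈⟨ linear-product x y y≉0 ⟨
      x ^ q - y ^ e * x                                          ∎
   split : Dec (y ≈ 0#) → (x + y) ^ q ≈ x ^ q + y ^ q
   split (yes p) = zero-case p
   split (no ¬p) = nonzero-case ¬p

  ^q-zero : 0# ^ q ≈ 0#
  ^q-zero = trans (^q≈ 0#) (zeroˡ _)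

  ^q-injective₀ : ∀ x → x ^ q ≈ 0# → x ≈ 0#
  ^q-injective₀ x p = decidable-stable (zero? x) λ x≉0 → ^-nonzero q x≉0 p

  ^q-neg : ∀ x → (- x) ^ q ≈ - (x ^ q)
  ^q-neg x = begin
    (- x) ^ q                        ≈⟨ solve 2 (λ s t → s := s :+ t :- t) refl _ (x ^ q) ⟩
    (- x) ^ q + x ^ q - x ^ q        ≈⟨ +-congʳ (^q-+ (- x) x) ⟨
    (- x + x) ^ q - x ^ q            ≈⟨ +-congʳ (trans (^-congˡ q (-‿inverseˡ x)) ^q-zero) ⟩
    0# - x ^ q                       ≈⟨ +-identityˡ _ ⟩
    - (x ^ q)                        ∎
    where open Solver

  ^q-isRingHomomorphism : RingMorphisms.IsRingHomomorphism rawRing rawRing (_^ q)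
  ^q-isRingHomomorphism = record
    { isSemiringHomomorphism = record
      { isNearSemiringHomomorphism = record
        { +-isMonoidHomomorphism = record
          { isMagmaHomomorphism = record
            { isRelHomomorphism = record { cong = ^-congˡ q }
            ; homo = ^q-+ }
          ; ε-homo = ^q-zero }
        ; *-homo = λ x y → ^-distrib-* x y q }
      ; 1#-homo = trans (^-congˡ q (sym ι.1#-homo)) (trans (ι-fixed k.1#) ι.1#-homo) }
    ; -‿homo = ^q-neg }

  iter-^q : ∀ n x → iter (_^ q) n x ≈ x ^ (q ℕ.^ n)
  iter-^q zero    x = sym (*-identityʳ x)
  iter-^q (suc n) x = trans (iter-^q n (x ^ q)) (^-assocʳ x q (q ℕ.^ n))

  iter-ι : ∀ n a → iter (_^ q) n (ι a) ≈ ι a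
  iter-ι zero    a = refl
  iter-ι (suc n) a = trans (iter-cong n (ι-fixed a)) (iter-ι n a)
    where
    iter-cong : ∀ n {x y} → x ≈ y → iter (_^ q) n x ≈ iter (_^ q) n y
    iter-cong zero    p = p
    iter-cong (suc n) p = iter-cong n (^-congˡ q p)

-- Quotient rings

module Quotient {c ℓ : Level} (R : CommutativeRing c ℓ) (d : CommutativeRing.Carrier R) where
  open CommutativeRing R using (Carrier; _≈_; _+_; _*_; -_; _-_; 0#; 1#; refl; sym; trans; rawRing; ring; isCommutativeRing; isRing; isEquivalence; +-cong; +-congʳ; *-cong; *-congˡ; +-assoc; *-assoc; +-comm; *-comm; +-identityˡ; +-identityʳ; *-identityˡ; *-identityʳ; zeroˡ; distribˡ; distribʳ; -‿inverseˡ; -‿inverseʳ; -‿cong)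
  open RawSemiringDefinitions (RawRing.rawSemiring rawRing) using (_∣_)
  open ℤ-Solver R
  open RingProperties ring using (-0#≈0#)

  infix 4 _∼_
  _∼_ : Carrier → Carrier → Set _
  a ∼ b = d ∣ (a + (- b))

  ≈⇒∼ : ∀ {a b} → a ≈ b → a ∼ b
  ≈⇒∼ {a} {b} p = 0# , trans (zeroˡ d) (sym (trans (+-congʳ p) (-‿inverseʳ b)))

  quotientRing : CommutativeRing c (c ⊔ ℓ)
  quotientRing = record
    { Carrier = Carrier ; _≈_ = _∼_ ; _+_ = _+_ ; _*_ = _*_ ; -_ = -_ ; 0# = 0# ; 1# = 1#
    ; isCommutativeRing = record
      { isRing = record
        { +-isAbelianGroup = record
          { isGroup = record
            { isMonoid = record
              { isSemigroup = record
                { isMagma = record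
                  { isEquivalence = record { refl = ≈⇒∼ refl ; sym = ∼-sym ; trans = ∼-trans }
                  ; ∙-cong = +-cong′ }
                ; assoc = λ x y z → ≈⇒∼ (+-assoc x y z) }
              ; identity = (λ x → ≈⇒∼ (+-identityˡ x)) , (λ x → ≈⇒∼ (+-identityʳ x)) }
            ; inverse = (λ x → ≈⇒∼ (-‿inverseˡ x)) , (λ x → ≈⇒∼ (-‿inverseʳ x))
            ; ⁻¹-cong = neg-cong′ }
          ; comm = λ x y → ≈⇒∼ (+-comm x y) }
        ; *-cong = *-cong′
        ; *-assoc = λ x y z → ≈⇒∼ (*-assoc x y z)
        ; *-identity = (λ x → ≈⇒∼ (*-identityˡ x)) , (λ x → ≈⇒∼ (*-identityʳ x))
        ; distrib = (λ x y z → ≈⇒∼ (distribˡ x y z)) , (λ x y z → ≈⇒∼ (distribʳ x y z)) }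
      ; *-comm = λ x y → ≈⇒∼ (*-comm x y) } }
    where
    ∼-sym : ∀ {a b} → a ∼ b → b ∼ a
    ∼-sym {a} {b} (s , p) = - s , trans (solve 2 (λ s d → (:- s) :* d := :- (s :* d)) refl s d)
      (trans (-‿cong p) (solve 2 (λ a b → :- (a :- b) := b :- a) refl a b))
    ∼-trans : ∀ {a b e} → a ∼ b → b ∼ e → a ∼ e
    ∼-trans {a} {b} {e} (s , p) (t , r) = s + t , trans (distribʳ d s t)
      (trans (+-cong p r) (solve 3 (λ a b e → (a :- b) :+ (b :- e) := a :- e) refl a b e))
    +-cong′ : ∀ {a b e f} → a ∼ b → e ∼ f → a + e ∼ b + f
    +-cong′ {a} {b} {e} {f} (s , p) (t , r) = s + t , trans (distribʳ d s t)
      (trans (+-cong p r) (solve 4 (λ a b e f → (a :- b) :+ (e :- f) := a :+ e :- (b :+ f)) refl a b e f))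
    neg-cong′ : ∀ {a b} → a ∼ b → - a ∼ - b
    neg-cong′ {a} {b} (s , p) = - s , trans (solve 2 (λ s d → (:- s) :* d := :- (s :* d)) refl s d)
      (trans (-‿cong p) (solve 2 (λ a b → :- (a :- b) := :- a :- (:- b)) refl a b))
    *-cong′ : ∀ {a b e f} → a ∼ b → e ∼ f → a * e ∼ b * f
    *-cong′ {a} {b} {e} {f} (s , p) (t , r) = e * s + b * t ,
      trans (solve 5 (λ s t e b d → (e :* s :+ b :* t) :* d := e :* (s :* d) :+ b :* (t :* d)) refl s t e b d)
      (trans (+-cong (*-congˡ p) (*-congˡ r))
        (solve 4 (λ a b e f → e :* (a :- b) :+ b :* (e :- f) := a :* e :- b :* f) refl a b e f))

  -- The same relation, wrapped so that its arguments can be inferred.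
  infix 4 _≃_
  record _≃_ (a b : Carrier) : Set (c ⊔ ℓ) where
    constructor mod
    field unmod : a ∼ b
  open _≃_ public

  quotientRing≃ : CommutativeRing c (c ⊔ ℓ)
  quotientRing≃ = record
    { isCommutativeRing = RingMonomorphism.isCommutativeRing unwrap (CommutativeRing.isCommutativeRing quotientRing) }
    where
    raw : RawRing c (c ⊔ ℓ)
    raw = record { Carrier = Carrier ; _≈_ = _≃_ ; _+_ = _+_ ; _*_ = _*_ ; -_ = -_ ; 0# = 0# ; 1# = 1# }
    same : ∀ a → a ∼ a
    same a = ≈⇒∼ refl
    unwrap : RingMorphisms.IsRingMonomorphism raw (CommutativeRing.rawRing quotientRing) id
    unwrap = record
      { isRingHomomorphism = record
        { isSemiringHomomorphism = record
          { isNearSemiringHomomorphism = record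
            { +-isMonoidHomomorphism = record
              { isMagmaHomomorphism = record
                { isRelHomomorphism = record { cong = unmod }
                ; homo = λ x y → same (x + y) }
              ; ε-homo = same 0# }
            ; *-homo = λ x y → same (x * y) }
          ; 1#-homo = same 1# }
        ; -‿homo = λ x → same (- x) }
      ; injective = mod }

  ≈⇒≃ : ∀ {a b} → a ≈ b → a ≃ b
  ≈⇒≃ p = mod (≈⇒∼ p)

  ∣⇒∼0 : ∀ {a} → d ∣ a → a ∼ 0#
  ∣⇒∼0 {a} (s , p) = s , trans p (solve 1 (λ a → a := a :- con ℤ.0ℤ) refl a)

  ∼0⇒∣ : ∀ {a} → a ∼ 0# → d ∣ a
  ∼0⇒∣ {a} (s , p) = s , trans p (solve 1 (λ a → a :- con ℤ.0ℤ := a) refl a)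

-- Residues modulo a monic polynomial

coeff-tabulate : ∀ (R : CommutativeRing c ℓ) N (g : Fin N → CommutativeRing.Carrier R) i →
                 Skew.coeff R id (Poly.id-isRingHomomorphism R) (tabulate g) (Fin.toℕ i) ≡ g i
coeff-tabulate R (suc N) g zero    = ≡.refl
coeff-tabulate R (suc N) g (suc i) = coeff-tabulate R N (g ∘ suc) i

funToFin-cong : ∀ {m n} {f g : Fin m → Fin n} → (∀ i → f i ≡ g i) → funToFin f ≡ funToFin g
funToFin-cong {zero}  p = ≡.refl
funToFin-cong {suc m} p = ≡.cong₂ combine (p zero) (funToFin-cong (p ∘ suc))

module PolyQuotient {q : ℕ} (k : FiniteField c ℓ q) where
  kᴰ : Domain c ℓ
  kᴰ = field⇒domain (FiniteField.asField k)

  private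
    module k where
      open Domain kᴰ public using (commutativeRing; 1≉0; Carrier; _≈_; -_; _-_; 1#; sym; trans; reflexive; *-identityʳ)
      open Inverse (FiniteField.cardinality k) public using (to; from; to-cong; from-cong; strictlyInverseˡ; strictlyInverseʳ)
  open FunctionField k using (A; A/; _∣_; _≡_mod_; Prime)
  open Poly k.commutativeRing using (id-isRingHomomorphism; Poly; coeff; add; mul; _≋_; mk; at; ≋-refl; ≋-sym; ≋-trans; mul-zeroˡ; Monic)
  open SkewDegree k.commutativeRing id id-isRingHomomorphism using (_<°_; below; vanish; _≤°_; <°-length; <°-resp; <°-add; <°-neg; <°-∷; []-<°; divide)
  open SkewDomain kᴰ id id-isRingHomomorphism (λ _ p → p) using (degree?; zero-poly?; lead-nonzero)
  open PolyDomain kᴰ using (polyDomain≋; polyDomain)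
  private
    module A = Domain polyDomain using (commutativeRing; 1≉0; zero?; zero-product; Carrier; _≈_; _+_; -_; _-_; 1#; refl; sym; trans; reflexive; setoid; +-congʳ; *-identityˡ; *-identityʳ; _^_; module Solver; difference-zero)
    module A≋ = Domain polyDomain≋ using (setoid; +-congʳ; *-identityˡ; module Solver; difference-zero)

  Aᴰ : Domain c ℓ
  Aᴰ = polyDomain

  monic-multiple : ∀ {d δ} → d ≤° δ → coeff d δ k.≈ k.1# → ∀ s → mul s d <° δ → s ≋ []
  monic-multiple {d} {δ} d≤ lead s p with degree? s
  ... | inj₁ s≋0 = s≋0
  ... | inj₂ (e , s≤ , se) = contradiction (vanish p (e ℕ.+ δ) (ℕ.m≤n+m δ e))
    (lead-nonzero {s} {d} s≤ d≤ se λ z → k.1≉0 (k.trans (k.sym lead) z))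

  module Residues (d : A.Carrier) (monic : Monic d) where
    open Monic monic renaming (degree to δ)
    open Quotient A.commutativeRing d public using (_∼_; ≈⇒∼; quotientRing; _≃_; mod; unmod; quotientRing≃; ≈⇒≃; ∣⇒∼0; ∼0⇒∣)
    private
      module Q  = CommutativeRing quotientRing
      module Q≃ = CommutativeRing quotientRing≃ using (refl; sym; trans)

    monic-≤° : d ≤° δ
    monic-≤° = below above-degree

    division : ∀ f → ∃[ u ] ∃[ ρ ] f ≋ add (mul u d) ρ × u <° length f ℕ.∸ δ × ρ <° δ
    division f = divide {d} {δ} {k.1#} monic-≤° (k.trans (k.*-identityʳ _) leading) (length f) f (<°-length f)

    rem : A.Carrier → A.Carrier
    rem f = proj₁ (proj₂ (division f))

    rem-<° : ∀ f → rem f <° δ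
    rem-<° f = proj₂ (proj₂ (proj₂ (proj₂ (division f))))

    rem-≃ : ∀ f → f ≃ rem f
    rem-≃ f = mod (s , at (begin
      mul s d                                      ≈⟨ solve 2 (λ x y → x := x :+ y :- y) ≋-refl (mul s d) (rem f) ⟩
      add (add (mul s d) (rem f)) (map k.-_ (rem f)) ≈⟨ A≋.+-congʳ (≋-sym (proj₁ (proj₂ (proj₂ (division f))))) ⟩
      add f (map k.-_ (rem f))                     ∎))
      where
      s = proj₁ (division f)
      open SetoidReasoning A≋.setoid
      open A≋.Solver

    small-multiple : ∀ {f} → f <° δ → d ∣ f → f ≋ []
    small-multiple {f} f< (s , p) =
      ≋-trans (≋-sym (mk p)) (mul-zeroˡ s d (monic-multiple monic-≤° leading s (<°-resp (≋-sym (mk p)) f<)))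

    small-unique : ∀ {f g} → f <° δ → g <° δ → f ≃ g → f ≋ g
    small-unique f< g< p = A≋.difference-zero (small-multiple (<°-add f< (<°-neg g<)) (unmod p))

    divides? : ∀ f → Dec (d ∣ f)
    divides? f = map′ to-∣ from-∣ (zero-poly? (rem f))
      where
      to-∣ : rem f ≋ [] → d ∣ f
      to-∣ p = ∼0⇒∣ (unmod (Q≃.trans (rem-≃ f) (≈⇒≃ {rem f} {[]} (at p))))
      from-∣ : d ∣ f → rem f ≋ []
      from-∣ p = small-multiple (rem-<° f) (∼0⇒∣ (unmod (Q≃.trans (Q≃.sym (rem-≃ f)) (mod (∣⇒∼0 p)))))

    private
      digits : A.Carrier → Fin δ → Fin q
      digits f i = k.to (coeff (rem f) (Fin.toℕ i))

      build : Fin (q ℕ.^ δ) → A.Carrier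
      build j = tabulate (λ i → k.from (finToFun {q} {δ} j i))

      build-<° : ∀ {N} (g : Fin N → k.Carrier) → tabulate g <° N
      build-<° {zero}  g = []-<°
      build-<° {suc N} g = <°-∷ (build-<° (g ∘ suc))

      below-≋ : ∀ N {f g} → f <° N → g <° N → (∀ (i : Fin N) → coeff f (Fin.toℕ i) k.≈ coeff g (Fin.toℕ i)) → f ≋ g
      below-≋ N {f} {g} f< g< p = mk compare
        where
        compare : ∀ n → coeff f n k.≈ coeff g n
        compare n with n ℕ.<? N
        ... | yes n<N = ≡.subst (λ n → coeff f n k.≈ coeff g n) (Fin.toℕ-fromℕ< n<N) (p (Fin.fromℕ< n<N))
        ... | no  n≮N = k.trans (vanish f< n (ℕ.≮⇒≥ n≮N)) (k.sym (vanish g< n (ℕ.≮⇒≥ n≮N)))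

    -- A residue is coded by the δ coefficients of its remainder, taken as the base q digits of a
    -- number below q^δ.
    residues : Inverse Q.setoid (≡.setoid (Fin (q ℕ.^ δ)))
    residues = record
      { to = λ f → funToFin (digits f)
      ; from = build
      ; to-cong = λ {f} {g} p → to-cong {f} {g} (mod p)
      ; from-cong = λ { {j} ≡.refl → unmod (Q≃.refl {build j}) }
      ; inverse = (λ {j} {f} f∼ → ≡.trans (to-cong {f} {build j} (mod f∼)) (to-build j))
                , (λ {f} {j} j≡ → ≡.subst (λ j → build j ∼ f) (≡.sym j≡) (unmod (build-to f))) }
      where
      to-cong : ∀ {f g} → f ≃ g → funToFin (digits f) ≡ funToFin (digits g)
      to-cong {f} {g} f∼g = funToFin-cong {δ} {q} λ i → k.to-cong (at (small-unique (rem-<° f) (rem-<° g)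
        (Q≃.trans (Q≃.sym (rem-≃ f)) (Q≃.trans f∼g (rem-≃ g)))) (Fin.toℕ i))
      to-build : ∀ j → funToFin (digits (build j)) ≡ j
      to-build j = ≡.trans (funToFin-cong {δ} {q} λ i → ≡.trans
          (k.to-cong (k.trans (at (small-unique (rem-<° (build j)) (build-<° _) (Q≃.sym (rem-≃ (build j)))) (Fin.toℕ i))
            (k.reflexive (coeff-tabulate k.commutativeRing δ (λ i → k.from (finToFun {q} {δ} j i)) i))))
          (k.strictlyInverseˡ _))
        (Fin.funToFin-finToFin {δ} {q} j)
      build-to : ∀ f → build (funToFin (digits f)) ≃ f
      build-to f = Q≃.trans (≈⇒≃ {build (funToFin (digits f))} {rem f} (at (below-≋ δ (build-<° _) (rem-<° f) λ i → k.trans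
          (k.reflexive (≡.trans (coeff-tabulate k.commutativeRing δ (λ i → k.from (finToFun {q} {δ} (funToFin (digits f)) i)) i)
            (≡.cong k.from (Fin.finToFun-funToFin (digits f) i))))
          (k.strictlyInverseʳ _)))) (Q≃.sym (rem-≃ f))

    residues-injective : ∀ a b → Inverse.to residues a ≡ Inverse.to residues b → a ∼ b
    residues-injective a b p = unmod (Q≃.trans (Q≃.sym (inv a)) (Q≃.trans (mod {from (to a)} {from (to b)} (from-cong p)) (inv b)))
      where
      open Inverse residues
      inv : ∀ a → from (to a) ≃ a
      inv a = mod (strictlyInverseʳ a)

    module _ (prime : Prime d) where
      private
        module prime where
          open RawSemiringDefinitions.Prime prime public

      quotientDomain : Domain c (c ⊔ ℓ)
      quotientDomain = record
        { commutativeRing = quotientRing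
        ; 1≉0 = λ p → prime.p∤1 (∼0⇒∣ p)
        ; zero? = λ f → map′ ∣⇒∼0 ∼0⇒∣ (divides? f)
        ; zero-product = λ f g p → [ inj₁ ∘ ∣⇒∼0 , inj₂ ∘ ∣⇒∼0 ]′ (prime.split-∣ (∼0⇒∣ p)) }

      0<δ : 0 ℕ.< δ
      0<δ = positive δ ≡.refl
        where
        positive : ∀ e → e ≡ δ → 0 ℕ.< e
        positive (suc e) _ = s≤s z≤n
        positive zero    e = contradiction (A.1# , at (≋-trans (A≋.*-identityˡ d) d≋1)) prime.p∤1
          where
          d≋1 : d ≋ A.1#
          d≋1 = mk λ { zero → ≡.subst (λ e → coeff d e k.≈ k.1#) (≡.sym e) leading
                     ; (suc n) → above-degree (suc n) (≡.subst (ℕ._< suc n) e (s≤s z≤n)) }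

-- Twisted polynomials over a domain containing k

module Twist {c ℓ c′ ℓ′ : Level} {q : ℕ} (k : FiniteField c ℓ q) (L : Domain c′ ℓ′) (ι : FiniteField.Carrier k → Domain.Carrier L)
             (ι-hom : RingMorphisms.IsRingHomomorphism (FiniteField.rawRing k) (Domain.rawRing L) ι) where
  private
    module k = Domain (field⇒domain (FiniteField.asField k)) using (1≉0; Carrier; _≈_; -_; _-_; 0#; 1#)
    module ι = RingHom ι-hom
  open Domain L using (commutativeRing; 1≉0; zero-product; Carrier; _≈_; _+_; _*_; -_; _-_; 0#; 1#; refl; sym; trans; setoid; rawRing; +-cong; +-congˡ; +-congʳ; *-congˡ; *-congʳ; +-assoc; *-assoc; *-comm; +-identityˡ; +-identityʳ; *-identityˡ; *-identityʳ; zeroˡ; zeroʳ; distribˡ; distribʳ; -‿inverseˡ; -‿inverseʳ; -‿cong; -0#≈0#; -‿distribˡ-*; -‿distribʳ-*; -‿involutive; _^_; ^-congˡ; ^-distrib-*; module Solver; difference-zero; zero-difference)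
  open Frobenius k L ι ι-hom public using (ι-injective; ι-^; ι-fixed; 2≤q; ^q≈; linear; linear-product; ∏-zero; proportional; fixed; ^q-+; ^q-zero; ^q-injective₀; ^q-neg; ^q-isRingHomomorphism; iter-^q; iter-ι)

  σ : Carrier → Carrier
  σ = _^ q

  open Skew commutativeRing σ ^q-isRingHomomorphism public using (rawSkew; Poly; coeff; add; τ·; mul; act; _≋_; mk; at; ≋-refl; ≋-sym; ≋-trans; ∷-cong; tail≋; coeff-add; coeff-map; coeff-scale; coeff-neg; coeff-σ; add-cong; scale-cong; mapσ-cong; neg-cong; add-assoc; add-comm; add-zeroʳ; add-negʳ; scale-add; add-scale; scale-scale; scale-zero; scale-one; mapσ-add; mapσ-scale; τ·-cong; τ·-add; τ·-scale; mul-congʳ; mul-zeroʳ; mul-zeroˡ; mul-congˡ; mul-cong; mul-distribʳ; mul-distribˡ; mul-scale; mul-mapσ; mul-τ·; mul-assoc; mul-oneˡ; mul-shiftʳ; mul-oneʳ; skewRing; unwrap)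
  open SkewDegree commutativeRing σ ^q-isRingHomomorphism public using (_<°_; below; vanish; _≤°_; <°-length; <°-resp; <°-mono; <°-add; <°-neg; <°-scale; <°-mapσ; <°-∷; <°-tail; <°0⇒≋[]; []-<°; τ·-≤°; mul-≤°; coeff-mul-lead; coeff₀-mul; coeff-mul-const; τ^; τ^-≤°; coeff-τ^; mul-τ^; mul-τ^ʳ; divide; act-cong; act-add; act-scale; act-mapσ; act-mul; act-+; act-0; act-τ^)
  open SkewDomain L σ ^q-isRingHomomorphism ^q-injective₀ public using (degree?; zero-poly?; iter-nonzero; lead-nonzero; mul-zero-product)

  module M = Ring skewRing using (1#; setoid; +-cong; +-congˡ; +-congʳ; *-congˡ; *-congʳ; +-assoc; *-assoc; +-comm; *-identityˡ; *-identityʳ; distribˡ; distribʳ; -‿inverseˡ; -‿cong)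
  module ≋-Reasoning = SetoidReasoning M.setoid
  private module ≈-Reasoning = SetoidReasoning setoid

  lin : ∀ {N} → Vec k.Carrier N → Vec Carrier N → Carrier
  lin []       []       = 0#
  lin (a ∷ as) (w ∷ ws) = ι a * w + lin as ws

  Independent : ∀ {N} → Vec Carrier N → Set _
  Independent ws = ∀ as → lin as ws ≈ 0# → All (k._≈ k.0#) as

  lin-0 : ∀ {N} (ws : Vec Carrier N) → lin (Vec.replicate N k.0#) ws ≈ 0#
  lin-0 []       = refl
  lin-0 (w ∷ ws) = trans (+-cong (trans (*-congʳ ι.0#-homo) (zeroˡ w)) (lin-0 ws)) (+-identityˡ 0#)

  lin-++ : ∀ {N M} (as : Vec k.Carrier N) (bs : Vec k.Carrier M) ws vs →
           lin (as Vec.++ bs) (ws Vec.++ vs) ≈ lin as ws + lin bs vs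
  lin-++ []       bs []       vs = sym (+-identityˡ _)
  lin-++ (a ∷ as) bs (w ∷ ws) vs = trans (+-congˡ (lin-++ as bs ws vs)) (sym (+-assoc _ _ _))

  act-ι : ∀ u a x → act u (ι a * x) ≈ ι a * act u x
  act-ι []      a x = sym (zeroʳ _)
  act-ι (b ∷ u) a x = begin
    b * (ι a * x) + act u (σ (ι a * x))       ≈⟨ +-congˡ (act-cong (≋-refl {u}) (trans (^-distrib-* (ι a) x q) (*-congʳ (ι-fixed a)))) ⟩
    b * (ι a * x) + act u (ι a * σ x)         ≈⟨ +-congˡ (act-ι u a (σ x)) ⟩
    b * (ι a * x) + ι a * act u (σ x)         ≈⟨ solve 4 (λ b a x y → b :* (a :* x) :+ a :* y := a :* (b :* x :+ y)) refl b (ι a) x _ ⟩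
    ι a * (b * x + act u (σ x))               ∎
    where open ≈-Reasoning
          open Solver

  act-lin : ∀ u {N} (as : Vec k.Carrier N) ws → act u (lin as ws) ≈ lin as (Vec.map (act u) ws)
  act-lin u []       []       = act-0 u
  act-lin u (a ∷ as) (w ∷ ws) = trans (act-+ u _ _) (+-cong (act-ι u a w) (act-lin u as ws))

  Kills : ∀ {N} → Poly → Vec Carrier N → Set _
  Kills ρ = All (λ w → act ρ w ≈ 0#)

  -- A polynomial killing w ≠ 0 is a left multiple of τ - w^(q-1), whose kernel
  -- is the line k w, so the quotient kills the images of the remaining points.
  too-many-roots : ∀ N (ws : Vec Carrier N) ρ → Independent ws → Kills ρ ws → ρ <° N → ρ ≋ []
  too-many-roots zero    []       ρ ind _           ρ< = <°0⇒≋[] ρ<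
  too-many-roots (suc N) (w ∷ ws) ρ ind (ρw ∷ ρws) ρ< =
    reduce (divide {π} {1} {1#} (<°-length π) (*-identityʳ 1#) (suc N) ρ ρ<)
    where
    e = ℕ.pred q
    π = - (w ^ e) ∷ 1# ∷ []

    w≉0 : ¬ w ≈ 0#
    w≉0 w≈0 with ind (k.1# ∷ Vec.replicate N k.0#) (trans (+-cong (trans (*-congˡ w≈0) (zeroʳ _)) (lin-0 ws)) (+-identityˡ 0#))
    ... | 1≈0 ∷ _ = k.1≉0 1≈0

    act-π : ∀ x → act π x ≈ x ^ q - w ^ e * x
    act-π x = solve 3 (λ v x y → (:- v) :* x :+ (con ℤ.1ℤ :* y :+ con ℤ.0ℤ) := y :- v :* x) refl (w ^ e) x (x ^ q)
      where open Solver

    π-kernel : ∀ x → act π x ≈ 0# → ∃[ a ] x ≈ ι a * w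
    π-kernel x p = proportional x w w≉0 (difference-zero (trans (sym (act-π x)) p))

    πw : act π w ≈ 0#
    πw = trans (act-π w) (zero-difference (trans (^q≈ w) (*-comm _ _)))

    images-independent : Independent (Vec.map (act π) ws)
    images-independent as p =
      let a , r = π-kernel (lin as ws) (trans (act-lin π as ws) p)
      in All.tail (ind (k.- a ∷ as) (trans (+-cong (*-congʳ (ι.-‿homo a)) r) (cancel (ι a))))
      where
      open Solver
      cancel : ∀ a → - a * w + a * w ≈ 0#
      cancel a = solve 2 (λ a w → (:- a) :* w :+ a :* w := con ℤ.0ℤ) refl a w

    reduce : ∃[ ρ′ ] ∃[ r ] ρ ≋ add (mul ρ′ π) r × ρ′ <° N × r <° 1 → ρ ≋ []
    reduce (ρ′ , r , ρ≋ , ρ′< , r<) = ≋-trans ρ≋ (≋-trans (add-cong (mul-zeroˡ ρ′ π ρ′≋0) r≋0) ≋-refl)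
      where
      act-ρ : ∀ x → act ρ x ≈ act ρ′ (act π x) + act r x
      act-ρ x = trans (act-cong ρ≋ refl) (trans (act-add (mul ρ′ π) r x) (+-congʳ (act-mul ρ′ π x)))

      r-const : r ≋ coeff r 0 ∷ []
      r-const = mk λ { zero → refl ; (suc n) → vanish r< (suc n) (s≤s z≤n) }

      act-r : ∀ x → act r x ≈ coeff r 0 * x
      act-r x = trans (act-cong r-const refl) (+-identityʳ _)

      r≋0 : r ≋ []
      r≋0 = [ (λ r₀ → ≋-trans r-const (mk λ { zero → r₀ ; (suc n) → refl })) , (λ w≈0 → contradiction w≈0 w≉0) ]′
        (zero-product (coeff r 0) w (begin
          coeff r 0 * w                  ≈⟨ act-r w ⟨
          act r w                        ≈⟨ +-identityˡ _ ⟨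
          0# + act r w                   ≈⟨ +-congʳ (trans (act-cong (≋-refl {ρ′}) πw) (act-0 ρ′)) ⟨
          act ρ′ (act π w) + act r w     ≈⟨ act-ρ w ⟨
          act ρ w                        ≈⟨ ρw ⟩
          0#                             ∎))
        where open ≈-Reasoning

      killed : ∀ {N} (ws : Vec Carrier N) → Kills ρ ws → Kills ρ′ (Vec.map (act π) ws)
      killed []       []         = []
      killed (v ∷ vs) (ρv ∷ ρvs) = trans (sym (trans (act-ρ v) (trans (+-congˡ (act-cong r≋0 refl)) (+-identityʳ _)))) ρv ∷ killed vs ρvs

      ρ′≋0 : ρ′ ≋ []
      ρ′≋0 = too-many-roots N (Vec.map (act π) ws) ρ′ images-independent (killed ws ρws) ρ′<

  multiple-below : ∀ {v d} → v ≤° d → ¬ coeff v d ≈ 0# → ∀ u → mul u v <° d → u ≋ []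
  multiple-below {v} {d} v≤ vd u p with degree? u
  ... | inj₁ u≋0 = u≋0
  ... | inj₂ (e , u≤ , ue) = contradiction (vanish p (e ℕ.+ d) (ℕ.m≤n+m d e)) (lead-nonzero {u} {v} u≤ v≤ ue vd)

  -- Passing τⁿ over a coefficient applies σⁿ to it, which changes nothing.
  central : ∀ n → (∀ x → iter σ n x ≈ x) → ∀ f → mul (τ^ n) f ≋ mul f (τ^ n)
  central n σⁿ f = ≋-trans (mul-τ^ n f) (≋-trans (shift n f) (≋-trans (shift-cong n fixed-coeffs) (≋-sym (mul-τ^ʳ n f))))
    where
    σ^-cong : ∀ n {x y} → x ≈ y → iter σ n x ≈ iter σ n y
    σ^-cong zero    p = p
    σ^-cong (suc n) p = σ^-cong n (^-congˡ q p)
    σ^-0 : ∀ n → iter σ n 0# ≈ 0#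
    σ^-0 zero    = refl
    σ^-0 (suc n) = trans (σ^-cong n ^q-zero) (σ^-0 n)
    shift-cong : ∀ n {u v} → u ≋ v → iter (0# ∷_) n u ≋ iter (0# ∷_) n v
    shift-cong zero    p = p
    shift-cong (suc n) p = shift-cong n (∷-cong refl p)
    fuse : ∀ n f → map (iter σ n) (map σ f) ≋ map (iter σ (suc n)) f
    fuse n []      = ≋-refl
    fuse n (a ∷ f) = ∷-cong refl (fuse n f)
    shift : ∀ n f → iter τ· n f ≋ iter (0# ∷_) n (map (iter σ n) f)
    shift zero    f = mk λ i → sym (coeff-map (iter σ zero) refl f i)
    shift (suc n) f = ≋-trans (shift n (τ· f)) (shift-cong n (∷-cong (σ^-0 n) (fuse n f)))
    fixed-coeffs : map (iter σ n) f ≋ f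
    fixed-coeffs = mk λ i → trans (coeff-map (iter σ n) (σ^-0 n) f i) (σⁿ _)

  -- If Ψ of degree d ≤ n has d independent roots fixed by τⁿ, it divides τⁿ - 1.
  module Division {n d : ℕ} (0<n : 0 ℕ.< n) (σⁿ : ∀ x → iter σ n x ≈ x)
                  {Ψ : Poly} (Ψ≤ : Ψ ≤° d) {w : Carrier} (Ψw : coeff Ψ d * w ≈ 1#)
                  {ws : Vec Carrier d} (independent : Independent ws) (killed : Kills Ψ ws) where
    τⁿ-1 : Poly
    τⁿ-1 = add (τ^ n) (map -_ (1# ∷ []))

    τⁿ-1-kills : ∀ x → act τⁿ-1 x ≈ 0#
    τⁿ-1-kills x = trans (act-add (τ^ n) _ x) (trans
      (+-cong (trans (act-τ^ n x) (σⁿ x)) (solve 1 (λ x → (:- con ℤ.1ℤ) :* x :+ con ℤ.0ℤ := :- x) refl x)) (-‿inverseʳ x))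
      where open Solver

    τⁿ-1-≤° : τⁿ-1 ≤° n
    τⁿ-1-≤° = <°-add (τ^-≤° n) (<°-mono (s≤s z≤n) (<°-neg (<°-length (1# ∷ []))))

    coeff₀-τ^ : ∀ {n} → 0 ℕ.< n → coeff (τ^ n) 0 ≈ 0#
    coeff₀-τ^ {suc n} _ = refl

    τⁿ-1-coeff₀ : coeff τⁿ-1 0 ≈ - 1#
    τⁿ-1-coeff₀ = trans (coeff-add (τ^ n) _ 0) (trans (+-congʳ (coeff₀-τ^ 0<n)) (+-identityˡ _))

    private
      kills-all : ∀ {N} (vs : Vec Carrier N) → Kills τⁿ-1 vs
      kills-all []       = []
      kills-all (v ∷ vs) = τⁿ-1-kills v ∷ kills-all vs

    -- If n < d, then τⁿ - 1 would vanish at more independent points than its degree allows and be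
    -- zero, although its constant term is -1.
    d≤n : d ℕ.≤ n
    d≤n = ℕ.≮⇒≥ λ n<d → 1≉0 (begin
      1#                ≈⟨ -‿involutive 1# ⟨
      - - 1#            ≈⟨ -‿cong τⁿ-1-coeff₀ ⟨
      - coeff τⁿ-1 0    ≈⟨ -‿cong (at (too-many-roots d ws τⁿ-1 independent (kills-all ws) (<°-mono n<d τⁿ-1-≤°)) 0) ⟩
      - 0#              ≈⟨ -0#≈0# ⟩
      0#                ∎)
      where open ≈-Reasoning

    quotient : ∃[ u ] mul u Ψ ≋ τⁿ-1 × u ≤° n ℕ.∸ d
    quotient =
      let u , ρ , τⁿ-1≋ , u< , ρ< = divide {Ψ} {d} {w} Ψ≤ Ψw (suc n) τⁿ-1 τⁿ-1-≤°
      in u , ≋-trans (≋-sym (add-zeroʳ _)) (≋-trans (add-cong (≋-refl {mul u Ψ}) (≋-sym (ρ≋0 u ρ τⁿ-1≋ ρ<))) (≋-sym τⁿ-1≋))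
           , ≡.subst (u <°_) (ℕ.+-∸-assoc 1 d≤n) u<
      where
      -- Both τⁿ - 1 and u Ψ kill the d points, hence so does the remainder, whose degree is below
      -- d.
      ρ≋0 : ∀ u ρ → τⁿ-1 ≋ add (mul u Ψ) ρ → ρ <° d → ρ ≋ []
      ρ≋0 u ρ τⁿ-1≋ ρ< = too-many-roots d ws ρ independent (kills ws killed) ρ<
        where
        open ≈-Reasoning
        kills : ∀ {N} (vs : Vec Carrier N) → Kills Ψ vs → Kills ρ vs
        kills []       []         = []
        kills (v ∷ vs) (Ψv ∷ Ψvs) = (begin
          act ρ v                                ≈⟨ +-identityˡ _ ⟨
          0# + act ρ v                           ≈⟨ +-congʳ (trans (act-mul u Ψ v) (trans (act-cong (≋-refl {u}) Ψv) (act-0 u))) ⟨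
          act (mul u Ψ) v + act ρ v              ≈⟨ act-add (mul u Ψ) ρ v ⟨
          act (add (mul u Ψ) ρ) v                ≈⟨ act-cong τⁿ-1≋ refl ⟨
          act τⁿ-1 v                             ≈⟨ τⁿ-1-kills v ⟩
          0#                                     ∎) ∷ kills vs Ψvs

    -- (u φ - φ u) Ψ = u Ψ φ - φ u Ψ = (τⁿ - 1) φ - φ (τⁿ - 1) = 0, and Ψ can be cancelled on the
    -- right.
    commutes : ∀ {φ u} → mul Ψ φ ≋ mul φ Ψ → mul u Ψ ≋ τⁿ-1 → mul u φ ≋ mul φ u
    commutes {φ} {u} Ψφ uΨ = begin
      mul u φ                                ≈⟨ add-zeroʳ _ ⟨
      add (mul u φ) []                       ≈⟨ M.+-congˡ {mul u φ} (M.-‿inverseˡ (mul φ u)) ⟨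
      add (mul u φ) (add (map -_ (mul φ u)) (mul φ u)) ≈⟨ M.+-assoc (mul u φ) _ _ ⟨
      add δ (mul φ u)                        ≈⟨ M.+-congʳ {mul φ u} δ≋0 ⟩
      mul φ u                                ∎
      where
      open ≋-Reasoning
      module MP = RingProperties skewRing
      δ = add (mul u φ) (map -_ (mul φ u))
      δΨ : mul δ Ψ ≋ []
      δΨ = begin
        mul δ Ψ                                                ≈⟨ M.distribʳ Ψ (mul u φ) _ ⟩
        add (mul (mul u φ) Ψ) (mul (map -_ (mul φ u)) Ψ)       ≈⟨ M.+-cong (M.*-assoc u φ Ψ) (≋-sym (MP.-‿distribˡ-* (mul φ u) Ψ)) ⟩
        add (mul u (mul φ Ψ)) (map -_ (mul (mul φ u) Ψ))       ≈⟨ M.+-cong (M.*-congˡ {u} (≋-sym Ψφ)) (M.-‿cong (M.*-assoc φ u Ψ)) ⟩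
        add (mul u (mul Ψ φ)) (map -_ (mul φ (mul u Ψ)))       ≈⟨ M.+-cong (≋-sym (M.*-assoc u Ψ φ)) (M.-‿cong (M.*-congˡ {φ} uΨ)) ⟩
        add (mul (mul u Ψ) φ) (map -_ (mul φ τⁿ-1))            ≈⟨ M.+-cong (M.*-congʳ {φ} uΨ) (M.-‿cong central′) ⟩
        add (mul τⁿ-1 φ) (map -_ (mul τⁿ-1 φ))                 ≈⟨ add-negʳ (mul τⁿ-1 φ) ⟩
        []                                                     ∎
        where
        central′ : mul φ τⁿ-1 ≋ mul τⁿ-1 φ
        central′ = begin
          mul φ τⁿ-1                                          ≈⟨ M.distribˡ φ (τ^ n) _ ⟩
          add (mul φ (τ^ n)) (mul φ (map -_ (1# ∷ [])))       ≈⟨ M.+-cong (≋-sym (central n σⁿ φ)) (≋-sym (MP.-‿distribʳ-* φ M.1#)) ⟩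
          add (mul (τ^ n) φ) (map -_ (mul φ (1# ∷ [])))       ≈⟨ M.+-congˡ {mul (τ^ n) φ} (M.-‿cong (≋-trans (M.*-identityʳ φ) (≋-sym (M.*-identityˡ φ)))) ⟩
          add (mul (τ^ n) φ) (map -_ (mul (1# ∷ []) φ))       ≈⟨ M.+-congˡ {mul (τ^ n) φ} (MP.-‿distribˡ-* M.1# φ) ⟩
          add (mul (τ^ n) φ) (mul (map -_ (1# ∷ [])) φ)       ≈⟨ M.distribʳ φ (τ^ n) _ ⟨
          mul τⁿ-1 φ                                          ∎
      δ≋0 : δ ≋ []
      δ≋0 = multiple-below Ψ≤ Ψd≉0 δ (<°-resp (≋-sym δΨ) []-<°)
        where
        Ψd≉0 : ¬ coeff Ψ d ≈ 0#
        Ψd≉0 p = 1≉0 (trans (sym Ψw) (trans (*-congʳ p) (zeroˡ w)))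

-- Coefficientwise ring homomorphisms

module SkewMap {c ℓ c′ ℓ′ : Level} (R : CommutativeRing c ℓ) (S : CommutativeRing c′ ℓ′)
               (σ : CommutativeRing.Carrier R → CommutativeRing.Carrier R)
               (σ-hom : RingMorphisms.IsRingHomomorphism (CommutativeRing.rawRing R) (CommutativeRing.rawRing R) σ)
               (ρ : CommutativeRing.Carrier S → CommutativeRing.Carrier S)
               (ρ-hom : RingMorphisms.IsRingHomomorphism (CommutativeRing.rawRing S) (CommutativeRing.rawRing S) ρ)
               (f : CommutativeRing.Carrier R → CommutativeRing.Carrier S)
               (f-hom : RingMorphisms.IsRingHomomorphism (CommutativeRing.rawRing R) (CommutativeRing.rawRing S) f)
               (f-σ : ∀ x → CommutativeRing._≈_ S (f (σ x)) (ρ (f x))) where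
  private
    module f = RingHom f-hom
    module R = Skew R σ σ-hom using (coeff; add; τ·; mul; _≋_; at)
    module RR = CommutativeRing R using (_*_)
  open CommutativeRing S using (Carrier; _≈_; _*_; refl; sym; trans; rawRing)
  open Skew S ρ ρ-hom using (coeff; add; τ·; mul; _≋_; mk; at; ≋-refl; ≋-trans; ∷-cong; add-cong; mul-congʳ)

  coeff-mapf : ∀ u n → coeff (map f u) n ≈ f (R.coeff u n)
  coeff-mapf []      n       = sym f.0#-homo
  coeff-mapf (a ∷ u) zero    = refl
  coeff-mapf (a ∷ u) (suc n) = coeff-mapf u n

  mapf-cong : ∀ {u v} → u R.≋ v → map f u ≋ map f v
  mapf-cong {u} {v} p = mk λ n → trans (coeff-mapf u n) (trans (f.⟦⟧-cong (R.at p n)) (sym (coeff-mapf v n)))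

  mapf-add : ∀ u v → map f (R.add u v) ≋ add (map f u) (map f v)
  mapf-add []      v       = ≋-refl
  mapf-add (a ∷ u) []      = ≋-refl
  mapf-add (a ∷ u) (b ∷ v) = ∷-cong (f.+-homo a b) (mapf-add u v)

  mapf-scale : ∀ a v → map f (map (a RR.*_) v) ≋ map (f a *_) (map f v)
  mapf-scale a []      = ≋-refl
  mapf-scale a (b ∷ v) = ∷-cong (f.*-homo a b) (mapf-scale a v)

  mapf-σ : ∀ v → map f (map σ v) ≋ map ρ (map f v)
  mapf-σ []      = ≋-refl
  mapf-σ (b ∷ v) = ∷-cong (f-σ b) (mapf-σ v)

  mapf-mul : ∀ u v → map f (R.mul u v) ≋ mul (map f u) (map f v)
  mapf-mul []      v = ≋-refl
  mapf-mul (a ∷ u) v = ≋-trans (mapf-add (map (a RR.*_) v) (R.mul u (R.τ· v)))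
    (add-cong (mapf-scale a v) (≋-trans (mapf-mul u (R.τ· v)) (mul-congʳ (map f u) (∷-cong f.0#-homo (mapf-σ v)))))

-- The characteristic polynomial of an endomorphism.  L{τ} is a module over L[t],
-- with t acting as right multiplication by φ and basis 1, τ.  Right multiplication
-- by u is L[t]-linear with matrix (α β ; γ ε); left multiplication by τ is
-- semilinear, which makes trace and determinant invariant under σ.

module CharacteristicPolynomial
    {q : ℕ} (k : FiniteField c ℓ q) (L : Domain c′ ℓ′) (ι : FiniteField.Carrier k → Domain.Carrier L)
    (ι-hom : RingMorphisms.IsRingHomomorphism (FiniteField.rawRing k) (Domain.rawRing L) ι)
    (θ g₁ g₂ h : Domain.Carrier L) (g₂h : Domain._≈_ L (Domain._*_ L g₂ h) (Domain.1# L)) where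
  open Domain L using (commutativeRing; 1≉0; Carrier; _≈_; _+_; _*_; -_; _-_; 0#; 1#; refl; sym; trans; setoid; rawRing; +-cong; +-congˡ; +-congʳ; *-congˡ; *-congʳ; +-assoc; +-comm; +-identityˡ; +-identityʳ; *-identityʳ; zeroˡ; zeroʳ; -‿cong; ^-congˡ; module Solver; difference-zero; *-cancelˡ)
  open Twist k L ι ι-hom using (fixed; ^q-zero; ^q-isRingHomomorphism; σ; Poly; coeff; add; τ·; mul; _≋_; mk; at; ≋-refl; ≋-sym; ≋-trans; ∷-cong; tail≋; coeff-add; coeff-scale; add-cong; scale-cong; neg-cong; add-comm; add-zeroʳ; add-negʳ; scale-add; add-scale; scale-scale; scale-zero; τ·-cong; τ·-add; τ·-scale; mul-congʳ; mul-zeroˡ; mul-congˡ; mul-distribʳ; mul-scale; mul-τ·; mul-assoc; mul-oneˡ; _<°_; below; vanish; _≤°_; <°-length; <°-resp; <°-mono; <°-add; <°-neg; <°-∷; <°-tail; <°0⇒≋[]; []-<°; mul-≤°; coeff₀-mul; mul-τ^; divide; module M; module ≋-Reasoning; multiple-below)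
  private
    module k = Domain (field⇒domain (FiniteField.asField k)) using ()
    module σ = RingHom ^q-isRingHomomorphism
    module P where
      open Poly commutativeRing public using (id-isRingHomomorphism; Poly; coeff; add; mul; _≋_; mk; at; ≋-refl; ≋-sym; ≋-trans; ∷-cong; tail≋; add-cong; neg-cong; add-negʳ; mul-congʳ; mul-congˡ; eval; mul-∷; mul-comm)
      open SkewDegree commutativeRing id id-isRingHomomorphism public using (_<°_; below; vanish; _≤°_; <°-length; <°-resp; <°-mono; <°-add; <°-neg; <°-∷; <°-tail; <°0⇒≋[]; []-<°; mul-≤°)
      open Domain (PolyDomain.polyDomain≋ L) public using (module Solver; *-cancelˡ; setoid; +-congˡ; +-congʳ; *-congˡ; *-congʳ; +-cong; *-cong)
    module σᴾ = SkewMap commutativeRing commutativeRing id P.id-isRingHomomorphism id P.id-isRingHomomorphism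
                  σ ^q-isRingHomomorphism (λ _ → refl) using (coeff-mapf; mapf-add; mapf-mul)
  open P using (eval)
  open Eval commutativeRing using (eval-cong; eval-add; eval-mul; eval-neg)

  φ : Poly
  φ = θ ∷ g₁ ∷ g₂ ∷ []

  φ≤ : φ ≤° 2
  φ≤ = <°-length φ

  g₂≉0 : ¬ g₂ ≈ 0#
  g₂≉0 p = 1≉0 (trans (sym g₂h) (trans (*-congʳ p) (zeroˡ h)))

  infixr 7 _•_
  _•_ : List Carrier → Poly → Poly
  []      • f = []
  (a ∷ α) • f = add (map (a *_) f) (mul (α • f) φ)

  •-zero : ∀ α f → α P.≋ [] → α • f ≋ []
  •-zero []      f p = ≋-refl
  •-zero (a ∷ α) f p = ≋-trans (add-cong (≋-trans (scale-cong (P.at p 0) ≋-refl) (scale-zero f))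
    (mul-zeroˡ _ φ (•-zero α f (P.mk λ n → P.at p (suc n))))) ≋-refl

  •-congˡ : ∀ {α β} f → α P.≋ β → α • f ≋ β • f
  •-congˡ {[]}    {β}     f p = ≋-sym (•-zero β f (P.≋-sym p))
  •-congˡ {a ∷ α} {[]}    f p = •-zero (a ∷ α) f p
  •-congˡ {a ∷ α} {b ∷ β} f p = add-cong (scale-cong (P.at p 0) ≋-refl) (mul-congˡ φ (•-congˡ f (P.tail≋ p)))

  •-congʳ : ∀ α {f g} → f ≋ g → α • f ≋ α • g
  •-congʳ []      p = ≋-refl
  •-congʳ (a ∷ α) p = add-cong (scale-cong refl p) (mul-congˡ φ (•-congʳ α p))

  private
    medial : ∀ s t u v → add (add s t) (add u v) ≋ add (add s u) (add t v)
    medial s t u v = begin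
      add (add s t) (add u v)    ≈⟨ M.+-assoc s t _ ⟩
      add s (add t (add u v))    ≈⟨ M.+-congˡ {s} (≋-sym (M.+-assoc t u v)) ⟩
      add s (add (add t u) v)    ≈⟨ M.+-congˡ {s} (M.+-congʳ {v} (M.+-comm t u)) ⟩
      add s (add (add u t) v)    ≈⟨ M.+-congˡ {s} (M.+-assoc u t v) ⟩
      add s (add u (add t v))    ≈⟨ M.+-assoc s u _ ⟨
      add (add s u) (add t v)    ∎
      where open ≋-Reasoning

  •-addˡ : ∀ α β f → P.add α β • f ≋ add (α • f) (β • f)
  •-addˡ []      β       f = ≋-refl
  •-addˡ (a ∷ α) []      f = ≋-sym (add-zeroʳ _)
  •-addˡ (a ∷ α) (b ∷ β) f = ≋-trans
    (add-cong (add-scale a b f) (≋-trans (mul-congˡ φ (•-addˡ α β f)) (mul-distribʳ φ (α • f) (β • f))))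
    (medial (map (a *_) f) (map (b *_) f) (mul (α • f) φ) (mul (β • f) φ))

  •-addʳ : ∀ α f g → α • add f g ≋ add (α • f) (α • g)
  •-addʳ []      f g = ≋-refl
  •-addʳ (a ∷ α) f g = ≋-trans
    (add-cong (scale-add a f g) (≋-trans (mul-congˡ φ (•-addʳ α f g)) (mul-distribʳ φ (α • f) (α • g))))
    (medial (map (a *_) f) (map (a *_) g) (mul (α • f) φ) (mul (α • g) φ))

  •-scale : ∀ a α f → map (a *_) α • f ≋ map (a *_) (α • f)
  •-scale a []      f = ≋-refl
  •-scale a (b ∷ α) f = ≋-trans
    (add-cong (≋-sym (scale-scale a b f)) (≋-trans (mul-congˡ φ (•-scale a α f)) (mul-scale a (α • f) φ)))
    (≋-sym (scale-add a (map (b *_) f) (mul (α • f) φ)))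

  •-mulˡ : ∀ α β f → P.mul α β • f ≋ α • β • f
  •-mulˡ []      β f = ≋-refl
  •-mulˡ (a ∷ α) β f = begin
    P.mul (a ∷ α) β • f                                         ≈⟨ •-congˡ f (P.mul-∷ a α β) ⟩
    P.add (map (a *_) β) (0# ∷ P.mul α β) • f                   ≈⟨ •-addˡ (map (a *_) β) _ f ⟩
    add (map (a *_) β • f) (add (map (0# *_) f) (mul (P.mul α β • f) φ))
      ≈⟨ add-cong (•-scale a β f) (≋-trans (add-cong (scale-zero f) (mul-congˡ φ (•-mulˡ α β f))) ≋-refl) ⟩
    add (map (a *_) (β • f)) (mul (α • β • f) φ)                ∎
    where open ≋-Reasoning

  •-mulʳ : ∀ α f u → mul u φ ≋ mul φ u → mul (α • f) u ≋ α • mul f u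
  •-mulʳ []      f u p = ≋-refl
  •-mulʳ (a ∷ α) f u p = begin
    mul (add (map (a *_) f) (mul (α • f) φ)) u               ≈⟨ mul-distribʳ u (map (a *_) f) _ ⟩
    add (mul (map (a *_) f) u) (mul (mul (α • f) φ) u)       ≈⟨ add-cong (mul-scale a f u) (mul-assoc (α • f) φ u) ⟩
    add (map (a *_) (mul f u)) (mul (α • f) (mul φ u))       ≈⟨ add-cong ≋-refl (mul-congʳ (α • f) (≋-sym p)) ⟩
    add (map (a *_) (mul f u)) (mul (α • f) (mul u φ))       ≈⟨ add-cong ≋-refl (≋-sym (mul-assoc (α • f) u φ)) ⟩
    add (map (a *_) (mul f u)) (mul (mul (α • f) u) φ)       ≈⟨ add-cong ≋-refl (mul-congˡ φ (•-mulʳ α f u p)) ⟩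
    add (map (a *_) (mul f u)) (mul (α • mul f u) φ)         ∎
    where open ≋-Reasoning

  •-τ : ∀ α f → τ· (α • f) ≋ map σ α • τ· f
  •-τ []      f = mk λ { zero → refl ; (suc n) → refl }
  •-τ (a ∷ α) f = ≋-trans (τ·-add (map (a *_) f) (mul (α • f) φ))
    (add-cong (τ·-scale a f) (≋-trans (≋-sym (mul-τ· (α • f) φ)) (mul-congˡ φ (•-τ α f))))

  one t : Poly
  one = 1# ∷ []
  t   = 0# ∷ 1# ∷ []

  τ·one : τ· one ≋ t
  τ·one = ∷-cong refl (∷-cong σ.1#-homo ≋-refl)

  ⟦_,_⟧ : List Carrier → List Carrier → Poly
  ⟦ α , β ⟧ = add (α • one) (β • t)

  ⟦⟧-cong : ∀ {α β α′ β′} → α P.≋ α′ → β P.≋ β′ → ⟦ α , β ⟧ ≋ ⟦ α′ , β′ ⟧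
  ⟦⟧-cong p r = add-cong (•-congˡ one p) (•-congˡ t r)

  ⟦⟧-add : ∀ α β α′ β′ → add ⟦ α , β ⟧ ⟦ α′ , β′ ⟧ ≋ ⟦ P.add α α′ , P.add β β′ ⟧
  ⟦⟧-add α β α′ β′ = ≋-trans (medial (α • one) (β • t) (α′ • one) (β′ • t))
    (≋-sym (add-cong (•-addˡ α α′ one) (•-addˡ β β′ t)))

  ⟦⟧-• : ∀ η α β → η • ⟦ α , β ⟧ ≋ ⟦ P.mul η α , P.mul η β ⟧
  ⟦⟧-• η α β = ≋-trans (•-addʳ η (α • one) (β • t)) (≋-sym (add-cong (•-mulˡ η α one) (•-mulˡ η β t)))

  ⟦⟧-∷ : ∀ a b α β → ⟦ a ∷ α , b ∷ β ⟧ ≋ add (a ∷ b ∷ []) (mul ⟦ α , β ⟧ φ)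
  ⟦⟧-∷ a b α β = ≋-trans (medial (map (a *_) one) (mul (α • one) φ) (map (b *_) t) (mul (β • t) φ))
    (add-cong (∷-cong (trans (+-cong (*-identityʳ a) (zeroʳ b)) (+-identityʳ a)) (∷-cong (*-identityʳ b) ≋-refl))
      (≋-sym (mul-distribʳ φ (α • one) (β • t))))

  -- Repeated right division by φ, which has degree 2, gives an expansion Σ rᵢ φⁱ with digits rᵢ of
  -- degree at most 1; α collects their constant terms and β their coefficients of τ.
  decompose : ∀ e u → u <° e ℕ.+ e → ∃[ α ] ∃[ β ] α P.<° e × β P.<° e × u ≋ ⟦ α , β ⟧
  decompose zero    u p = [] , [] , P.[]-<° , P.[]-<° , <°0⇒≋[] p
  decompose (suc e) u p =
    let v , r , u≋ , v< , r< = divide {φ} {2} {h} φ≤ g₂h (suc e ℕ.+ suc e) u p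
        α , β , α< , β< , v≋ = decompose e v (≡.subst (v <°_) (≡.cong (ℕ._∸ 1) (ℕ.+-suc e e)) v<)
    in coeff r 0 ∷ α , coeff r 1 ∷ β , P.<°-∷ α< , P.<°-∷ β< ,
       ≋-trans u≋ (≋-trans (add-cong (mul-congˡ φ v≋) (two r r<))
         (≋-trans (add-comm (mul ⟦ α , β ⟧ φ) _) (≋-sym (⟦⟧-∷ (coeff r 0) (coeff r 1) α β))))
    where
    two : ∀ r → r <° 2 → r ≋ coeff r 0 ∷ coeff r 1 ∷ []
    two r r< = mk λ { 0 → refl ; 1 → refl ; (suc (suc n)) → vanish r< (suc (suc n)) (s≤s (s≤s z≤n)) }

  private
    head₀ : List Carrier → Carrier
    head₀ []      = 0#
    head₀ (a ∷ _) = a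

    tail₀ : List Carrier → List Carrier
    tail₀ []      = []
    tail₀ (_ ∷ α) = α

    uncons : ∀ α → α P.≋ head₀ α ∷ tail₀ α
    uncons []      = P.mk λ { zero → refl ; (suc n) → refl }
    uncons (a ∷ α) = P.≋-refl

  -- Uniqueness of the digits: the part divisible by φ equals minus the lowest digit, so it has
  -- degree below 2 and must vanish; the lowest digit is then zero too.
  independent : ∀ N α β → α P.<° N → β P.<° N → ⟦ α , β ⟧ ≋ [] → α P.≋ [] × β P.≋ []
  independent zero    α β α< β< p = P.<°0⇒≋[] α< , P.<°0⇒≋[] β<
  independent (suc N) α β α< β< p =
    (P.≋-trans (uncons α) (zero-∷ (trans (sym (+-identityʳ _)) (digits 0)) α≋0)) ,
    (P.≋-trans (uncons β) (zero-∷ (trans (sym (+-identityʳ _)) (digits 1)) β≋0))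
    where
    α′ = tail₀ α
    β′ = tail₀ β
    r = head₀ α ∷ head₀ β ∷ []
    zero-∷ : ∀ {a v} → a ≈ 0# → v P.≋ [] → a ∷ v P.≋ []
    zero-∷ a≈0 v≋0 = P.mk λ { zero → a≈0 ; (suc n) → P.at v≋0 n }
    sum : add r (mul ⟦ α′ , β′ ⟧ φ) ≋ []
    sum = ≋-trans (≋-sym (⟦⟧-∷ (head₀ α) (head₀ β) α′ β′)) (≋-trans (≋-sym (⟦⟧-cong (uncons α) (uncons β))) p)
    tail-zero : ⟦ α′ , β′ ⟧ ≋ []
    tail-zero = multiple-below φ≤ g₂≉0 ⟦ α′ , β′ ⟧ (below λ n 2≤n → begin
      coeff (mul ⟦ α′ , β′ ⟧ φ) n                     ≈⟨ +-identityˡ _ ⟨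
      0# + coeff (mul ⟦ α′ , β′ ⟧ φ) n                ≈⟨ +-congʳ (vanish (<°-length r) n 2≤n) ⟨
      coeff r n + coeff (mul ⟦ α′ , β′ ⟧ φ) n         ≈⟨ coeff-add r (mul ⟦ α′ , β′ ⟧ φ) n ⟨
      coeff (add r (mul ⟦ α′ , β′ ⟧ φ)) n             ≈⟨ at sum n ⟩
      0#                                              ∎)
      where open SetoidReasoning setoid
    digits : ∀ n → coeff r n + 0# ≈ 0#
    digits n = trans (+-congˡ (sym (at (mul-zeroˡ _ φ tail-zero) n))) (trans (sym (coeff-add r (mul ⟦ α′ , β′ ⟧ φ) n)) (at sum n))
    tails = independent N α′ β′ (P.<°-tail (P.<°-resp (uncons α) α<)) (P.<°-tail (P.<°-resp (uncons β) β<)) tail-zero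
    α≋0 = proj₁ tails
    β≋0 = proj₂ tails

  ⟦⟧-injective : ∀ {α β α′ β′} → ⟦ α , β ⟧ ≋ ⟦ α′ , β′ ⟧ → α P.≋ α′ × β P.≋ β′
  ⟦⟧-injective {α} {β} {α′} {β′} p = P-equal (proj₁ zeros) , P-equal (proj₂ zeros)
    where
    open Domain (PolyDomain.polyDomain≋ L) using () renaming (difference-zero to P-equal)
    neg : List Carrier → List Carrier
    neg v = map -_ v
    ⟦⟧-zero : ⟦ P.add α (neg α′) , P.add β (neg β′) ⟧ ≋ []
    ⟦⟧-zero = begin
      ⟦ P.add α (neg α′) , P.add β (neg β′) ⟧     ≈⟨ ⟦⟧-add α β (neg α′) (neg β′) ⟨
      add ⟦ α , β ⟧ ⟦ neg α′ , neg β′ ⟧           ≈⟨ add-cong p ≋-refl ⟩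
      add ⟦ α′ , β′ ⟧ ⟦ neg α′ , neg β′ ⟧         ≈⟨ ⟦⟧-add α′ β′ (neg α′) (neg β′) ⟩
      ⟦ P.add α′ (neg α′) , P.add β′ (neg β′) ⟧   ≈⟨ ⟦⟧-cong (P.add-negʳ α′) (P.add-negʳ β′) ⟩
      []                                          ∎
      where open ≋-Reasoning
    N₁ = length (P.add α (neg α′))
    N₂ = length (P.add β (neg β′))
    zeros = independent (N₁ ℕ.+ N₂) (P.add α (neg α′)) (P.add β (neg β′))
      (P.<°-mono (ℕ.m≤m+n N₁ N₂) (P.<°-length _)) (P.<°-mono (ℕ.m≤n+m N₂ N₁) (P.<°-length _)) ⟦⟧-zero

  private
    -- The coordinates of τ² in the basis 1, τ, obtained from τ² = h (φ - θ - g₁ τ), where h φ is h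
    -- times the variable of L[t].
    λ′ μ : List Carrier
    λ′ = - (h * θ) ∷ h ∷ []
    μ  = - (h * g₁) ∷ []

    τ·t : τ· t ≋ ⟦ λ′ , μ ⟧
    τ·t = mk λ
      { 0 → solve 3 (λ h θ g → con ℤ.0ℤ := :- (h :* θ) :* con ℤ.1ℤ :+ h :* con ℤ.1ℤ :* θ :+ :- (h :* g) :* con ℤ.0ℤ) refl h θ g₁
      ; 1 → trans ^q-zero (solve 2 (λ h g → con ℤ.0ℤ := h :* con ℤ.1ℤ :* g :+ :- (h :* g) :* con ℤ.1ℤ) refl h g₁)
      ; 2 → trans σ.1#-homo (trans (sym g₂h) (solve 2 (λ g h → g :* h := h :* con ℤ.1ℤ :* g) refl g₂ h))
      ; (suc (suc (suc n))) → refl }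
      where open Solver

    λ′≤ : λ′ P.≤° 1
    λ′≤ = P.<°-length λ′

    λ′≉0 : ¬ λ′ P.≋ []
    λ′≉0 p = 1≉0 (trans (sym g₂h) (trans (*-congˡ (P.at p 1)) (zeroʳ g₂)))

    eval-λ′ : eval λ′ θ ≈ 0#
    eval-λ′ = solve 2 (λ h θ → :- (h :* θ) :+ θ :* (h :+ θ :* con ℤ.0ℤ) := con ℤ.0ℤ) refl h θ
      where open Solver

  -- On constant terms right multiplication by φ is multiplication by θ.
  coeff₀-• : ∀ α f → coeff (α • f) 0 ≈ eval α θ * coeff f 0
  coeff₀-• []      f = sym (zeroˡ _)
  coeff₀-• (a ∷ α) f = begin
    coeff (add (map (a *_) f) (mul (α • f) φ)) 0         ≈⟨ coeff-add (map (a *_) f) _ 0 ⟩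
    coeff (map (a *_) f) 0 + coeff (mul (α • f) φ) 0     ≈⟨ +-cong (coeff-scale a f 0) (coeff₀-mul (α • f) φ) ⟩
    a * coeff f 0 + coeff (α • f) 0 * θ                  ≈⟨ +-congˡ (*-congʳ (coeff₀-• α f)) ⟩
    a * coeff f 0 + eval α θ * coeff f 0 * θ             ≈⟨ solve 4 (λ a f e θ → a :* f :+ e :* f :* θ := (a :+ θ :* e) :* f) refl a (coeff f 0) (eval α θ) θ ⟩
    (a + θ * eval α θ) * coeff f 0                       ∎
    where open SetoidReasoning setoid
          open Solver

  module Matrix (e : ℕ) (u : Poly) (commutes : mul u φ ≋ mul φ u)
                (α β : List Carrier) (α≤ : α P.≤° e) (β≤ : β P.≤° e) (u≋ : u ≋ ⟦ α , β ⟧) where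
    -- γ and ε form the second row of the matrix: τ u = σ(α) τ + σ(β) τ², with τ² replaced by its
    -- coordinates λ′ and μ.
    ασ βσ γ ε γσ εσ : List Carrier
    ασ = map σ α
    βσ = map σ β
    γ  = P.mul βσ λ′
    ε  = P.add ασ (P.mul βσ μ)
    γσ = map σ γ
    εσ = map σ ε

    τ·⟦⟧ : ∀ α β → τ· ⟦ α , β ⟧ ≋ ⟦ P.mul (map σ β) λ′ , P.add (map σ α) (P.mul (map σ β) μ) ⟧
    τ·⟦⟧ α β = begin
      τ· ⟦ α , β ⟧                                                     ≈⟨ τ·-add (α • one) (β • t) ⟩
      add (τ· (α • one)) (τ· (β • t))                                  ≈⟨ add-cong (•-τ α one) (•-τ β t) ⟩
      add (map σ α • τ· one) (map σ β • τ· t)                          ≈⟨ add-cong (•-congʳ (map σ α) τ·one) (•-congʳ (map σ β) τ·t) ⟩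
      add ⟦ [] , map σ α ⟧ (map σ β • ⟦ λ′ , μ ⟧)                      ≈⟨ add-cong (≋-refl {⟦ [] , map σ α ⟧}) (⟦⟧-• (map σ β) λ′ μ) ⟩
      add ⟦ [] , map σ α ⟧ ⟦ P.mul (map σ β) λ′ , P.mul (map σ β) μ ⟧  ≈⟨ ⟦⟧-add [] (map σ α) (P.mul (map σ β) λ′) (P.mul (map σ β) μ) ⟩
      ⟦ P.mul (map σ β) λ′ , P.add (map σ α) (P.mul (map σ β) μ) ⟧     ∎
      where open ≋-Reasoning

    τu≋ : τ· u ≋ ⟦ γ , ε ⟧
    τu≋ = ≋-trans (τ·-cong u≋) (τ·⟦⟧ α β)

    t-mul : mul t u ≋ τ· u
    t-mul = mul-τ^ 1 u

    -- τ² u is expanded as τ (τ u) and as (τ²) u. Comparing coordinates yields the two relations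
    -- from which the invariance of trace and determinant follows.
    ττu : ⟦ P.mul εσ λ′ , P.add γσ (P.mul εσ μ) ⟧ ≋ ⟦ P.add (P.mul λ′ α) (P.mul μ γ) , P.add (P.mul λ′ β) (P.mul μ ε) ⟧
    ττu = begin
      ⟦ P.mul εσ λ′ , P.add γσ (P.mul εσ μ) ⟧                          ≈⟨ τ·⟦⟧ γ ε ⟨
      τ· ⟦ γ , ε ⟧                                                     ≈⟨ τ·-cong τu≋ ⟨
      τ· (τ· u)                                                        ≈⟨ τ·-cong t-mul ⟨
      τ· (mul t u)                                                     ≈⟨ mul-τ· t u ⟨
      mul (τ· t) u                                                     ≈⟨ mul-congˡ u τ·t ⟩
      mul ⟦ λ′ , μ ⟧ u                                                 ≈⟨ mul-distribʳ u (λ′ • one) (μ • t) ⟩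
      add (mul (λ′ • one) u) (mul (μ • t) u)                           ≈⟨ add-cong (•-mulʳ λ′ one u commutes) (•-mulʳ μ t u commutes) ⟩
      add (λ′ • mul one u) (μ • mul t u)                               ≈⟨ add-cong (•-congʳ λ′ (≋-trans (mul-oneˡ u) u≋)) (•-congʳ μ (≋-trans t-mul τu≋)) ⟩
      add (λ′ • ⟦ α , β ⟧) (μ • ⟦ γ , ε ⟧)                             ≈⟨ add-cong (⟦⟧-• λ′ α β) (⟦⟧-• μ γ ε) ⟩
      add ⟦ P.mul λ′ α , P.mul λ′ β ⟧ ⟦ P.mul μ γ , P.mul μ ε ⟧        ≈⟨ ⟦⟧-add (P.mul λ′ α) (P.mul λ′ β) _ _ ⟩
      ⟦ P.add (P.mul λ′ α) (P.mul μ γ) , P.add (P.mul λ′ β) (P.mul μ ε) ⟧ ∎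
      where open ≋-Reasoning

    ττu-entries = ⟦⟧-injective {P.mul εσ λ′} {P.add γσ (P.mul εσ μ)}
                    {P.add (P.mul λ′ α) (P.mul μ γ)} {P.add (P.mul λ′ β) (P.mul μ ε)} ττu

    module PS = P.Solver
    module P-Reasoning = SetoidReasoning P.setoid

    infixl 6 _⊕_ _⊖_
    infixl 7 _⊗_
    _⊕_ _⊖_ _⊗_ : List Carrier → List Carrier → List Carrier
    _⊕_ = P.add
    _⊗_ = P.mul
    x ⊖ y = x ⊕ map -_ y

    -- The first entry of `ττu`, after cancelling λ′, which also divides γ = σ(β) λ′.
    εσ≋ : εσ P.≋ α ⊕ μ ⊗ βσ
    εσ≋ = P.*-cancelˡ {λ′} λ′≉0 (begin
      λ′ ⊗ εσ                    ≈⟨ P.mul-comm λ′ εσ ⟩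
      εσ ⊗ λ′                    ≈⟨ proj₁ ττu-entries ⟩
      λ′ ⊗ α ⊕ μ ⊗ (βσ ⊗ λ′)     ≈⟨ PS.solve 4 (λ l a m b → l PS.:* a PS.:+ m PS.:* (b PS.:* l) PS.:= l PS.:* (a PS.:+ m PS.:* b)) P.≋-refl λ′ α μ βσ ⟩
      λ′ ⊗ (α ⊕ μ ⊗ βσ)          ∎)
      where open P-Reasoning

    trace det : List Carrier
    trace = α ⊕ ε
    det   = α ⊗ ε ⊖ β ⊗ γ

    trace-fixed : map σ trace P.≋ trace
    trace-fixed = begin
      map σ (α ⊕ ε)                    ≈⟨ σᴾ.mapf-add α ε ⟩
      ασ ⊕ εσ                          ≈⟨ P.add-cong P.≋-refl εσ≋ ⟩
      ασ ⊕ (α ⊕ μ ⊗ βσ)                ≈⟨ PS.solve 4 (λ s a m b → s PS.:+ (a PS.:+ m PS.:* b) PS.:= a PS.:+ (s PS.:+ b PS.:* m)) P.≋-refl ασ α μ βσ ⟩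
      α ⊕ (ασ ⊕ βσ ⊗ μ)                ∎
      where open P-Reasoning

    det-fixed : map σ det P.≋ det
    det-fixed = begin
      map σ (α ⊗ ε ⊖ β ⊗ γ)                                  ≈⟨ σᴾ.mapf-add (α ⊗ ε) (map -_ (β ⊗ γ)) ⟩
      map σ (α ⊗ ε) ⊕ map σ (map -_ (β ⊗ γ))                 ≈⟨ P.add-cong (σᴾ.mapf-mul α ε) (P.≋-trans (map-neg (β ⊗ γ)) (P.neg-cong (σᴾ.mapf-mul β γ))) ⟩
      -- The second entry of `ττu` determines only γσ + εσ μ, so εσ μ is added and subtracted.
      ασ ⊗ εσ ⊖ βσ ⊗ γσ                                      ≈⟨ PS.solve 6 (λ s e b g m x → s PS.:* e PS.:- b PS.:* g PS.:= s PS.:* e PS.:- b PS.:* ((g PS.:+ e PS.:* m) PS.:- e PS.:* m)) P.≋-refl ασ εσ βσ γσ μ λ′ ⟩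
      ασ ⊗ εσ ⊖ βσ ⊗ (γσ ⊕ εσ ⊗ μ ⊖ εσ ⊗ μ)                  ≈⟨ P.add-cong (P.mul-congʳ ασ εσ≋) (P.neg-cong (P.mul-congʳ βσ
                                                                  (P.add-cong (proj₂ ττu-entries) (P.neg-cong (P.mul-congˡ μ εσ≋))))) ⟩
      ασ ⊗ (α ⊕ μ ⊗ βσ) ⊖ βσ ⊗ (λ′ ⊗ β ⊕ μ ⊗ (ασ ⊕ βσ ⊗ μ) ⊖ (α ⊕ μ ⊗ βσ) ⊗ μ)
        ≈⟨ PS.solve 6 (λ s a m b l c → s PS.:* (a PS.:+ m PS.:* b) PS.:- b PS.:* (l PS.:* c PS.:+ m PS.:* (s PS.:+ b PS.:* m) PS.:- (a PS.:+ m PS.:* b) PS.:* m)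
                          PS.:= a PS.:* (s PS.:+ b PS.:* m) PS.:- c PS.:* (b PS.:* l)) P.≋-refl ασ α μ βσ λ′ β ⟩
      α ⊗ (ασ ⊕ βσ ⊗ μ) ⊖ β ⊗ (βσ ⊗ λ′)                      ∎
      where
      open P-Reasoning
      map-neg : ∀ v → map σ (map -_ v) P.≋ map -_ (map σ v)
      map-neg []      = P.≋-refl
      map-neg (a ∷ v) = P.∷-cong (σ.-‿homo a) (map-neg v)

    private
      σᴾ-≤° : ∀ {v N} → v P.<° N → map σ v P.<° N
      σᴾ-≤° {v} p = P.below λ n N≤n → trans (σᴾ.coeff-mapf v n) (trans (^-congˡ q (P.vanish p n N≤n)) ^q-zero)

    ε≤ : ε P.≤° e
    ε≤ = P.<°-add (σᴾ-≤° α≤) (≡.subst (P.mul βσ μ P.≤°_) (ℕ.+-identityʳ e) (P.mul-≤° (σᴾ-≤° β≤) (P.<°-length μ)))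

    trace≤ : trace P.≤° e
    trace≤ = P.<°-add α≤ ε≤

    det≤ : det P.≤° e ℕ.+ suc e
    det≤ = P.<°-add (P.<°-mono (s≤s (ℕ.+-monoʳ-≤ e (ℕ.n≤1+n e))) (P.mul-≤° α≤ ε≤))
      (P.<°-neg (P.mul-≤° β≤ (≡.subst (P.mul βσ λ′ P.≤°_) (ℕ.+-comm e 1) (P.mul-≤° (σᴾ-≤° β≤) λ′≤))))

    -- At t = θ the matrix is triangular with the constant term of u on the diagonal.
    characteristic-equation : ∀ x → coeff u 0 ≈ x → x * x - eval trace θ * x + eval det θ ≈ 0#
    characteristic-equation x u₀ = begin
      x * x - eval trace θ * x + eval det θ
        ≈⟨ +-cong (+-congˡ (-‿cong (*-congʳ (trans (eval-add α ε θ) (+-congʳ α₀))))) det₀ ⟩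
      x * x - (x + eval ε θ) * x + x * eval ε θ
        ≈⟨ solve 2 (λ x y → x :* x :- (x :+ y) :* x :+ x :* y := con ℤ.0ℤ) refl x (eval ε θ) ⟩
      0# ∎
      where
      open SetoidReasoning setoid
      open Solver
      α₀ : eval α θ ≈ x
      α₀ = begin
        eval α θ                             ≈⟨ solve 2 (λ a b → a := a :* con ℤ.1ℤ :+ b :* con ℤ.0ℤ) refl (eval α θ) (eval β θ) ⟩
        eval α θ * 1# + eval β θ * 0#        ≈⟨ +-cong (coeff₀-• α one) (coeff₀-• β t) ⟨
        coeff (α • one) 0 + coeff (β • t) 0  ≈⟨ coeff-add (α • one) (β • t) 0 ⟨
        coeff ⟦ α , β ⟧ 0                    ≈⟨ at u≋ 0 ⟨
        coeff u 0                            ≈⟨ u₀ ⟩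
        x                                    ∎
      γ₀ : eval γ θ ≈ 0#
      γ₀ = trans (eval-mul βσ λ′ θ) (trans (*-congˡ eval-λ′) (zeroʳ _))
      det₀ : eval det θ ≈ x * eval ε θ
      det₀ = begin
        eval det θ                                       ≈⟨ eval-add (α ⊗ ε) _ θ ⟩
        eval (α ⊗ ε) θ + eval (map -_ (β ⊗ γ)) θ         ≈⟨ +-cong (trans (eval-mul α ε θ) (*-congʳ α₀)) (trans (eval-neg (β ⊗ γ) θ) (-‿cong (trans (eval-mul β γ θ) (trans (*-congˡ γ₀) (zeroʳ _))))) ⟩
        x * eval ε θ - 0#                                ≈⟨ solve 1 (λ y → y :- con ℤ.0ℤ := y) refl _ ⟩
        x * eval ε θ                                     ∎

  -- Each coefficient satisfies x^q = x and so comes from k by `fixed`. The exact length lets degree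
  -- bounds be read off the list over k.
  descend : ∀ N f → f P.<° N → map σ f P.≋ f → ∃[ F ] length F ≡ N × map ι F P.≋ f
  descend zero    f f< fσ = [] , ≡.refl , P.≋-sym (P.<°0⇒≋[] f<)
  descend (suc N) f f< fσ =
    let a , r = fixed (head₀ f) (trans (σ-head f) (trans (P.at fσ 0) (sym (head-coeff f))))
        F , |F| , F≋ = descend N (tail₀ f) (P.<°-tail (P.<°-resp (uncons f) f<)) (σ-tail f fσ)
    in a ∷ F , ≡.cong suc |F| , P.≋-trans (P.∷-cong (sym r) F≋) (P.≋-sym (uncons f))
    where
    head-coeff : ∀ f → head₀ f ≈ P.coeff f 0
    head-coeff []      = refl
    head-coeff (a ∷ f) = refl
    σ-head : ∀ f → σ (head₀ f) ≈ P.coeff (map σ f) 0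
    σ-head []      = ^q-zero
    σ-head (a ∷ f) = refl
    σ-tail : ∀ f → map σ f P.≋ f → map σ (tail₀ f) P.≋ tail₀ f
    σ-tail []      p = P.≋-refl
    σ-tail (a ∷ f) p = P.tail≋ p

  -- The quadratic relation is recorded at the constant term of u, where it is an equation in the
  -- commutative ring L and the square can be completed. The trace has degree at most e and the norm
  -- at most 2e + 1.
  quadratic : ∀ e u → mul u φ ≋ mul φ u → u <° suc e ℕ.+ suc e →
              ∃[ a ] ∃[ b ] length a ≡ suc e × length b ≡ suc (e ℕ.+ suc e) ×
              coeff u 0 * coeff u 0 - eval (map ι a) θ * coeff u 0 + eval (map ι b) θ ≈ 0#
  quadratic e u commutes u< =
    let α , β , α< , β< , u≋ = decompose (suc e) u u<
        open Matrix e u commutes α β α< β< u≋ using (ασ; βσ; γ; ε; γσ; εσ; τ·⟦⟧; τu≋; t-mul; ττu; module PS; module P-Reasoning; _⊕_; _⊖_; _⊗_; εσ≋; trace; det; trace-fixed; det-fixed; ε≤; trace≤; det≤; characteristic-equation)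
        a , |a| , a≋ = descend (suc e) trace trace≤ trace-fixed
        b , |b| , b≋ = descend (suc (e ℕ.+ suc e)) det det≤ det-fixed
    in a , b , |a| , |b| , trans
      (+-cong (+-congˡ (-‿cong (*-congʳ (eval-cong θ a≋)))) (eval-cong θ b≋))
      (characteristic-equation (coeff u 0) refl)

-- Rank 2 Drinfeld modules and their torsion

module Constants {c ℓ : Level} {q : ℕ} (k : FiniteField c ℓ q) where
  open PolyQuotient k using (kᴰ; Aᴰ)
  private
    module k = Domain kᴰ using (commutativeRing; 1#; refl; +-identityʳ)
    module A = Domain Aᴰ using (commutativeRing; 1#; refl; rawRing; +-identityʳ)
  open Poly k.commutativeRing using (Poly; add; mul; _≋_; ≋-refl; ≋-sym; ≋-trans; ∷-cong; add-cong; mul-shiftʳ; mul-oneʳ; constant; T)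

  constant-hom : RingMorphisms.IsRingHomomorphism (FiniteField.rawRing k) A.rawRing constant
  constant-hom = record
    { isSemiringHomomorphism = record
      { isNearSemiringHomomorphism = record
        { +-isMonoidHomomorphism = record
          { isMagmaHomomorphism = record
            { isRelHomomorphism = record { cong = λ p → λ { zero → p ; (suc n) → k.refl } }
            ; homo = λ _ _ _ → k.refl }
          ; ε-homo = λ { zero → k.refl ; (suc n) → k.refl } }
        ; *-homo = λ _ _ _ → k.refl }
      ; 1#-homo = λ _ → k.refl }
    ; -‿homo = λ _ _ → k.refl }

  ∷-horner : ∀ a f → a ∷ f ≋ add (constant a) (mul f T)
  ∷-horner a f = ≋-sym (≋-trans (add-cong {constant a} ≋-refl (≋-trans (mul-shiftʳ f (k.1# ∷ [])) (∷-cong k.refl (mul-oneʳ f))))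
    (∷-cong (k.+-identityʳ a) ≋-refl))

module Drinfeld {c ℓ c′ ℓ′ : Level} {q : ℕ} (k : FiniteField c ℓ q) (L : Domain c′ ℓ′)
                (γ : RawRing.Carrier (FunctionField.A k) → Domain.Carrier L)
                (γ-hom : RingMorphisms.IsRingHomomorphism (FunctionField.A k) (Domain.rawRing L) γ) where
  open PolyQuotient k using (kᴰ; Aᴰ)
  open FunctionField k using (DrinfeldModule; T; constant; Monic; _∣_; A/-module; _⊕_; module Twisted)
  open Constants k using (constant-hom; ∷-horner)
  private
    module k = Domain kᴰ using (1≉0; Carrier; _≈_; 0#; refl; sym; trans)
    module A where
      open Domain Aᴰ public using (commutativeRing; Carrier; _+_; _*_; 0#; 1#)
      open Poly (Domain.commutativeRing kᴰ) public using (id-isRingHomomorphism; Poly; coeff; add; mul; _≋_; mk; at; ≋-refl; ≋-sym; ≋-trans; mul-congʳ; mul-zeroˡ; mul-oneˡ; mul-comm)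
      open SkewDegree (Domain.commutativeRing kᴰ) id id-isRingHomomorphism public using (_<°_; _≤°_; <°-∷; <°-tail; <°0⇒≋[]; []-<°)
    module γ = RingHom γ-hom
  open Domain L using (commutativeRing; 1≉0; Carrier; _≈_; _+_; _*_; 0#; 1#; refl; sym; trans; setoid; rawRing; +-cong; +-congˡ; +-congʳ; *-congˡ; *-congʳ; +-comm; *-comm; +-identityˡ; +-identityʳ; *-identityʳ; zeroʳ; module Solver; *-cancelˡ)

  ι : k.Carrier → Carrier
  ι a = γ (constant a)

  ι-hom : RingMorphisms.IsRingHomomorphism (FiniteField.rawRing k) rawRing ι
  ι-hom = Composition.isRingHomomorphism trans constant-hom γ-hom

  open Twist k L ι ι-hom public using (ι-injective; ι-^; ι-fixed; 2≤q; ^q≈; linear; linear-product; ∏-zero; proportional; fixed; ^q-+; ^q-zero; ^q-injective₀; ^q-neg; ^q-isRingHomomorphism; iter-^q; iter-ι; σ; rawSkew; Poly; coeff; add; τ·; mul; act; _≋_; mk; at; ≋-refl; ≋-sym; ≋-trans; ∷-cong; tail≋; coeff-add; coeff-map; coeff-scale; coeff-neg; coeff-σ; add-cong; scale-cong; mapσ-cong; neg-cong; add-assoc; add-comm; add-zeroʳ; add-negʳ; scale-add; add-scale; scale-scale; scale-zero; scale-one; mapσ-add; mapσ-scale; τ·-cong; τ·-add; τ·-scale; mul-congʳ; mul-zeroʳ; mul-zeroˡ; mul-congˡ; mul-cong; mul-distribʳ; mul-distribˡ; mul-scale; mul-mapσ; mul-τ·; mul-assoc; mul-oneˡ; mul-shiftʳ;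 mul-oneʳ; skewRing; unwrap; _<°_; below; vanish; _≤°_; <°-length; <°-resp; <°-mono; <°-add; <°-neg; <°-scale; <°-mapσ; <°-∷; <°-tail; <°0⇒≋[]; []-<°; τ·-≤°; mul-≤°; coeff-mul-lead; coeff₀-mul; coeff-mul-const; τ^; τ^-≤°; coeff-τ^; mul-τ^; mul-τ^ʳ; divide; act-cong; act-add; act-scale; act-mapσ; act-mul; act-+; act-0; act-τ^; degree?; zero-poly?; iter-nonzero; lead-nonzero; mul-zero-product; module M; module ≋-Reasoning; lin; Independent; lin-0; lin-++; act-ι; act-lin; Kills; too-many-roots; multiple-below; central; module Division)
  private module σ = RingHom ^q-isRingHomomorphism

  γ-∷ : ∀ a f → γ (a ∷ f) ≈ ι a + γ f * γ T
  γ-∷ a f = trans (γ.⟦⟧-cong (A.at (∷-horner a f))) (trans (γ.+-homo (constant a) (A.mul f T)) (+-congˡ (γ.*-homo f T)))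

  γ-[] : γ [] ≈ 0#
  γ-[] = γ.0#-homo

  γ-eval : ∀ f → Poly.eval commutativeRing (map ι f) (γ T) ≈ γ f
  γ-eval []      = sym γ-[]
  γ-eval (a ∷ f) = trans (+-congˡ (trans (*-comm _ _) (*-congʳ (γ-eval f)))) (sym (γ-∷ a f))

  module Module (D : DrinfeldModule rawRing γ 2) where
    open DrinfeldModule D public using (ψ; g; constant-term; leading; above-rank)
    private module ψ = RingHom (DrinfeldModule.isRingHomomorphism D)

    ψ-cong : ∀ {f f′} → f A.≋ f′ → ψ f ≋ ψ f′
    ψ-cong p = mk (ψ.⟦⟧-cong (A.at p))

    ψ-add : ∀ f f′ → ψ (A.add f f′) ≋ add (ψ f) (ψ f′)
    ψ-add f f′ = mk (ψ.+-homo f f′)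

    ψ-mul : ∀ f f′ → ψ (A.mul f f′) ≋ mul (ψ f) (ψ f′)
    ψ-mul f f′ = mk (ψ.*-homo f f′)

    ψ-[] : ψ [] ≋ []
    ψ-[] = mk ψ.0#-homo

    φ : Poly
    φ = γ T ∷ g 1 ∷ g 2 ∷ []

    φ≤ : φ ≤° 2
    φ≤ = <°-length φ

    ψ-T : ψ T ≋ φ
    ψ-T = mk λ { 0 → constant-term ; 1 → refl ; 2 → refl ; (suc (suc (suc n))) → above-rank (suc (suc (suc n))) (s≤s (s≤s (s≤s z≤n))) }

    -- Horner's rule a + f T carried over by ψ. It expresses ψ through φ alone, and the inductions
    -- on f below run along it.
    ψ-∷ : ∀ a f → ψ (a ∷ f) ≋ add (ι a ∷ []) (mul (ψ f) φ)
    ψ-∷ a f = ≋-trans (ψ-cong (∷-horner a f)) (≋-trans (ψ-add (constant a) (A.mul f T))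
      (add-cong (mk (DrinfeldModule.isAlgebra D a)) (≋-trans (ψ-mul f T) (mul-congʳ (ψ f) ψ-T))))

    ψ-coeff₀ : ∀ f → coeff (ψ f) 0 ≈ γ f
    ψ-coeff₀ []      = trans (at ψ-[] 0) (sym γ-[])
    ψ-coeff₀ (a ∷ f) = begin
      coeff (ψ (a ∷ f)) 0                            ≈⟨ at (ψ-∷ a f) 0 ⟩
      coeff (add (ι a ∷ []) (mul (ψ f) φ)) 0         ≈⟨ coeff-add (ι a ∷ []) (mul (ψ f) φ) 0 ⟩
      ι a + coeff (mul (ψ f) φ) 0                    ≈⟨ +-congˡ (trans (coeff₀-mul (ψ f) φ) (*-congʳ (ψ-coeff₀ f))) ⟩
      ι a + γ f * γ T                                ≈⟨ γ-∷ a f ⟨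
      γ (a ∷ f)                                      ∎
      where open SetoidReasoning setoid

    private
      ψ-constant : ∀ a f → f A.≋ [] → ψ (a ∷ f) ≋ ι a ∷ []
      ψ-constant a f p = ≋-trans (ψ-∷ a f) (≋-trans (add-cong ≋-refl (mul-zeroˡ (ψ f) φ (≋-trans (ψ-cong p) ψ-[]))) (add-zeroʳ _))

      2+ : ∀ d → d ℕ.+ d ℕ.+ 2 ≡ suc d ℕ.+ suc d
      2+ d = ≡.trans (ℕ.+-comm (d ℕ.+ d) 2) (≡.cong suc (≡.sym (ℕ.+-suc d d)))

    ψ-≤° : ∀ f d → f A.≤° d → ψ f ≤° d ℕ.+ d
    ψ-≤° []      d       p = <°-resp (≋-sym ψ-[]) []-<°
    ψ-≤° (a ∷ f) zero    p = <°-resp (≋-sym (ψ-constant a f (A.<°0⇒≋[] (A.<°-tail {a} p)))) (<°-length (ι a ∷ []))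
    ψ-≤° (a ∷ f) (suc d) p = <°-resp (≋-sym (ψ-∷ a f)) (<°-add (<°-mono (s≤s z≤n) (<°-length (ι a ∷ [])))
      (≡.subst (mul (ψ f) φ ≤°_) (2+ d) (mul-≤° (ψ-≤° f d (A.<°-tail p)) φ≤)))

    ψ-lead : ∀ f d → f A.≤° d → ¬ A.coeff f d k.≈ k.0# → ¬ coeff (ψ f) (d ℕ.+ d) ≈ 0#
    ψ-lead []      d       p fd z = fd k.refl
    ψ-lead (a ∷ f) zero    p fd z = fd (ι-injective (trans (sym (at (ψ-constant a f (A.<°0⇒≋[] (A.<°-tail {a} p))) 0))
      (trans z (sym (trans (γ.⟦⟧-cong λ { zero → k.refl ; (suc n) → k.refl }) γ-[])))))
    ψ-lead (a ∷ f) (suc d) p fd z = lead-nonzero {ψ f} {φ} (ψ-≤° f d (A.<°-tail p)) φ≤ (ψ-lead f d (A.<°-tail p) fd) leading (begin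
      coeff (mul (ψ f) φ) (d ℕ.+ d ℕ.+ 2)                      ≡⟨ ≡.cong (coeff (mul (ψ f) φ)) (2+ d) ⟩
      coeff (mul (ψ f) φ) (suc d ℕ.+ suc d)                    ≈⟨ +-identityˡ _ ⟨
      coeff (ι a ∷ []) (suc d ℕ.+ suc d) + coeff (mul (ψ f) φ) (suc d ℕ.+ suc d) ≈⟨ coeff-add (ι a ∷ []) (mul (ψ f) φ) (suc d ℕ.+ suc d) ⟨
      coeff (add (ι a ∷ []) (mul (ψ f) φ)) (suc d ℕ.+ suc d)   ≈⟨ at (ψ-∷ a f) (suc d ℕ.+ suc d) ⟨
      coeff (ψ (a ∷ f)) (suc d ℕ.+ suc d)                      ≈⟨ z ⟩
      0#                                                       ∎)
      where open SetoidReasoning setoid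

    ψ-commutes : ∀ f → mul (ψ f) φ ≋ mul φ (ψ f)
    ψ-commutes f = begin
      mul (ψ f) φ          ≈⟨ mul-congʳ (ψ f) ψ-T ⟨
      mul (ψ f) (ψ T)      ≈⟨ ψ-mul f T ⟨
      ψ (A.mul f T)        ≈⟨ ψ-cong (A.mul-comm f T) ⟩
      ψ (A.mul T f)        ≈⟨ ψ-mul T f ⟩
      mul (ψ T) (ψ f)      ≈⟨ mul-congˡ (ψ f) ψ-T ⟩
      mul φ (ψ f)          ∎
      where open ≋-Reasoning

    -- The points Tⁱ w for i < N. Their k-combinations are the f w with deg f < N, so for N = δ they
    -- describe a cyclic module A/d₁ as a k-space.
    orbit : Carrier → (N : ℕ) → Vec Carrier N
    orbit w zero    = []
    orbit w (suc N) = w ∷ orbit (act φ w) N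

    lin-orbit : ∀ {N} (as : Vec k.Carrier N) w → lin as (orbit w N) ≈ act (ψ (Vec.toList as)) w
    lin-orbit []       w = sym (act-cong ψ-[] refl)
    lin-orbit (a ∷ as) w = begin
      ι a * w + lin as (orbit (act φ w) _)                          ≈⟨ +-congˡ (lin-orbit as (act φ w)) ⟩
      ι a * w + act (ψ (Vec.toList as)) (act φ w)                   ≈⟨ +-cong (sym (+-identityʳ _)) (sym (act-mul (ψ (Vec.toList as)) φ w)) ⟩
      act (ι a ∷ []) w + act (mul (ψ (Vec.toList as)) φ) w          ≈⟨ act-add (ι a ∷ []) (mul (ψ (Vec.toList as)) φ) w ⟨
      act (add (ι a ∷ []) (mul (ψ (Vec.toList as)) φ)) w            ≈⟨ act-cong (ψ-∷ a (Vec.toList as)) refl ⟨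
      act (ψ (a ∷ Vec.toList as)) w                                 ∎
      where open SetoidReasoning setoid

    orbit-killed : ∀ f N w → act (ψ f) w ≈ 0# → Kills (ψ f) (orbit w N)
    orbit-killed f zero    w p = []
    orbit-killed f (suc N) w p = p ∷ orbit-killed f N (act φ w) (begin
      act (ψ f) (act φ w)      ≈⟨ act-mul (ψ f) φ w ⟨
      act (mul (ψ f) φ) w      ≈⟨ act-cong (ψ-commutes f) refl ⟩
      act (mul φ (ψ f)) w      ≈⟨ act-mul φ (ψ f) w ⟩
      act φ (act (ψ f) w)      ≈⟨ act-cong (≋-refl {φ}) p ⟩
      act φ 0#                 ≈⟨ act-0 φ ⟩
      0#                       ∎)
      where open SetoidReasoning setoid

    toList-<° : ∀ {N} (as : Vec k.Carrier N) → Vec.toList as A.<° N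
    toList-<° []       = A.[]-<°
    toList-<° (a ∷ as) = A.<°-∷ (toList-<° as)

    toList-zero : ∀ {N} (as : Vec k.Carrier N) → Vec.toList as A.≋ [] → All (k._≈ k.0#) as
    toList-zero []       p = []
    toList-zero (a ∷ as) p = A.at p 0 ∷ toList-zero as (A.mk λ n → A.at p (suc n))

    -- The d₁-torsion of L ≅ A/d₁ ⊕ A/d₂ is (A/d₁)², generated by (1, 0) and (0, d₂/d₁).
    module Torsion (d₁ d₂ : A.Carrier) (monic₁ : Monic d₁) (monic₂ : Monic d₂) (d₁∣d₂ : d₁ ∣ d₂)
                   (f : Carrier → A.Carrier × A.Carrier)
                   (iso : LeftModuleMorphisms.IsLeftModuleIsomorphism (DrinfeldModule.module-on-L D)
                            (A/-module d₁ ⊕ A/-module d₂) f) where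
      open LeftModuleMorphisms.IsLeftModuleIsomorphism iso using (+ᴹ-homo; 0ᴹ-homo; *ₗ-homo; ⟦⟧-cong; injective; surjective)
      private
        module R₁ = PolyQuotient.Residues k d₁ monic₁
        module R₂ = PolyQuotient.Residues k d₂ monic₂
        module Q₁ = CommutativeRing R₁.quotientRing≃ using (sym; trans; setoid; +-cong; *-congˡ; +-identityʳ; *-identityʳ; zeroʳ)
        module Q₂ = CommutativeRing R₂.quotientRing≃ using (sym; trans; setoid; +-cong; +-congʳ; *-congˡ; +-identityˡ; zeroʳ)
        module A≋ = Domain (PolyDomain.polyDomain≋ kᴰ) using (setoid; module Solver; *-cancelˡ)
      open Monic monic₁ using () renaming (degree to δ)
      open _∣ʳ_ d₁∣d₂ renaming (quotient to e; equality to ed₁)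

      w₁ w₂ : Carrier
      w₁ = proj₁ (surjective (A.1# , A.0#))
      w₂ = proj₁ (surjective (A.0# , e))

      private
        infix 4 _≈₂_
        _≈₂_ : A.Carrier × A.Carrier → A.Carrier × A.Carrier → Set _
        (x , y) ≈₂ (x′ , y′) = (x R₁.≃ x′) × (y R₂.≃ y′)

        f-w₁ : f w₁ ≈₂ (A.1# , A.0#)
        f-w₁ = let p , r = proj₂ (surjective (A.1# , A.0#)) refl in R₁.mod p , R₂.mod r

        f-w₂ : f w₂ ≈₂ (A.0# , e)
        f-w₂ = let p , r = proj₂ (surjective (A.0# , e)) refl in R₁.mod p , R₂.mod r

        f-cong : ∀ {x y} → x ≈ y → f x ≈₂ f y
        f-cong p = let r , s = ⟦⟧-cong p in R₁.mod r , R₂.mod s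

        f-0 : f 0# ≈₂ (A.0# , A.0#)
        f-0 = R₁.mod (proj₁ 0ᴹ-homo) , R₂.mod (proj₂ 0ᴹ-homo)

        f-+ : ∀ x y → f (x + y) ≈₂ (proj₁ (f x) A.+ proj₁ (f y) , proj₂ (f x) A.+ proj₂ (f y))
        f-+ x y = R₁.mod (proj₁ (+ᴹ-homo x y)) , R₂.mod (proj₂ (+ᴹ-homo x y))

        f-act : ∀ a x → f (act (ψ a) x) ≈₂ (a A.* proj₁ (f x) , a A.* proj₂ (f x))
        f-act a x = R₁.mod (proj₁ (*ₗ-homo a x)) , R₂.mod (proj₂ (*ₗ-homo a x))

      points : Vec Carrier (δ ℕ.+ δ)
      points = orbit w₁ δ Vec.++ orbit w₂ δ

      private
        zero-image : ∀ x → proj₁ (f x) R₁.≃ A.0# → proj₂ (f x) R₂.≃ A.0# → x ≈ 0#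
        zero-image x p r = injective (R₁.unmod (Q₁.trans p (Q₁.sym (proj₁ f-0))) , R₂.unmod (Q₂.trans r (Q₂.sym (proj₂ f-0))))

        torsion₁ : act (ψ d₁) w₁ ≈ 0#
        torsion₁ = zero-image _
          (Q₁.trans (proj₁ (f-act d₁ w₁)) (Q₁.trans (Q₁.*-congˡ {d₁} (proj₁ f-w₁)) (R₁.mod (R₁.∣⇒∼0 (A.1# , A.at (A.mul-comm A.1# d₁))))))
          (Q₂.trans (proj₂ (f-act d₁ w₁)) (Q₂.trans (Q₂.*-congˡ {d₁} (proj₂ f-w₁)) (Q₂.zeroʳ d₁)))

        torsion₂ : act (ψ d₁) w₂ ≈ 0#
        torsion₂ = zero-image _
          (Q₁.trans (proj₁ (f-act d₁ w₂)) (Q₁.trans (Q₁.*-congˡ {d₁} (proj₁ f-w₂)) (Q₁.zeroʳ d₁)))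
          (Q₂.trans (proj₂ (f-act d₁ w₂)) (Q₂.trans (Q₂.*-congˡ {d₁} (proj₂ f-w₂))
            (R₂.mod (R₂.∣⇒∼0 (A.1# , A.at (A.≋-trans (A.mul-oneˡ d₂) (A.≋-trans (A.≋-sym (A.mk ed₁)) (A.mul-comm e d₁))))))))

      killed : Kills (ψ d₁) points
      killed = All.++⁺ (orbit-killed d₁ δ w₁ torsion₁) (orbit-killed d₁ δ w₂ torsion₂)

      private
        d₂≉0 : ¬ d₂ A.≋ []
        d₂≉0 p = k.1≉0 (k.trans (k.sym (Monic.leading monic₂)) (A.at p (Monic.degree monic₂)))

        e≉0 : ¬ e A.≋ []
        e≉0 p = d₂≉0 (A.≋-trans (A.≋-sym (A.mk ed₁)) (A.mul-zeroˡ e d₁ p))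

        module _ (bs cs : Vec k.Carrier δ) (p : act (ψ (Vec.toList bs)) w₁ + act (ψ (Vec.toList cs)) w₂ ≈ 0#) where
          u₁ = Vec.toList bs
          u₂ = Vec.toList cs
          x₁ = act (ψ u₁) w₁
          x₂ = act (ψ u₂) w₂

          u₁∼0 : u₁ R₁.≃ A.0#
          u₁∼0 = begin
            u₁                                       ≈⟨ Q₁.trans (Q₁.+-cong (Q₁.*-identityʳ u₁) (Q₁.zeroʳ u₂)) (Q₁.+-identityʳ u₁) ⟨
            u₁ A.* A.1# A.+ u₂ A.* A.0#               ≈⟨ Q₁.+-cong (Q₁.*-congˡ {u₁} (proj₁ f-w₁)) (Q₁.*-congˡ {u₂} (proj₁ f-w₂)) ⟨
            u₁ A.* proj₁ (f w₁) A.+ u₂ A.* proj₁ (f w₂) ≈⟨ Q₁.+-cong (proj₁ (f-act u₁ w₁)) (proj₁ (f-act u₂ w₂)) ⟨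
            proj₁ (f x₁) A.+ proj₁ (f x₂)           ≈⟨ proj₁ (f-+ x₁ x₂) ⟨
            proj₁ (f (x₁ + x₂))                     ≈⟨ proj₁ (f-cong p) ⟩
            proj₁ (f 0#)                            ≈⟨ proj₁ f-0 ⟩
            A.0#                                    ∎
            where open SetoidReasoning Q₁.setoid

          u₂e∼0 : u₂ A.* e R₂.≃ A.0#
          u₂e∼0 = begin
            u₂ A.* e                                 ≈⟨ Q₂.trans (Q₂.+-congʳ {u₂ A.* e} (Q₂.zeroʳ u₁)) (Q₂.+-identityˡ (u₂ A.* e)) ⟨
            u₁ A.* A.0# A.+ u₂ A.* e                  ≈⟨ Q₂.+-cong (Q₂.*-congˡ {u₁} (proj₂ f-w₁)) (Q₂.*-congˡ {u₂} (proj₂ f-w₂)) ⟨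
            u₁ A.* proj₂ (f w₁) A.+ u₂ A.* proj₂ (f w₂) ≈⟨ Q₂.+-cong (proj₂ (f-act u₁ w₁)) (proj₂ (f-act u₂ w₂)) ⟨
            proj₂ (f x₁) A.+ proj₂ (f x₂)           ≈⟨ proj₂ (f-+ x₁ x₂) ⟨
            proj₂ (f (x₁ + x₂))                     ≈⟨ proj₂ (f-cong p) ⟩
            proj₂ (f 0#)                            ≈⟨ proj₂ f-0 ⟩
            A.0#                                    ∎
            where open SetoidReasoning Q₂.setoid

          d₁∣u₂ : d₂ ∣ u₂ A.* e → d₁ ∣ u₂
          d₁∣u₂ (s , r) = s , A.at (A≋.*-cancelˡ {e} {A.mul s d₁} {u₂} e≉0 (begin
            A.mul e (A.mul s d₁)    ≈⟨ solve 3 (λ e s d → e :* (s :* d) := s :* (e :* d)) A.≋-refl e s d₁ ⟩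
            A.mul s (A.mul e d₁)    ≈⟨ A.mul-congʳ s (A.mk ed₁) ⟩
            A.mul s d₂              ≈⟨ A.mk r ⟩
            A.mul u₂ e              ≈⟨ A.mul-comm u₂ e ⟩
            A.mul e u₂              ∎))
            where
            open SetoidReasoning A≋.setoid
            open A≋.Solver

          split-zero : All (k._≈ k.0#) bs × All (k._≈ k.0#) cs
          split-zero = toList-zero bs (R₁.small-multiple (toList-<° bs) (R₁.∼0⇒∣ (R₁.unmod u₁∼0)))
                     , toList-zero cs (R₁.small-multiple (toList-<° cs) (d₁∣u₂ (R₂.∼0⇒∣ (R₂.unmod u₂e∼0))))

      -- A relation among the points reads (u₁, u₂ e) = 0 in A/d₁ ⊕ A/d₂ with u₁, u₂ of degree below
      -- δ. Then d₁ divides u₁ and, after cancelling e, also u₂, so both vanish.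
      points-independent : Independent points
      points-independent as p =
        let bs , cs , as≡ = Vec.splitAt δ as
            zeros = split-zero bs cs (trans (sym (trans (lin-++ bs cs (orbit w₁ δ) (orbit w₂ δ)) (+-cong (lin-orbit bs w₁) (lin-orbit cs w₂))))
                      (≡.subst (λ as → lin as points ≈ 0#) as≡ p))
        in ≡.subst (All (k._≈ k.0#)) (≡.sym as≡) (All.++⁺ (proj₁ zeros) (proj₂ zeros))

-- The endomorphism of the reduction and its discriminant

module ReducedModule {c ℓ c′ ℓ′ : Level} {q : ℕ} (k : FiniteField c ℓ q) (L : Domain c′ ℓ′)
    (γ : RawRing.Carrier (FunctionField.A k) → Domain.Carrier L)
    (γ-hom : RingMorphisms.IsRingHomomorphism (FunctionField.A k) (Domain.rawRing L) γ)
    {n : ℕ} (0<n : 0 ℕ.< n) (card : Inverse (Domain.setoid L) (≡.setoid (Fin (q ℕ.^ n))))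
    (D : FunctionField.DrinfeldModule k (Domain.rawRing L) γ 2)
    (d₁ d₂ : RawRing.Carrier (FunctionField.A k)) (monic₁ : FunctionField.Monic k d₁) (monic₂ : FunctionField.Monic k d₂)
    (d₁∣d₂ : FunctionField._∣_ k d₁ d₂)
    (iso : FunctionField._≅_ k (FunctionField.DrinfeldModule.module-on-L D)
             (FunctionField._⊕_ k (FunctionField.A/-module k d₁) (FunctionField.A/-module k d₂))) where
  open FunctionField k using (A; T; Monic; module Monic; module DrinfeldModule)
  open Domain L using (commutativeRing; 1≉0; Carrier; _≈_; _+_; _*_; -_; _-_; 0#; 1#; refl; sym; trans; setoid; rawRing; +-cong; +-congˡ; +-congʳ; *-cong; *-congˡ; *-congʳ; +-identityˡ; zeroʳ; -‿cong; -‿distribˡ-*; -‿distribʳ-*; -‿+-comm; _^_; module Solver)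
  open Drinfeld k L γ γ-hom using (ι; ι-hom; 2≤q; iter-^q; σ; Poly; coeff; add; mul; _≋_; at; ≋-sym; coeff-add; coeff-neg; add-cong; neg-cong; mul-distribʳ; mul-distribˡ; skewRing; _<°_; below; _≤°_; <°-length; <°-mono; <°-add; <°-neg; mul-≤°; coeff₀-mul; module ≋-Reasoning; module Division; γ-eval; module Module)
  open Module D using (ψ; g; leading; φ; ψ-coeff₀; ψ-≤°; ψ-lead; ψ-commutes; module Torsion)
  open Torsion d₁ d₂ monic₁ monic₂ d₁∣d₂ (proj₁ iso) (proj₂ iso) using (killed; points-independent)
  open FiniteDomain L card using (finite-inverse; fermat)
  open PolyQuotient k using (kᴰ; Aᴰ)
  private
    module A where
      open Domain Aᴰ public using (commutativeRing; Carrier; -_; _-_)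
      open Poly (Domain.commutativeRing kᴰ) public using (id-isRingHomomorphism; Poly; add; mul)
      open SkewDegree (Domain.commutativeRing kᴰ) id id-isRingHomomorphism public using (_<°_; below; _≤°_; <°-length; <°-mono; <°-add; <°-neg; mul-≤°)
    module k = Domain kᴰ using (1≉0; sym; trans)
    module γ = RingHom γ-hom

  open Monic monic₁ using () renaming (degree to δ)

  -- The isomorphism sends the qⁿ elements of L injectively into A/d₁ ⊕ A/d₂, which has q^(δ + δ₂)
  -- elements.
  degree-≤ : n ℕ.≤ δ ℕ.+ Monic.degree monic₂
  degree-≤ = ℕ.≮⇒≥ λ δ₁+δ₂<n → ℕ.<⇒≱ (ℕ.^-monoʳ-< q 2≤q δ₁+δ₂<n) q^n≤
    where
    module R₁ = PolyQuotient.Residues k d₁ monic₁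
    module R₂ = PolyQuotient.Residues k d₂ monic₂
    module L≅ = Inverse card
    module I₁ = Inverse R₁.residues
    module I₂ = Inverse R₂.residues
    open LeftModuleMorphisms.IsLeftModuleIsomorphism (proj₂ iso) using (injective)
    f = proj₁ iso
    δ₂ = Monic.degree monic₂
    embed : Fin (q ℕ.^ n) → Fin (q ℕ.^ δ ℕ.* q ℕ.^ δ₂)
    embed i = combine (I₁.to (proj₁ (f (L≅.from i)))) (I₂.to (proj₂ (f (L≅.from i))))
    embed-injective : ∀ {i j} → embed i ≡ embed j → i ≡ j
    embed-injective {i} {j} p = ≡.trans (≡.sym (L≅.strictlyInverseˡ i)) (≡.trans
      (L≅.to-cong (injective
        ( R₁.residues-injective (proj₁ (f (L≅.from i))) (proj₁ (f (L≅.from j))) (Fin.combine-injectiveˡ (I₁.to (proj₁ (f (L≅.from i)))) (I₂.to (proj₂ (f (L≅.from i)))) _ _ p)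
        , R₂.residues-injective (proj₂ (f (L≅.from i))) (proj₂ (f (L≅.from j))) (Fin.combine-injectiveʳ (I₁.to (proj₁ (f (L≅.from i)))) (I₂.to (proj₂ (f (L≅.from i)))) _ _ p))))
      (L≅.strictlyInverseˡ j))
    q^n≤ : q ℕ.^ n ℕ.≤ q ℕ.^ (δ ℕ.+ δ₂)
    q^n≤ = ≡.subst (q ℕ.^ n ℕ.≤_) (≡.sym (ℕ.^-distribˡ-+-* q δ δ₂)) (Fin.injective⇒≤ embed-injective)

  σⁿ : ∀ x → iter σ n x ≈ x
  σⁿ x = trans (iter-^q n x) (fermat x)

  private
    d₁≤ : d₁ A.≤° δ
    d₁≤ = A.below (Monic.above-degree monic₁)

    lead≉0 : ¬ coeff (ψ d₁) (δ ℕ.+ δ) ≈ 0#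
    lead≉0 = ψ-lead d₁ δ d₁≤ λ z → k.1≉0 (k.trans (k.sym (Monic.leading monic₁)) z)

    lead⁻¹ = finite-inverse _ lead≉0
    g₂⁻¹   = finite-inverse (g 2) leading

  open Division {n} {δ ℕ.+ δ} 0<n σⁿ {ψ d₁} (ψ-≤° d₁ δ d₁≤) (proj₂ lead⁻¹) points-independent killed using (τⁿ-1; τⁿ-1-coeff₀; d≤n; quotient; commutes)

  2δ≤n : δ ℕ.+ δ ℕ.≤ n
  2δ≤n = d≤n

  m : ℕ
  m = n ℕ.∸ (δ ℕ.+ δ)

  private
    -- The degree m of u is below 2 (e + 1), so e + 1 digits to the base φ suffice; and since 2 e ≤
    -- m, subtracting ψ a from 2 u keeps the degree within m.
    e = ℕ.⌊ m /2⌋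

    2e≤m : e ℕ.+ e ℕ.≤ m
    2e≤m = ≡.subst (e ℕ.+ e ℕ.≤_) (ℕ.⌊n/2⌋+⌈n/2⌉≡n m) (ℕ.+-monoʳ-≤ e (ℕ.⌊n/2⌋≤⌈n/2⌉ m))

    m<2e+2 : suc m ℕ.≤ suc e ℕ.+ suc e
    m<2e+2 = s≤s (≡.subst (ℕ._≤ e ℕ.+ suc e) (ℕ.⌊n/2⌋+⌈n/2⌉≡n m) (ℕ.+-monoʳ-≤ e (⌈⌉≤ m)))
      where
      ⌈⌉≤ : ∀ m → ℕ.⌈ m /2⌉ ℕ.≤ suc ℕ.⌊ m /2⌋
      ⌈⌉≤ zero          = z≤n
      ⌈⌉≤ (suc zero)    = s≤s z≤n
      ⌈⌉≤ (suc (suc m)) = s≤s (⌈⌉≤ m)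

  -- The last component is 2 u₀ d₁ = -2, with 2 u₀ rewritten as v₀ + a; it comes from the constant
  -- terms of u ψ_(d₁) = τⁿ - 1.
  Discriminant : Set _
  Discriminant = ∃[ Δ ] ∃[ a ] ∃[ v ] Δ A.≤° suc m × a A.≤° m × v ≤° m × mul v φ ≋ mul φ v ×
                 coeff v 0 * coeff v 0 ≈ γ Δ × (coeff v 0 + γ a) * γ d₁ ≈ - (1# + 1#)

  -- v = 2 u - ψ a, where u² - a u + b = 0, is a square root of the discriminant.
  private
    module _ (u : Poly) (uΨ : mul u (ψ d₁) ≋ τⁿ-1) (u≤ : u ≤° m) (uφ : mul u φ ≋ mul φ u)
             (a b : A.Carrier) (|a| : length a ≡ suc e) (|b| : length b ≡ suc (e ℕ.+ suc e))
             (eq : coeff u 0 * coeff u 0 - Poly.eval commutativeRing (map ι a) (γ T) * coeff u 0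
                     + Poly.eval commutativeRing (map ι b) (γ T) ≈ 0#) where
      x : Carrier
      x = coeff u 0
      Δ : A.Carrier
      Δ = A.mul a a A.- A.add (A.add b b) (A.add b b)
      v : Poly
      v = add (add u u) (map -_ (ψ a))

      a≤ : a A.≤° e
      a≤ = ≡.subst (a A.<°_) |a| (A.<°-length a)

      Δ≤ : Δ A.≤° suc m
      Δ≤ = A.<°-add (A.<°-mono (s≤s (ℕ.m≤n⇒m≤1+n 2e≤m)) (A.mul-≤° a≤ a≤))
             (A.<°-neg (A.<°-add (A.<°-add b≤ b≤) (A.<°-add b≤ b≤)))
        where
        b≤ : b A.≤° suc m
        b≤ = A.<°-mono (ℕ.≤-trans (ℕ.≤-reflexive |b|) (s≤s (≡.subst (ℕ._≤ suc m) (≡.sym (ℕ.+-suc e e)) (s≤s 2e≤m)))) (A.<°-length b)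

      v≤ : v ≤° m
      v≤ = <°-add (<°-add u≤ u≤) (<°-neg (<°-mono (s≤s 2e≤m) (ψ-≤° a e a≤)))

      vφ : mul v φ ≋ mul φ v
      vφ = begin
        mul v φ                                                         ≈⟨ mul-distribʳ φ (add u u) _ ⟩
        add (mul (add u u) φ) (mul (map -_ (ψ a)) φ)                    ≈⟨ add-cong (mul-distribʳ φ u u) (≋-sym (MP.-‿distribˡ-* (ψ a) φ)) ⟩
        add (add (mul u φ) (mul u φ)) (map -_ (mul (ψ a) φ))            ≈⟨ add-cong (add-cong uφ uφ) (neg-cong (ψ-commutes a)) ⟩
        add (add (mul φ u) (mul φ u)) (map -_ (mul φ (ψ a)))            ≈⟨ add-cong (≋-sym (mul-distribˡ φ u u)) (MP.-‿distribʳ-* φ (ψ a)) ⟩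
        add (mul φ (add u u)) (mul φ (map -_ (ψ a)))                    ≈⟨ mul-distribˡ φ (add u u) _ ⟨
        mul φ v                                                         ∎
        where
        open ≋-Reasoning
        module MP = RingProperties skewRing

      v₀ : coeff v 0 ≈ x + x - γ a
      v₀ = trans (coeff-add (add u u) _ 0) (+-cong (coeff-add u u 0) (trans (coeff-neg (ψ a) 0) (-‿cong (ψ-coeff₀ a))))

      γΔ : γ Δ ≈ γ a * γ a - (γ b + γ b + (γ b + γ b))
      γΔ = trans (γ.+-homo (A.mul a a) _) (+-cong (γ.*-homo a a) (trans (γ.-‿homo (A.add (A.add b b) (A.add b b))) (-‿cong
             (trans (γ.+-homo (A.add b b) (A.add b b)) (+-cong (γ.+-homo b b) (γ.+-homo b b))))))

      square : coeff v 0 * coeff v 0 ≈ γ Δ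
      square = begin
        coeff v 0 * coeff v 0                         ≈⟨ *-cong v₀ v₀ ⟩
        (x + x - γ a) * (x + x - γ a)                 ≈⟨ solve 3 (λ x a b → (x :+ x :- a) :* (x :+ x :- a)
                                                           := con (ℤ.+ 4) :* (x :* x :- a :* x :+ b) :+ (a :* a :- (b :+ b :+ (b :+ b)))) refl x (γ a) (γ b) ⟩
        _                                             ≈⟨ +-congʳ (trans (*-congˡ eq′) (zeroʳ _)) ⟩
        0# + (γ a * γ a - (γ b + γ b + (γ b + γ b)))  ≈⟨ +-identityˡ _ ⟩
        γ a * γ a - (γ b + γ b + (γ b + γ b))         ≈⟨ γΔ ⟨
        γ Δ                                           ∎
        where
        open SetoidReasoning setoid
        open Solver
        eq′ : x * x - γ a * x + γ b ≈ 0#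
        eq′ = trans (+-cong (+-congˡ (-‿cong (*-congʳ (sym (γ-eval a))))) (sym (γ-eval b))) eq

      unit : (coeff v 0 + γ a) * γ d₁ ≈ - (1# + 1#)
      unit = begin
        (coeff v 0 + γ a) * γ d₁         ≈⟨ *-congʳ (+-congʳ v₀) ⟩
        (x + x - γ a + γ a) * γ d₁       ≈⟨ solve 3 (λ x a d → (x :+ x :- a :+ a) :* d := x :* d :+ x :* d) refl x (γ a) (γ d₁) ⟩
        x * γ d₁ + x * γ d₁              ≈⟨ +-cong xd₁ xd₁ ⟩
        - 1# + - 1#                      ≈⟨ -‿+-comm 1# 1# ⟩
        - (1# + 1#)                      ∎
        where
        open SetoidReasoning setoid
        open Solver
        xd₁ : x * γ d₁ ≈ - 1#
        xd₁ = trans (*-congˡ (sym (ψ-coeff₀ d₁))) (trans (sym (coeff₀-mul u (ψ d₁))) (trans (at uΨ 0) τⁿ-1-coeff₀))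

      build : Discriminant
      build = Δ , a , v , Δ≤ , A.<°-mono (s≤s (ℕ.≤-trans (ℕ.m≤m+n e e) 2e≤m)) a≤ , v≤ , vφ , square , unit

    complete : ∀ u → mul u (ψ d₁) ≋ τⁿ-1 → u ≤° m → mul u φ ≋ mul φ u → Discriminant
    complete u uΨ u≤ uφ =
      let a , b , |a| , |b| , eq = CharacteristicPolynomial.quadratic k L ι ι-hom (γ T) (g 1) (g 2) (proj₁ g₂⁻¹) (proj₂ g₂⁻¹)
                                     e u uφ (<°-mono m<2e+2 u≤)
      in build u uΨ u≤ uφ a b |a| |b| eq

  discriminant : Discriminant
  discriminant =
    let u , uΨ , u≤ = quotient
    in complete u uΨ u≤ (commutes {φ} {u} (ψ-commutes d₁) uΨ)

-- The commutation relation u φ = φ u, read off at τ^(i+1), with u_(i-1) = c_i.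

module Commutation {c ℓ : Level} (L : CommutativeRing c ℓ) (σ : CommutativeRing.Carrier L → CommutativeRing.Carrier L) where
  open CommutativeRing L using (Carrier; _≈_; _+_; _*_)

  Commutes : (θ g₁ g₂ : Carrier) → (ℕ → Carrier) → ℕ → Set ℓ
  Commutes θ g₁ g₂ c i =
    -- At i = 0 the truncated exponent `i ∸ 1` is a default value; it is harmless because the
    -- relation is used with sequences whose entry c 0, standing for u₋₁, is zero.
    c (2 ℕ.+ i) * iter σ (suc i) θ + c (suc i) * iter σ i g₁ + c i * iter σ (i ℕ.∸ 1) g₂
      ≈ θ * c (2 ℕ.+ i) + g₁ * σ (c (suc i)) + g₂ * σ (σ (c i))

-- Solving the commutation relation for u with u₀ = √D gives u_i = √D s_(i+1) / Δ_(i+1)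
-- with s and Δ in A.  Here q = 2 h + 1, and g₁ = G₁ / e, g₂ = G₂ / e.

module Scaling {c ℓ : Level} (A : CommutativeRing c ℓ) (h : ℕ) (T e G₁ G₂ D : CommutativeRing.Carrier A) where
  open CommutativeRing A using (Carrier; _+_; _*_; -_; _-_; 0#; 1#; commutativeSemiring)
  open Exp commutativeSemiring using (_^_)

  q : ℕ
  q = suc (h ℕ.+ h)

  σ : Carrier → Carrier
  σ = _^ q

  -- `μ (suc i)` clears the divisor T^(q^(i+1)) - T of the recursion together with the denominators
  -- of g₁, g₂ and of their twists. As Δ_(i+2) = μ_(i+1) σ(Δ_(i+1)) = μ_(i+1) σ(μ_i) σ²(Δ_i), it is
  -- also a multiple of the denominators of the Frobenius images of the two previous terms.
  μ Δ s : ℕ → Carrier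
  μ zero    = 1#
  μ (suc i) = (iter σ (suc i) T - T) * (e * iter σ i e * iter σ (i ℕ.∸ 1) e)

  Δ zero    = 1#
  Δ (suc i) = μ i * σ (Δ i)

  s zero          = 0#
  s (suc zero)    = 1#
  s (suc (suc i)) =
      -- Here Dʰ is y^(q-1) for y² = D, which is what remains of σ(y) after splitting off y.
      -- Likewise Δ^(h+h) = Δ^(q-1) raises the denominator of an untwisted term from Δ to σ(Δ).
      E * G₁ * D ^ h * σ (s (suc i))
    - e * iter σ (i ℕ.∸ 1) e * iter σ i G₁ * Δ (suc i) ^ (h ℕ.+ h) * s (suc i)
    + σ (μ i) * ( E * G₂ * (D ^ h * σ (D ^ h)) * σ (σ (s i))
                - e * iter σ i e * iter σ (i ℕ.∸ 1) G₂ * (Δ i ^ (h ℕ.+ h) * σ (Δ i ^ (h ℕ.+ h))) * s i)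
    where
    E = iter σ i e * iter σ (i ℕ.∸ 1) e

module ScalingSolution
    (A : CommutativeRing c ℓ) (h : ℕ) (T e G₁ G₂ D : CommutativeRing.Carrier A)
    (L : CommutativeRing c′ ℓ′) (f : CommutativeRing.Carrier A → CommutativeRing.Carrier L)
    (f-hom : RingMorphisms.IsRingHomomorphism (CommutativeRing.rawRing A) (CommutativeRing.rawRing L) f) where
  open Scaling A h T e G₁ G₂ D using (q; σ; μ; Δ; s)
  private
    module A where
      open CommutativeRing A public using (_*_; -_; _-_; 1#; commutativeSemiring)
      open Exp commutativeSemiring public using (_^_)
    module f = RingHom f-hom
  open CommutativeRing L using (Carrier; _≈_; _+_; _*_; -_; _-_; 0#; 1#; refl; sym; trans; setoid; rawRing; commutativeSemiring; +-cong; +-congˡ; +-congʳ; *-cong; *-congˡ; *-congʳ; *-assoc; *-comm; *-identityˡ; *-identityʳ; zeroʳ; -‿cong)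
  open Exp commutativeSemiring using (_^_; ^-congˡ; ^-distrib-*; ^-homo-*; ^-assocʳ)
  open SetoidReasoning setoid

  ρ : Carrier → Carrier
  ρ = _^ q

  open Commutation L ρ using (Commutes)

  f-^ : ∀ x n → f (x A.^ n) ≈ f x ^ n
  f-^ x zero    = f.1#-homo
  f-^ x (suc n) = trans (f.*-homo x _) (*-congˡ (f-^ x n))

  iter-cong : ∀ n {x y} → x ≈ y → iter ρ n x ≈ iter ρ n y
  iter-cong zero    p = p
  iter-cong (suc n) p = iter-cong n (^-congˡ q p)

  f-iter : ∀ n x → f (iter σ n x) ≈ iter ρ n (f x)
  f-iter zero    x = refl
  f-iter (suc n) x = trans (f-iter n (σ x)) (iter-cong n (f-^ x q))

  iter-* : ∀ n x y → iter ρ n (x * y) ≈ iter ρ n x * iter ρ n y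
  iter-* zero    x y = refl
  iter-* (suc n) x y = trans (iter-cong n (^-distrib-* x y q)) (iter-* n (ρ x) (ρ y))

  module _ (g₁ g₂ y : Carrier) (c : ℕ → Carrier)
           (g₁e : g₁ * f e ≈ f G₁) (g₂e : g₂ * f e ≈ f G₂) (y² : y * y ≈ f D)
           (c₀ : c 0 ≈ 0#) (c₁ : c 1 ≈ y) where

    private
      y^q : ρ y ≈ y * f D ^ h
      y^q = *-congˡ (begin
        y ^ (h ℕ.+ h)      ≈⟨ ^-homo-* y h h ⟩
        y ^ h * y ^ h      ≈⟨ ^-distrib-* y y h ⟨
        (y * y) ^ h        ≈⟨ ^-congˡ h y² ⟩
        f D ^ h            ∎)

      y^qq : ρ (ρ y) ≈ y * (f D ^ h * ρ (f D ^ h))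
      y^qq = begin
        ρ (ρ y)                           ≈⟨ ^-congˡ q y^q ⟩
        ρ (y * f D ^ h)                   ≈⟨ ^-distrib-* y _ q ⟩
        ρ y * ρ (f D ^ h)                 ≈⟨ *-congʳ y^q ⟩
        y * f D ^ h * ρ (f D ^ h)         ≈⟨ *-assoc _ _ _ ⟩
        y * (f D ^ h * ρ (f D ^ h))       ∎

      iter-g : ∀ {g G} n → g * f e ≈ f G → iter ρ n (f e) * iter ρ n g ≈ f (iter σ n G)
      iter-g {g} {G} n p = begin
        iter ρ n (f e) * iter ρ n g     ≈⟨ *-comm _ _ ⟩
        iter ρ n g * iter ρ n (f e)     ≈⟨ iter-* n g (f e) ⟨
        iter ρ n (g * f e)              ≈⟨ iter-cong n p ⟩
        iter ρ n (f G)                  ≈⟨ f-iter n G ⟨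
        f (iter σ n G)                  ∎

      Holds : ℕ → Set _
      Holds i = y * f (s i) ≈ f (Δ i) * c i

      module Step (i : ℕ) (rec : Commutes (f T) g₁ g₂ c i) (P₀ : Holds i) (P₁ : Holds (suc i)) where
        H D₂ k₀ k₁ S₀ S₁ d₀ d₁ x₀ x₁ mᵢ E₀ E₁ : Carrier
        H  = f D ^ h
        D₂ = H * ρ H
        E₀ = iter ρ (i ℕ.∸ 1) (f e)
        E₁ = iter ρ i (f e)
        S₀ = f (s i)
        S₁ = f (s (suc i))
        d₀ = f (Δ i)
        d₁ = f (Δ (suc i))
        mᵢ = f (μ i)
        x₀ = c i
        x₁ = c (suc i)
        k₀ = iter ρ (i ℕ.∸ 1) g₂
        k₁ = iter ρ i g₁
        X : Carrier
        X = c (2 ℕ.+ i)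
        bracket : Carrier
        bracket = iter ρ (suc i) (f T) - f T

        d₁≈ : d₁ ≈ mᵢ * ρ d₀
        d₁≈ = trans (f.*-homo _ _) (*-congˡ (f-^ (Δ i) q))

        open ℤ-Solver L

        relation : bracket * X ≈ g₁ * ρ x₁ - k₁ * x₁ + (g₂ * ρ (ρ x₀) - k₀ * x₀)
        relation = begin
          (t - f T) * X
            ≈⟨ solve 7 (λ t θ X x₁ k₁ x₀ k₀ → (t :- θ) :* X := X :* t :+ x₁ :* k₁ :+ x₀ :* k₀ :- x₁ :* k₁ :- x₀ :* k₀ :- θ :* X) refl t (f T) X x₁ k₁ x₀ k₀ ⟩
          X * t + x₁ * k₁ + x₀ * k₀ - x₁ * k₁ - x₀ * k₀ - f T * X
            ≈⟨ +-congʳ (+-congʳ (+-congʳ rec)) ⟩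
          f T * X + g₁ * ρ x₁ + g₂ * ρ (ρ x₀) - x₁ * k₁ - x₀ * k₀ - f T * X
            ≈⟨ solve 7 (λ θX a b x₁ k₁ x₀ k₀ → θX :+ a :+ b :- x₁ :* k₁ :- x₀ :* k₀ :- θX := a :- k₁ :* x₁ :+ (b :- k₀ :* x₀)) refl (f T * X) (g₁ * ρ x₁) (g₂ * ρ (ρ x₀)) x₁ k₁ x₀ k₀ ⟩
          g₁ * ρ x₁ - k₁ * x₁ + (g₂ * ρ (ρ x₀) - k₀ * x₀) ∎
          where t = iter ρ (suc i) (f T)

        ρd₁ : ρ d₁ ≈ ρ mᵢ * ρ (ρ d₀)
        ρd₁ = trans (^-congˡ q d₁≈) (^-distrib-* mᵢ (ρ d₀) q)

        term₁ : ρ d₁ * ρ x₁ ≈ y * H * ρ S₁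
        term₁ = begin
          ρ d₁ * ρ x₁      ≈⟨ ^-distrib-* d₁ x₁ q ⟨
          ρ (d₁ * x₁)      ≈⟨ ^-congˡ q P₁ ⟨
          ρ (y * S₁)       ≈⟨ ^-distrib-* y S₁ q ⟩
          ρ y * ρ S₁       ≈⟨ *-congʳ y^q ⟩
          y * H * ρ S₁     ∎

        term₂ : ρ d₁ * x₁ ≈ y * (d₁ ^ (h ℕ.+ h) * S₁)
        term₂ = begin
          d₁ * d₁ ^ (h ℕ.+ h) * x₁      ≈⟨ solve 3 (λ d w x → d :* w :* x := w :* (d :* x)) refl d₁ _ x₁ ⟩
          d₁ ^ (h ℕ.+ h) * (d₁ * x₁)    ≈⟨ *-congˡ P₁ ⟨
          d₁ ^ (h ℕ.+ h) * (y * S₁)     ≈⟨ solve 3 (λ w y s → w :* (y :* s) := y :* (w :* s)) refl _ y S₁ ⟩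
          y * (d₁ ^ (h ℕ.+ h) * S₁)     ∎

        term₃ : ρ (ρ d₀) * ρ (ρ x₀) ≈ y * D₂ * ρ (ρ S₀)
        term₃ = begin
          ρ (ρ d₀) * ρ (ρ x₀)           ≈⟨ trans (^-congˡ q (^-distrib-* d₀ x₀ q)) (^-distrib-* (ρ d₀) (ρ x₀) q) ⟨
          ρ (ρ (d₀ * x₀))               ≈⟨ ^-congˡ q (^-congˡ q P₀) ⟨
          ρ (ρ (y * S₀))                ≈⟨ trans (^-congˡ q (^-distrib-* y S₀ q)) (^-distrib-* (ρ y) (ρ S₀) q) ⟩
          ρ (ρ y) * ρ (ρ S₀)            ≈⟨ *-congʳ y^qq ⟩
          y * D₂ * ρ (ρ S₀)             ∎

        W : Carrier
        W = d₀ ^ (h ℕ.+ h) * ρ (d₀ ^ (h ℕ.+ h))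

        term₄ : ρ (ρ d₀) * x₀ ≈ y * (W * S₀)
        term₄ = begin
          ρ (d₀ * w) * x₀               ≈⟨ *-congʳ (^-distrib-* d₀ w q) ⟩
          d₀ * w * ρ w * x₀             ≈⟨ solve 4 (λ d w v x → d :* w :* v :* x := w :* v :* (d :* x)) refl d₀ w (ρ w) x₀ ⟩
          w * ρ w * (d₀ * x₀)           ≈⟨ *-congˡ P₀ ⟨
          w * ρ w * (y * S₀)            ≈⟨ solve 3 (λ w y s → w :* (y :* s) := y :* (w :* s)) refl (w * ρ w) y S₀ ⟩
          y * (w * ρ w * S₀)            ∎
          where w = d₀ ^ (h ℕ.+ h)

        f-Δ : f (Δ (2 ℕ.+ i)) ≈ bracket * (f e * E₁ * E₀) * ρ d₁
        f-Δ = begin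
          f (μ (suc i) A.* σ (Δ (suc i)))             ≈⟨ trans (f.*-homo _ _) (*-congˡ (f-^ (Δ (suc i)) q)) ⟩
          f (μ (suc i)) * ρ d₁                        ≈⟨ *-congʳ (f.*-homo _ _) ⟩
          f (iter σ (suc i) T A.- T) * f (e A.* iter σ i e A.* iter σ (i ℕ.∸ 1) e) * ρ d₁
            ≈⟨ *-congʳ (*-cong (trans (f.+-homo _ _) (+-cong (f-iter (suc i) T) (f.-‿homo T)))
                               (trans (f.*-homo _ _) (*-cong (trans (f.*-homo _ _) (*-congˡ (f-iter i e))) (f-iter (i ℕ.∸ 1) e)))) ⟩
          bracket * (f e * E₁ * E₀) * ρ d₁            ∎

        F₁ F₂ F₁′ F₂′ : Carrier
        F₁  = f G₁
        F₂  = f G₂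
        F₁′ = f (iter σ i G₁)
        F₂′ = f (iter σ (i ℕ.∸ 1) G₂)

        f-D : f (D A.^ h A.* σ (D A.^ h)) ≈ D₂
        f-D = trans (f.*-homo _ _) (*-cong (f-^ D h) (trans (f-^ (D A.^ h) q) (^-congˡ q (f-^ D h))))

        f-s : f (s (2 ℕ.+ i)) ≈ E₁ * E₀ * F₁ * H * ρ S₁ - f e * E₀ * F₁′ * d₁ ^ (h ℕ.+ h) * S₁
                              + ρ mᵢ * (E₁ * E₀ * F₂ * D₂ * ρ (ρ S₀) - f e * E₁ * F₂′ * W * S₀)
        f-s = trans (f.+-homo _ _) (+-cong
          (trans (f.+-homo _ _) (+-cong
            (f-5 (trans (f.*-homo _ _) (*-congʳ f-E)) (f-^ D h) (f-^ (s (suc i)) q))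
            (trans (f.-‿homo _) (-‿cong (f-5 (trans (f.*-homo _ _) (*-congʳ f-e₀)) (f-^ (Δ (suc i)) (h ℕ.+ h)) refl)))))
          (trans (f.*-homo _ _) (*-cong (f-^ (μ i) q) (trans (f.+-homo _ _) (+-cong
            (f-5 (trans (f.*-homo _ _) (*-congʳ f-E)) f-D (trans (f-^ (σ (s i)) q) (^-congˡ q (f-^ (s i) q))))
            (trans (f.-‿homo _) (-‿cong (f-5 (trans (f.*-homo _ _) (*-congʳ f-e₁)) f-W refl))))))))
          where
          f-5 : ∀ {a b c a′ b′ c′} → f a ≈ a′ → f b ≈ b′ → f c ≈ c′ → f (a A.* b A.* c) ≈ a′ * b′ * c′
          f-5 p r t = trans (f.*-homo _ _) (*-cong (trans (f.*-homo _ _) (*-cong p r)) t)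
          f-E : f (iter σ i e A.* iter σ (i ℕ.∸ 1) e) ≈ E₁ * E₀
          f-E = trans (f.*-homo _ _) (*-cong (f-iter i e) (f-iter (i ℕ.∸ 1) e))
          f-e₀ : f (e A.* iter σ (i ℕ.∸ 1) e) ≈ f e * E₀
          f-e₀ = trans (f.*-homo _ _) (*-congˡ (f-iter (i ℕ.∸ 1) e))
          f-e₁ : f (e A.* iter σ i e) ≈ f e * E₁
          f-e₁ = trans (f.*-homo _ _) (*-congˡ (f-iter i e))
          f-W : f (Δ i A.^ (h ℕ.+ h) A.* σ (Δ i A.^ (h ℕ.+ h))) ≈ W
          f-W = trans (f.*-homo _ _) (*-cong (f-^ (Δ i) (h ℕ.+ h)) (trans (f-^ _ q) (^-congˡ q (f-^ (Δ i) (h ℕ.+ h)))))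

        -- The recursion is multiplied by e E₁ E₀ σ(Δ_(i+1)). In each term one of e, E₁, E₀ clears
        -- the coefficient; for the terms in x₀ the factor σ(Δ_(i+1)) is split as σ(μ_i) σ²(Δ_i).
        step : Holds (2 ℕ.+ i)
        step = sym (begin
          f (Δ (2 ℕ.+ i)) * X
            ≈⟨ *-congʳ f-Δ ⟩
          bracket * (f e * E₁ * E₀) * ρ d₁ * X
            ≈⟨ solve 6 (λ b e E₁ E₀ d X → b :* (e :* E₁ :* E₀) :* d :* X := e :* E₁ :* E₀ :* d :* (b :* X)) refl bracket (f e) E₁ E₀ (ρ d₁) X ⟩
          f e * E₁ * E₀ * ρ d₁ * (bracket * X)
            ≈⟨ *-congˡ relation ⟩
          f e * E₁ * E₀ * ρ d₁ * (g₁ * ρ x₁ - k₁ * x₁ + (g₂ * ρ (ρ x₀) - k₀ * x₀))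
            ≈⟨ expand (f e) E₁ E₀ (ρ d₁) g₁ (ρ x₁) k₁ x₁ (g₂ * ρ (ρ x₀) - k₀ * x₀) ⟩
          E₁ * E₀ * (g₁ * f e) * (ρ d₁ * ρ x₁) - f e * E₀ * (E₁ * k₁) * (ρ d₁ * x₁)
            + f e * E₁ * E₀ * ρ d₁ * (g₂ * ρ (ρ x₀) - k₀ * x₀)
            ≈⟨ +-cong (+-cong (*-cong (*-congˡ g₁e) term₁) (-‿cong (*-cong (*-congˡ (iter-g i g₁e)) term₂))) (*-congʳ (*-congˡ ρd₁)) ⟩
          E₁ * E₀ * F₁ * (y * H * ρ S₁) - f e * E₀ * F₁′ * (y * (d₁ ^ (h ℕ.+ h) * S₁))
            + f e * E₁ * E₀ * (ρ mᵢ * ρ (ρ d₀)) * (g₂ * ρ (ρ x₀) - k₀ * x₀)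
            ≈⟨ +-congˡ (expand′ (f e) E₁ E₀ (ρ mᵢ) (ρ (ρ d₀)) g₂ (ρ (ρ x₀)) k₀ x₀) ⟩
          E₁ * E₀ * F₁ * (y * H * ρ S₁) - f e * E₀ * F₁′ * (y * (d₁ ^ (h ℕ.+ h) * S₁))
            + ρ mᵢ * (E₁ * E₀ * (g₂ * f e) * (ρ (ρ d₀) * ρ (ρ x₀)) - f e * E₁ * (E₀ * k₀) * (ρ (ρ d₀) * x₀))
            ≈⟨ +-congˡ (*-congˡ (+-cong (*-cong (*-congˡ g₂e) term₃) (-‿cong (*-cong (*-congˡ (iter-g (i ℕ.∸ 1) g₂e)) term₄)))) ⟩
          E₁ * E₀ * F₁ * (y * H * ρ S₁) - f e * E₀ * F₁′ * (y * (d₁ ^ (h ℕ.+ h) * S₁))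
            + ρ mᵢ * (E₁ * E₀ * F₂ * (y * D₂ * ρ (ρ S₀)) - f e * E₁ * F₂′ * (y * (W * S₀)))
            ≈⟨ collect y (E₁ * E₀ * F₁) H (ρ S₁) (f e * E₀ * F₁′) (d₁ ^ (h ℕ.+ h)) S₁ _ ⟩
          y * (E₁ * E₀ * F₁ * H * ρ S₁ - f e * E₀ * F₁′ * d₁ ^ (h ℕ.+ h) * S₁)
            + ρ mᵢ * (E₁ * E₀ * F₂ * (y * D₂ * ρ (ρ S₀)) - f e * E₁ * F₂′ * (y * (W * S₀)))
            ≈⟨ collect′ y _ (ρ mᵢ) (E₁ * E₀ * F₂) D₂ (ρ (ρ S₀)) (f e * E₁ * F₂′) W S₀ ⟩
          y * (E₁ * E₀ * F₁ * H * ρ S₁ - f e * E₀ * F₁′ * d₁ ^ (h ℕ.+ h) * S₁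
                + ρ mᵢ * (E₁ * E₀ * F₂ * D₂ * ρ (ρ S₀) - f e * E₁ * F₂′ * W * S₀))
            ≈⟨ *-congˡ f-s ⟨
          y * f (s (2 ℕ.+ i)) ∎)
          where
          expand : ∀ e E₁ E₀ d g x k z r → e * E₁ * E₀ * d * (g * x - k * z + r)
            ≈ E₁ * E₀ * (g * e) * (d * x) - e * E₀ * (E₁ * k) * (d * z) + e * E₁ * E₀ * d * r
          expand = solve 9 (λ e E₁ E₀ d g x k z r → e :* E₁ :* E₀ :* d :* (g :* x :- k :* z :+ r)
            := E₁ :* E₀ :* (g :* e) :* (d :* x) :- e :* E₀ :* (E₁ :* k) :* (d :* z) :+ e :* E₁ :* E₀ :* d :* r) refl
          expand′ : ∀ e E₁ E₀ m d g x k z → e * E₁ * E₀ * (m * d) * (g * x - k * z)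
            ≈ m * (E₁ * E₀ * (g * e) * (d * x) - e * E₁ * (E₀ * k) * (d * z))
          expand′ = solve 9 (λ e E₁ E₀ m d g x k z → e :* E₁ :* E₀ :* (m :* d) :* (g :* x :- k :* z)
            := m :* (E₁ :* E₀ :* (g :* e) :* (d :* x) :- e :* E₁ :* (E₀ :* k) :* (d :* z))) refl
          collect : ∀ y a H r b d s t → a * (y * H * r) - b * (y * (d * s)) + t ≈ y * (a * H * r - b * d * s) + t
          collect = solve 8 (λ y a H r b d s t → a :* (y :* H :* r) :- b :* (y :* (d :* s)) :+ t := y :* (a :* H :* r :- b :* d :* s) :+ t) refl
          collect′ : ∀ y z m a D r b W s → y * z + m * (a * (y * D * r) - b * (y * (W * s))) ≈ y * (z + m * (a * D * r - b * W * s))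
          collect′ = solve 9 (λ y z m a D r b W s → y :* z :+ m :* (a :* (y :* D :* r) :- b :* (y :* (W :* s)))
            := y :* (z :+ m :* (a :* D :* r :- b :* W :* s))) refl

    scaling : ∀ N → (∀ i → i ℕ.< N → Commutes (f T) g₁ g₂ c i) → ∀ i → i ℕ.≤ suc N → y * f (s i) ≈ f (Δ i) * c i
    scaling N rec i i≤ = proj₁ (both i) i≤
      where
      both : ∀ i → (i ℕ.≤ suc N → Holds i) × (suc i ℕ.≤ suc N → Holds (suc i))
      both zero    = (λ _ → trans (trans (*-congˡ f.0#-homo) (zeroʳ y)) (sym (trans (*-congˡ c₀) (zeroʳ _))))
                   , (λ _ → trans (trans (*-congˡ f.1#-homo) (*-identityʳ y)) (sym (trans (*-cong one c₁) (*-identityˡ y))))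
        where
        1^ : ∀ n → 1# ^ n ≈ 1#
        1^ zero    = refl
        1^ (suc n) = trans (*-identityˡ _) (1^ n)
        one : f (Δ 1) ≈ 1#
        one = trans (f.*-homo _ _) (trans (*-cong f.1#-homo (trans (f-^ A.1# q) (trans (^-congˡ q f.1#-homo) (1^ q)))) (*-identityˡ 1#))
      both (suc i) = proj₂ (both i) , λ i+2≤ → Step.step i (rec i (ℕ.s≤s⁻¹ i+2≤))
        (proj₁ (both i) (ℕ.≤-trans (ℕ.n≤1+n i) (ℕ.≤-trans (ℕ.n≤1+n _) i+2≤)))
        (proj₂ (both i) (ℕ.≤-trans (ℕ.n≤1+n _) i+2≤))

-- Degrees of powers in k[T]

module Powers {q : ℕ} (k : FiniteField c ℓ q) where
  open PolyQuotient k using (kᴰ; Aᴰ)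
  private module k = Domain kᴰ
  open Domain Aᴰ using (Carrier; _*_; _^_; _-_)
  open Poly k.commutativeRing using (id-isRingHomomorphism; Poly; coeff; mul; _≋_; mk; at; ≋-refl; ≋-trans; ∷-cong; add-cong; scale-zero; mul-congʳ; mul-cong; mul-oneˡ; T; mul-∷)
  open SkewDegree k.commutativeRing id id-isRingHomomorphism using (vanish; _≤°_; <°-length; mul-≤°; τ^; coeff-τ^)

  σ : Carrier → Carrier
  σ = _^ q

  ^-≤° : ∀ {u d} n → u ≤° d → u ^ n ≤° n ℕ.* d
  ^-≤° zero    p = <°-length (k.1# ∷ [])
  ^-≤° (suc n) p = mul-≤° p (^-≤° n p)

  iter-≤° : ∀ {u d} n → u ≤° d → iter σ n u ≤° q ℕ.^ n ℕ.* d
  iter-≤° {u} {d} zero    p = ≡.subst (u ≤°_) (≡.sym (ℕ.+-identityʳ d)) p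
  iter-≤° {u} {d} (suc n) p = ≡.subst (iter σ n (u ^ q) ≤°_)
    (≡.trans (≡.sym (ℕ.*-assoc (q ℕ.^ n) q d)) (≡.cong (ℕ._* d) (ℕ.*-comm (q ℕ.^ n) q))) (iter-≤° n (^-≤° q p))

  private
    ^-cong : ∀ n {u v} → u ≋ v → u ^ n ≋ v ^ n
    ^-cong zero    p = ≋-refl
    ^-cong (suc n) p = mul-cong p (^-cong n p)

    iter-cong : ∀ n {u v} → u ≋ v → iter σ n u ≋ iter σ n v
    iter-cong zero    p = p
    iter-cong (suc n) p = iter-cong n (^-cong q p)

    τ^-* : ∀ i j → mul (τ^ i) (τ^ j) ≋ τ^ (i ℕ.+ j)
    τ^-* zero    j = mul-oneˡ (τ^ j)
    τ^-* (suc i) j = ≋-trans (mul-∷ k.0# (τ^ i) (τ^ j)) (≋-trans (add-cong (scale-zero (τ^ j)) ≋-refl) (∷-cong k.refl (τ^-* i j)))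

    τ^-^ : ∀ n j → τ^ j ^ n ≋ τ^ (n ℕ.* j)
    τ^-^ zero    j = ≋-refl
    τ^-^ (suc n) j = ≋-trans (mul-congʳ (τ^ j) (τ^-^ n j)) (τ^-* j (n ℕ.* j))

    iter-τ^ : ∀ n j → iter σ n (τ^ j) ≋ τ^ (q ℕ.^ n ℕ.* j)
    iter-τ^ zero    j = mk λ i → k.reflexive (≡.cong (λ j → coeff (τ^ j) i) (≡.sym (ℕ.+-identityʳ j)))
    iter-τ^ (suc n) j = ≋-trans (iter-cong n (τ^-^ q j)) (≋-trans (iter-τ^ n (q ℕ.* j))
      (mk λ i → k.reflexive (≡.cong (λ j → coeff (τ^ j) i)
        (≡.trans (≡.sym (ℕ.*-assoc (q ℕ.^ n) q j)) (≡.cong (ℕ._* j) (ℕ.*-comm (q ℕ.^ n) q))))))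

  -- The left side is the monomial T^(q^(n+1)), of degree at least 2.
  iter-T≉T : 2 ℕ.≤ q → ∀ n → ¬ iter σ (suc n) T ≋ T
  iter-T≉T 2≤q n p = k.1≉0 (k.trans (k.sym (coeff-τ^ N))
    (k.trans (k.sym (at (iter-τ^ (suc n) 1) N)) (k.trans (at p N) (vanish (<°-length T) N 2≤N))))
    where
    N = q ℕ.^ suc n ℕ.* 1
    2≤N : 2 ℕ.≤ N
    2≤N = ≡.subst (2 ℕ.≤_) (≡.sym (ℕ.*-identityʳ _)) (ℕ.≤-trans 2≤q (ℕ.m≤m*n q (q ℕ.^ n) {{ℕ.m^n≢0 q n {{ℕ.>-nonZero (ℕ.≤-trans (s≤s z≤n) 2≤q)}}}}))

-- The commutation relation, coefficient by coefficient

module CommutationCoefficients {c ℓ c′ ℓ′ : Level} {q : ℕ} (k : FiniteField c ℓ q) (L : Domain c′ ℓ′) (ι : FiniteField.Carrier k → Domain.Carrier L)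
    (ι-hom : RingMorphisms.IsRingHomomorphism (FiniteField.rawRing k) (Domain.rawRing L) ι)
    (θ g₁ g₂ : Domain.Carrier L) where
  open Domain L using (commutativeRing; Carrier; _≈_; _+_; _*_; 0#; sym; trans; setoid; rawRing; +-cong; +-congˡ; *-congˡ; +-assoc; *-comm; +-identityʳ; zeroˡ; ^-congˡ)
  open Twist k L ι ι-hom using (^q-zero; σ; Poly; coeff; add; τ·; mul; _≋_; mk; at; ≋-refl; ∷-cong; coeff-add; coeff-scale; coeff-σ; mul-congʳ; mul-distribˡ; mul-shiftʳ; coeff₀-mul; coeff-mul-const)
  open Commutation commutativeRing σ using (Commutes)
  open SetoidReasoning setoid

  φ : Poly
  φ = θ ∷ g₁ ∷ g₂ ∷ []

  -- The index is shifted by one so that position 0 holds u₋₁ = 0 and the coefficient of τ¹ obeys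
  -- the same relation as all later ones.
  sequence : Poly → ℕ → Carrier
  sequence u = coeff (0# ∷ u)

  coeff-mul-∷ʳ : ∀ u a v n → coeff (mul u (a ∷ v)) n ≈ coeff u n * iter σ n a + coeff (0# ∷ mul u v) n
  coeff-mul-∷ʳ u a v n = begin
    coeff (mul u (a ∷ v)) n                                  ≈⟨ at (mul-congʳ u {a ∷ v} {add (a ∷ []) (0# ∷ v)} (∷-cong (sym (+-identityʳ a)) ≋-refl)) n ⟩
    coeff (mul u (add (a ∷ []) (0# ∷ v))) n                  ≈⟨ at (mul-distribˡ u (a ∷ []) (0# ∷ v)) n ⟩
    coeff (add (mul u (a ∷ [])) (mul u (0# ∷ v))) n          ≈⟨ coeff-add (mul u (a ∷ [])) _ n ⟩
    coeff (mul u (a ∷ [])) n + coeff (mul u (0# ∷ v)) n      ≈⟨ +-cong (coeff-mul-const u a n) (at (mul-shiftʳ u v) n) ⟩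
    coeff u n * iter σ n a + coeff (0# ∷ mul u v) n          ∎

  private
    coeff-shift-const : ∀ u a n → coeff (0# ∷ mul u (a ∷ [])) n ≈ sequence u n * iter σ (n ℕ.∸ 1) a
    coeff-shift-const u a zero    = sym (zeroˡ _)
    coeff-shift-const u a (suc n) = coeff-mul-const u a n

    coeff-τ· : ∀ u n → coeff (τ· u) n ≈ σ (sequence u n)
    coeff-τ· u zero    = sym ^q-zero
    coeff-τ· u (suc n) = coeff-σ u n

  coeff-uφ : ∀ u i → coeff (mul u φ) (suc i) ≈
             sequence u (2 ℕ.+ i) * iter σ (suc i) θ + sequence u (suc i) * iter σ i g₁ + sequence u i * iter σ (i ℕ.∸ 1) g₂
  coeff-uφ u i = begin
    coeff (mul u φ) (suc i)
      ≈⟨ coeff-mul-∷ʳ u θ (g₁ ∷ g₂ ∷ []) (suc i) ⟩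
    coeff u (suc i) * iter σ (suc i) θ + coeff (mul u (g₁ ∷ g₂ ∷ [])) i
      ≈⟨ +-congˡ (trans (coeff-mul-∷ʳ u g₁ (g₂ ∷ []) i) (+-congˡ (coeff-shift-const u g₂ i))) ⟩
    coeff u (suc i) * iter σ (suc i) θ + (coeff u i * iter σ i g₁ + sequence u i * iter σ (i ℕ.∸ 1) g₂)
      ≈⟨ +-assoc _ _ _ ⟨
    coeff u (suc i) * iter σ (suc i) θ + coeff u i * iter σ i g₁ + sequence u i * iter σ (i ℕ.∸ 1) g₂ ∎

  coeff-φu : ∀ u i → coeff (mul φ u) (suc i) ≈
             θ * sequence u (2 ℕ.+ i) + g₁ * σ (sequence u (suc i)) + g₂ * σ (σ (sequence u i))
  coeff-φu u i = begin
    coeff (add (map (θ *_) u) (add (map (g₁ *_) (τ· u)) r)) (suc i)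
      ≈⟨ trans (coeff-add (map (θ *_) u) (add (map (g₁ *_) (τ· u)) r) (suc i)) (+-congˡ (trans (coeff-add (map (g₁ *_) (τ· u)) r (suc i))
           (+-congˡ (trans (coeff-add (map (g₂ *_) (τ· (τ· u))) [] (suc i)) (+-identityʳ _))))) ⟩
    coeff (map (θ *_) u) (suc i) + (coeff (map (g₁ *_) (τ· u)) (suc i) + coeff (map (g₂ *_) (τ· (τ· u))) (suc i))
      ≈⟨ +-cong (coeff-scale θ u (suc i)) (+-cong
           (trans (coeff-scale g₁ (τ· u) (suc i)) (*-congˡ (coeff-τ· u (suc i))))
           (trans (coeff-scale g₂ (τ· (τ· u)) (suc i)) (*-congˡ (trans (coeff-τ· (τ· u) (suc i)) (^-congˡ q (coeff-τ· u i)))))) ⟩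
    θ * coeff u (suc i) + (g₁ * σ (coeff u i) + g₂ * σ (σ (sequence u i)))
      ≈⟨ +-assoc _ _ _ ⟨
    θ * coeff u (suc i) + g₁ * σ (coeff u i) + g₂ * σ (σ (sequence u i)) ∎
    where r = add (map (g₂ *_) (τ· (τ· u))) []

  to-relation : ∀ u → mul u φ ≋ mul φ u → ∀ i → Commutes θ g₁ g₂ (sequence u) i
  to-relation u p i = trans (sym (coeff-uφ u i)) (trans (at p (suc i)) (coeff-φu u i))

  from-relation : ∀ u → (∀ i → Commutes θ g₁ g₂ (sequence u) i) → mul u φ ≋ mul φ u
  from-relation u p = mk λ
    -- The coefficient of τ⁰ imposes no condition: it is the product of the constant terms on both
    -- sides. Hence u₀ may be prescribed.
    { zero → trans (coeff₀-mul u φ) (trans (*-comm _ _) (sym (coeff₀-mul φ u)))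
    ; (suc i) → trans (coeff-uφ u i) (trans (p i) (sym (coeff-φu u i))) }

-- Over K, u_i = √D s_(i+1) / Δ_(i+1) always solves the commutation relation with ψ_T;
-- if two consecutive values of s vanish, it terminates and is an endomorphism.

module TerminatingSolution {c ℓ c′ ℓ′ : Level} (h : ℕ) (k : FiniteField c ℓ (suc (h ℕ.+ h))) (L : Domain c′ ℓ′)
    (γ : RawRing.Carrier (FunctionField.A k) → Domain.Carrier L)
    (γ-hom : RingMorphisms.IsRingHomomorphism (FunctionField.A k) (Domain.rawRing L) γ) (g₁ g₂ : Domain.Carrier L) where
  open FunctionField k using (T)
  open PolyQuotient k using (kᴰ; Aᴰ)
  private
    module k = Domain kᴰ using ()
    module A where
      open Domain Aᴰ public using (commutativeRing; Carrier; _*_; -_; _-_)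
      open Poly (Domain.commutativeRing kᴰ) public using (Poly; mul; _≋_; at)
    module γ = RingHom γ-hom

  open Domain L using (commutativeRing; 1≉0; zero-product; Carrier; _≈_; _+_; _*_; -_; _-_; 0#; 1#; refl; sym; trans; setoid; rawRing; +-cong; +-congˡ; +-congʳ; *-cong; *-congˡ; *-congʳ; *-assoc; +-identityˡ; +-identityʳ; *-identityˡ; *-identityʳ; zeroˡ; zeroʳ; ^-congˡ; module Solver; nonzero-product; difference-zero; zero-difference; ^-nonzero)
  open Drinfeld k L γ γ-hom using (ι; ι-hom; 2≤q; ^q-zero; σ; Poly; coeff; add; mul; _≋_; at; coeff-add; coeff-scale; vanish; <°-scale; τ^; τ^-≤°; coeff-τ^; iter-nonzero; γ-[])
  open Commutation commutativeRing σ using (Commutes)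
  open CommutationCoefficients k L ι ι-hom (γ T) g₁ g₂ using (φ; sequence; from-relation)

  module _ (γ-injective : ∀ {a b} → γ a ≈ γ b → a A.≋ b) (inverse : ∀ x → x ≈ 0# ⊎ ∃[ y ] x * y ≈ 1#)
           (constant-term : ∀ u → mul u φ ≋ mul φ u → ∃[ a ] coeff u 0 ≈ γ a)
           (e G₁ G₂ D : A.Carrier) (e≉0 : ¬ e A.≋ []) (g₁e : g₁ * γ e ≈ γ G₁) (g₂e : g₂ * γ e ≈ γ G₂) where
    private
      module Sc = Scaling A.commutativeRing h T e G₁ G₂ D using (σ; μ; Δ; s)
      module Sol = ScalingSolution A.commutativeRing h T e G₁ G₂ D commutativeRing γ γ-hom using (f-^; f-iter; scaling)

      γ-nonzero : ∀ {a} → ¬ a A.≋ [] → ¬ γ a ≈ 0#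
      γ-nonzero a≉0 p = a≉0 (γ-injective (trans p (sym γ-[])))

      q : ℕ
      q = suc (h ℕ.+ h)

      iter-σ≉0 : ∀ n {a} → ¬ a A.≋ [] → ¬ iter Sc.σ n a A.≋ []
      iter-σ≉0 n {a} a≉0 p = iter-nonzero n (γ-nonzero a≉0) (trans (sym (Sol.f-iter n a)) (trans (γ.⟦⟧-cong (A.at p)) γ-[]))

    -- γ is injective here. In the reduction this element is zero whenever deg p divides `suc n`.
    bracket≉0 : ∀ n → ¬ γ (iter Sc.σ (suc n) T) - γ T ≈ 0#
    bracket≉0 n p = Powers.iter-T≉T k 2≤q n (γ-injective (difference-zero p))

    μ≉0 : ∀ i → ¬ γ (Sc.μ i) ≈ 0#
    μ≉0 zero    p = 1≉0 (trans (sym γ.1#-homo) p)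
    μ≉0 (suc i) p = nonzero-product (bracket≉0 i) (nonzero-product (nonzero-product (γ-nonzero e≉0)
        (γ-nonzero (iter-σ≉0 i e≉0))) (γ-nonzero (iter-σ≉0 (i ℕ.∸ 1) e≉0))) (begin
      (γ (iter Sc.σ (suc i) T) - γ T) * (γ e * γ (iter Sc.σ i e) * γ (iter Sc.σ (i ℕ.∸ 1) e))
        ≈⟨ *-cong (trans (γ.+-homo _ _) (+-congˡ (γ.-‿homo T))) (trans (γ.*-homo _ _) (*-congʳ (γ.*-homo e _))) ⟨
      γ (iter Sc.σ (suc i) T A.- T) * γ (e A.* iter Sc.σ i e A.* iter Sc.σ (i ℕ.∸ 1) e)
        ≈⟨ γ.*-homo _ _ ⟨
      γ (Sc.μ (suc i)) ≈⟨ p ⟩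
      0# ∎)
      where open SetoidReasoning setoid

    Δ≉0 : ∀ i → ¬ γ (Sc.Δ i) ≈ 0#
    Δ≉0 zero    p = 1≉0 (trans (sym γ.1#-homo) p)
    Δ≉0 (suc i) p = nonzero-product (μ≉0 i) (^-nonzero q (Δ≉0 i))
      (trans (sym (trans (γ.*-homo _ _) (*-congˡ (Sol.f-^ (Sc.Δ i) q)))) p)

    private
      module Solution (x : Carrier) where
        bracket : ℕ → Carrier
        bracket i = iter σ (suc i) (γ T) - γ T

        bracket-inverse : ∀ i → ∃[ y ] bracket i * y ≈ 1#
        bracket-inverse i = [ (λ p → contradiction (trans (+-congʳ (Sol.f-iter (suc i) T)) p) (bracket≉0 i)) , id ]′
          (inverse (bracket i))

        rest : ℕ → Carrier → Carrier → Carrier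
        rest i x₀ x₁ = g₁ * σ x₁ - iter σ i g₁ * x₁ + (g₂ * σ (σ x₀) - iter σ (i ℕ.∸ 1) g₂ * x₀)

        u⁺ : ℕ → Carrier
        u⁺ zero          = 0#
        u⁺ (suc zero)    = x
        u⁺ (suc (suc i)) = proj₁ (bracket-inverse i) * rest i (u⁺ i) (u⁺ (suc i))

        relation : ∀ i → Commutes (γ T) g₁ g₂ u⁺ i
        relation i = difference-zero (begin
          X * t + x₁ * k₁ + x₀ * k₀ - (γ T * X + a + b)
            ≈⟨ solve 9 (λ X t x₁ k₁ x₀ k₀ θ a b → X :* t :+ x₁ :* k₁ :+ x₀ :* k₀ :- (θ :* X :+ a :+ b)
                 := (t :- θ) :* X :- (a :- k₁ :* x₁ :+ (b :- k₀ :* x₀))) refl X t x₁ k₁ x₀ k₀ (γ T) a b ⟩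
          (t - γ T) * X - rest i x₀ x₁
            ≈⟨ zero-difference (trans (sym (*-assoc _ _ _)) (trans (*-congʳ (proj₂ (bracket-inverse i))) (*-identityˡ _))) ⟩
          0# ∎)
          where
          open SetoidReasoning setoid
          open Solver
          X = u⁺ (2 ℕ.+ i)
          x₁ = u⁺ (suc i)
          x₀ = u⁺ i
          t = iter σ (suc i) (γ T)
          k₁ = iter σ i g₁
          k₀ = iter σ (i ℕ.∸ 1) g₂
          a = g₁ * σ x₁
          b = g₂ * σ (σ x₀)

        truncation : ℕ → List Carrier
        truncation zero    = []
        truncation (suc N) = add (truncation N) (map (u⁺ (suc N) *_) (τ^ N))

        truncation-< : ∀ N i → i ℕ.< N → coeff (truncation N) i ≈ u⁺ (suc i)
        truncation-≥ : ∀ N i → N ℕ.≤ i → coeff (truncation N) i ≈ 0#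
        truncation-< (suc N) i (s≤s i≤N) = trans (coeff-add (truncation N) _ i) (trans (+-congˡ (coeff-scale (u⁺ (suc N)) (τ^ N) i))
          (by-cases (ℕ.m≤n⇒m<n∨m≡n i≤N)))
          where
          coeff-τ^-< : ∀ {i N} → i ℕ.< N → coeff (τ^ N) i ≈ 0#
          coeff-τ^-< {zero}  {suc N} _       = refl
          coeff-τ^-< {suc i} {suc N} (s≤s p) = coeff-τ^-< p
          by-cases : i ℕ.< N ⊎ i ≡ N → coeff (truncation N) i + u⁺ (suc N) * coeff (τ^ N) i ≈ u⁺ (suc i)
          by-cases (inj₁ i<N)    = trans (+-cong (truncation-< N i i<N) (trans (*-congˡ (coeff-τ^-< i<N)) (zeroʳ _))) (+-identityʳ _)
          by-cases (inj₂ ≡.refl) = trans (+-cong (truncation-≥ N N ℕ.≤-refl) (trans (*-congˡ (coeff-τ^ N)) (*-identityʳ _))) (+-identityˡ _)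
        truncation-≥ zero    i _ = refl
        truncation-≥ (suc N) i p = trans (coeff-add (truncation N) _ i) (trans
          (+-cong (truncation-≥ N i (ℕ.≤-trans (ℕ.n≤1+n N) p)) (vanish (<°-scale (u⁺ (suc N)) (τ^-≤° N)) i p)) (+-identityˡ 0#))

        module _ (N : ℕ) (zero₁ : u⁺ (suc N) ≈ 0#) (zero₂ : u⁺ (2 ℕ.+ N) ≈ 0#) where
          u : List Carrier
          u = truncation N

          agree : ∀ i → i ℕ.≤ 2 ℕ.+ N → sequence u i ≈ u⁺ i
          agree zero    _ = refl
          agree (suc i) p = by-cases (i ℕ.<? N)
            where
            last : N ℕ.≤ i → u⁺ (suc i) ≈ 0#
            last N≤i = [ (λ N<i → ≡.subst (λ j → u⁺ (suc j) ≈ 0#) (ℕ.≤-antisym N<i (ℕ.s≤s⁻¹ p)) zero₂)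
                       , (λ N≡i → ≡.subst (λ j → u⁺ (suc j) ≈ 0#) N≡i zero₁) ]′ (ℕ.m≤n⇒m<n∨m≡n N≤i)
            by-cases : Dec (i ℕ.< N) → coeff u i ≈ u⁺ (suc i)
            by-cases (yes i<N) = truncation-< N i i<N
            by-cases (no  i≮N) = trans (truncation-≥ N i (ℕ.≮⇒≥ i≮N)) (sym (last (ℕ.≮⇒≥ i≮N)))

          -- For i ≤ N only indices up to N + 2 occur, where the truncation agrees with `u⁺` thanks
          -- to the two zeros. For i > N all three terms lie in the range cut off, and both sides
          -- are 0.
          u-relation : ∀ i → Commutes (γ T) g₁ g₂ (sequence u) i
          u-relation i = by-cases (i ℕ.≤? N)
            where
            by-cases : Dec (i ℕ.≤ N) → Commutes (γ T) g₁ g₂ (sequence u) i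
            by-cases (yes i≤N) = trans
              (+-cong (+-cong (*-congʳ a₂) (*-congʳ a₁)) (*-congʳ a₀))
              (trans (relation i) (sym (+-cong (+-cong (*-congˡ a₂) (*-congˡ (^-congˡ q a₁))) (*-congˡ (^-congˡ q (^-congˡ q a₀))))))
              where
              a₂ = agree (2 ℕ.+ i) (s≤s (s≤s i≤N))
              a₁ = agree (1 ℕ.+ i) (s≤s (ℕ.m≤n⇒m≤1+n i≤N))
              a₀ = agree i (ℕ.m≤n⇒m≤1+n (ℕ.m≤n⇒m≤1+n i≤N))
            by-cases (no i≰N) = trans (sum-zero (kill z₂) (kill z₁) (kill z₀))
                (sym (sum-zero (kill′ z₂) (kill′ (σ0 z₁)) (kill′ (σ0 (σ0 z₀)))))
              where
              N<i = ℕ.≰⇒> i≰N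
              z : ∀ j → N ℕ.< j → sequence u j ≈ 0#
              z (suc j) (s≤s N≤j) = truncation-≥ N j N≤j
              z₂ = z (2 ℕ.+ i) (ℕ.m≤n⇒m≤1+n (ℕ.m≤n⇒m≤1+n N<i))
              z₁ = z (1 ℕ.+ i) (ℕ.m≤n⇒m≤1+n N<i)
              z₀ = z i N<i
              σ0 : ∀ {a} → a ≈ 0# → σ a ≈ 0#
              σ0 p = trans (^-congˡ q p) ^q-zero
              kill : ∀ {a b} → a ≈ 0# → a * b ≈ 0#
              kill p = trans (*-congʳ p) (zeroˡ _)
              kill′ : ∀ {a b} → b ≈ 0# → a * b ≈ 0#
              kill′ p = trans (*-congˡ p) (zeroʳ _)
              sum-zero : ∀ {a b r} → a ≈ 0# → b ≈ 0# → r ≈ 0# → a + b + r ≈ 0#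
              sum-zero p r t = trans (+-cong (trans (+-cong p r) (+-identityˡ 0#)) t) (+-identityˡ 0#)

    -- As Δ does not vanish, the zeros of s are zeros of the solution, so its truncation commutes
    -- with φ. The bound 1 ≤ N keeps the constant term x inside the truncation; being the constant
    -- term of an endomorphism, x lies in γ(A).
    is-square : ∀ x → x * x ≈ γ D → ∀ N → 1 ℕ.≤ N → Sc.s (suc N) A.≋ [] → Sc.s (2 ℕ.+ N) A.≋ [] → ∃[ a ] A.mul a a A.≋ D
    is-square x x² N 1≤N s₁ s₂ =
      let a , r = constant-term (truncation N) (from-relation (truncation N) (u-relation N (c-zero (suc N) (ℕ.n≤1+n _) s₁) (c-zero (2 ℕ.+ N) ℕ.≤-refl s₂)))
      in a , γ-injective (trans (γ.*-homo a a) (trans (sym (*-cong (trans (sym u₀) r) (trans (sym u₀) r))) x²))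
      where
      open Solution x using (bracket; bracket-inverse; rest; u⁺; relation; truncation; truncation-<; truncation-≥; u; agree; u-relation)
      c-zero : ∀ i → i ℕ.≤ 2 ℕ.+ N → Sc.s i A.≋ [] → u⁺ i ≈ 0#
      c-zero i i≤ sᵢ = [ (λ p → contradiction p (Δ≉0 i)) , id ]′ (zero-product (γ (Sc.Δ i)) (u⁺ i) (trans
        (sym (Sol.scaling g₁ g₂ x u⁺ g₁e g₂e
                x² refl refl (suc N) (λ i _ → relation i) i i≤))
        (trans (*-congˡ (trans (γ.⟦⟧-cong (A.at sᵢ)) γ-[])) (zeroʳ x))))
      u₀ : coeff (truncation N) 0 ≈ x
      u₀ = truncation-< N 0 1≤N

-- Square roots of D in the algebraic closure

module SquareRoot {c ℓ f ℓf s ℓs : Level} (h : ℕ) (k : FiniteField c ℓ (suc (h ℕ.+ h)))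
    (F : FractionField (FunctionField.A k) f ℓf) (K : AlgebraicClosure (FractionField.asField F) s ℓs)
    (ψ : FunctionField.DrinfeldModule k (FractionField.rawRing F) (FractionField.embedding F) 2)
    (trivial : FunctionField.Rational.TrivialEndomorphismRing k F K ψ) where
  open FunctionField k using (T; module DrinfeldModule; module Rational)
  open Rational F using (IsEndomorphism; ψᴷ)
  open PolyQuotient k using (kᴰ; Aᴰ)
  private
    module k = Domain kᴰ using ()
    module A where
      open Domain Aᴰ public using (commutativeRing; Carrier; rawRing)
      open Poly (Domain.commutativeRing kᴰ) public using (id-isRingHomomorphism; Poly; mul; _≋_; mk)
      open SkewDegree (Domain.commutativeRing kᴰ) id id-isRingHomomorphism public using ()
    module F = FractionField F
    module K = AlgebraicClosure K
    Fᴰ = field⇒domain F.asField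
    Kᴰ = field⇒domain K.asField
    module Fᴰ = Domain Fᴰ using (commutativeRing; _^_)

    γF-hom : RingMorphisms.IsRingHomomorphism A.rawRing F.rawRing F.embedding
    γF-hom = RingMorphisms.IsRingMonomorphism.isRingHomomorphism F.isRingMonomorphism

  γ : A.Carrier → K.Carrier
  γ a = K.embedding (F.embedding a)

  γ-hom : RingMorphisms.IsRingHomomorphism A.rawRing K.rawRing γ
  γ-hom = Composition.isRingHomomorphism K.trans γF-hom K.isRingHomomorphism

  private
    module γ = RingHom γ-hom
    module emb = RingHom K.isRingHomomorphism
    module DF where
      open Drinfeld k Fᴰ F.embedding γF-hom public using (ι; ^q-isRingHomomorphism; σ; mul; module Module)
      open Module ψ public using (ψ; ψ-[]; φ; ψ-∷; ψ-coeff₀)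
    module ψ = DrinfeldModule ψ

  open Domain Kᴰ using (commutativeRing; Carrier; _≈_; _+_; _*_; -_; _-_; 0#; 1#; refl; sym; trans; rawRing; *-congˡ; *-comm; _^_; module Solver; difference-zero)
  open Drinfeld k Kᴰ γ γ-hom using (ι; ι-hom; ^q-isRingHomomorphism; iter-ι; σ; Poly; coeff; add; mul; _≋_; mk; at; ≋-refl; ≋-sym; ≋-trans; coeff-scale; add-cong; add-zeroʳ; mul-congʳ; mul-zeroʳ; mul-zeroˡ; mul-congˡ; mul-distribʳ; mul-distribˡ; mul-assoc; coeff-mul-const; module ≋-Reasoning; module Module)
  open Commutation commutativeRing σ using ()

  γ-injective : ∀ {a b} → γ a ≈ γ b → a A.≋ b
  γ-injective p = A.mk (RingMorphisms.IsRingMonomorphism.injective F.isRingMonomorphism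
    (field-hom-injective F.asField Kᴰ K.embedding K.isRingHomomorphism p))

  g₁ g₂ : Carrier
  g₁ = K.embedding (ψ.g 1)
  g₂ = K.embedding (ψ.g 2)

  private
    emb-^ : ∀ x n → K.embedding (x Fᴰ.^ n) ≈ K.embedding x ^ n
    emb-^ x zero    = emb.1#-homo
    emb-^ x (suc n) = trans (emb.*-homo x _) (*-congˡ (emb-^ x n))

    module Emb = SkewMap Fᴰ.commutativeRing commutativeRing DF.σ DF.^q-isRingHomomorphism σ ^q-isRingHomomorphism
                   K.embedding K.isRingHomomorphism (λ x → emb-^ x (suc (h ℕ.+ h))) using (coeff-mapf; mapf-cong; mapf-add; mapf-mul)

  open CommutationCoefficients k Kᴰ ι ι-hom (γ T) g₁ g₂ using (φ)

  ψᴷ-∷ : ∀ a b → ψᴷ K ψ (a ∷ b) ≋ add (ι a ∷ []) (mul (ψᴷ K ψ b) φ)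
  ψᴷ-∷ a b = ≋-trans (Emb.mapf-cong (DF.ψ-∷ a b)) (≋-trans (Emb.mapf-add (DF.ι a ∷ []) (DF.mul (ψ.ψ b) DF.φ))
    (add-cong ≋-refl (Emb.mapf-mul (ψ.ψ b) DF.φ)))

  -- The image of ψ is generated by φ and the constants from k, and the latter commute with τ
  -- because Frobenius fixes k.
  endomorphism : ∀ u → mul u φ ≋ mul φ u → IsEndomorphism K ψ u
  endomorphism u uφ a = at (commutes a)
    where
    open ≋-Reasoning
    const-commutes : ∀ a → mul u (ι a ∷ []) ≋ mul (ι a ∷ []) u
    const-commutes a = mk λ n → trans (coeff-mul-const u (ι a) n) (trans (trans (*-congˡ (iter-ι n a)) (*-comm _ _))
      (sym (trans (at (add-zeroʳ (map (ι a *_) u)) n) (coeff-scale (ι a) u n))))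
    commutes : ∀ a → mul u (ψᴷ K ψ a) ≋ mul (ψᴷ K ψ a) u
    commutes [] = ≋-trans (mul-congʳ u ψ[]) (≋-trans (mul-zeroʳ u) (≋-sym (mul-zeroˡ (ψᴷ K ψ []) u ψ[])))
      where
      ψ[] : ψᴷ K ψ [] ≋ []
      ψ[] = Emb.mapf-cong DF.ψ-[]
    commutes (a ∷ b) = begin
      mul u (ψᴷ K ψ (a ∷ b))                                     ≈⟨ mul-congʳ u (ψᴷ-∷ a b) ⟩
      mul u (add (ι a ∷ []) (mul (ψᴷ K ψ b) φ))                  ≈⟨ mul-distribˡ u (ι a ∷ []) (mul (ψᴷ K ψ b) φ) ⟩
      add (mul u (ι a ∷ [])) (mul u (mul (ψᴷ K ψ b) φ))          ≈⟨ add-cong (const-commutes a) (≋-sym (mul-assoc u (ψᴷ K ψ b) φ)) ⟩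
      add (mul (ι a ∷ []) u) (mul (mul u (ψᴷ K ψ b)) φ)          ≈⟨ add-cong (≋-refl {mul (ι a ∷ []) u}) (mul-congˡ φ (commutes b)) ⟩
      add (mul (ι a ∷ []) u) (mul (mul (ψᴷ K ψ b) u) φ)          ≈⟨ add-cong (≋-refl {mul (ι a ∷ []) u}) (mul-assoc (ψᴷ K ψ b) u φ) ⟩
      add (mul (ι a ∷ []) u) (mul (ψᴷ K ψ b) (mul u φ))          ≈⟨ add-cong (≋-refl {mul (ι a ∷ []) u}) (mul-congʳ (ψᴷ K ψ b) uφ) ⟩
      add (mul (ι a ∷ []) u) (mul (ψᴷ K ψ b) (mul φ u))          ≈⟨ add-cong (≋-refl {mul (ι a ∷ []) u}) (≋-sym (mul-assoc (ψᴷ K ψ b) φ u)) ⟩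
      add (mul (ι a ∷ []) u) (mul (mul (ψᴷ K ψ b) φ) u)          ≈⟨ mul-distribʳ u (ι a ∷ []) (mul (ψᴷ K ψ b) φ) ⟨
      mul (add (ι a ∷ []) (mul (ψᴷ K ψ b) φ)) u                  ≈⟨ mul-congˡ u (ψᴷ-∷ a b) ⟨
      mul (ψᴷ K ψ (a ∷ b)) u                                     ∎

  -- The point at which the absence of complex multiplication enters: u is some ψ a, whose constant
  -- term is a.
  constant-term : ∀ u → mul u φ ≋ mul φ u → ∃[ a ] coeff u 0 ≈ γ a
  constant-term u uφ =
    let a , u≈ = Equivalence.to (trivial u) (endomorphism u uφ)
    in a , trans (u≈ 0) (trans (Emb.coeff-mapf (ψ.ψ a) 0) (emb.⟦⟧-cong (DF.ψ-coeff₀ a)))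

  square-root-in-K : ∀ a → ∃[ x ] x * x ≈ a
  square-root-in-K a =
    let x , p = K.algebraicallyClosed poly monic (s≤s z≤n)
    in x , difference-zero (trans (solve 2 (λ x a → x :* x :- a
         := :- a :+ x :* (con ℤ.0ℤ :+ x :* (con ℤ.1ℤ :+ x :* con ℤ.0ℤ))) refl x a) p)
    where
    open Solver
    poly : List Carrier
    poly = - a ∷ 0# ∷ 1# ∷ []
    monic : Polynomials.Monic rawRing poly
    monic = record { degree = 2 ; leading = refl
                   ; above-degree = λ { (suc zero) (s≤s ()) ; (suc (suc zero)) (s≤s (s≤s ())) ; (suc (suc (suc n))) _ → refl } }

  is-square : ∀ e G₁ G₂ D → ¬ e A.≋ [] → ψ.g 1 F.* F.embedding e F.≈ F.embedding G₁ → ψ.g 2 F.* F.embedding e F.≈ F.embedding G₂ →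
              ∀ N → 1 ℕ.≤ N → Scaling.s A.commutativeRing h T e G₁ G₂ D (suc N) A.≋ [] →
              Scaling.s A.commutativeRing h T e G₁ G₂ D (2 ℕ.+ N) A.≋ [] → ∃[ a ] A.mul a a A.≋ D
  is-square e G₁ G₂ D e≉0 g₁e g₂e = TerminatingSolution.is-square h k Kᴰ γ γ-hom g₁ g₂ γ-injective K.inverse constant-term
    e G₁ G₂ D e≉0 (trans (sym (emb.*-homo _ _)) (emb.⟦⟧-cong g₁e)) (trans (sym (emb.*-homo _ _)) (emb.⟦⟧-cong g₂e))
    (proj₁ (square-root-in-K (γ D))) (proj₂ (square-root-in-K (γ D)))

-- Degrees of s and Δ

module DegreeBounds {c ℓ : Level} (h : ℕ) (k : FiniteField c ℓ (suc (h ℕ.+ h))) (C M : ℕ) where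
  q : ℕ
  q = suc (h ℕ.+ h)

  -- The cost of one step in units of q^(i+1): 1 for T^(q^(i+1)) - T, 3 C for three twists of e, G₁
  -- or G₂, and q M for Dʰ σ(Dʰ).
  w : ℕ
  w = 1 ℕ.+ 3 ℕ.* C ℕ.+ q ℕ.* M

  -- The solution of bound (i + 2) = q bound (i + 1) + q^(i+1) w: a step raises earlier terms to the
  -- q-th power and adds the cost `room`. The inhomogeneous term grows at the same rate q, whence
  -- the factor i.
  bound : ℕ → ℕ
  bound zero    = 0
  bound (suc i) = i ℕ.* (q ℕ.^ i ℕ.* w)

  room : ℕ → ℕ
  room zero    = 0
  room (suc i) = q ℕ.^ suc i ℕ.* w

  bound-suc : ∀ i → bound (2 ℕ.+ i) ≡ room (suc i) ℕ.+ q ℕ.* bound (suc i)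
  bound-suc i = solve 4 (λ i q x w → (con 1 :+ i) :* (q :* x :* w) := q :* x :* w :+ q :* (i :* (x :* w))) ≡.refl i q (q ℕ.^ i) w
    where open ℕ.+-*-Solver

  room-bound : ∀ i → room i ℕ.+ q ℕ.* bound i ℕ.≤ bound (suc i)
  room-bound zero    = ℕ.≤-reflexive (ℕ.*-zeroʳ q)
  room-bound (suc i) = ℕ.≤-reflexive (≡.sym (bound-suc i))

  private
    module _ (i : ℕ) where
      X XC R Y Z HM : ℕ
      X  = q ℕ.^ i
      XC = X ℕ.* C
      R  = room i
      Y  = bound (suc i)
      Z  = bound i
      HM = h ℕ.* M ℕ.+ q ℕ.* (h ℕ.* M)

      1≤X : 1 ℕ.≤ X
      1≤X = ℕ.m^n>0 q i

      C≤XC : C ℕ.≤ XC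
      C≤XC = ℕ.m≤n*m C X {{ℕ.>-nonZero 1≤X}}

      HM≤ : HM ℕ.≤ X ℕ.* (q ℕ.* (q ℕ.* M))
      HM≤ = begin
        -- The terms added in the first two steps are exactly the difference M + 2 h M + 2 h² M
        -- between q² M and the left side.
        h ℕ.* M ℕ.+ q ℕ.* (h ℕ.* M)                                          ≤⟨ ℕ.m≤m+n _ (h ℕ.* M ℕ.+ M ℕ.+ 2 ℕ.* (h ℕ.* (h ℕ.* M))) ⟩
        h ℕ.* M ℕ.+ q ℕ.* (h ℕ.* M) ℕ.+ (h ℕ.* M ℕ.+ M ℕ.+ 2 ℕ.* (h ℕ.* (h ℕ.* M))) ≤⟨ ℕ.m≤m+n _ (h ℕ.* M) ⟩
        h ℕ.* M ℕ.+ q ℕ.* (h ℕ.* M) ℕ.+ (h ℕ.* M ℕ.+ M ℕ.+ 2 ℕ.* (h ℕ.* (h ℕ.* M))) ℕ.+ h ℕ.* M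
          ≡⟨ solve 2 (λ h m → h :* m :+ (con 1 :+ (h :+ h)) :* (h :* m) :+ (h :* m :+ m :+ con 2 :* (h :* (h :* m))) :+ h :* m
               := (con 1 :+ (h :+ h)) :* ((con 1 :+ (h :+ h)) :* m)) ≡.refl h M ⟩
        q ℕ.* (q ℕ.* M)                                                      ≤⟨ ℕ.m≤n*m _ X {{ℕ.>-nonZero 1≤X}} ⟩
        X ℕ.* (q ℕ.* (q ℕ.* M))                                              ∎
        where open ℕ.≤-Reasoning
              open ℕ.+-*-Solver

      κ : ℕ
      κ = 3 ℕ.* (X ℕ.* C)

      room-≥ : q ℕ.^ suc i ℕ.* 1 ℕ.+ (κ ℕ.+ HM) ℕ.≤ room (suc i)
      room-≥ = begin
        q ℕ.* X ℕ.* 1 ℕ.+ (3 ℕ.* (X ℕ.* C) ℕ.+ HM)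
          ≤⟨ ℕ.+-monoʳ-≤ (q ℕ.* X ℕ.* 1) (ℕ.+-mono-≤ (ℕ.m≤n*m _ q) HM≤) ⟩
        q ℕ.* X ℕ.* 1 ℕ.+ (q ℕ.* (3 ℕ.* (X ℕ.* C)) ℕ.+ X ℕ.* (q ℕ.* (q ℕ.* M)))
          ≡⟨ solve 4 (λ q x c m → q :* x :* con 1 :+ (q :* (con 3 :* (x :* c)) :+ x :* (q :* (q :* m)))
               := q :* x :* (con 1 :+ con 3 :* c :+ q :* m)) ≡.refl q X C M ⟩
        q ℕ.* X ℕ.* w ∎
        where open ℕ.≤-Reasoning
              open ℕ.+-*-Solver

      κHM≤ : κ ℕ.+ HM ℕ.≤ room (suc i)
      κHM≤ = ℕ.≤-trans (ℕ.m≤n+m (κ ℕ.+ HM) (q ℕ.^ suc i ℕ.* 1)) room-≥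

      κ≤ : κ ℕ.≤ room (suc i)
      κ≤ = ℕ.≤-trans (ℕ.m≤m+n κ HM) κHM≤

      triple₁ : XC ℕ.+ XC ℕ.+ C ℕ.≤ κ
      triple₁ = ℕ.≤-trans (ℕ.+-monoʳ-≤ (XC ℕ.+ XC) C≤XC) (ℕ.≤-reflexive (solve 1 (λ x → x :+ x :+ x := con 3 :* x) ≡.refl XC))
        where open ℕ.+-*-Solver

      triple₂ : C ℕ.+ XC ℕ.+ XC ℕ.≤ κ
      triple₂ = ℕ.≤-trans (ℕ.+-monoˡ-≤ XC (ℕ.+-monoˡ-≤ XC C≤XC)) (ℕ.≤-reflexive (solve 1 (λ x → x :+ x :+ x := con 3 :* x) ≡.refl XC))
        where open ℕ.+-*-Solver

      target : ∀ {t} → t ℕ.≤ room (suc i) ℕ.+ q ℕ.* Y → t ℕ.≤ bound (2 ℕ.+ i)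
      target {t} = ≡.subst (t ℕ.≤_) (≡.sym (bound-suc i))

      term₁ : XC ℕ.+ XC ℕ.+ C ℕ.+ h ℕ.* M ℕ.+ q ℕ.* Y ℕ.≤ bound (2 ℕ.+ i)
      term₁ = target (ℕ.+-monoˡ-≤ (q ℕ.* Y) (ℕ.≤-trans (ℕ.+-mono-≤ triple₁ (ℕ.m≤m+n (h ℕ.* M) _)) κHM≤))

      term₂ : C ℕ.+ XC ℕ.+ XC ℕ.+ (h ℕ.+ h) ℕ.* Y ℕ.+ Y ℕ.≤ bound (2 ℕ.+ i)
      term₂ = target (≡.subst (ℕ._≤ room (suc i) ℕ.+ q ℕ.* Y)
        (solve 3 (λ a h y → a :+ (con 1 :+ (h :+ h)) :* y := a :+ (h :+ h) :* y :+ y) ≡.refl (C ℕ.+ XC ℕ.+ XC) h Y)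
        (ℕ.+-monoˡ-≤ (q ℕ.* Y) (ℕ.≤-trans triple₂ κ≤)))
        where open ℕ.+-*-Solver

      inner : ℕ
      inner = κ ℕ.+ HM ℕ.+ q ℕ.* (q ℕ.* Z)

      term₃ : XC ℕ.+ XC ℕ.+ C ℕ.+ HM ℕ.+ q ℕ.* (q ℕ.* Z) ℕ.≤ inner
      term₃ = ℕ.+-monoˡ-≤ (q ℕ.* (q ℕ.* Z)) (ℕ.+-monoˡ-≤ HM triple₁)

      term₄ : C ℕ.+ XC ℕ.+ XC ℕ.+ ((h ℕ.+ h) ℕ.* Z ℕ.+ q ℕ.* ((h ℕ.+ h) ℕ.* Z)) ℕ.+ Z ℕ.≤ inner
      term₄ = ≡.subst (ℕ._≤ inner)
        (solve 3 (λ a h z → a :+ (con 1 :+ (h :+ h)) :* ((con 1 :+ (h :+ h)) :* z)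
                   := a :+ ((h :+ h) :* z :+ (con 1 :+ (h :+ h)) :* ((h :+ h) :* z)) :+ z) ≡.refl (C ℕ.+ XC ℕ.+ XC) h Z)
        (ℕ.+-monoˡ-≤ (q ℕ.* (q ℕ.* Z)) (ℕ.≤-trans triple₂ (ℕ.m≤m+n κ HM)))
        where open ℕ.+-*-Solver

      outer : q ℕ.* R ℕ.+ inner ℕ.≤ bound (2 ℕ.+ i)
      outer = target (≡.subst (ℕ._≤ room (suc i) ℕ.+ q ℕ.* Y)
        (solve 4 (λ a q r z → a :+ q :* (r :+ z) := q :* r :+ (a :+ q :* z)) ≡.refl (κ ℕ.+ HM) q R (q ℕ.* Z))
        (ℕ.+-mono-≤ κHM≤ (ℕ.*-monoʳ-≤ q (room-bound i))))
        where open ℕ.+-*-Solver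

  open PolyQuotient k using (kᴰ; Aᴰ)
  private module k = Domain kᴰ
  open Domain Aᴰ using (commutativeRing; Carrier)
  open Poly k.commutativeRing using (id-isRingHomomorphism; Poly; T)
  open SkewDegree k.commutativeRing id id-isRingHomomorphism using (_≤°_; <°-length; <°-mono; <°-add; <°-neg; []-<°; mul-≤°)
  open Powers k using (^-≤°; iter-≤°)

  module _ (e G₁ G₂ D : Carrier) (e≤ : e ≤° C) (G₁≤ : G₁ ≤° C) (G₂≤ : G₂ ≤° C) (D≤ : D ≤° M) where
    open Scaling commutativeRing h T e G₁ G₂ D using (σ; μ; Δ; s)

    private
      iter-pred-≤° : ∀ {u d} i → u ≤° d → iter σ (i ℕ.∸ 1) u ≤° q ℕ.^ i ℕ.* d
      iter-pred-≤° {u} {d} i u≤ = <°-mono (s≤s (ℕ.*-monoˡ-≤ d (ℕ.^-monoʳ-≤ q (ℕ.m∸n≤m i 1)))) (iter-≤° (i ℕ.∸ 1) u≤)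

    μ-≤° : ∀ i → μ i ≤° room i
    μ-≤° zero    = <°-length (k.1# ∷ [])
    μ-≤° (suc i) = <°-mono (s≤s (ℕ.≤-trans (ℕ.+-monoʳ-≤ (q ℕ.^ suc i ℕ.* 1) (ℕ.≤-trans (triple₂ i) (ℕ.m≤m+n (κ i) (HM i)))) (room-≥ i)))
      (mul-≤° (<°-add (iter-≤° (suc i) (<°-length T))
                      (<°-neg (<°-mono (s≤s (≡.subst (1 ℕ.≤_) (≡.sym (ℕ.*-identityʳ (q ℕ.^ suc i))) (ℕ.m^n>0 q (suc i)))) (<°-length T))))
              (mul-≤° (mul-≤° e≤ (iter-≤° i e≤)) (iter-pred-≤° i e≤)))

    Δ-≤° : ∀ i → Δ i ≤° bound i
    Δ-≤° zero    = <°-length (k.1# ∷ [])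
    Δ-≤° (suc i) = <°-mono (s≤s (room-bound i)) (mul-≤° (μ-≤° i) (^-≤° q (Δ-≤° i)))

    s-≤° : ∀ i → s i ≤° bound i
    s-≤° zero          = []-<°
    s-≤° (suc zero)    = <°-length (k.1# ∷ [])
    s-≤° (suc (suc i)) = <°-add
      (<°-add
        (<°-mono (s≤s (term₁ i)) (mul-≤° (mul-≤° (mul-≤° E≤ G₁≤) (^-≤° h D≤)) (^-≤° q (s-≤° (suc i)))))
        (<°-neg (<°-mono (s≤s (term₂ i)) (mul-≤° (mul-≤° (mul-≤° (mul-≤° e≤ (iter-pred-≤° i e≤)) (iter-≤° i G₁≤)) (^-≤° (h ℕ.+ h) (Δ-≤° (suc i)))) (s-≤° (suc i))))))
      (<°-mono (s≤s (outer i)) (mul-≤° (^-≤° q (μ-≤° i)) (<°-add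
        (<°-mono (s≤s (term₃ i)) (mul-≤° (mul-≤° (mul-≤° E≤ G₂≤) (mul-≤° (^-≤° h D≤) (^-≤° q (^-≤° h D≤)))) (^-≤° q (^-≤° q (s-≤° i)))))
        (<°-neg (<°-mono (s≤s (term₄ i)) (mul-≤° (mul-≤° (mul-≤° (mul-≤° e≤ (iter-≤° i e≤)) (iter-pred-≤° i G₂≤))
          (mul-≤° (^-≤° (h ℕ.+ h) (Δ-≤° i)) (^-≤° q (^-≤° (h ℕ.+ h) (Δ-≤° i))))) (s-≤° i)))))))
      where
      E≤ : Domain._*_ Aᴰ (iter σ i e) (iter σ (i ℕ.∸ 1) e) ≤° q ℕ.^ i ℕ.* C ℕ.+ q ℕ.^ i ℕ.* C
      E≤ = mul-≤° (iter-≤° i e≤) (iter-pred-≤° i e≤)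

-- Bounding deg p in terms of m

module ReducedDegree {c ℓ c′ ℓ′ : Level} (h : ℕ) (k : FiniteField c ℓ (suc (h ℕ.+ h))) (L : Domain c′ ℓ′)
    (γ : RawRing.Carrier (FunctionField.A k) → Domain.Carrier L)
    (γ-hom : RingMorphisms.IsRingHomomorphism (FunctionField.A k) (Domain.rawRing L) γ)
    {n : ℕ} (0<n : 0 ℕ.< n) (card : Inverse (Domain.setoid L) (≡.setoid (Fin (suc (h ℕ.+ h) ℕ.^ n))))
    (ψ̄ : FunctionField.DrinfeldModule k (Domain.rawRing L) γ 2)
    (d₁ d₂ : RawRing.Carrier (FunctionField.A k)) (monic₁ : FunctionField.Monic k d₁) (monic₂ : FunctionField.Monic k d₂)
    (d₁∣d₂ : FunctionField._∣_ k d₁ d₂)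
    (iso : FunctionField._≅_ k (FunctionField.DrinfeldModule.module-on-L ψ̄)
             (FunctionField._⊕_ k (FunctionField.A/-module k d₁) (FunctionField.A/-module k d₂))) where
  open FunctionField k using (T; module Monic; module DrinfeldModule)
  open Domain L using (commutativeRing; zero-product; Carrier; _≈_; _+_; _*_; -_; _-_; 0#; 1#; refl; sym; trans; setoid; rawRing; +-cong; +-congˡ; +-congʳ; *-congˡ; *-congʳ; *-assoc; *-comm; zeroʳ; -‿inverseʳ; -‿cong; -0#≈0#; -‿involutive; _^_; module Solver; difference-zero; *-cancelˡ)
  open PolyQuotient k using (kᴰ; Aᴰ; monic-multiple)
  private
    q : ℕ
    q = suc (h ℕ.+ h)
    module k = Domain kᴰ using (_≈_; _+_; -_; _-_; 0#; 1#; trans; setoid; -‿cong; -0#≈0#; -‿involutive)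
    module A where
      open Domain Aᴰ public using (commutativeRing; Carrier; _+_; -_; _-_; 1#)
      open Poly (Domain.commutativeRing kᴰ) public using (id-isRingHomomorphism; Poly; coeff; mul; _≋_; at; ≋-sym; mul-zeroˡ)
      open SkewDegree (Domain.commutativeRing kᴰ) id id-isRingHomomorphism public using (_<°_; below; vanish; _≤°_; <°-length; <°-resp; <°-mono; <°-add; <°-neg; []-<°; mul-≤°)
      open SkewDomain kᴰ id id-isRingHomomorphism (λ _ p → p) public using (degree?; lead-nonzero)
    module A≋ = Domain (PolyDomain.polyDomain≋ kᴰ) using (difference-zero)
    module γ = RingHom γ-hom
    module ψ̄ = DrinfeldModule ψ̄
    module Red = ReducedModule k L γ γ-hom 0<n card ψ̄ d₁ d₂ monic₁ monic₂ d₁∣d₂ iso using (degree-≤; 2δ≤n; m; discriminant)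
    module DL = Drinfeld k L γ γ-hom using (ι; ι-hom; Poly; coeff; mul; _≋_; vanish; _≤°_)
    module CC = CommutationCoefficients k L DL.ι DL.ι-hom (γ T) (ψ̄.g 1) (ψ̄.g 2) using (φ; sequence; to-relation)

    δ = Monic.degree monic₁
    δ₂ = Monic.degree monic₂

    2≉0 : ¬ k.1# k.+ k.1# k.≈ k.0#
    2≉0 = FiniteDomain.odd⇒2≉0 kᴰ (FiniteField.cardinality k) h ≡.refl

  m : ℕ
  m = Red.m

  private
    n≡ : δ ℕ.+ δ ℕ.+ m ≡ n
    n≡ = ℕ.m+[n∸m]≡n Red.2δ≤n

  n+m≤2δ₂ : n ℕ.+ m ℕ.≤ δ₂ ℕ.+ δ₂
  n+m≤2δ₂ = ℕ.+-cancelˡ-≤ (δ ℕ.+ δ) _ _ (begin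
    δ ℕ.+ δ ℕ.+ (n ℕ.+ m)        ≡⟨ solve 3 (λ a n m → a :+ (n :+ m) := n :+ (a :+ m)) ≡.refl (δ ℕ.+ δ) n m ⟩
    n ℕ.+ (δ ℕ.+ δ ℕ.+ m)        ≡⟨ ≡.cong (n ℕ.+_) n≡ ⟩
    n ℕ.+ n                      ≤⟨ ℕ.+-mono-≤ Red.degree-≤ Red.degree-≤ ⟩
    δ ℕ.+ δ₂ ℕ.+ (δ ℕ.+ δ₂)      ≡⟨ solve 2 (λ a b → a :+ b :+ (a :+ b) := a :+ a :+ (b :+ b)) ≡.refl δ δ₂ ⟩
    δ ℕ.+ δ ℕ.+ (δ₂ ℕ.+ δ₂)      ∎)
    where open ℕ.≤-Reasoning
          open ℕ.+-*-Solver

  γ-cong : ∀ {f g} → f A.≋ g → γ f ≈ γ g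
  γ-cong p = γ.⟦⟧-cong (A.at p)

  -- The denominator e is fixed once for all primes and may be divisible by p, so it is never
  -- inverted; the one cancelled is b, which belongs to the prime at hand.
  clear-denominators : ∀ {x a b} e G → ¬ γ b ≈ 0# → A.mul a e A.≋ A.mul b G → x * γ b ≈ γ a → x * γ e ≈ γ G
  clear-denominators {x} {a} {b} e G γb≉0 ae xb = *-cancelˡ γb≉0 (begin
    γ b * (x * γ e)      ≈⟨ trans (sym (*-assoc _ _ _)) (*-congʳ (trans (*-comm _ _) xb)) ⟩
    γ a * γ e            ≈⟨ γ.*-homo a e ⟨
    γ (A.mul a e)        ≈⟨ γ-cong ae ⟩
    γ (A.mul b G)        ≈⟨ γ.*-homo b G ⟩
    γ b * γ G            ∎)
    where open SetoidReasoning setoid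

  module _ (kernel : ∀ f → f A.<° n → γ f ≈ 0# → f A.≋ []) where
    private
      small-unique : ∀ {f g} → f A.<° n → g A.<° n → γ f ≈ γ g → f A.≋ g
      small-unique {f} {g} f< g< p = A≋.difference-zero {f} {g} (kernel (f A.- g) (A.<°-add f< (A.<°-neg g<))
        (trans (γ.+-homo f (A.- g)) (trans (+-cong p (γ.-‿homo g)) (-‿inverseʳ _))))

    -- The left side has degree < n, so this would hold in A, where d₁ does not divide 2.
    no-inverse : 2 ℕ.≤ δ → ∀ z → z A.≤° suc m → ¬ γ z * γ d₁ ≈ - (1# + 1#)
    no-inverse 2≤δ z z≤ zd₁ = 2≉0 (begin
      k.1# k.+ k.1#              ≈⟨ k.-‿involutive _ ⟨
      k.- k.- (k.1# k.+ k.1#)    ≈⟨ k.-‿cong (A.at zd₁≋ 0) ⟨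
      k.- A.coeff (A.mul z d₁) 0 ≈⟨ k.-‿cong (A.at (A.mul-zeroˡ z d₁ z≋0) 0) ⟩
      k.- k.0#                   ≈⟨ k.-0#≈0# ⟩
      k.0#                       ∎)
      where
      open SetoidReasoning k.setoid
      -2# = A.- (A.1# A.+ A.1#)
      d₁≤ : d₁ A.≤° δ
      d₁≤ = A.below (Monic.above-degree monic₁)
      small : suc (suc m ℕ.+ δ) ℕ.≤ n
      small = ≡.subst (suc (suc m ℕ.+ δ) ℕ.≤_) n≡ (≡.subst (2 ℕ.+ m ℕ.+ δ ℕ.≤_)
        (solve 2 (λ d m → d :+ m :+ d := d :+ d :+ m) ≡.refl δ m) (ℕ.+-monoˡ-≤ δ (ℕ.+-monoˡ-≤ m 2≤δ)))
        where open ℕ.+-*-Solver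
      γ-2 : γ -2# ≈ - (1# + 1#)
      γ-2 = trans (γ.-‿homo (A.1# A.+ A.1#)) (-‿cong (trans (γ.+-homo A.1# A.1#) (+-cong γ.1#-homo γ.1#-homo)))
      zd₁≋ : A.mul z d₁ A.≋ -2#
      zd₁≋ = small-unique (A.<°-mono small (A.mul-≤° z≤ d₁≤)) (A.<°-mono (ℕ.≤-trans (s≤s z≤n) small) (A.<°-length -2#))
        (trans (γ.*-homo z d₁) (trans zd₁ (sym γ-2)))
      z≋0 : z A.≋ []
      z≋0 = monic-multiple d₁≤ (Monic.leading monic₁) z
        (A.<°-resp (A.≋-sym zd₁≋) (A.<°-mono (ℕ.≤-trans (s≤s z≤n) 2≤δ) (A.<°-length -2#)))

    module _ (C : ℕ) (e G₁ G₂ : A.Carrier) (e≤ : e A.≤° C) (G₁≤ : G₁ A.≤° C) (G₂≤ : G₂ A.≤° C)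
             (g₁e : ψ̄.g 1 * γ e ≈ γ G₁) (g₂e : ψ̄.g 2 * γ e ≈ γ G₂)
             (square-root : ∀ D i → 1 ℕ.≤ i → Scaling.s A.commutativeRing h T e G₁ G₂ D (suc i) A.≋ []
                            → Scaling.s A.commutativeRing h T e G₁ G₂ D (2 ℕ.+ i) A.≋ [] → ∃[ r ] A.mul r r A.≋ D) where
      degree-bound : ℕ
      degree-bound = (2 ℕ.+ m) ℕ.* (q ℕ.^ (2 ℕ.+ m) ℕ.* (1 ℕ.+ 3 ℕ.* C ℕ.+ q ℕ.* suc m))

      private
        module _ (2≤δ : 2 ℕ.≤ δ) (bound<n : degree-bound ℕ.< n)
                 (D a : A.Carrier) (v : DL.Poly) (D≤ : D A.≤° suc m) (a≤ : a A.≤° m) (v≤ : v DL.≤° m)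
                 (vφ : DL.mul v CC.φ DL.≋ DL.mul CC.φ v) (v² : DL.coeff v 0 * DL.coeff v 0 ≈ γ D)
                 (unit : (DL.coeff v 0 + γ a) * γ d₁ ≈ - (1# + 1#)) where
          y : Carrier
          y = DL.coeff v 0

          open DegreeBounds h k C (suc m) using (bound; w; s-≤°)
          open Scaling A.commutativeRing h T e G₁ G₂ D using (s; Δ)

          -- Otherwise `unit` reads (r + a) d₁ ≡ -2 with r + a of degree at most m + 1, against
          -- `no-inverse`. With r = 0 this shows y ≠ 0.
          not-±root : ∀ r → r A.≤° suc m → ¬ y ≈ γ r
          not-±root r r≤ y≈ = no-inverse 2≤δ (r A.+ a) (A.<°-add r≤ (A.<°-mono (ℕ.n≤1+n _) a≤))
            (trans (*-congʳ (trans (γ.+-homo r a) (+-congʳ (sym y≈)))) unit)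

          y≉0 : ¬ y ≈ 0#
          y≉0 y≈0 = not-±root [] A.[]-<° (trans y≈0 (sym γ.0#-homo))

          -- From y s_i ≡ Δ_i v_(i-1) ≡ 0 and y ≠ 0 it follows that p divides s_i, and deg s_i < n
          -- leaves only s_i = 0.
          vanishing : ∀ i → CC.sequence v i ≈ 0# → i ℕ.≤ 3 ℕ.+ m → s i A.≋ []
          vanishing i vᵢ i≤ = kernel (s i)
            (A.<°-mono (ℕ.≤-trans (s≤s (bound-mono i i≤)) bound<n) (s-≤° e G₁ G₂ D e≤ G₁≤ G₂≤ D≤ i))
            ([ (λ y≈0 → contradiction y≈0 y≉0) , id ]′ (zero-product y (γ (s i)) ys≈0))
            where
            ys≈0 : y * γ (s i) ≈ 0#
            ys≈0 = trans (ScalingSolution.scaling A.commutativeRing h T e G₁ G₂ D commutativeRing γ γ-hom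
                     (ψ̄.g 1) (ψ̄.g 2) y (CC.sequence v) g₁e g₂e v²
                     refl refl (2 ℕ.+ m) (λ i _ → CC.to-relation v vφ i) i i≤)
                   (trans (*-congˡ vᵢ) (zeroʳ _))
            bound-mono : ∀ i → i ℕ.≤ 3 ℕ.+ m → bound i ℕ.≤ degree-bound
            bound-mono zero    _       = z≤n
            bound-mono (suc i) (s≤s p) = ℕ.*-mono-≤ p (ℕ.*-monoˡ-≤ w (ℕ.^-monoʳ-≤ q p))

          root-≤° : ∀ r → A.mul r r A.≋ D → r A.≤° suc m
          root-≤° r r² = [ (λ r≋0 → A.<°-resp (A.≋-sym r≋0) A.[]-<°) , nonzero ]′ (A.degree? r)
            where
            nonzero : ∃[ d ] r A.≤° d × ¬ A.coeff r d k.≈ k.0# → r A.≤° suc m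
            nonzero (d , r≤ , rd) = A.<°-mono (s≤s (ℕ.≮⇒≥ λ M<d → A.lead-nonzero {r} {r} r≤ r≤ rd rd
              (k.trans (A.at r² (d ℕ.+ d)) (A.vanish D≤ (d ℕ.+ d) (ℕ.≤-trans M<d (ℕ.m≤m+n d d)))))) r≤

          from-root : ∀ r → A.mul r r A.≋ D → ⊥
          from-root r r² = [ not-±root r r≤ ∘ difference-zero
                           , not-±root (A.- r) (A.<°-neg r≤) ∘ difference-zero
                               ∘ trans (+-congˡ (trans (-‿cong (γ.-‿homo r)) (-‿involutive _)))
                           ]′ (zero-product (y - γ r) (y + γ r) factored)
            where
            r≤ = root-≤° r r²
            factored : (y - γ r) * (y + γ r) ≈ 0#
            factored = begin
              (y - γ r) * (y + γ r)      ≈⟨ solve 2 (λ y r → (y :- r) :* (y :+ r) := y :* y :- r :* r) refl y (γ r) ⟩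
              y * y - γ r * γ r          ≈⟨ +-cong v² (-‿cong (trans (sym (γ.*-homo r r)) (γ-cong r²))) ⟩
              γ D - γ D                  ≈⟨ -‿inverseʳ _ ⟩
              0#                         ∎
              where open SetoidReasoning setoid
                    open Solver

          impossible : ⊥
          impossible =
            -- v has degree at most m, so its coefficients at τ^(m+1) and τ^(m+2) vanish; in the
            -- shifted sequence these sit at m + 2 and m + 3.
            let r , r² = square-root D (suc m) (s≤s z≤n)
                           (vanishing (2 ℕ.+ m) (DL.vanish v≤ (suc m) ℕ.≤-refl) (ℕ.n≤1+n _))
                           (vanishing (3 ℕ.+ m) (DL.vanish v≤ (2 ℕ.+ m) (ℕ.n≤1+n _)) ℕ.≤-refl)
            in from-root r r²

      degree-bounded : n ℕ.≤ degree-bound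
      degree-bounded = by-cases (2 ℕ.≤? δ)
        where
        -- `no-inverse` compares degrees up to m + 1 + δ with n = 2 δ + m, and the former is smaller
        -- exactly when δ ≥ 2. For δ ≤ 1 the bound holds at once, since n ≤ m + 2.
        by-cases : Dec (2 ℕ.≤ δ) → n ℕ.≤ degree-bound
        by-cases (yes 2≤δ) = ℕ.≮⇒≥ λ bound<n →
          let D , a , v , D≤ , a≤ , v≤ , vφ , v² , unit = Red.discriminant
          in impossible 2≤δ bound<n D a v D≤ a≤ v≤ vφ v² unit
        by-cases (no  2≰δ) = begin
          n                    ≡⟨ n≡ ⟨
          δ ℕ.+ δ ℕ.+ m        ≤⟨ ℕ.+-monoˡ-≤ m (ℕ.+-mono-≤ δ≤1 δ≤1) ⟩
          2 ℕ.+ m              ≤⟨ ℕ.m≤m*n (2 ℕ.+ m) (q ℕ.^ (2 ℕ.+ m) ℕ.* (1 ℕ.+ 3 ℕ.* C ℕ.+ q ℕ.* suc m)) {{ℕ.m*n≢0 _ _ {{ℕ.m^n≢0 q (2 ℕ.+ m)}}}} ⟩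
          degree-bound         ∎
          where
          open ℕ.≤-Reasoning
          δ≤1 = ℕ.s≤s⁻¹ (ℕ.≰⇒> 2≰δ)

-- One degree bound for all reductions of ψ

module Combinatorial {c ℓ f ℓf s ℓs : Level} (h : ℕ) (k : FiniteField c ℓ (suc (h ℕ.+ h)))
    (F : FractionField (FunctionField.A k) f ℓf) (K : AlgebraicClosure (FractionField.asField F) s ℓs)
    (ψ : FunctionField.DrinfeldModule k (FractionField.rawRing F) (FractionField.embedding F) 2)
    (trivial : FunctionField.Rational.TrivialEndomorphismRing k F K ψ) where
  open FunctionField k using (A; A/; A/-module; _∣_; _⊕_; _≅_; T; Monic; Prime; DrinfeldModule; module Rational)
  open Rational F using (IsReduction)
  private module F = FractionField F
  open PolyQuotient k using (kᴰ; Aᴰ)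
  private
    q : ℕ
    q = suc (h ℕ.+ h)
    module A where
      open Domain Aᴰ public using (commutativeRing; Carrier; _≈_; _+_; _*_; -_; _-_; 0#; 1#; rawRing)
      open Poly (Domain.commutativeRing kᴰ) public using (id-isRingHomomorphism; Poly; mul; _≋_; mk; at)
      open SkewDegree (Domain.commutativeRing kᴰ) id id-isRingHomomorphism public using (_≤°_; <°-length; <°-mono)
    module A≋ = Domain (PolyDomain.polyDomain≋ kᴰ) using (nonzero-product)
    module ψ = DrinfeldModule ψ
    Fᴰ = field⇒domain F.asField
    module Fᴰ = Domain Fᴰ using (module Solver)
    module emb = RingHom (RingMorphisms.IsRingMonomorphism.isRingHomomorphism F.isRingMonomorphism)

    emb-injective : ∀ {a b} → F.embedding a F.≈ F.embedding b → a A.≋ b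
    emb-injective p = A.mk (RingMorphisms.IsRingMonomorphism.injective F.isRingMonomorphism p)

  record CommonDenominator : Set (c ⊔ ℓ ⊔ ℓf) where
    field
      e G₁ G₂ : A.Carrier
      e≉0     : ¬ e A.≋ []
      g₁e     : ψ.g 1 F.* F.embedding e F.≈ F.embedding G₁
      g₂e     : ψ.g 2 F.* F.embedding e F.≈ F.embedding G₂

  commonDenominator : CommonDenominator
  commonDenominator = common (F.fraction (ψ.g 1)) (F.fraction (ψ.g 2))
    where
    Fraction : F.Carrier → Set _
    Fraction x = ∃[ a ] ∃[ b ] (¬ b A.≈ A.0#) × x F.* F.embedding b F.≈ F.embedding a
    common : Fraction (ψ.g 1) → Fraction (ψ.g 2) → CommonDenominator
    common (a₁ , b₁ , b₁≉0 , p₁) (a₂ , b₂ , b₂≉0 , p₂) = record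
      { e = A.mul b₁ b₂ ; G₁ = A.mul a₁ b₂ ; G₂ = A.mul a₂ b₁
      ; e≉0 = A≋.nonzero-product {b₁} {b₂} (b₁≉0 ∘ A.at) (b₂≉0 ∘ A.at)
      ; g₁e = F.trans (F.*-congˡ (emb.*-homo b₁ b₂)) (F.trans (F.sym (F.*-assoc _ _ _)) (F.trans (F.*-congʳ p₁) (F.sym (emb.*-homo a₁ b₂))))
      ; g₂e = F.trans (F.*-congˡ (F.trans (emb.*-homo b₁ b₂) (F.*-comm _ _))) (F.trans (F.sym (F.*-assoc _ _ _)) (F.trans (F.*-congʳ p₂) (F.sym (emb.*-homo a₂ b₁)))) }

  open CommonDenominator commonDenominator

  -- The length of a list exceeds its degree whatever its trailing zeros, so lengths serve as degree
  -- bounds; C depends on ψ alone.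
  C : ℕ
  C = length e ℕ.+ (length G₁ ℕ.+ length G₂)

  private
    length-≤° : ∀ a N → length a ℕ.≤ N → a A.≤° N
    length-≤° a N p = A.<°-mono (ℕ.m≤n⇒m≤1+n p) (A.<°-length a)

    e≤ : e A.≤° C
    e≤ = length-≤° e C (ℕ.m≤m+n _ _)
    G₁≤ : G₁ A.≤° C
    G₁≤ = length-≤° G₁ C (ℕ.≤-trans (ℕ.m≤m+n (length G₁) (length G₂)) (ℕ.m≤n+m _ (length e)))
    G₂≤ : G₂ A.≤° C
    G₂≤ = length-≤° G₂ C (ℕ.≤-trans (ℕ.m≤n+m (length G₂) (length G₁)) (ℕ.m≤n+m _ (length e)))

  degree-bound : ℕ → ℕ
  degree-bound m = (2 ℕ.+ m) ℕ.* (q ℕ.^ (2 ℕ.+ m) ℕ.* (1 ℕ.+ 3 ℕ.* C ℕ.+ q ℕ.* suc m))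

  cross-multiply : ∀ {g a b e G} → g F.* F.embedding b F.≈ F.embedding a → g F.* F.embedding e F.≈ F.embedding G →
                   A.mul a e A.≋ A.mul b G
  cross-multiply {g} {a} {b} {e} {G} gb ge = emb-injective (F.trans (emb.*-homo a e) (F.trans (F.*-congʳ (F.sym gb)) (F.trans
    (Fᴰ.Solver.solve 3 (λ g b e → g Fᴰ.Solver.:* b Fᴰ.Solver.:* e Fᴰ.Solver.:= b Fᴰ.Solver.:* (g Fᴰ.Solver.:* e)) F.refl g (F.embedding b) (F.embedding e))
    (F.trans (F.*-congˡ ge) (F.sym (emb.*-homo b G))))))

  module AtPrime (p : A.Carrier) (p-monic : Monic p) (prime : Prime p)
      (ψ̄ : DrinfeldModule (A/ p) id 2) (reduction : IsReduction p ψ ψ̄)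
      (d₁ d₂ : A.Carrier) (monic₁ : Monic d₁) (monic₂ : Monic d₂) (d₁∣d₂ : d₁ ∣ d₂)
      (iso : DrinfeldModule.module-on-L ψ̄ ≅ A/-module d₁ ⊕ A/-module d₂) where
    private
      module R = PolyQuotient.Residues k p p-monic
      Lᴰ = R.quotientDomain prime
      module L = Domain Lᴰ using (_≈_; _*_; refl; rawRing)
      module ψ̄ = DrinfeldModule ψ̄

      γ-hom : RingMorphisms.IsRingHomomorphism A.rawRing L.rawRing id
      γ-hom = record
        { isSemiringHomomorphism = record
          { isNearSemiringHomomorphism = record
            { +-isMonoidHomomorphism = record
              { isMagmaHomomorphism = record
                { isRelHomomorphism = record { cong = λ {x} {y} → R.≈⇒∼ {x} {y} }
                ; homo = λ x y → L.refl {x A.+ y} }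
              ; ε-homo = L.refl {A.0#} }
            ; *-homo = λ x y → L.refl {x A.* y} }
          ; 1#-homo = L.refl {A.1#} }
        ; -‿homo = λ x → L.refl {A.- x} }

      0<n = R.0<δ prime

    n = Monic.degree p-monic
    δ₂ = Monic.degree monic₂

    m : ℕ
    m = ReducedDegree.m h k Lᴰ id γ-hom 0<n R.residues ψ̄ d₁ d₂ monic₁ monic₂ d₁∣d₂ iso

    private
      reduced : ∀ i {G} → ψ.g i F.* F.embedding e F.≈ F.embedding G → ψ̄.g i L.* e L.≈ G
      reduced i {G} ge =
        let a , b , p∤b , gb , yb = reduction i
        in ReducedDegree.clear-denominators h k Lᴰ id γ-hom 0<n R.residues ψ̄ d₁ d₂ monic₁ monic₂ d₁∣d₂ iso
             {ψ̄.g i} {a} {b} e G (p∤b ∘ R.∼0⇒∣) (cross-multiply gb ge) yb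

    conclusion : ∃[ m ] n ℕ.+ m ℕ.≤ δ₂ ℕ.+ δ₂ × n ℕ.≤ degree-bound m × 1 ℕ.≤ n
    conclusion = m
      , ReducedDegree.n+m≤2δ₂ h k Lᴰ id γ-hom 0<n R.residues ψ̄ d₁ d₂ monic₁ monic₂ d₁∣d₂ iso
      , ReducedDegree.degree-bounded h k Lᴰ id γ-hom 0<n R.residues ψ̄ d₁ d₂ monic₁ monic₂ d₁∣d₂ iso
          (λ f f< f∼0 → R.small-multiple f< (R.∼0⇒∣ f∼0)) C e G₁ G₂ e≤ G₁≤ G₂≤ (reduced 1 g₁e) (reduced 2 g₂e)
          (λ D → SquareRoot.is-square h k F K ψ trivial e G₁ G₂ D e≉0 g₁e g₂e)
      , 0<n

-- Logarithms of natural numbers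

module Logarithms where
  open import Data.Rational.Base using (0ℚ; 1ℚ; _+_; _*_; _-_; -_; _≤_; _<_)
  open ℤ-Solver ℚ.+-*-commutativeRing
  open ℕ.+-*-Solver using () renaming (solve to solveℕ; _:*_ to _:*′_; _:+_ to _:+′_; _:=_ to _:=′_; con to con′)

  -- Natural numbers as rationals

  ⌜_⌝ : ℕ → ℚ
  ⌜ n ⌝ = ℤ.+ n ℚ./ 1

  private
    toℚᵘ-⌜⌝ : ∀ n → ℚ.toℚᵘ ⌜ n ⌝ ℚᵘ.≃ mkℚᵘ (ℤ.+ n) 0
    toℚᵘ-⌜⌝ n = ℚ.toℚᵘ-fromℚᵘ (mkℚᵘ (ℤ.+ n) 0)

  ⌜⌝-+ : ∀ m n → ⌜ m ℕ.+ n ⌝ ≡ ⌜ m ⌝ + ⌜ n ⌝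
  ⌜⌝-+ m n = ℚ.toℚᵘ-injective (ℚᵘ.≃-trans (toℚᵘ-⌜⌝ (m ℕ.+ n)) (ℚᵘ.≃-sym (ℚᵘ.≃-trans (ℚ.toℚᵘ-homo-+ ⌜ m ⌝ ⌜ n ⌝)
    (ℚᵘ.≃-trans (ℚᵘ.+-cong (toℚᵘ-⌜⌝ m) (toℚᵘ-⌜⌝ n)) (*≡* (cong (ℤ._* ℤ.1ℤ) (cong₂ ℤ._+_ (ℤ.*-identityʳ (ℤ.+ m)) (ℤ.*-identityʳ (ℤ.+ n)))))))))

  ⌜⌝-* : ∀ m n → ⌜ m ℕ.* n ⌝ ≡ ⌜ m ⌝ * ⌜ n ⌝
  ⌜⌝-* m n = ℚ.toℚᵘ-injective (ℚᵘ.≃-trans (toℚᵘ-⌜⌝ (m ℕ.* n)) (ℚᵘ.≃-sym (ℚᵘ.≃-trans (ℚ.toℚᵘ-homo-* ⌜ m ⌝ ⌜ n ⌝)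
    (ℚᵘ.≃-trans (ℚᵘ.*-cong (toℚᵘ-⌜⌝ m) (toℚᵘ-⌜⌝ n)) (*≡* (cong (ℤ._* ℤ.1ℤ) (≡.sym (ℤ.pos-* m n))))))))

  ⌜⌝-mono : ∀ {m n} → m ℕ.≤ n → ⌜ m ⌝ ≤ ⌜ n ⌝
  ⌜⌝-mono {m} {n} m≤n = ℚ.toℚᵘ-cancel-≤ (ℚᵘ.≤-respˡ-≃ (ℚᵘ.≃-sym (toℚᵘ-⌜⌝ m)) (ℚᵘ.≤-respʳ-≃ (ℚᵘ.≃-sym (toℚᵘ-⌜⌝ n))
    (*≤* (ℤ.*-monoʳ-≤-nonNeg ℤ.1ℤ (ℤ.+≤+ m≤n)))))

  ⌜⌝-cancel : ∀ {m n} → ⌜ m ⌝ ≤ ⌜ n ⌝ → m ℕ.≤ n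
  ⌜⌝-cancel {m} {n} p = drop (ℚᵘ.≤-respˡ-≃ (toℚᵘ-⌜⌝ m) (ℚᵘ.≤-respʳ-≃ (toℚᵘ-⌜⌝ n) (ℚ.toℚᵘ-mono-≤ p)))
    where
    drop : mkℚᵘ (ℤ.+ m) 0 ℚᵘ.≤ mkℚᵘ (ℤ.+ n) 0 → m ℕ.≤ n
    drop (*≤* r) = ℤ.drop‿+≤+ (≡.subst₂ ℤ._≤_ (ℤ.*-identityʳ (ℤ.+ m)) (ℤ.*-identityʳ (ℤ.+ n)) r)

  recip : ℕ → ℚ
  recip k = ℤ.+ 1 ℚ./ suc k

  recip-inverse : ∀ k → ⌜ suc k ⌝ * recip k ≡ 1ℚ
  recip-inverse k = ℚ.toℚᵘ-injective (ℚᵘ.≃-trans (ℚ.toℚᵘ-homo-* ⌜ suc k ⌝ (recip k))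
    (ℚᵘ.≃-trans (ℚᵘ.*-cong (toℚᵘ-⌜⌝ (suc k)) (ℚ.toℚᵘ-fromℚᵘ (mkℚᵘ (ℤ.+ 1) k)))
      (*≡* (≡.trans (ℤ.*-identityʳ _) (≡.trans (ℤ.*-identityʳ (ℤ.+ suc k))
        (≡.sym (≡.trans (ℤ.*-identityˡ _) (cong (λ j → ℤ.+ suc j) (ℕ.+-identityʳ k)))))))))

  0≤⌜⌝ : ∀ n → 0ℚ ≤ ⌜ n ⌝
  0≤⌜⌝ n = ⌜⌝-mono {0} {n} z≤n

  0<recip : ∀ k → 0ℚ < recip k
  0<recip k = ℚ.positive⁻¹ (recip k) {{ℚ.normalize-pos 1 (suc k)}}

  -- Ordered field lemmas

  *-mono : ∀ {a b x y} → 0ℚ ≤ a → 0ℚ ≤ y → a ≤ b → x ≤ y → a * x ≤ b * y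
  *-mono {a} {b} {x} {y} 0≤a 0≤y a≤b x≤y = ℚ.≤-trans
    (ℚ.*-monoˡ-≤-nonNeg a {{ℚ.nonNegative 0≤a}} x≤y) (ℚ.*-monoʳ-≤-nonNeg y {{ℚ.nonNegative 0≤y}} a≤b)

  *-monoˡ : ∀ {a x y} → 0ℚ ≤ a → x ≤ y → a * x ≤ a * y
  *-monoˡ {a} 0≤a = ℚ.*-monoˡ-≤-nonNeg a {{ℚ.nonNegative 0≤a}}

  *-monoʳ : ∀ {a x y} → 0ℚ ≤ a → x ≤ y → x * a ≤ y * a
  *-monoʳ {a} 0≤a = ℚ.*-monoʳ-≤-nonNeg a {{ℚ.nonNegative 0≤a}}

  *-nonNeg : ∀ {a b} → 0ℚ ≤ a → 0ℚ ≤ b → 0ℚ ≤ a * b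
  *-nonNeg {a} {b} 0≤a 0≤b = ≡.subst (_≤ a * b) (ℚ.*-zeroʳ a) (*-monoˡ 0≤a 0≤b)

  +-nonNeg : ∀ {a b} → 0ℚ ≤ a → 0ℚ ≤ b → 0ℚ ≤ a + b
  +-nonNeg 0≤a 0≤b = ℚ.+-mono-≤ 0≤a 0≤b

  cancelʳ : ∀ {a x y} → 0ℚ < a → x * a ≤ y * a → x ≤ y
  cancelʳ {a} 0<a = ℚ.*-cancelʳ-≤-pos a {{ℚ.positive 0<a}}

  cancelˡ : ∀ {a x y} → 0ℚ < a → a * x ≤ a * y → x ≤ y
  cancelˡ {a} 0<a = ℚ.*-cancelˡ-≤-pos a {{ℚ.positive 0<a}}

  +-cancelʳ : ∀ {x y} z → x + z ≤ y + z → x ≤ y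
  +-cancelʳ {x} {y} z p = ≡.subst₂ _≤_ (lemma x) (lemma y) (ℚ.+-monoˡ-≤ (- z) p)
    where
    lemma : ∀ x → x + z + - z ≡ x
    lemma x = solve 2 (λ x z → x :+ z :+ :- z := x) ≡.refl x z

  0≤difference : ∀ {x y} → x ≤ y → 0ℚ ≤ y - x
  0≤difference {x} {y} p = ≡.subst (_≤ y - x) (ℚ.+-inverseʳ x) (ℚ.+-monoˡ-≤ (- x) p)

  <⇒≱ : ∀ {x y} → x < y → ¬ y ≤ x
  <⇒≱ x<y y≤x = ℚ.<-irrefl ≡.refl (ℚ.<-≤-trans x<y y≤x)

  ≰⇒≥ : ∀ {x y} → ¬ x ≤ y → y ≤ x
  ≰⇒≥ p = ℚ.<⇒≤ (ℚ.≰⇒> p)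

  square-cancel : ∀ {x y} → 0ℚ ≤ y → x * x ≤ y * y → x ≤ y
  square-cancel {x} {y} 0≤y p with x ℚ.≤? y
  ... | yes x≤y = x≤y
  ... | no  x≰y = contradiction p (<⇒≱ (ℚ.≤-<-trans (*-monoˡ 0≤y (ℚ.<⇒≤ y<x)) (ℚ.*-monoˡ-<-pos x {{ℚ.positive (ℚ.≤-<-trans 0≤y y<x)}} y<x)))
    where y<x = ℚ.≰⇒> x≰y

  ∣-∣-upper : ∀ p → p ≤ ℚ.∣ p ∣
  ∣-∣-upper p with ℚ.∣p∣≡p∨∣p∣≡-p p
  ... | inj₁ e = ℚ.≤-reflexive (≡.sym e)
  ... | inj₂ e = ℚ.≤-trans p≤0 (ℚ.0≤∣p∣ p)
    where
    p≤0 : p ≤ 0ℚ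
    p≤0 = ≡.subst (_≤ 0ℚ) (solve 1 (λ p → :- (:- p) := p) ≡.refl p) (ℚ.neg-antimono-≤ (≡.subst (0ℚ ≤_) e (ℚ.0≤∣p∣ p)))

  close⇒≤ : ∀ {x y ε} → ℚ.∣ x - y ∣ ≤ ε → x ≤ y + ε
  close⇒≤ {x} {y} {ε} p = ≡.subst (_≤ y + ε) (solve 2 (λ x y → y :+ (x :- y) := x) ≡.refl x y)
    (ℚ.+-monoʳ-≤ y (ℚ.≤-trans (∣-∣-upper (x - y)) p))

  close⇒≥ : ∀ {x y ε} → ℚ.∣ x - y ∣ ≤ ε → y ≤ x + ε
  close⇒≥ {x} {y} {ε} p = ≡.subst (_≤ x + ε) (solve 2 (λ x y → x :+ :- (x :- y) := y) ≡.refl x y)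
    (ℚ.+-monoʳ-≤ x (ℚ.≤-trans (≡.subst (- (x - y) ≤_) (ℚ.∣-p∣≡∣p∣ (x - y)) (∣-∣-upper (- (x - y)))) p))

  -- Partial sums of the exponential series

  term-nonNeg : ∀ {x} k → 0ℚ ≤ x → 0ℚ ≤ expTerm x k
  term-nonNeg zero    0≤x = 0≤⌜⌝ 1
  term-nonNeg (suc k) 0≤x = *-nonNeg (term-nonNeg k 0≤x) (*-nonNeg 0≤x (ℚ.<⇒≤ (0<recip k)))

  sum-step : ∀ {x} N → 0ℚ ≤ x → expSum x N ≤ expSum x (suc N)
  sum-step {x} N 0≤x = ≡.subst (_≤ expSum x (suc N)) (ℚ.+-identityʳ _) (ℚ.+-monoʳ-≤ (expSum x N) (term-nonNeg N 0≤x))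

  sum-monoʳ : ∀ {x N M} → 0ℚ ≤ x → N ℕ.≤ M → expSum x N ≤ expSum x M
  sum-monoʳ {x} {N} {M} 0≤x N≤M = ≡.subst (λ M → expSum x N ≤ expSum x M) (ℕ.m+[n∸m]≡n N≤M) (go (M ℕ.∸ N))
    where
    go : ∀ d → expSum x N ≤ expSum x (N ℕ.+ d)
    go zero    = ℚ.≤-reflexive (cong (expSum x) (≡.sym (ℕ.+-identityʳ N)))
    go (suc d) = ≡.subst (λ M → expSum x N ≤ expSum x M) (≡.sym (ℕ.+-suc N d)) (ℚ.≤-trans (go d) (sum-step (N ℕ.+ d) 0≤x))

  -- An approximation of the logarithm is so far only known to be at least -ε, so the comparison has
  -- to allow negative r with |r| ≤ x.
  term-abs : ∀ {r x} k → - x ≤ r → r ≤ x → (- expTerm x k ≤ expTerm r k) × (expTerm r k ≤ expTerm x k)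
  term-abs {r} {x} zero    -x≤r r≤x = ℚ.≤-trans (ℚ.neg-antimono-≤ (0≤⌜⌝ 1)) (0≤⌜⌝ 1) , ℚ.≤-refl
  term-abs {r} {x} (suc k) -x≤r r≤x = lower , upper
    where
    t = expTerm r k
    s = expTerm x k
    d = recip k
    -s≤t = proj₁ (term-abs k -x≤r r≤x)
    t≤s = proj₂ (term-abs k -x≤r r≤x)
    0≤d = ℚ.<⇒≤ (0<recip k)
    -- |t r| ≤ s x from (s ± t)(x ∓ r) ≥ 0 and (s ± t)(x ± r) ≥ 0.
    pos : ∀ {a b} → - b ≤ a → 0ℚ ≤ b + a
    pos {a} {b} p = ≡.subst (_≤ b + a) (ℚ.+-inverseʳ b) (ℚ.+-monoʳ-≤ b p)
    double : ∀ {a} → 0ℚ ≤ a + a → 0ℚ ≤ a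
    double {a} p with 0ℚ ℚ.≤? a
    ... | yes 0≤a = 0≤a
    ... | no  0≰a = contradiction p (<⇒≱ (ℚ.+-mono-< (ℚ.≰⇒> 0≰a) (ℚ.≰⇒> 0≰a)))
    tr≤sx : 0ℚ ≤ s * x - t * r
    tr≤sx = double (≡.subst (0ℚ ≤_) (solve 4 (λ s t x r → (s :+ t) :* (x :- r) :+ (s :- t) :* (x :+ r) := s :* x :- t :* r :+ (s :* x :- t :* r)) ≡.refl s t x r)
      (+-nonNeg (*-nonNeg (pos -s≤t) (0≤difference r≤x)) (*-nonNeg (0≤difference t≤s) (pos -x≤r))))
    -sx≤tr : 0ℚ ≤ s * x + t * r
    -sx≤tr = double (≡.subst (0ℚ ≤_) (solve 4 (λ s t x r → (s :+ t) :* (x :+ r) :+ (s :- t) :* (x :- r) := s :* x :+ t :* r :+ (s :* x :+ t :* r)) ≡.refl s t x r)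
      (+-nonNeg (*-nonNeg (pos -s≤t) (pos -x≤r)) (*-nonNeg (0≤difference t≤s) (0≤difference r≤x))))
    upper : t * (r * d) ≤ s * (x * d)
    upper = ≡.subst₂ _≤_ (solve 4 (λ s t r d → t :* (r :* d) :+ con ℤ.0ℤ := t :* (r :* d)) ≡.refl s t r d)
      (solve 5 (λ s t x r d → t :* (r :* d) :+ (s :* x :- t :* r) :* d := s :* (x :* d)) ≡.refl s t x r d)
      (ℚ.+-monoʳ-≤ (t * (r * d)) (*-nonNeg tr≤sx 0≤d))
    lower : - (s * (x * d)) ≤ t * (r * d)
    lower = ≡.subst₂ _≤_ (solve 3 (λ s x d → :- (s :* (x :* d)) :+ con ℤ.0ℤ := :- (s :* (x :* d))) ≡.refl s x d)
      (solve 5 (λ s t x r d → :- (s :* (x :* d)) :+ (s :* x :+ t :* r) :* d := t :* (r :* d)) ≡.refl s t x r d)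
      (ℚ.+-monoʳ-≤ (- (s * (x * d))) (*-nonNeg -sx≤tr 0≤d))

  sum-abs : ∀ {r x} N → - x ≤ r → r ≤ x → expSum r N ≤ expSum x N
  sum-abs zero    p s = ℚ.≤-refl
  sum-abs (suc N) p s = ℚ.+-mono-≤ (sum-abs N p s) (proj₂ (term-abs N p s))

  sum-monoˡ : ∀ {r x} N → 0ℚ ≤ r → r ≤ x → expSum r N ≤ expSum x N
  sum-monoˡ N 0≤r r≤x = sum-abs N (ℚ.≤-trans (ℚ.neg-antimono-≤ (ℚ.≤-trans 0≤r r≤x)) 0≤r) r≤x

  term-rec : ∀ x k → x * expTerm x k ≡ ⌜ suc k ⌝ * expTerm x (suc k)
  term-rec x k = begin
    x * t                            ≡⟨ solve 2 (λ x t → x :* t := con ℤ.1ℤ :* (x :* t)) ≡.refl x t ⟩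
    1ℚ * (x * t)                     ≡⟨ cong (_* (x * t)) (recip-inverse k) ⟨
    ⌜ suc k ⌝ * recip k * (x * t)    ≡⟨ solve 4 (λ c d x t → c :* d :* (x :* t) := c :* (t :* (x :* d))) ≡.refl ⌜ suc k ⌝ (recip k) x t ⟩
    ⌜ suc k ⌝ * (t * (x * recip k))  ∎
    where
    open ≡.≡-Reasoning
    t = expTerm x k

  -- The mean value inequality for the terms of the series.
  term-difference : ∀ {x y} k → 0ℚ ≤ y → y ≤ x → expTerm x (suc k) ≤ expTerm y (suc k) + (x - y) * expTerm x k
  term-difference {x} {y} zero    0≤y y≤x = ℚ.≤-reflexive (solve 2 (λ x y → con ℤ.1ℤ :* (x :* con ℤ.1ℤ)
    := con ℤ.1ℤ :* (y :* con ℤ.1ℤ) :+ (x :- y) :* con ℤ.1ℤ) ≡.refl x y)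
  term-difference {x} {y} (suc k) 0≤y y≤x = begin
    Tx * (x * d)                                              ≡⟨ solve 4 (λ t x y d → t :* (x :* d) := d :* ((x :- y) :* t :+ y :* t)) ≡.refl Tx x y d ⟩
    d * ((x - y) * Tx + y * Tx)                               ≤⟨ *-monoˡ 0≤d (ℚ.+-monoʳ-≤ ((x - y) * Tx) (*-monoˡ 0≤y (term-difference k 0≤y y≤x))) ⟩
    d * ((x - y) * Tx + y * (Ty + (x - y) * t))               ≤⟨ *-monoˡ 0≤d (ℚ.+-monoʳ-≤ ((x - y) * Tx) y-step) ⟩
    d * ((x - y) * Tx + (y * Ty + (x - y) * (⌜ suc k ⌝ * Tx)))
      ≡⟨ solve 6 (λ d x y T S c → d :* ((x :- y) :* T :+ (y :* S :+ (x :- y) :* (c :* T)))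
           := S :* (y :* d) :+ (con ℤ.1ℤ :+ c) :* d :* ((x :- y) :* T)) ≡.refl d x y Tx Ty ⌜ suc k ⌝ ⟩
    Ty * (y * d) + (⌜ 1 ⌝ + ⌜ suc k ⌝) * d * ((x - y) * Tx)   ≡⟨ cong (λ c → Ty * (y * d) + c * d * ((x - y) * Tx)) (⌜⌝-+ 1 (suc k)) ⟨
    Ty * (y * d) + ⌜ suc (suc k) ⌝ * d * ((x - y) * Tx)       ≡⟨ cong (λ c → Ty * (y * d) + c * ((x - y) * Tx)) (recip-inverse (suc k)) ⟩
    Ty * (y * d) + 1ℚ * ((x - y) * Tx)                        ≡⟨ cong (Ty * (y * d) +_) (ℚ.*-identityˡ _) ⟩
    Ty * (y * d) + (x - y) * Tx                               ∎
    where
    open ℚ.≤-Reasoning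
    t = expTerm x k
    Tx = expTerm x (suc k)
    Ty = expTerm y (suc k)
    d = recip (suc k)
    0≤d = ℚ.<⇒≤ (0<recip (suc k))
    0≤x = ℚ.≤-trans 0≤y y≤x
    y-step : y * (Ty + (x - y) * t) ≤ y * Ty + (x - y) * (⌜ suc k ⌝ * Tx)
    y-step = begin
      y * (Ty + (x - y) * t)              ≡⟨ solve 4 (λ y T x t → y :* (T :+ (x :- y) :* t) := y :* T :+ (x :- y) :* (y :* t)) ≡.refl y Ty x t ⟩
      y * Ty + (x - y) * (y * t)          ≤⟨ ℚ.+-monoʳ-≤ (y * Ty) (*-monoˡ (0≤difference y≤x) (*-monoʳ (term-nonNeg k 0≤x) y≤x)) ⟩
      y * Ty + (x - y) * (x * t)          ≡⟨ cong (λ z → y * Ty + (x - y) * z) (term-rec x k) ⟩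
      y * Ty + (x - y) * (⌜ suc k ⌝ * Tx) ∎

  -- e^x - e^y ≤ (x - y) e^x, proved term by term for partial sums.
  sum-difference : ∀ {x y} N → 0ℚ ≤ y → y ≤ x → expSum x N ≤ expSum y N + (x - y) * expSum x N
  sum-difference {x} {y} zero    0≤y y≤x = ℚ.≤-reflexive (solve 2 (λ x y → con ℤ.0ℤ := con ℤ.0ℤ :+ (x :- y) :* con ℤ.0ℤ) ≡.refl x y)
  sum-difference {x} {y} (suc N) 0≤y y≤x = ℚ.≤-trans (go N)
    (ℚ.+-monoʳ-≤ (expSum y (suc N)) (*-monoˡ (0≤difference y≤x) (sum-step N (ℚ.≤-trans 0≤y y≤x))))
    where
    go : ∀ N → expSum x (suc N) ≤ expSum y (suc N) + (x - y) * expSum x N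
    go zero    = ℚ.≤-reflexive (solve 2 (λ x y → con ℤ.0ℤ :+ con ℤ.1ℤ := con ℤ.0ℤ :+ con ℤ.1ℤ :+ (x :- y) :* con ℤ.0ℤ) ≡.refl x y)
    go (suc N) = ℚ.≤-trans (ℚ.+-mono-≤ (go N) (term-difference N 0≤y y≤x))
      (ℚ.≤-reflexive (solve 5 (λ s d e t u → s :+ d :* e :+ (t :+ d :* u) := s :+ t :+ d :* (e :+ u)) ≡.refl
        (expSum y (suc N)) (x - y) (expSum x N) (expTerm y (suc N)) (expTerm x N)))

  -- All estimates are made in units of ε = 1/128.

  ε : ℚ
  ε = recip 127

  0<ε : 0ℚ < ε
  0<ε = 0<recip 127

  0≤ε : 0ℚ ≤ ε
  0≤ε = ℚ.<⇒≤ 0<ε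

  128ε : ⌜ 128 ⌝ * ε ≡ 1ℚ
  128ε = recip-inverse 127

  units : ∀ n → ⌜ n ⌝ ≡ ⌜ n ℕ.* 128 ⌝ * ε
  units n = begin
    ⌜ n ⌝                      ≡⟨ ℚ.*-identityʳ ⌜ n ⌝ ⟨
    ⌜ n ⌝ * 1ℚ                 ≡⟨ cong (⌜ n ⌝ *_) 128ε ⟨
    ⌜ n ⌝ * (⌜ 128 ⌝ * ε)      ≡⟨ ℚ.*-assoc ⌜ n ⌝ ⌜ 128 ⌝ ε ⟨
    ⌜ n ⌝ * ⌜ 128 ⌝ * ε        ≡⟨ cong (_* ε) (⌜⌝-* n 128) ⟨
    ⌜ n ℕ.* 128 ⌝ * ε          ∎
    where open ≡.≡-Reasoning

  units-mono : ∀ {m n} → m ℕ.≤ n → ⌜ m ⌝ * ε ≤ ⌜ n ⌝ * ε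
  units-mono p = *-monoʳ 0≤ε (⌜⌝-mono p)

  units-cancel : ∀ {m n} → ⌜ m ⌝ * ε ≤ ⌜ n ⌝ * ε → m ℕ.≤ n
  units-cancel p = ⌜⌝-cancel (cancelʳ 0<ε p)

  units-suc : ∀ n → ⌜ n ⌝ * ε + ε ≡ ⌜ n ℕ.+ 1 ⌝ * ε
  units-suc n = begin
    ⌜ n ⌝ * ε + ε         ≡⟨ solve 2 (λ n e → n :* e :+ e := (n :+ con ℤ.1ℤ) :* e) ≡.refl ⌜ n ⌝ ε ⟩
    (⌜ n ⌝ + 1ℚ) * ε      ≡⟨ cong (_* ε) (⌜⌝-+ n 1) ⟨
    ⌜ n ℕ.+ 1 ⌝ * ε       ∎
    where open ≡.≡-Reasoning

  ε≤1 : ε ≤ 1ℚ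
  ε≤1 = ≡.subst₂ _≤_ (ℚ.*-identityˡ ε) 128ε (units-mono {1} {128} (s≤s z≤n))

  -- k/32

  grid : ℕ → ℚ
  grid k = ⌜ k ℕ.* 4 ⌝ * ε

  0≤grid : ∀ k → 0ℚ ≤ grid k
  0≤grid k = *-nonNeg (0≤⌜⌝ (k ℕ.* 4)) 0≤ε

  expSum-0 : ∀ N → expSum 0ℚ N ≤ 1ℚ
  expSum-0 zero    = 0≤⌜⌝ 1
  expSum-0 (suc N) = ℚ.≤-reflexive (go N)
    where
    term-0 : ∀ k → expTerm 0ℚ (suc k) ≡ 0ℚ
    term-0 k = solve 2 (λ t d → t :* (con ℤ.0ℤ :* d) := con ℤ.0ℤ) ≡.refl (expTerm 0ℚ k) (recip k)
    go : ∀ N → expSum 0ℚ (suc N) ≡ 1ℚ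
    go zero    = ≡.refl
    go (suc N) = ≡.trans (cong₂ _+_ (go N) (term-0 N)) (ℚ.+-identityʳ 1ℚ)

  -- For a step of 1/32, `sum-difference` reads X ≤ Y + X/32, that is 31 X ≤ 32 Y. Iterating it
  -- bounds e^(k/32) by (32/31)ᵏ uniformly in N, so that later comparisons become inequalities
  -- between integers.
  exp-grid : ∀ k N → ⌜ 31 ℕ.^ k ⌝ * expSum (grid k) N ≤ ⌜ 32 ℕ.^ k ⌝
  exp-grid zero N = ≡.subst (_≤ ⌜ 1 ⌝) (≡.sym (ℚ.*-identityˡ _))
    (≡.subst (λ x → expSum x N ≤ 1ℚ) (≡.sym (ℚ.*-zeroˡ ε)) (expSum-0 N))
  exp-grid (suc k) N = begin
    ⌜ 31 ℕ.* 31 ℕ.^ k ⌝ * X           ≡⟨ cong (_* X) (⌜⌝-* 31 (31 ℕ.^ k)) ⟩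
    ⌜ 31 ⌝ * ⌜ 31 ℕ.^ k ⌝ * X         ≡⟨ solve 3 (λ a b x → a :* b :* x := b :* (a :* x)) ≡.refl ⌜ 31 ⌝ ⌜ 31 ℕ.^ k ⌝ X ⟩
    ⌜ 31 ℕ.^ k ⌝ * (⌜ 31 ⌝ * X)       ≤⟨ *-monoˡ (0≤⌜⌝ (31 ℕ.^ k)) step ⟩
    ⌜ 31 ℕ.^ k ⌝ * (⌜ 32 ⌝ * Y)       ≡⟨ solve 3 (λ a b x → b :* (a :* x) := a :* (b :* x)) ≡.refl ⌜ 32 ⌝ ⌜ 31 ℕ.^ k ⌝ Y ⟩
    ⌜ 32 ⌝ * (⌜ 31 ℕ.^ k ⌝ * Y)       ≤⟨ *-monoˡ (0≤⌜⌝ 32) (exp-grid k N) ⟩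
    ⌜ 32 ⌝ * ⌜ 32 ℕ.^ k ⌝             ≡⟨ ⌜⌝-* 32 (32 ℕ.^ k) ⟨
    ⌜ 32 ℕ.* 32 ℕ.^ k ⌝               ∎
    where
    open ℚ.≤-Reasoning
    x = grid (suc k)
    y = grid k
    X = expSum x N
    Y = expSum y N
    x-y : x - y ≡ ⌜ 4 ⌝ * ε
    x-y = ≡.trans (cong (λ z → z * ε - y) (⌜⌝-+ 4 (k ℕ.* 4)))
      (solve 3 (λ a b e → (a :+ b) :* e :- b :* e := a :* e) ≡.refl ⌜ 4 ⌝ ⌜ k ℕ.* 4 ⌝ ε)
    unit : ⌜ 32 ⌝ * (⌜ 4 ⌝ * ε) ≡ 1ℚ
    unit = ≡.trans (≡.sym (ℚ.*-assoc ⌜ 32 ⌝ ⌜ 4 ⌝ ε)) (≡.trans (cong (_* ε) (≡.sym (⌜⌝-* 32 4))) 128ε)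
    step : ⌜ 31 ⌝ * X ≤ ⌜ 32 ⌝ * Y
    step = +-cancelʳ X (begin
      ⌜ 31 ⌝ * X + X                            ≡⟨ solve 2 (λ a x → a :* x :+ x := (a :+ con ℤ.1ℤ) :* x) ≡.refl ⌜ 31 ⌝ X ⟩
      (⌜ 31 ⌝ + ⌜ 1 ⌝) * X                      ≡⟨ cong (_* X) (⌜⌝-+ 31 1) ⟨
      ⌜ 32 ⌝ * X                                ≤⟨ *-monoˡ (0≤⌜⌝ 32) (sum-difference N (0≤grid k) (units-mono (ℕ.*-monoˡ-≤ 4 (ℕ.n≤1+n k)))) ⟩
      ⌜ 32 ⌝ * (Y + (x - y) * X)                ≡⟨ cong (λ z → ⌜ 32 ⌝ * (Y + z * X)) x-y ⟩
      ⌜ 32 ⌝ * (Y + ⌜ 4 ⌝ * ε * X)              ≡⟨ solve 4 (λ a y b x → a :* (y :+ b :* x) := a :* y :+ a :* b :* x) ≡.refl ⌜ 32 ⌝ Y (⌜ 4 ⌝ * ε) X ⟩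
      ⌜ 32 ⌝ * Y + ⌜ 32 ⌝ * (⌜ 4 ⌝ * ε) * X     ≡⟨ cong (λ z → ⌜ 32 ⌝ * Y + z * X) unit ⟩
      ⌜ 32 ⌝ * Y + 1ℚ * X                       ≡⟨ cong (⌜ 32 ⌝ * Y +_) (ℚ.*-identityˡ X) ⟩
      ⌜ 32 ⌝ * Y + X                            ∎)

  private
    distrib : ∀ n a b → a ℕ.^ n ℕ.* b ℕ.^ n ≡ (a ℕ.* b) ℕ.^ n
    distrib zero    a b = ≡.refl
    distrib (suc n) a b = ≡.trans (solveℕ 4 (λ a x b y → a :*′ x :*′ (b :*′ y) :=′ a :*′ b :*′ (x :*′ y)) ≡.refl a (a ℕ.^ n) b (b ℕ.^ n))
      (cong (a ℕ.* b ℕ.*_) (distrib n a b))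

    power-split : ∀ b c e n → c ℕ.^ n ℕ.* b ℕ.^ (e ℕ.* n) ≡ (c ℕ.* b ℕ.^ e) ℕ.^ n
    power-split b c e n = ≡.trans (cong (c ℕ.^ n ℕ.*_) (≡.sym (ℕ.^-*-assoc b e n))) (distrib n c (b ℕ.^ e))

    power-≤′ : ∀ a b c e n → a ℕ.^ e ℕ.≤ c ℕ.* b ℕ.^ e → a ℕ.^ (e ℕ.* n) ℕ.≤ c ℕ.^ n ℕ.* b ℕ.^ (e ℕ.* n)
    power-≤′ a b c e n p = ≡.subst₂ ℕ._≤_ (ℕ.^-*-assoc a e n) (≡.sym (power-split b c e n)) (ℕ.^-monoˡ-≤ n p)

    power-<′ : ∀ s t a b c e n → s ℕ.* a ℕ.^ e ℕ.≤ t ℕ.* (c ℕ.* b ℕ.^ e) → a ℕ.^ e ℕ.≤ c ℕ.* b ℕ.^ e →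
               1 ℕ.≤ n → s ℕ.* a ℕ.^ (e ℕ.* n) ℕ.≤ t ℕ.* (c ℕ.^ n ℕ.* b ℕ.^ (e ℕ.* n))
    power-<′ s t a b c e n p r 1≤n = ≡.subst₂ ℕ._≤_ (cong (s ℕ.*_) (ℕ.^-*-assoc a e n)) (cong (t ℕ.*_) (≡.sym (power-split b c e n)))
      (go (a ℕ.^ e) (c ℕ.* b ℕ.^ e) n p r 1≤n)
      where
      go : ∀ x y n → s ℕ.* x ℕ.≤ t ℕ.* y → x ℕ.≤ y → 1 ℕ.≤ n → s ℕ.* x ℕ.^ n ℕ.≤ t ℕ.* y ℕ.^ n
      go x y (suc n) p r _ = ≡.subst₂ ℕ._≤_ (ℕ.*-assoc s x (x ℕ.^ n)) (ℕ.*-assoc t y (y ℕ.^ n)) (ℕ.*-mono-≤ p (ℕ.^-monoˡ-≤ n r))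

  -- e^(34/32) < 3, in the form 65/64 * 32³⁴ ≤ 3 * 31³⁴.

  power-≤ : ∀ n → 32 ℕ.^ (34 ℕ.* n) ℕ.≤ 3 ℕ.^ n ℕ.* 31 ℕ.^ (34 ℕ.* n)
  power-≤ n = power-≤′ 32 31 3 34 n (ℕ.≤ᵇ⇒≤ (32 ℕ.^ 34) (3 ℕ.* 31 ℕ.^ 34) tt)

  power-< : ∀ n → 1 ℕ.≤ n → 65 ℕ.* 32 ℕ.^ (34 ℕ.* n) ℕ.≤ 64 ℕ.* (3 ℕ.^ n ℕ.* 31 ℕ.^ (34 ℕ.* n))
  power-< n = power-<′ 65 64 32 31 3 34 n (ℕ.≤ᵇ⇒≤ (65 ℕ.* 32 ℕ.^ 34) (64 ℕ.* (3 ℕ.* 31 ℕ.^ 34)) tt)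
    (ℕ.≤ᵇ⇒≤ (32 ℕ.^ 34) (3 ℕ.* 31 ℕ.^ 34) tt)

  private
    scaled-bound : ∀ Z W Q E → ⌜ Z ⌝ * E ≤ ⌜ W ⌝ → ⌜ Q ⌝ ≤ E + ε → Z ℕ.* Q ℕ.* 128 ℕ.≤ W ℕ.* 128 ℕ.+ Z
    scaled-bound Z W Q E ZE≤W Q≤E = units-cancel (begin
      ⌜ Z ℕ.* Q ℕ.* 128 ⌝ * ε            ≡⟨ units (Z ℕ.* Q) ⟨
      ⌜ Z ℕ.* Q ⌝                        ≡⟨ ⌜⌝-* Z Q ⟩
      ⌜ Z ⌝ * ⌜ Q ⌝                      ≤⟨ *-monoˡ (0≤⌜⌝ Z) Q≤E ⟩
      ⌜ Z ⌝ * (E + ε)                    ≡⟨ ℚ.*-distribˡ-+ ⌜ Z ⌝ E ε ⟩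
      ⌜ Z ⌝ * E + ⌜ Z ⌝ * ε              ≤⟨ ℚ.+-monoˡ-≤ (⌜ Z ⌝ * ε) ZE≤W ⟩
      ⌜ W ⌝ + ⌜ Z ⌝ * ε                  ≡⟨ cong (_+ ⌜ Z ⌝ * ε) (units W) ⟩
      ⌜ W ℕ.* 128 ⌝ * ε + ⌜ Z ⌝ * ε      ≡⟨ ℚ.*-distribʳ-+ ε ⌜ W ℕ.* 128 ⌝ ⌜ Z ⌝ ⟨
      (⌜ W ℕ.* 128 ⌝ + ⌜ Z ⌝) * ε        ≡⟨ cong (_* ε) (⌜⌝-+ (W ℕ.* 128) Z) ⟨
      ⌜ W ℕ.* 128 ℕ.+ Z ⌝ * ε            ∎)
      where open ℚ.≤-Reasoning

    -- The slack 65/64 = 130/128 of `power-<` outweighs the tolerance 1/128: 130 W ≤ 128 Z Q ≤ 128 W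
    -- + Z ≤ 129 W.
    vanish : ∀ Z W P Q → 65 ℕ.* W ℕ.≤ 64 ℕ.* (P ℕ.* Z) → P ℕ.≤ Q → Z ℕ.≤ W → Z ℕ.* Q ℕ.* 128 ℕ.≤ W ℕ.* 128 ℕ.+ Z → W ℕ.≤ 0
    vanish Z W P Q p P≤Q Z≤W r = ℕ.+-cancelˡ-≤ (129 ℕ.* W) _ _ (begin
      129 ℕ.* W ℕ.+ W                ≡⟨ solveℕ 1 (λ w → con′ 129 :*′ w :+′ w :=′ con′ 2 :*′ (con′ 65 :*′ w)) ≡.refl W ⟩
      2 ℕ.* (65 ℕ.* W)               ≤⟨ ℕ.*-monoʳ-≤ 2 p ⟩
      2 ℕ.* (64 ℕ.* (P ℕ.* Z))       ≤⟨ ℕ.*-monoʳ-≤ 2 (ℕ.*-monoʳ-≤ 64 (ℕ.*-monoˡ-≤ Z P≤Q)) ⟩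
      2 ℕ.* (64 ℕ.* (Q ℕ.* Z))       ≡⟨ solveℕ 2 (λ p z → con′ 2 :*′ (con′ 64 :*′ (p :*′ z)) :=′ z :*′ p :*′ con′ 128) ≡.refl Q Z ⟩
      Z ℕ.* Q ℕ.* 128                ≤⟨ r ⟩
      W ℕ.* 128 ℕ.+ Z                ≤⟨ ℕ.+-monoʳ-≤ (W ℕ.* 128) Z≤W ⟩
      W ℕ.* 128 ℕ.+ W                ≡⟨ solveℕ 1 (λ w → w :*′ con′ 128 :+′ w :=′ con′ 129 :*′ w :+′ con′ 0) ≡.refl W ⟩
      129 ℕ.* W ℕ.+ 0                ∎)
      where open ℕ.≤-Reasoning

  -- log 3 exceeds 34/32. Below that slope the partial sum at Λ is at most (32/31)^(34 n) ≤ (64/65)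
  -- 3ⁿ, too small to be within ε of qⁿ.
  log-lower : ∀ {q n Λ} N → 3 ℕ.≤ q → 1 ℕ.≤ n → 0ℚ ≤ Λ + ε → ⌜ q ℕ.^ n ⌝ ≤ expSum Λ N + ε → grid (34 ℕ.* n) ≤ Λ
  log-lower {q} {n} {Λ} N 3≤q 1≤n 0≤Λ+ε exp≥ = decidable-stable (x ℚ.≤? Λ) λ ¬p →
    ℕ.<⇒≱ (ℕ.m^n>0 32 j) (vanish (31 ℕ.^ j) (32 ℕ.^ j) (3 ℕ.^ n) (q ℕ.^ n) (power-< n 1≤n) (ℕ.^-monoˡ-≤ n 3≤q)
      (ℕ.^-monoˡ-≤ j (ℕ.n≤1+n 31))
      (scaled-bound (31 ℕ.^ j) (32 ℕ.^ j) (q ℕ.^ n) (expSum x N) (exp-grid j N)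
        (ℚ.≤-trans exp≥ (ℚ.+-monoˡ-≤ ε (sum-abs N -x≤Λ (≰⇒≥ ¬p))))))
    where
    j = 34 ℕ.* n
    x = grid j
    ε≤x : ε ≤ x
    ε≤x = ≡.subst (_≤ x) (ℚ.*-identityˡ ε) (units-mono {1} {j ℕ.* 4} (ℕ.≤-trans 1≤n (ℕ.≤-trans (ℕ.m≤n*m n 34) (ℕ.m≤m*n j 4))))
    -x≤Λ : - x ≤ Λ
    -x≤Λ = ℚ.≤-trans (ℚ.neg-antimono-≤ ε≤x) (≡.subst₂ _≤_ (ℚ.+-identityˡ (- ε)) (solve 2 (λ l e → l :+ e :+ :- e := l) ≡.refl Λ ε) (ℚ.+-monoˡ-≤ (- ε) 0≤Λ+ε))

  -- The terms of index 0 and n in the series of e^(qn) already sum to at least 1 + qⁿ, because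
  -- (qn)ⁿ / n! ≥ qⁿ. The 1 outweighs the tolerance, and n < N makes the partial sum reach the
  -- second of these terms.
  log-upper : ∀ {q n Λ} N → 1 ℕ.≤ n → n ℕ.< N → expSum Λ N ≤ ⌜ q ℕ.^ n ⌝ + ε → Λ ≤ ⌜ q ℕ.* n ⌝
  log-upper {q} {n} {Λ} N 1≤n n<N exp≤ = decidable-stable (Λ ℚ.≤? x) λ ¬p → ℕ.<⇒≱ (ℕ.≤ᵇ⇒≤ 2 128 tt) (units-cancel {128} {1} (128≤1 ¬p))
    where
    x = ⌜ q ℕ.* n ⌝
    0≤x = 0≤⌜⌝ (q ℕ.* n)
    factor : ∀ {i} → i ℕ.< n → ⌜ q ⌝ ≤ x * recip i
    factor {i} i<n = begin
      ⌜ q ⌝                             ≡⟨ ℚ.*-identityʳ ⌜ q ⌝ ⟨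
      ⌜ q ⌝ * 1ℚ                        ≡⟨ cong (⌜ q ⌝ *_) (recip-inverse i) ⟨
      ⌜ q ⌝ * (⌜ suc i ⌝ * recip i)     ≡⟨ ℚ.*-assoc ⌜ q ⌝ ⌜ suc i ⌝ (recip i) ⟨
      ⌜ q ⌝ * ⌜ suc i ⌝ * recip i       ≡⟨ cong (_* recip i) (⌜⌝-* q (suc i)) ⟨
      ⌜ q ℕ.* suc i ⌝ * recip i         ≤⟨ *-monoʳ (ℚ.<⇒≤ (0<recip i)) (⌜⌝-mono (ℕ.*-monoʳ-≤ q i<n)) ⟩
      x * recip i                       ∎
      where open ℚ.≤-Reasoning
    term≥ : ∀ i → i ℕ.≤ n → ⌜ q ℕ.^ i ⌝ ≤ expTerm x i
    term≥ zero    _   = ℚ.≤-refl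
    term≥ (suc i) i<n = begin
      ⌜ q ℕ.* q ℕ.^ i ⌝                 ≡⟨ ≡.trans (⌜⌝-* q (q ℕ.^ i)) (ℚ.*-comm ⌜ q ⌝ _) ⟩
      ⌜ q ℕ.^ i ⌝ * ⌜ q ⌝               ≤⟨ *-mono (0≤⌜⌝ (q ℕ.^ i)) (ℚ.≤-trans (0≤⌜⌝ q) (factor i<n)) (term≥ i (ℕ.<⇒≤ i<n)) (factor i<n) ⟩
      expTerm x i * (x * recip i)       ∎
      where open ℚ.≤-Reasoning
    sum≥ : ¬ Λ ≤ x → 1ℚ + ⌜ q ℕ.^ n ⌝ ≤ expSum Λ N
    sum≥ ¬p = begin
      1ℚ + ⌜ q ℕ.^ n ⌝                  ≤⟨ ℚ.+-mono-≤ (sum-monoʳ {x} {1} 0≤x 1≤n) (term≥ n ℕ.≤-refl) ⟩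
      expSum x (suc n)                  ≤⟨ sum-monoʳ 0≤x n<N ⟩
      expSum x N                        ≤⟨ sum-monoˡ N 0≤x (≰⇒≥ ¬p) ⟩
      expSum Λ N                        ∎
      where open ℚ.≤-Reasoning
    128≤1 : ¬ Λ ≤ x → ⌜ 128 ⌝ * ε ≤ ⌜ 1 ⌝ * ε
    128≤1 ¬p = ≡.subst₂ _≤_ (≡.sym 128ε) (≡.sym (ℚ.*-identityˡ ε)) (+-cancelʳ ⌜ q ℕ.^ n ⌝ (ℚ.≤-trans (sum≥ ¬p) (ℚ.≤-trans exp≤ (ℚ.≤-reflexive (ℚ.+-comm ⌜ q ℕ.^ n ⌝ ε)))))

  private
    too-small : ∀ a b c E Λ → ⌜ a ⌝ * E ≤ ⌜ b ⌝ → ⌜ c ⌝ * ε ≤ Λ → Λ ≤ E + ε → a ℕ.* c ℕ.≤ b ℕ.* 128 ℕ.+ a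
    too-small a b c E Λ aE≤b c≤Λ Λ≤E = units-cancel (begin
      ⌜ a ℕ.* c ⌝ * ε                    ≡⟨ ≡.trans (cong (_* ε) (⌜⌝-* a c)) (ℚ.*-assoc ⌜ a ⌝ ⌜ c ⌝ ε) ⟩
      ⌜ a ⌝ * (⌜ c ⌝ * ε)                ≤⟨ *-monoˡ (0≤⌜⌝ a) (ℚ.≤-trans c≤Λ Λ≤E) ⟩
      ⌜ a ⌝ * (E + ε)                    ≡⟨ ℚ.*-distribˡ-+ ⌜ a ⌝ E ε ⟩
      ⌜ a ⌝ * E + ⌜ a ⌝ * ε              ≤⟨ ℚ.+-monoˡ-≤ (⌜ a ⌝ * ε) aE≤b ⟩
      ⌜ b ⌝ + ⌜ a ⌝ * ε                  ≡⟨ cong (_+ ⌜ a ⌝ * ε) (units b) ⟩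
      ⌜ b ℕ.* 128 ⌝ * ε + ⌜ a ⌝ * ε      ≡⟨ ≡.trans (cong (_* ε) (⌜⌝-+ (b ℕ.* 128) a)) (ℚ.*-distribʳ-+ ε ⌜ b ℕ.* 128 ⌝ ⌜ a ⌝) ⟨
      ⌜ b ℕ.* 128 ℕ.+ a ⌝ * ε            ∎)
      where open ℚ.≤-Reasoning

    sum≤power : ∀ m N → expSum (grid (34 ℕ.* m)) N ≤ ⌜ 3 ℕ.^ m ⌝
    sum≤power m N = divide (31 ℕ.^ j) (32 ℕ.^ j) (3 ℕ.^ m) (expSum (grid j) N) (ℕ.m^n>0 31 j) (power-≤ m) (exp-grid j N)
      where
      j = 34 ℕ.* m
      divide : ∀ Z W P E → 0 ℕ.< Z → W ℕ.≤ P ℕ.* Z → ⌜ Z ⌝ * E ≤ ⌜ W ⌝ → E ≤ ⌜ P ⌝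
      divide Z W P E 0<Z W≤PZ ZE≤W = cancelˡ {⌜ Z ⌝} (ℚ.<-≤-trans (ℚ.positive⁻¹ 1ℚ) (⌜⌝-mono {1} {Z} 0<Z))
        (ℚ.≤-trans ZE≤W (≡.subst (⌜ W ⌝ ≤_) (≡.trans (⌜⌝-* P Z) (ℚ.*-comm ⌜ P ⌝ ⌜ Z ⌝)) (⌜⌝-mono W≤PZ)))

  loglog-positive : ∀ {Λ ℓ} N → 0ℚ ≤ ℓ → grid 34 ≤ Λ → Λ ≤ expSum ℓ N + ε → grid 1 ≤ ℓ
  loglog-positive {Λ} {ℓ} N 0≤ℓ Λ≥ exp≥ = decidable-stable (grid 1 ℚ.≤? ℓ) λ ¬p →
    -- If ℓ < 1/32 then e^ℓ ≤ 32/31, while Λ ≥ 34/32 = 136/128; over the denominator 31 · 128 this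
    -- is refuted by 31 · 136 = 4216 > 4127 = 32 · 128 + 31.
    ℕ.<⇒≱ (ℕ.≤ᵇ⇒≤ 4128 4216 tt) (too-small 31 32 136 (expSum (grid 1) N) Λ (exp-grid 1 N) Λ≥
      (ℚ.≤-trans exp≥ (ℚ.+-monoˡ-≤ ε (sum-monoˡ N 0≤ℓ (≰⇒≥ ¬p)))))

  -- If ℓ < m, then e^ℓ ≤ e^(34m/32) ≤ 3ᵐ ≤ n, while Λ ≥ 34n/32. The surplus 2n/32 of the slope
  -- 34/32 over 1 exceeds the tolerance.
  loglog-lower : ∀ {Λ ℓ n m} N → 0ℚ ≤ ℓ → 1 ℕ.≤ n → 3 ℕ.^ m ℕ.≤ n → grid (34 ℕ.* n) ≤ Λ → Λ ≤ expSum ℓ N + ε → ⌜ m ⌝ ≤ ℓ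
  loglog-lower {Λ} {ℓ} {n} {m} N 0≤ℓ 1≤n 3^m≤n Λ≥ exp≥ = decidable-stable (⌜ m ⌝ ℚ.≤? ℓ) λ ¬p →
    absurd n 1≤n (too-small 1 n (34 ℕ.* n ℕ.* 4) (expSum x N) Λ
      (≡.subst (_≤ ⌜ n ⌝) (≡.sym (ℚ.*-identityˡ (expSum x N))) (ℚ.≤-trans (sum≤power m N) (⌜⌝-mono 3^m≤n)))
      Λ≥ (ℚ.≤-trans exp≥ (ℚ.+-monoˡ-≤ ε (sum-monoˡ N 0≤ℓ (ℚ.≤-trans (≰⇒≥ ¬p) m≤x)))))
    where
    x = grid (34 ℕ.* m)
    m≤x : ⌜ m ⌝ ≤ x
    m≤x = ≡.subst (_≤ x) (≡.sym (units m)) (units-mono (≡.subst (m ℕ.* 128 ℕ.≤_)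
      (solveℕ 1 (λ m → m :*′ con′ 128 :+′ m :*′ con′ 8 :=′ con′ 34 :*′ m :*′ con′ 4) ≡.refl m) (ℕ.m≤m+n (m ℕ.* 128) (m ℕ.* 8))))
    absurd : ∀ n → 1 ℕ.≤ n → ¬ 1 ℕ.* (34 ℕ.* n ℕ.* 4) ℕ.≤ n ℕ.* 128 ℕ.+ 1
    absurd n 1≤n p = ℕ.<⇒≱ (ℕ.≤-trans (s≤s (s≤s z≤n)) (ℕ.*-monoˡ-≤ 8 1≤n)) (ℕ.+-cancelˡ-≤ (n ℕ.* 128) (n ℕ.* 8) 1
      (≡.subst (ℕ._≤ n ℕ.* 128 ℕ.+ 1) (solveℕ 1 (λ n → con′ 1 :*′ (con′ 34 :*′ n :*′ con′ 4) :=′ n :*′ con′ 128 :+′ n :*′ con′ 8) ≡.refl n) p))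

  private
    -- An approximate square root is nonnegative only up to ε. If it were below 2ε, then x² + ε ≤
    -- 4ε² + ε ≤ 5ε, less than 6ε.
    away-from-zero : ∀ {x a} → 0ℚ ≤ x + ε → a ≤ x * x + ε → ⌜ 6 ⌝ * ε ≤ a → ⌜ 2 ⌝ * ε ≤ x
    away-from-zero {x} {a} 0≤x+ε a≤ 6≤a = decidable-stable (⌜ 2 ⌝ * ε ℚ.≤? x) λ ¬p →
      ℕ.<⇒≱ (ℕ.≤ᵇ⇒≤ 6 6 tt) (units-cancel {6} {5} (ℚ.≤-trans 6≤a (ℚ.≤-trans a≤ (small (≰⇒≥ ¬p)))))
      where
      d = ⌜ 2 ⌝ * ε
      0≤d : 0ℚ ≤ d
      0≤d = *-nonNeg (0≤⌜⌝ 2) 0≤ε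
      ε≤d : ε ≤ d
      ε≤d = ≡.subst (_≤ d) (ℚ.*-identityˡ ε) (units-mono {1} {2} (s≤s z≤n))
      small : x ≤ d → x * x + ε ≤ ⌜ 5 ⌝ * ε
      small x≤d = begin
        x * x + ε                                  ≡⟨ solve 2 (λ x e → x :* x :+ e := x :* x :+ con ℤ.0ℤ :+ e) ≡.refl x ε ⟩
        x * x + 0ℚ + ε                             ≤⟨ ℚ.+-monoˡ-≤ ε (ℚ.+-monoʳ-≤ (x * x) (*-nonNeg (0≤difference x≤d) (ℚ.≤-trans 0≤x+ε
                                                        (≡.subst (x + ε ≤_) (ℚ.+-comm x d) (ℚ.+-monoʳ-≤ x ε≤d))))) ⟩
        x * x + (d - x) * (d + x) + ε              ≡⟨ solve 3 (λ x d e → x :* x :+ (d :- x) :* (d :+ x) :+ e := d :* d :+ e) ≡.refl x d ε ⟩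
        d * d + ε                                  ≤⟨ ℚ.+-monoˡ-≤ ε (*-monoˡ 0≤d (*-monoˡ (0≤⌜⌝ 2) ε≤1)) ⟩
        d * (⌜ 2 ⌝ * 1ℚ) + ε                       ≡⟨ cong (λ z → d * z + ε) (ℚ.*-identityʳ ⌜ 2 ⌝) ⟩
        d * ⌜ 2 ⌝ + ε                              ≡⟨ solve 2 (λ a e → a :* e :* a :+ e := a :* a :* e :+ e) ≡.refl ⌜ 2 ⌝ ε ⟩
        ⌜ 2 ⌝ * ⌜ 2 ⌝ * ε + ε                      ≡⟨ cong (λ z → z * ε + ε) (⌜⌝-* 2 2) ⟨
        ⌜ 4 ⌝ * ε + ε                              ≡⟨ units-suc 4 ⟩
        ⌜ 5 ⌝ * ε                                  ∎
        where open ℚ.≤-Reasoning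

  -- The inequality between approximations at one index

  module Numerical {q B n m δ H : ℕ} (3≤q : 3 ℕ.≤ q) (1≤B : 1 ℕ.≤ B) (1≤n : 1 ℕ.≤ n) (n+m≤2δ : n ℕ.+ m ℕ.≤ δ ℕ.+ δ)
      (n≤ : n ℕ.≤ B ℕ.* (suc m ℕ.* suc m ℕ.* q ℕ.^ m)) (H≡ : H ≡ 12 ℕ.* q ℕ.* B ℕ.* 1089) where

    private
      1≤q : 1 ℕ.≤ q
      1≤q = ℕ.≤-trans (s≤s z≤n) 3≤q

      1≤H : 1 ℕ.≤ H
      1≤H = ≡.subst (1 ℕ.≤_) (≡.sym H≡) (ℕ.*-mono-≤ (ℕ.*-mono-≤ (ℕ.*-mono-≤ {1} {12} (s≤s z≤n) 1≤q) 1≤B) (ℕ.≤ᵇ⇒≤ 1 1089 tt))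

    -- n is at most B (X ℓ⁻¹)² qᵐ ℓ² with X ≤ 33 ℓ: take X = m + 1 if log log |p| ≥ m, and X = 1 if n < 3ᵐ.
    multiplier : ∀ {Λ ℓ} N → 0ℚ ≤ ℓ → grid (34 ℕ.* n) ≤ Λ → Λ ≤ expSum ℓ N + ε →
                 ∃[ X ] n ℕ.≤ B ℕ.* (X ℕ.* X ℕ.* q ℕ.^ m) × ⌜ X ⌝ ≤ ⌜ 33 ⌝ * ℓ
    multiplier {Λ} {ℓ} N 0≤ℓ Λ≥ exp≥ = by-cases (3 ℕ.^ m ℕ.≤? n)
      where
      grid1≤ℓ : grid 1 ≤ ℓ
      grid1≤ℓ = loglog-positive N 0≤ℓ (ℚ.≤-trans (units-mono (ℕ.*-monoˡ-≤ 4 (ℕ.*-monoʳ-≤ 34 1≤n))) Λ≥) exp≥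
      1≤32ℓ : ⌜ 1 ⌝ ≤ ⌜ 32 ⌝ * ℓ
      1≤32ℓ = begin
        ⌜ 1 ⌝                       ≡⟨ 128ε ⟨
        ⌜ 128 ⌝ * ε                 ≡⟨ ≡.trans (cong (_* ε) (⌜⌝-* 32 4)) (ℚ.*-assoc ⌜ 32 ⌝ ⌜ 4 ⌝ ε) ⟩
        ⌜ 32 ⌝ * grid 1             ≤⟨ *-monoˡ (0≤⌜⌝ 32) grid1≤ℓ ⟩
        ⌜ 32 ⌝ * ℓ                  ∎
        where open ℚ.≤-Reasoning
      32ℓ+ℓ : ⌜ 32 ⌝ * ℓ + ℓ ≡ ⌜ 33 ⌝ * ℓ
      32ℓ+ℓ = ≡.trans (solve 2 (λ a l → a :* l :+ l := (a :+ con ℤ.1ℤ) :* l) ≡.refl ⌜ 32 ⌝ ℓ) (cong (_* ℓ) (≡.sym (⌜⌝-+ 32 1)))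
      by-cases : Dec (3 ℕ.^ m ℕ.≤ n) → ∃[ X ] n ℕ.≤ B ℕ.* (X ℕ.* X ℕ.* q ℕ.^ m) × ⌜ X ⌝ ≤ ⌜ 33 ⌝ * ℓ
      by-cases (yes 3^m≤n) = suc m , n≤ , (begin
        ⌜ suc m ⌝                   ≡⟨ ⌜⌝-+ 1 m ⟩
        ⌜ 1 ⌝ + ⌜ m ⌝               ≤⟨ ℚ.+-mono-≤ 1≤32ℓ (loglog-lower {m = m} N 0≤ℓ 1≤n 3^m≤n Λ≥ exp≥) ⟩
        ⌜ 32 ⌝ * ℓ + ℓ              ≡⟨ 32ℓ+ℓ ⟩
        ⌜ 33 ⌝ * ℓ                  ∎)
        where open ℚ.≤-Reasoning
      by-cases (no 3^m≰n) = 1 , n≤q^m , ℚ.≤-trans 1≤32ℓ (*-monoʳ 0≤ℓ (⌜⌝-mono (ℕ.n≤1+n 32)))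
        where
        n≤q^m : n ℕ.≤ B ℕ.* (1 ℕ.* 1 ℕ.* q ℕ.^ m)
        n≤q^m = begin
          n                                ≤⟨ ℕ.<⇒≤ (ℕ.≰⇒> 3^m≰n) ⟩
          3 ℕ.^ m                          ≤⟨ ℕ.^-monoˡ-≤ m 3≤q ⟩
          q ℕ.^ m                          ≡⟨ ℕ.*-identityˡ _ ⟨
          1 ℕ.* 1 ℕ.* q ℕ.^ m              ≤⟨ ℕ.m≤n*m _ B {{ℕ.>-nonZero 1≤B}} ⟩
          B ℕ.* (1 ℕ.* 1 ℕ.* q ℕ.^ m)      ∎
          where open ℕ.≤-Reasoning

    private
      Qn : ℚ
      Qn = ⌜ q ℕ.^ n ⌝

      0≤Qn : 0ℚ ≤ Qn
      0≤Qn = 0≤⌜⌝ (q ℕ.^ n)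

      three≤Qn : ⌜ 3 ⌝ ≤ Qn
      three≤Qn = ⌜⌝-mono (ℕ.≤-trans 3≤q (≡.subst (ℕ._≤ q ℕ.^ n) (ℕ.*-identityʳ q) (ℕ.^-monoʳ-≤ q {{ℕ.>-nonZero 1≤q}} 1≤n)))

      six≤three : ⌜ 6 ⌝ * ε ≤ ⌜ 3 ⌝
      six≤three = ≡.subst (⌜ 6 ⌝ * ε ≤_) (≡.sym (units 3)) (units-mono (ℕ.≤ᵇ⇒≤ 6 384 tt))

      square-P : ∀ {P} → P * P ≤ Qn + ε → P * P ≤ ⌜ 2 ⌝ * Qn
      square-P {P} p = ℚ.≤-trans p (≡.subst (Qn + ε ≤_) (≡.trans (solve 1 (λ x → x :+ x := (con ℤ.1ℤ :+ con ℤ.1ℤ) :* x) ≡.refl Qn)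
        (cong (_* Qn) (≡.sym (⌜⌝-+ 1 1)))) (ℚ.+-monoʳ-≤ Qn (ℚ.≤-trans ε≤1 (ℚ.≤-trans (⌜⌝-mono {1} {3} (s≤s z≤n)) three≤Qn))))

      qn : ℚ
      qn = ⌜ q ℕ.* n ⌝

      -- y stands for w ℓ, an approximation of S = √log |p|. Then y² ≤ (S + 1)² ≤ 2 S² + 2, and each
      -- S² is at most 2 q n.
      square-wℓ : ∀ {y S Λ} → 0ℚ ≤ y → 0ℚ ≤ S → y ≤ S + ε → S * S ≤ Λ + ε → Λ ≤ qn → y * y ≤ ⌜ 6 ⌝ * qn
      square-wℓ {y} {S} {Λ} 0≤y 0≤S y≤ S²≤ Λ≤ = begin
        y * y                                     ≤⟨ *-mono 0≤y (+-nonNeg 0≤S (0≤⌜⌝ 1)) y≤S+1 y≤S+1 ⟩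
        (S + 1ℚ) * (S + 1ℚ)                       ≡⟨ solve 1 (λ s → (s :+ con ℤ.1ℤ) :* (s :+ con ℤ.1ℤ) := (s :+ con ℤ.1ℤ) :* (s :+ con ℤ.1ℤ) :+ con ℤ.0ℤ) ≡.refl S ⟩
        (S + 1ℚ) * (S + 1ℚ) + 0ℚ                  ≤⟨ ℚ.+-monoʳ-≤ ((S + 1ℚ) * (S + 1ℚ)) (square-nonNeg (S - 1ℚ)) ⟩
        (S + 1ℚ) * (S + 1ℚ) + (S - 1ℚ) * (S - 1ℚ) ≡⟨ solve 1 (λ s → (s :+ con ℤ.1ℤ) :* (s :+ con ℤ.1ℤ) :+ (s :- con ℤ.1ℤ) :* (s :- con ℤ.1ℤ)
                                                       := s :* s :+ s :* s :+ (con ℤ.1ℤ :+ con ℤ.1ℤ)) ≡.refl S ⟩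
        S * S + S * S + (1ℚ + 1ℚ)                 ≤⟨ ℚ.+-mono-≤ (ℚ.+-mono-≤ S²≤2qn S²≤2qn) (ℚ.+-mono-≤ 1≤qn 1≤qn) ⟩
        (qn + qn) + (qn + qn) + (qn + qn)         ≡⟨ ≡.sym six ⟩
        ⌜ 6 ⌝ * qn                                ∎
        where
        open ℚ.≤-Reasoning
        y≤S+1 : y ≤ S + 1ℚ
        y≤S+1 = ℚ.≤-trans y≤ (ℚ.+-monoʳ-≤ S ε≤1)
        1≤qn : 1ℚ ≤ qn
        1≤qn = ⌜⌝-mono {1} (ℕ.*-mono-≤ 1≤q 1≤n)
        S²≤2qn : S * S ≤ qn + qn
        S²≤2qn = ℚ.≤-trans S²≤ (ℚ.+-mono-≤ Λ≤ (ℚ.≤-trans ε≤1 1≤qn))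
        six : ⌜ 6 ⌝ * qn ≡ (qn + qn) + (qn + qn) + (qn + qn)
        six = ≡.trans (cong (_* qn) (≡.trans (⌜⌝-+ 3 3) (cong₂ _+_ (⌜⌝-+ 1 2) (⌜⌝-+ 1 2))))
          (≡.trans (cong (λ z → (1ℚ + z + (1ℚ + z)) * qn) (⌜⌝-+ 1 1))
            (solve 1 (λ x → (con ℤ.1ℤ :+ (con ℤ.1ℤ :+ con ℤ.1ℤ) :+ (con ℤ.1ℤ :+ (con ℤ.1ℤ :+ con ℤ.1ℤ))) :* x := x :+ x :+ (x :+ x) :+ (x :+ x)) ≡.refl qn))
        square-nonNeg : ∀ x → 0ℚ ≤ x * x
        square-nonNeg x with ℚ.≤-total 0ℚ x
        ... | inj₁ 0≤x = *-nonNeg 0≤x 0≤x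
        ... | inj₂ x≤0 = ≡.subst (0ℚ ≤_) (solve 1 (λ x → (:- x) :* (:- x) := x :* x) ≡.refl x) (*-nonNeg (ℚ.neg-antimono-≤ x≤0) (ℚ.neg-antimono-≤ x≤0))

      Qδ : ℚ
      Qδ = ⌜ q ℕ.^ δ ⌝

      -- After squaring: (P y)² ≤ 12 q qⁿ n ≤ 12 q B q^(n+m) X² ≤ 12 q B · 33² q^(2δ) ℓ², where n +
      -- m ≤ 2 δ absorbs the factor qᵐ into |d₂|².
      compare : ∀ {P y ℓ X} → 0ℚ ≤ ℓ → P * P ≤ ⌜ 2 ⌝ * Qn → y * y ≤ ⌜ 6 ⌝ * qn → 0ℚ ≤ y * y →
                n ℕ.≤ B ℕ.* (X ℕ.* X ℕ.* q ℕ.^ m) → ⌜ X ⌝ ≤ ⌜ 33 ⌝ * ℓ → P * y ≤ ⌜ H ⌝ * Qδ * ℓ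
      compare {P} {y} {ℓ} {X} 0≤ℓ P² y² 0≤y² n≤X X≤ = square-cancel (*-nonNeg (*-nonNeg (0≤⌜⌝ H) (0≤⌜⌝ (q ℕ.^ δ))) 0≤ℓ) (begin
        P * y * (P * y)                                   ≡⟨ solve 2 (λ p y → p :* y :* (p :* y) := p :* p :* (y :* y)) ≡.refl P y ⟩
        P * P * (y * y)                                   ≤⟨ ℚ.≤-trans (*-monoʳ 0≤y² P²) (*-monoˡ (*-nonNeg (0≤⌜⌝ 2) 0≤Qn) y²) ⟩
        ⌜ 2 ⌝ * Qn * (⌜ 6 ⌝ * qn)                         ≡⟨ ≡.sym (≡.trans (⌜⌝-* (2 ℕ.* q ℕ.^ n) (6 ℕ.* (q ℕ.* n))) (cong₂ _*_ (⌜⌝-* 2 (q ℕ.^ n)) (⌜⌝-* 6 (q ℕ.* n)))) ⟩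
        ⌜ 2 ℕ.* q ℕ.^ n ℕ.* (6 ℕ.* (q ℕ.* n)) ⌝           ≤⟨ ⌜⌝-mono (ℕ.*-monoʳ-≤ (2 ℕ.* q ℕ.^ n) (ℕ.*-monoʳ-≤ 6 (ℕ.*-monoʳ-≤ q n≤X))) ⟩
        ⌜ 2 ℕ.* q ℕ.^ n ℕ.* (6 ℕ.* (q ℕ.* (B ℕ.* (X ℕ.* X ℕ.* q ℕ.^ m)))) ⌝
          ≡⟨ cong ⌜_⌝ (solveℕ 5 (λ a q B X b → con′ 2 :*′ a :*′ (con′ 6 :*′ (q :*′ (B :*′ (X :*′ X :*′ b)))) :=′ con′ 12 :*′ q :*′ B :*′ (a :*′ b) :*′ (X :*′ X)) ≡.refl (q ℕ.^ n) q B X (q ℕ.^ m)) ⟩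
        ⌜ 12 ℕ.* q ℕ.* B ℕ.* (q ℕ.^ n ℕ.* q ℕ.^ m) ℕ.* (X ℕ.* X) ⌝
          ≡⟨ ≡.trans (⌜⌝-* (12 ℕ.* q ℕ.* B ℕ.* (q ℕ.^ n ℕ.* q ℕ.^ m)) (X ℕ.* X)) (cong (⌜ 12 ℕ.* q ℕ.* B ℕ.* (q ℕ.^ n ℕ.* q ℕ.^ m) ⌝ *_) (⌜⌝-* X X)) ⟩
        ⌜ 12 ℕ.* q ℕ.* B ℕ.* (q ℕ.^ n ℕ.* q ℕ.^ m) ⌝ * (⌜ X ⌝ * ⌜ X ⌝)
          ≤⟨ *-monoˡ (0≤⌜⌝ (12 ℕ.* q ℕ.* B ℕ.* (q ℕ.^ n ℕ.* q ℕ.^ m))) (*-mono (0≤⌜⌝ X) (*-nonNeg (0≤⌜⌝ 33) 0≤ℓ) X≤ X≤) ⟩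
        ⌜ 12 ℕ.* q ℕ.* B ℕ.* (q ℕ.^ n ℕ.* q ℕ.^ m) ⌝ * (⌜ 33 ⌝ * ℓ * (⌜ 33 ⌝ * ℓ))
          ≡⟨ collect ⌜ 12 ℕ.* q ℕ.* B ℕ.* (q ℕ.^ n ℕ.* q ℕ.^ m) ⌝ ⟩
        ⌜ 12 ℕ.* q ℕ.* B ℕ.* (q ℕ.^ n ℕ.* q ℕ.^ m) ⌝ * ⌜ 1089 ⌝ * (ℓ * ℓ)
          ≡⟨ cong (_* (ℓ * ℓ)) (⌜⌝-* (12 ℕ.* q ℕ.* B ℕ.* (q ℕ.^ n ℕ.* q ℕ.^ m)) 1089) ⟨
        ⌜ 12 ℕ.* q ℕ.* B ℕ.* (q ℕ.^ n ℕ.* q ℕ.^ m) ℕ.* 1089 ⌝ * (ℓ * ℓ)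
          ≤⟨ *-monoʳ (*-nonNeg 0≤ℓ 0≤ℓ) (⌜⌝-mono naturals) ⟩
        ⌜ H ℕ.* q ℕ.^ δ ℕ.* (H ℕ.* q ℕ.^ δ) ⌝ * (ℓ * ℓ)
          ≡⟨ cong (_* (ℓ * ℓ)) (≡.trans (⌜⌝-* (H ℕ.* q ℕ.^ δ) (H ℕ.* q ℕ.^ δ)) (cong₂ _*_ (⌜⌝-* H (q ℕ.^ δ)) (⌜⌝-* H (q ℕ.^ δ)))) ⟩
        ⌜ H ⌝ * Qδ * (⌜ H ⌝ * Qδ) * (ℓ * ℓ)
          ≡⟨ solve 2 (λ h l → h :* h :* (l :* l) := h :* l :* (h :* l)) ≡.refl (⌜ H ⌝ * Qδ) ℓ ⟩
        ⌜ H ⌝ * Qδ * ℓ * (⌜ H ⌝ * Qδ * ℓ)                 ∎)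
        where
        open ℚ.≤-Reasoning
        collect : ∀ z → z * (⌜ 33 ⌝ * ℓ * (⌜ 33 ⌝ * ℓ)) ≡ z * ⌜ 1089 ⌝ * (ℓ * ℓ)
        collect z = ≡.trans (solve 3 (λ z a l → z :* (a :* l :* (a :* l)) := z :* (a :* a) :* (l :* l)) ≡.refl z ⌜ 33 ⌝ ℓ)
          (cong (λ a → z * a * (ℓ * ℓ)) (≡.sym (⌜⌝-* 33 33)))
        naturals : 12 ℕ.* q ℕ.* B ℕ.* (q ℕ.^ n ℕ.* q ℕ.^ m) ℕ.* 1089 ℕ.≤ H ℕ.* q ℕ.^ δ ℕ.* (H ℕ.* q ℕ.^ δ)
        naturals = reorder (12 ℕ.* q ℕ.* B) (q ℕ.^ n ℕ.* q ℕ.^ m) 1089 (q ℕ.^ δ) H≡ 1≤H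
          (≡.subst₂ ℕ._≤_ (ℕ.^-distribˡ-+-* q n m) (ℕ.^-distribˡ-+-* q δ δ) (ℕ.^-monoʳ-≤ q {{ℕ.>-nonZero 1≤q}} n+m≤2δ))
          where
          reorder : ∀ a b c d → H ≡ a ℕ.* c → 1 ℕ.≤ H → b ℕ.≤ d ℕ.* d → a ℕ.* b ℕ.* c ℕ.≤ H ℕ.* d ℕ.* (H ℕ.* d)
          reorder a b c d H≡ 1≤H b≤ = ≡.subst₂ ℕ._≤_
            (≡.trans (cong (ℕ._* b) H≡) (solveℕ 3 (λ a b c → a :*′ c :*′ b :=′ a :*′ b :*′ c) ≡.refl a b c))
            (solveℕ 2 (λ h d → h :*′ h :*′ (d :*′ d) :=′ h :*′ d :*′ (h :*′ d)) ≡.refl H d)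
            (ℕ.*-mono-≤ (ℕ.m≤m*n H H {{ℕ.>-nonZero 1≤H}}) b≤)

    -- The sign of ℓ is obtained from w ℓ, which is close to S ≥ 2ε and hence at least ε. If w ≤ 0
    -- the left side is not positive and the bound is immediate; if w ≥ 0, then ℓ > 0 and can be
    -- cancelled from `compare`.
    final : ∀ {c P Λ S ℓ w} N → n ℕ.< N → 0ℚ ≤ c → c * ⌜ H ⌝ ≡ 1ℚ →
            0ℚ ≤ P + ε → ℚ.∣ P * P - Qn ∣ ≤ ε → ℚ.∣ expSum Λ N - Qn ∣ ≤ ε →
            0ℚ ≤ S + ε → ℚ.∣ S * S - Λ ∣ ≤ ε → ℚ.∣ expSum ℓ N - Λ ∣ ≤ ε → ℚ.∣ w * ℓ - S ∣ ≤ ε →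
            c * P * w ≤ Qδ
    final {c} {P} {Λ} {S} {ℓ} {w} N n<N 0≤c cH P+ε P² expΛ S+ε S² expℓ wℓ = [ nonPos , nonNeg ]′ (ℚ.≤-total w 0ℚ)
      where
      0≤2ε : 0ℚ ≤ ⌜ 2 ⌝ * ε
      0≤2ε = *-nonNeg (0≤⌜⌝ 2) 0≤ε
      0≤P : 0ℚ ≤ P
      0≤P = ℚ.≤-trans 0≤2ε (away-from-zero P+ε (close⇒≥ {P * P} P²) (ℚ.≤-trans six≤three three≤Qn))
      nonPos : w ≤ 0ℚ → c * P * w ≤ Qδ
      nonPos w≤0 = ℚ.≤-trans (≡.subst (c * P * w ≤_) (ℚ.*-zeroʳ (c * P)) (*-monoˡ (*-nonNeg 0≤c 0≤P) w≤0)) (0≤⌜⌝ (q ℕ.^ δ))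
      0≤Λ+ε : 0ℚ ≤ Λ + ε
      0≤Λ+ε = ℚ.≤-trans (square S) (close⇒≤ {S * S} S²)
        where
        square : ∀ x → 0ℚ ≤ x * x
        square x = [ (λ p → *-nonNeg p p) , (λ p → ≡.subst (0ℚ ≤_) (solve 1 (λ x → (:- x) :* (:- x) := x :* x) ≡.refl x)
          (*-nonNeg (ℚ.neg-antimono-≤ p) (ℚ.neg-antimono-≤ p))) ]′ (ℚ.≤-total 0ℚ x)
      Λ≥ : grid (34 ℕ.* n) ≤ Λ
      Λ≥ = log-lower N 3≤q 1≤n 0≤Λ+ε (close⇒≥ {expSum Λ N} expΛ)
      Λ≤ : Λ ≤ qn
      Λ≤ = log-upper {q} {n} N 1≤n n<N (close⇒≤ {expSum Λ N} expΛ)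
      2ε≤S : ⌜ 2 ⌝ * ε ≤ S
      2ε≤S = away-from-zero S+ε (close⇒≥ {S * S} S²) (ℚ.≤-trans (units-mono (ℕ.≤-trans (ℕ.≤ᵇ⇒≤ 6 136 tt) (ℕ.*-monoˡ-≤ 4 (ℕ.*-monoʳ-≤ 34 1≤n)))) Λ≥)
      ε≤wℓ : ε ≤ w * ℓ
      ε≤wℓ = +-cancelʳ ε (≡.subst (_≤ w * ℓ + ε) double (ℚ.≤-trans 2ε≤S (close⇒≥ {w * ℓ} wℓ)))
        where
        double : ⌜ 2 ⌝ * ε ≡ ε + ε
        double = ≡.trans (cong (_* ε) (⌜⌝-+ 1 1)) (solve 1 (λ e → (con ℤ.1ℤ :+ con ℤ.1ℤ) :* e := e :+ e) ≡.refl ε)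
      nonNeg : 0ℚ ≤ w → c * P * w ≤ Qδ
      nonNeg 0≤w =
        let X , n≤X , X≤ = multiplier N 0≤ℓ Λ≥ (close⇒≥ {expSum ℓ N} expℓ)
        in divide (≡.subst (_≤ ⌜ H ⌝ * Qδ * ℓ) (≡.sym (ℚ.*-assoc P w ℓ))
             (compare {P} {w * ℓ} {ℓ} {X} 0≤ℓ (square-P {P} (close⇒≤ {P * P} P²)) (square-wℓ 0≤wℓ (ℚ.≤-trans 0≤2ε 2ε≤S) (close⇒≤ {w * ℓ} wℓ) (close⇒≤ {S * S} S²) Λ≤)
               (*-nonNeg 0≤wℓ 0≤wℓ) n≤X X≤))
        where
        0≤wℓ : 0ℚ ≤ w * ℓ
        0≤wℓ = ℚ.≤-trans 0≤ε ε≤wℓ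
        0<ℓ : 0ℚ < ℓ
        0<ℓ = ℚ.≰⇒> λ ℓ≤0 → <⇒≱ 0<ε (ℚ.≤-trans ε≤wℓ (≡.subst (w * ℓ ≤_) (ℚ.*-zeroʳ w) (*-monoˡ 0≤w ℓ≤0)))
        0≤ℓ : 0ℚ ≤ ℓ
        0≤ℓ = ℚ.<⇒≤ 0<ℓ
        divide : P * w * ℓ ≤ ⌜ H ⌝ * Qδ * ℓ → c * P * w ≤ Qδ
        divide p = begin
          c * P * w              ≡⟨ ℚ.*-assoc c P w ⟩
          c * (P * w)            ≤⟨ *-monoˡ 0≤c (cancelʳ 0<ℓ p) ⟩
          c * (⌜ H ⌝ * Qδ)       ≡⟨ ℚ.*-assoc c ⌜ H ⌝ Qδ ⟨
          c * ⌜ H ⌝ * Qδ         ≡⟨ cong (_* Qδ) cH ⟩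
          1ℚ * Qδ                ≡⟨ ℚ.*-identityˡ Qδ ⟩
          Qδ                     ∎
          where open ℚ.≤-Reasoning

open Logarithms

-- The constants B and C, and the passage to real numbers

odd⇒ : ∀ q → ¬ 2 ℕ.∣ q → ∃[ h ] q ≡ suc (h ℕ.+ h)
odd⇒ zero          2∤q = contradiction (2 ℕ.∣0) 2∤q
odd⇒ (suc zero)    2∤q = 0 , ≡.refl
odd⇒ (suc (suc q)) 2∤q =
  let h , q≡ = odd⇒ q (λ 2∣q → 2∤q (ℕ.∣m∣n⇒∣m+n (ℕ.divides 1 ≡.refl) 2∣q))
  in suc h , ≡.cong (λ n → ℕ.suc (ℕ.suc n)) (≡.trans q≡ (≡.sym (ℕ.+-suc h h)))

module _ {c ℓ f ℓf s ℓs : Level} {q : ℕ} (k : FiniteField c ℓ q)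
    (F : FractionField (FunctionField.A k) f ℓf) (K : AlgebraicClosure (FractionField.asField F) s ℓs)
    (ψ : FunctionField.DrinfeldModule k (FractionField.rawRing F) (FractionField.embedding F) 2)
    (trivial : FunctionField.Rational.TrivialEndomorphismRing k F K ψ) where
  open FunctionField k using (A; A/; A/-module; _∣_; _⊕_; _≅_; Monic; Prime; DrinfeldModule; module Rational)
  open Rational F using (IsReduction)

  degree-inequality : ∃[ h ] q ≡ suc (h ℕ.+ h) →
    ∃[ B ] 3 ℕ.≤ q × 1 ℕ.≤ B ×
      (∀ p (p-monic : Monic p) → Prime p → (ψ̄ : DrinfeldModule (A/ p) id 2) → IsReduction p ψ ψ̄ →
       ∀ d₁ d₂ → Monic d₁ → (d₂-monic : Monic d₂) → d₁ ∣ d₂ →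
       DrinfeldModule.module-on-L ψ̄ ≅ A/-module d₁ ⊕ A/-module d₂ →
       let n = Monic.degree p-monic; δ = Monic.degree d₂-monic in
       ∃[ m ] n ℕ.+ m ℕ.≤ δ ℕ.+ δ × n ℕ.≤ B ℕ.* (suc m ℕ.* suc m ℕ.* q ℕ.^ m) × 1 ℕ.≤ n)
  degree-inequality (h , ≡.refl) = B , 3≤q h ≡.refl , ℕ.>-nonZero⁻¹ B , λ p p-monic prime ψ̄ reduction d₁ d₂ monic₁ monic₂ d₁∣d₂ iso →
    let m , n+m≤ , n≤ , 1≤n = AtPrime.conclusion p p-monic prime ψ̄ reduction d₁ d₂ monic₁ monic₂ d₁∣d₂ iso
    in m , n+m≤ , ℕ.≤-trans n≤ (simplify m) , 1≤n
    where
    open Combinatorial h k F K ψ trivial using (C; degree-bound; module AtPrime)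
    B : ℕ
    -- The three factors come from m + 2 ≤ 2 (m + 1), from q^(m+2) = q² qᵐ, and from 1 + 3 C + q (m
    -- + 1) ≤ (1 + 3 C + q) (m + 1).
    B = 2 ℕ.* (q ℕ.* q) ℕ.* suc (3 ℕ.* C ℕ.+ q)
    3≤q : ∀ h′ → h′ ≡ h → 3 ℕ.≤ q
    3≤q zero     ≡.refl with s≤s () ← Frobenius.2≤q k (PolyQuotient.Aᴰ k) (FunctionField.constant k) (Constants.constant-hom k)
    3≤q (suc h′) ≡.refl = s≤s (s≤s (≡.subst (1 ℕ.≤_) (≡.sym (ℕ.+-suc h′ h′)) (s≤s z≤n)))
    simplify : ∀ m → degree-bound m ℕ.≤ B ℕ.* (suc m ℕ.* suc m ℕ.* q ℕ.^ m)
    simplify m = begin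
      (2 ℕ.+ m) ℕ.* (q ℕ.* (q ℕ.* q ℕ.^ m) ℕ.* (1 ℕ.+ 3 ℕ.* C ℕ.+ q ℕ.* suc m))
        ≤⟨ ℕ.*-mono-≤ (ℕ.≤-trans (ℕ.m≤m+n (2 ℕ.+ m) m) (ℕ.≤-reflexive (solve 1 (λ m → con 2 :+ m :+ m := con 2 :* (con 1 :+ m)) ≡.refl m)))
             (ℕ.*-monoʳ-≤ (q ℕ.* (q ℕ.* q ℕ.^ m)) (ℕ.+-monoˡ-≤ (q ℕ.* suc m) (ℕ.m≤m*n (1 ℕ.+ 3 ℕ.* C) (suc m)))) ⟩
      2 ℕ.* suc m ℕ.* (q ℕ.* (q ℕ.* q ℕ.^ m) ℕ.* ((1 ℕ.+ 3 ℕ.* C) ℕ.* suc m ℕ.+ q ℕ.* suc m))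
        ≡⟨ rearrange q (q ℕ.^ m) C m ⟩
      B ℕ.* (suc m ℕ.* suc m ℕ.* q ℕ.^ m) ∎
      where
      open ℕ.≤-Reasoning
      open ℕ.+-*-Solver
      rearrange : ∀ q x C m → 2 ℕ.* suc m ℕ.* (q ℕ.* (q ℕ.* x) ℕ.* ((1 ℕ.+ 3 ℕ.* C) ℕ.* suc m ℕ.+ q ℕ.* suc m))
                            ≡ 2 ℕ.* (q ℕ.* q) ℕ.* suc (3 ℕ.* C ℕ.+ q) ℕ.* (suc m ℕ.* suc m ℕ.* x)
      rearrange = solve 4 (λ q x c m → con 2 :* (con 1 :+ m) :* (q :* (q :* x) :* ((con 1 :+ con 3 :* c) :* (con 1 :+ m) :+ q :* (con 1 :+ m)))
        := con 2 :* (q :* q) :* (con 1 :+ (con 3 :* c :+ q)) :* ((con 1 :+ m) :* (con 1 :+ m) :* x)) ≡.refl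

Eventually : (ℕ → Set) → Set
Eventually P = ∃[ N ] ∀ j → N ℕ.≤ j → P j

infixr 3 _⊓_
_⊓_ : ∀ {P Q} → Eventually P → Eventually Q → Eventually (λ j → P j × Q j)
(N , p) ⊓ (M , q) = N ℕ.⊔ M , λ j N⊔M≤j →
  p j (ℕ.≤-trans (ℕ.m≤m⊔n N M) N⊔M≤j) , q j (ℕ.≤-trans (ℕ.m≤n⊔m N M) N⊔M≤j)

theorem2 : ∀ {c ℓ f ℓf s ℓs} {q : ℕ} → IsOddPrimePower q →
    (k : FiniteField c ℓ q) → let open FunctionField k in
    (F : FractionField A f ℓf) → let open Rational F in
    (K : AlgebraicClosure (FractionField.asField F) s ℓs) →
    (ψ : DrinfeldModule (FractionField.rawRing F) (FractionField.embedding F) 2) →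
    TrivialEndomorphismRing K ψ →
    Σ[ C ∈ ℝ ] (fromℕ 0 <ᴿ C) ×
    (∀ p → (p-monic : Monic p) → Prime p → GoodReduction p ψ →
    (ψ̄ : DrinfeldModule (A/ p) id 2) → IsReduction p ψ ψ̄ →
    ∀ d₁ d₂ → Monic d₁ → (d₂-monic : Monic d₂) → d₁ ∣ d₂ →
    DrinfeldModule.module-on-L ψ̄ ≅ A/-module d₁ ⊕ A/-module d₂ →
    ∀ {√∣p∣ log∣p∣ √log∣p∣ loglog∣p∣ w} →
    √∣p∣ IsSquareRootOf fromℕ ∣ p-monic ∣ →
    log∣p∣ IsLogOf fromℕ ∣ p-monic ∣ →
    √log∣p∣ IsSquareRootOf log∣p∣ →
    loglog∣p∣ IsLogOf log∣p∣ →
    w IsQuotientOf √log∣p∣ By loglog∣p∣ →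
    C *ᴿ √∣p∣ *ᴿ w ≤ᴿ fromℕ ∣ d₂-monic ∣)
theorem2 {q = q} (2∤q , _) k F K ψ trivial =
  let B , 3≤q , 1≤B , inequality = degree-inequality k F K ψ trivial (odd⇒ q 2∤q)
      -- 12 = 2 · 6 collects the losses in |p| and in log |p|, and 1089 = 33² the one in log log
      -- |p|. The squared inequality asks for this number to be at most H², so taking H equal to it
      -- avoids a square root in the constant 1/H.
      H = 12 ℕ.* q ℕ.* B ℕ.* 1089
      H≢0 = ℕ.m*n≢0 (12 ℕ.* q ℕ.* B) 1089
              {{ℕ.m*n≢0 (12 ℕ.* q) B {{ℕ.m*n≢0 12 q {{_}} {{ℕ.>-nonZero (ℕ.≤-trans (s≤s z≤n) 3≤q)}}}} {{ℕ.>-nonZero 1≤B}}}}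
      c = recip (ℕ.pred H)
      cH = ≡.trans (ℚ.*-comm c ⌜ H ⌝) (≡.trans (≡.cong (λ H → ⌜ H ⌝ ℚ.* c) (≡.sym (ℕ.suc-pred H {{H≢0}}))) (recip-inverse (ℕ.pred H)))
  in fromℚ c , (c , 0<recip (ℕ.pred H) , 0 , λ _ _ → ℚ.≤-reflexive (ℚ.+-identityˡ c)) ,
     λ p p-monic prime _ ψ̄ reduction d₁ d₂ monic₁ monic₂ d₁∣d₂ iso (0≤√p , √p²) logp (0≤√log , √log²) loglogp quotient η 0<η →
       let m , n+m≤ , n≤ , 1≤n = inequality p p-monic prime ψ̄ reduction d₁ d₂ monic₁ monic₂ d₁∣d₂ iso
           n = Polynomials.Monic.degree p-monic
           δ = Polynomials.Monic.degree monic₂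
           -- All limits are used with the same tolerance ε. The first condition makes j exceed deg
           -- p, so that the partial sum for log |p| contains the term of index n needed by
           -- `log-upper`.
           N , estimates = (suc n , λ _ n<j → n<j) ⊓ 0≤√p ε 0<ε ⊓ √p² ε 0<ε ⊓ logp ε 0<ε
                           ⊓ 0≤√log ε 0<ε ⊓ √log² ε 0<ε ⊓ loglogp ε 0<ε ⊓ quotient ε 0<ε
       in N , λ j N≤j →
            let n<j , P+ε , P² , expΛ , S+ε , S² , expℓ , wℓ = estimates j N≤j
            in ℚ.≤-trans (Numerical.final {q} {B} {n} {m} {δ} {H} 3≤q 1≤B 1≤n n+m≤ n≤ ≡.refl j n<j
                            (ℚ.<⇒≤ (0<recip (ℕ.pred H))) cH P+ε P² expΛ S+ε S² expℓ wℓ)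
                 (≡.subst (ℚ._≤ ⌜ q ℕ.^ δ ⌝ ℚ.+ η) (ℚ.+-identityʳ ⌜ q ℕ.^ δ ⌝) (ℚ.+-monoʳ-≤ ⌜ q ℕ.^ δ ⌝ (ℚ.<⇒≤ 0<η)))
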